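{- For a poset $\mathcal{P}$ of integer pairs and $k\in\mathbb{Z}$, write $\sum_{i-j=k}$ for the sum over all $(i,j)\in\mathcal{P}$ with $i-j=k$ (empty sums are $0$); all parameters $k,i$ below are integers. (a) If $\mathcal{P}=[m]\times[n]$ with $m,n\ge2$, then each of the following collections is a basis of $I_T(\mathcal{P})$: $$\mathcal{B}_1=\Big\{\sum_{i-j=k}\mathcal{T}_{(i,j)} : 1-n\le k\le m-1,\ k\ne0\Big\}\cup\Big\{ -1+\sum_{i-j=0}\mathcal{T}_{(i,j)}\Big\},$$ $$\mathcal{B}_2=\Big\{\sum_{i-j=k}\mathbf{1}_{(i,j)} : 1-n\le k\le m-1\Big\}.$$ (b) If $\mathcal{P}=([n]\times[n])\backslash\mathfrak{S}_2$ with $n\ge2$, then each of the following collections is a basis of $I_T(\mathcal{P})$: $$\mathcal{B}_1=\Big\{\sum_{i-j=k}\mathcal{T}_{(i,j)} : 1-n\le k<0\Big\}\cup\{\mathcal{T}_{(k,k)}:1<k\le n\}\cup\{\mathcal{T}_{(1,1)}-1\},$$ $$\mathcal{B}_2=\Big\{\sum_{i-j=k}\mathbf{1}_{(i,j)} : 1-n\le k<0\Big\}\cup\{2\cdot\mathbf{1}_{(i,i)}-\mathbf{1}_{(i-1,i)}-\mathbf{1}_{(i,i+1)}:1<i<n\}\cup\{2\cdot\mathbf{1}_{(1,1)}-\mathbf{1}_{(1,2)},\ 2\cdot\mathbf{1}_{(n,n)}-\mathbf{1}_{(n-1,n)}\}.$$ (c) If $\mathcal{P}=\Phi^+(A_n)$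 with $n\ge2$, then each of the following collections is a basis of $I_T(\mathcal{P})$: $$\mathcal{B}_1=\Big\{ -1+\sum_{i-j=2k+1-n}\mathcal{T}_{(i,j)} : 0\le k\le n-1\Big\},$$ $$\mathcal{B}_2=\Big\{\sum_{i-j=2k+1-n}2\cdot\mathbf{1}_{(i,j)}-\sum_{i-j=2k+2-n}\mathbf{1}_{(i,j)}-\sum_{i-j=2k-n}\mathbf{1}_{(i,j)} : 0\le k\le n-1\Big\}.$$ (d) If $\mathcal{P}=\Phi^+(B_n)$ with $n\ge2$, then each of the following collections is a basis of $I_T(\mathcal{P})$: $$\mathcal{B}_1=\Big\{ -1+\sum_{i-j=2k}\mathcal{T}_{(i,j)} : 0<k\le n-1\Big\}\cup\{\mathcal{T}_{(n,n)}-1\}\cup\{\mathcal{T}_{(i,i)}:n<i\le 2n-1\},$$ $$\mathcal{B}_2=\Big\{\sum_{i-j=2k}2\cdot\mathbf{1}_{(i,j)}-\sum_{i-j=2k-1}\mathbf{1}_{(i,j)}-\sum_{i-j=2k+1}\mathbf{1}_{(i,j)} : 0<k\le n-1\Big\}\cup\{2\cdot\mathbf{1}_{(k,k)}-\mathbf{1}_{(k,k-1)}-\mathbf{1}_{(k+1,k)}:n<k<2n-1\}$$ $$\cup\ \{2\cdot\mathbf{1}_{(2n-1,2n-1)}-\mathbf{1}_{(2n-1,2n-2)},\ 2\cdot\mathbf{1}_{(n,n)}-\mathbf{1}_{(n+1,n)}\}.$$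
   Context: For a finite poset $\mathcal{P}$, $\mathcal{J}(\mathcal{P})$ is the set of order ideals (down-closed subsets) of $\mathcal{P}$. For $p\in\mathcal{P}$ define real-valued functions on $\mathcal{J}(\mathcal{P})$: $\mathbf{1}_p(I)=1$ if $p\in I$ and $0$ otherwise; $\mathcal{T}_p^-(I)=1$ if $p$ is a maximal element of $I$ and $0$ otherwise; $\mathcal{T}_p^+(I)=1$ if $p\notin I$ and $I\cup\{p\}\in\mathcal{J}(\mathcal{P})$, and $0$ otherwise; $\mathcal{T}_p=\mathcal{T}_p^+-\mathcal{T}_p^-$. The order ideal toggleability space is the real vector space $I_T(\mathcal{P})=\mathrm{Span}_{\mathbb{R}}(\mathbf{1}_p\mid p\in\mathcal{P})\cap\mathrm{Span}_{\mathbb{R}}(\{1\}\cup\{\mathcal{T}_p\mid p\in\mathcal{P}\})$, where $1$ is the constant function. All four families are sets of integer pairs ordered componentwise ($(i,j)\preceq(k,\ell)$ iff $i\le k$ and $j\le\ell$): - $[m]\times[n]=\{(i,j): 1\le i\le m,\ 1\le j\le n\}$; - $([n]\times[n])\backslash\mathfrak{S}_2=\{(i,j):1\le i\le j\le n\}$; - $\Phi^+(A_n)=\{(i,j):1\le i,j\le n,\ i+j\ge n+1\}$; - $\Phi^+(B_n)=\{(i,j):1\le j\le i\le 2n-1,\ i+j\ge 2n\}$. -}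

module Defs where

open import Level using (0ℓ; _⊔_)
open import Algebra.Bundles using (CommutativeRing)
open import Algebra.Module.Bundles using (Module)
open import Algebra.Module.Structures.Biased using (module IsModuleFromLeft)
import Algebra.Properties.CommutativeMonoid.Sum as Sum
open import Data.Bool.Base using (Bool; T; _∨_; if_then_else_)
open import Data.Bool.Properties using (T?; T-∨)
open import Data.Fin.Base using (Fin)
open import Data.Integer.Base as ℤ using (ℤ; +_; -[1+_]; 0ℤ; 1ℤ)
import Data.Integer.Properties as ℤ
open import Data.List.Base
  using (List; []; _∷_; _++_; length; lookup; map; filter; foldr; applyUpTo; cartesianProduct)
open import Data.List.Membership.Propositional using (_∈_)
import Data.List.Membership.DecPropositional as DecMembership
open import Data.List.Relation.Unary.All as All using (All; all?)
open import Data.Nat.Base as ℕ using (ℕ; suc)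
import Data.Nat.Properties as ℕ
open import Data.Product.Base using (Σ; ∃-syntax; _×_; _,_)
import Data.Product.Properties as Product
open import Data.Product.Relation.Binary.Pointwise.NonDependent using (Pointwise; ×-decidable)
open import Data.Rational.Base as ℚ using (ℚ; 0ℚ; 1ℚ; ∣_∣; ½; 1/_)
import Data.Rational.Properties as ℚ
open import Data.Rational.Solver using (module +-*-Solver)
open import Data.Sum.Base using (inj₁; inj₂)
open import Function.Bundles using (Equivalence)
open import Relation.Binary.PropositionalEquality
  using (_≡_; refl; sym; trans; cong; subst)
open import Relation.Nullary.Decidable
  using (Dec; does; map′; ⌊_⌋; toWitness; fromWitness; ¬?; _×-dec_; _→-dec_)
open import Relation.Unary using (Pred; _∩_; _⊆_)

-- The real numbers: Cauchy sequences of rationals, two of them being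
-- equal when their difference tends to 0.

IsCauchy : (ℕ → ℚ) → Set
IsCauchy x = ∀ ε → 0ℚ ℚ.< ε →
  ∃[ N ] ∀ m n → N ℕ.≤ m → N ℕ.≤ n → ∣ x m ℚ.- x n ∣ ℚ.< ε

TendsTo0 : (ℕ → ℚ) → Set
TendsTo0 x = ∀ ε → 0ℚ ℚ.< ε → ∃[ N ] ∀ n → N ℕ.≤ n → ∣ x n ∣ ℚ.< ε

record ℝ : Set where
  constructor mkℝ
  field
    seq      : ℕ → ℚ
    isCauchy : IsCauchy seq

open ℝ public

infix 4 _≃_
_≃_ : ℝ → ℝ → Set
x ≃ y = TendsTo0 (λ n → seq x n ℚ.- seq y n)

private
  open +-*-Solver using (solve; _:+_; _:*_; _:-_; :-_; _:=_)

  ½-pos : ∀ {ε} → 0ℚ ℚ.< ε → 0ℚ ℚ.< ε ℚ.* ½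
  ½-pos {ε} ε>0 = ℚ.positive⁻¹ (ε ℚ.* ½) {{ℚ.pos*pos⇒pos ε {{ℚ.positive ε>0}} ½}}

  halves : ∀ ε → ε ℚ.* ½ ℚ.+ ε ℚ.* ½ ≡ ε
  halves ε = trans (sym (ℚ.*-distribˡ-+ ε ½ ½)) (ℚ.*-identityʳ ε)

  quotient : ∀ {ε K} → 0ℚ ℚ.< ε → 0ℚ ℚ.< K → ∃[ δ ] (0ℚ ℚ.< δ × δ ℚ.* K ≡ ε)
  quotient {ε} {K} ε>0 K>0 =
    ε ℚ.* 1/ K ,
    ℚ.positive⁻¹ _ {{ℚ.pos*pos⇒pos ε {{ℚ.positive ε>0}} (1/ K) {{ℚ.1/pos⇒pos K}}}} ,
    trans (ℚ.*-assoc ε (1/ K) K)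
      (trans (cong (ε ℚ.*_) (ℚ.*-inverseˡ K)) (ℚ.*-identityʳ ε))
    where instance
      _ = ℚ.positive K>0
      _ = ℚ.pos⇒nonZero K

  add-small : ∀ {a b ε} → ∣ a ∣ ℚ.< ε ℚ.* ½ → ∣ b ∣ ℚ.< ε ℚ.* ½ → ∣ a ℚ.+ b ∣ ℚ.< ε
  add-small {a} {b} {ε} a< b< = ℚ.≤-<-trans (ℚ.∣p+q∣≤∣p∣+∣q∣ a b)
    (subst (∣ a ∣ ℚ.+ ∣ b ∣ ℚ.<_) (halves ε) (ℚ.+-mono-< a< b<))

  mul-small : ∀ {a b δ K} → 0ℚ ℚ.< K → ∣ a ∣ ℚ.< δ → ∣ b ∣ ℚ.< K → ∣ a ℚ.* b ∣ ℚ.< δ ℚ.* K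
  mul-small {a} {b} {δ} {K} K>0 a< b< = subst (ℚ._< δ ℚ.* K) (sym (ℚ.∣p*q∣≡∣p∣*∣q∣ a b))
    (ℚ.≤-<-trans
      (ℚ.*-monoˡ-≤-nonNeg ∣ a ∣ {{ℚ.∣-∣-nonNeg a}} (ℚ.<⇒≤ b<))
      (ℚ.*-monoˡ-<-pos K {{ℚ.positive K>0}} a<))

  EventuallyBounded : (ℕ → ℚ) → Set
  EventuallyBounded x =
    ∃[ K ] (0ℚ ℚ.< K × ∃[ N ] ∀ n → N ℕ.≤ n → ∣ x n ∣ ℚ.< K)

  bounded : ∀ x → EventuallyBounded (seq x)
  bounded (mkℝ x c) with c 1ℚ (ℚ.positive⁻¹ 1ℚ)
  ... | N , h = K , ℚ.≤-<-trans (ℚ.0≤∣p∣ (x N)) (bound N ℕ.≤-refl) , N , bound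
    where
    K = 1ℚ ℚ.+ ∣ x N ∣
    bound : ∀ n → N ℕ.≤ n → ∣ x n ∣ ℚ.< K
    bound n N≤n = ℚ.≤-<-trans
      (subst (λ z → ∣ z ∣ ℚ.≤ ∣ x n ℚ.- x N ∣ ℚ.+ ∣ x N ∣)
        (solve 2 (λ a b → (a :- b) :+ b := a) refl (x n) (x N))
        (ℚ.∣p+q∣≤∣p∣+∣q∣ (x n ℚ.- x N) (x N)))
      (ℚ.+-monoˡ-< ∣ x N ∣ (h n N N≤n ℕ.≤-refl))

  ⊔ˡ : ∀ {M N n} → M ℕ.⊔ N ℕ.≤ n → M ℕ.≤ n
  ⊔ˡ {M} {N} = ℕ.≤-trans (ℕ.m≤m⊔n M N)

  ⊔ʳ : ∀ {M N n} → M ℕ.⊔ N ℕ.≤ n → N ℕ.≤ n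
  ⊔ʳ {M} {N} = ℕ.≤-trans (ℕ.m≤n⊔m M N)

  null-cong : ∀ {x y : ℕ → ℚ} → (∀ n → x n ≡ y n) → TendsTo0 x → TendsTo0 y
  null-cong eq h ε ε>0 with h ε ε>0
  ... | N , f = N , λ n N≤n → subst (λ z → ∣ z ∣ ℚ.< ε) (eq n) (f n N≤n)

  null-0 : ∀ {x : ℕ → ℚ} → (∀ n → x n ≡ 0ℚ) → TendsTo0 x
  null-0 eq ε ε>0 = 0 , λ n _ → subst (λ z → ∣ z ∣ ℚ.< ε) (sym (eq n)) ε>0

  null-+ : ∀ {x y} → TendsTo0 x → TendsTo0 y → TendsTo0 (λ n → x n ℚ.+ y n)
  null-+ hx hy ε ε>0 with hx _ (½-pos ε>0) | hy _ (½-pos ε>0)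
  ... | M , f | N , g = M ℕ.⊔ N , λ n le → add-small (f n (⊔ˡ le)) (g n (⊔ʳ {M} le))

  null-neg : ∀ {x} → TendsTo0 x → TendsTo0 (λ n → ℚ.- x n)
  null-neg {x} h ε ε>0 with h ε ε>0
  ... | N , f = N , λ n le → subst (ℚ._< ε) (sym (ℚ.∣-p∣≡∣p∣ (x n))) (f n le)

  null-* : ∀ {x y} → TendsTo0 x → EventuallyBounded y → TendsTo0 (λ n → x n ℚ.* y n)
  null-* hx (K , K>0 , N , g) ε ε>0 with quotient ε>0 K>0
  ... | δ , δ>0 , refl with hx δ δ>0
  ... | M , f = M ℕ.⊔ N , λ n le → mul-small K>0 (f n (⊔ˡ le)) (g n (⊔ʳ {M} le))

  pointwise : ∀ {x y} → (∀ n → seq x n ≡ seq y n) → x ≃ y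
  pointwise {x} {y} eq =
    null-0 λ n → trans (cong (ℚ._- seq y n) (eq n)) (ℚ.+-inverseʳ (seq y n))

infixl 6 _+ᴿ_
_+ᴿ_ : ℝ → ℝ → ℝ
mkℝ x cx +ᴿ mkℝ y cy = mkℝ (λ n → x n ℚ.+ y n) cauchy
  where
  cauchy : IsCauchy (λ n → x n ℚ.+ y n)
  cauchy ε ε>0 with cx _ (½-pos ε>0) | cy _ (½-pos ε>0)
  ... | M , f | N , g = M ℕ.⊔ N , λ m n lm ln →
    subst (λ z → ∣ z ∣ ℚ.< ε)
      (solve 4 (λ a b c d → (a :- c) :+ (b :- d) := (a :+ b) :- (c :+ d)) refl
        (x m) (y m) (x n) (y n))
      (add-small (f m n (⊔ˡ lm) (⊔ˡ ln)) (g m n (⊔ʳ {M} lm) (⊔ʳ {M} ln)))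

infix 8 -ᴿ_
-ᴿ_ : ℝ → ℝ
-ᴿ mkℝ x cx = mkℝ (λ n → ℚ.- x n) cauchy
  where
  cauchy : IsCauchy (λ n → ℚ.- x n)
  cauchy ε ε>0 with cx ε ε>0
  ... | N , f = N , λ m n lm ln →
    subst (ℚ._< ε)
      (trans (sym (ℚ.∣-p∣≡∣p∣ (x m ℚ.- x n)))
        (cong ∣_∣ (solve 2 (λ a b → :- (a :- b) := (:- a) :- (:- b)) refl (x m) (x n))))
      (f m n lm ln)

private
  product-difference : ∀ a b c d →
    (a ℚ.- c) ℚ.* b ℚ.+ (b ℚ.- d) ℚ.* c ≡ a ℚ.* b ℚ.- c ℚ.* d
  product-difference =
    solve 4 (λ a b c d → (a :- c) :* b :+ (b :- d) :* c := a :* b :- c :* d) refl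

  product-small : ∀ {δ L η K ε} a b c d → 0ℚ ℚ.< L → 0ℚ ℚ.< K →
    δ ℚ.* L ≡ ε ℚ.* ½ → η ℚ.* K ≡ ε ℚ.* ½ →
    ∣ a ℚ.- c ∣ ℚ.< δ → ∣ b ∣ ℚ.< L → ∣ b ℚ.- d ∣ ℚ.< η → ∣ c ∣ ℚ.< K →
    ∣ a ℚ.* b ℚ.- c ℚ.* d ∣ ℚ.< ε
  product-small {ε = ε} a b c d L>0 K>0 δL≡ ηK≡ ac< b< bd< c< =
    subst (λ z → ∣ z ∣ ℚ.< ε) (product-difference a b c d)
      (add-small {(a ℚ.- c) ℚ.* b} {(b ℚ.- d) ℚ.* c}
        (subst (∣ (a ℚ.- c) ℚ.* b ∣ ℚ.<_) δL≡ (mul-small {a ℚ.- c} {b} L>0 ac< b<))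
        (subst (∣ (b ℚ.- d) ℚ.* c ∣ ℚ.<_) ηK≡ (mul-small {b ℚ.- d} {c} K>0 bd< c<)))

infixl 7 _*ᴿ_
_*ᴿ_ : ℝ → ℝ → ℝ
X@(mkℝ x cx) *ᴿ Y@(mkℝ y cy) = mkℝ (λ n → x n ℚ.* y n) cauchy
  where
  cauchy : IsCauchy (λ n → x n ℚ.* y n)
  cauchy ε ε>0 = N , λ m n lm ln →
    product-small (x m) (y m) (x n) (y n) L>0 K>0 δL≡ ηK≡
      (h m n (⊔ˡ (l₃₄ lm)) (⊔ˡ (l₃₄ ln)))
      (g m (⊔ʳ {N₁} (l₁₂ lm)))
      (k m n (⊔ʳ {N₃} (l₃₄ lm)) (⊔ʳ {N₃} (l₃₄ ln)))
      (f n (⊔ˡ (l₁₂ ln)))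
    where
    open Σ (bounded X) renaming (proj₁ to K; proj₂ to bx)
    open Σ bx renaming (proj₁ to K>0; proj₂ to bx′)
    open Σ bx′ renaming (proj₁ to N₁; proj₂ to f)
    open Σ (bounded Y) renaming (proj₁ to L; proj₂ to by)
    open Σ by renaming (proj₁ to L>0; proj₂ to by′)
    open Σ by′ renaming (proj₁ to N₂; proj₂ to g)
    open Σ (quotient (½-pos ε>0) L>0) renaming (proj₁ to δ; proj₂ to qδ)
    open Σ qδ renaming (proj₁ to δ>0; proj₂ to δL≡)
    open Σ (quotient (½-pos ε>0) K>0) renaming (proj₁ to η; proj₂ to qη)
    open Σ qη renaming (proj₁ to η>0; proj₂ to ηK≡)
    open Σ (cx δ δ>0) renaming (proj₁ to N₃; proj₂ to h)
    open Σ (cy η η>0) renaming (proj₁ to N₄; proj₂ to k)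

    N : ℕ
    N = (N₁ ℕ.⊔ N₂) ℕ.⊔ (N₃ ℕ.⊔ N₄)

    l₁₂ : ∀ {i} → N ℕ.≤ i → N₁ ℕ.⊔ N₂ ℕ.≤ i
    l₁₂ = ⊔ˡ {N₁ ℕ.⊔ N₂}

    l₃₄ : ∀ {i} → N ℕ.≤ i → N₃ ℕ.⊔ N₄ ℕ.≤ i
    l₃₄ = ⊔ʳ {N₁ ℕ.⊔ N₂}

fromℚ : ℚ → ℝ
fromℚ q = mkℝ (λ _ → q) λ ε ε>0 → 0 , λ _ _ _ _ →
  subst (λ z → ∣ z ∣ ℚ.< ε) (sym (ℚ.+-inverseʳ q)) ε>0

0ᴿ 1ᴿ 2ᴿ : ℝ
0ᴿ = fromℚ 0ℚ
1ᴿ = fromℚ 1ℚ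
2ᴿ = 1ᴿ +ᴿ 1ᴿ

ℝ-commutativeRing : CommutativeRing 0ℓ 0ℓ
ℝ-commutativeRing = record
  { Carrier = ℝ
  ; _≈_ = _≃_
  ; _+_ = _+ᴿ_
  ; _*_ = _*ᴿ_
  ; -_ = -ᴿ_
  ; 0# = 0ᴿ
  ; 1# = 1ᴿ
  ; isCommutativeRing = record
    { isRing = record
      { +-isAbelianGroup = record
        { isGroup = record
          { isMonoid = record
            { isSemigroup = record
              { isMagma = record
                { isEquivalence = record
                  { refl = λ {x} → pointwise {x} {x} (λ _ → refl)
                  ; sym = λ {x} {y} h → null-cong
                      (λ n → solve 2 (λ a b → :- (a :- b) := b :- a) refl (seq x n) (seq y n))
                      (null-neg h)
                  ; trans = λ {x} {y} {z} h k → null-cong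
                      (λ n → solve 3 (λ a b c → (a :- b) :+ (b :- c) := a :- c) refl
                        (seq x n) (seq y n) (seq z n))
                      (null-+ h k)
                  }
                ; ∙-cong = λ {x} {y} {u} {v} h k → null-cong
                    (λ n → solve 4 (λ a b c d → (a :- b) :+ (c :- d) := (a :+ c) :- (b :+ d)) refl
                      (seq x n) (seq y n) (seq u n) (seq v n))
                    (null-+ h k)
                }
              ; assoc = λ x y z → pointwise {(x +ᴿ y) +ᴿ z} {x +ᴿ (y +ᴿ z)}
                  (λ n → ℚ.+-assoc (seq x n) (seq y n) (seq z n))
              }
            ; identity = (λ x → pointwise {0ᴿ +ᴿ x} {x} (λ n → ℚ.+-identityˡ (seq x n)))
                       , (λ x → pointwise {x +ᴿ 0ᴿ} {x} (λ n → ℚ.+-identityʳ (seq x n)))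
            }
          ; inverse = (λ x → pointwise { -ᴿ x +ᴿ x} {0ᴿ} (λ n → ℚ.+-inverseˡ (seq x n)))
                    , (λ x → pointwise {x +ᴿ -ᴿ x} {0ᴿ} (λ n → ℚ.+-inverseʳ (seq x n)))
          ; ⁻¹-cong = λ {x} {y} h → null-cong
              (λ n → solve 2 (λ a b → :- (a :- b) := (:- a) :- (:- b)) refl (seq x n) (seq y n))
              (null-neg h)
          }
        ; comm = λ x y → pointwise {x +ᴿ y} {y +ᴿ x} (λ n → ℚ.+-comm (seq x n) (seq y n))
        }
      ; *-cong = λ {x} {y} {u} {v} h k → null-cong
          (λ n → solve 4 (λ a b c d → (a :- b) :* c :+ (c :- d) :* b := a :* c :- b :* d) refl
            (seq x n) (seq y n) (seq u n) (seq v n))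
          (null-+ (null-* h (bounded u)) (null-* k (bounded y)))
      ; *-assoc = λ x y z → pointwise {(x *ᴿ y) *ᴿ z} {x *ᴿ (y *ᴿ z)}
          (λ n → ℚ.*-assoc (seq x n) (seq y n) (seq z n))
      ; *-identity = (λ x → pointwise {1ᴿ *ᴿ x} {x} (λ n → ℚ.*-identityˡ (seq x n)))
                   , (λ x → pointwise {x *ᴿ 1ᴿ} {x} (λ n → ℚ.*-identityʳ (seq x n)))
      ; distrib = (λ x y z → pointwise {x *ᴿ (y +ᴿ z)} {x *ᴿ y +ᴿ x *ᴿ z}
                    (λ n → ℚ.*-distribˡ-+ (seq x n) (seq y n) (seq z n)))
                , (λ x y z → pointwise {(y +ᴿ z) *ᴿ x} {y *ᴿ x +ᴿ z *ᴿ x}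
                    (λ n → ℚ.*-distribʳ-+ (seq x n) (seq y n) (seq z n)))
      }
    ; *-comm = λ x y → pointwise {x *ᴿ y} {y *ᴿ x} (λ n → ℚ.*-comm (seq x n) (seq y n))
    }
  }

functionSpace : ∀ {r ℓ a} (R : CommutativeRing r ℓ) (A : Set a) → Module R (r ⊔ a) (ℓ ⊔ a)
functionSpace R A = record
  { Carrierᴹ = A → Carrier
  ; _≈ᴹ_ = λ f g → ∀ a → f a ≈ g a
  ; _+ᴹ_ = λ f g a → f a + g a
  ; _*ₗ_ = λ c f a → c * f a
  ; _*ᵣ_ = λ f c a → c * f a
  ; 0ᴹ = λ _ → 0#
  ; -ᴹ_ = λ f a → - f a
  ; isModule = IsModuleFromLeft.isModule {commutativeRing = R} record
    { isLeftModule = record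
      { isLeftSemimodule = record
        { +ᴹ-isCommutativeMonoid = Pointwise.isCommutativeMonoid +-isCommutativeMonoid
        ; isPreleftSemimodule = record
          { *ₗ-cong = λ c≈d f≈g a → *-cong c≈d (f≈g a)
          ; *ₗ-zeroˡ = λ f a → zeroˡ (f a)
          ; *ₗ-distribʳ = λ f c d a → distribʳ (f a) c d
          ; *ₗ-identityˡ = λ f a → *-identityˡ (f a)
          ; *ₗ-assoc = λ c d f a → *-assoc c d (f a)
          ; *ₗ-zeroʳ = λ c a → zeroʳ c
          ; *ₗ-distribˡ = λ c f g a → distribˡ c (f a) (g a)
          }
        }
      ; -ᴹ‿cong = λ f≈g a → -‿cong (f≈g a)
      ; -ᴹ‿inverse = (λ f a → -‿inverseˡ (f a)) , (λ f a → -‿inverseʳ (f a))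
      }
    }
  }
  where
  open CommutativeRing R
  import Algebra.Construct.Pointwise A as Pointwise

module LinearAlgebra {r ℓr m ℓm} {R : CommutativeRing r ℓr} (M : Module R m ℓm) where

  open CommutativeRing R using (_≈_; 0#) renaming (Carrier to Scalar)
  open Module M
  open Sum +ᴹ-commutativeMonoid using (sum)

  -- A finite collection of vectors is a list, read as a family indexed by its
  -- positions; unions of collections are concatenations.
  linComb : (vs : List Carrierᴹ) → (Fin (length vs) → Scalar) → Carrierᴹ
  linComb vs c = sum (λ i → c i *ₗ lookup vs i)

  Span : List Carrierᴹ → Pred Carrierᴹ (r ⊔ ℓm)
  Span vs v = ∃[ c ] v ≈ᴹ linComb vs c

  LinearlyIndependent : List Carrierᴹ → Set (r ⊔ ℓr ⊔ ℓm)
  LinearlyIndependent vs = ∀ c → linComb vs c ≈ᴹ 0ᴹ → ∀ i → c i ≈ 0#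

  record IsBasis {w} (W : Pred Carrierᴹ w) (vs : List Carrierᴹ) : Set (r ⊔ ℓr ⊔ m ⊔ ℓm ⊔ w) where
    field
      elements    : All W vs
      independent : LinearlyIndependent vs
      spanning    : W ⊆ Span vs

Point : Set
Point = ℤ × ℤ

infix 4 _≟_ _⪯_ _⪯?_
_≟_ : (p q : Point) → Dec (p ≡ q)
_≟_ = Product.≡-dec ℤ._≟_ ℤ._≟_

_⪯_ : Point → Point → Set
_⪯_ = Pointwise ℤ._≤_ ℤ._≤_

_⪯?_ : (p q : Point) → Dec (p ⪯ q)
_⪯?_ = ×-decidable ℤ._≤?_ ℤ._≤?_

open DecMembership _≟_ using (_∈?_)

Subset : Set
Subset = Point → Bool

infix 4 _∋_
_∋_ : Subset → Point → Set
S ∋ p = T (S p)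

_∪｛_｝ : Subset → Point → Subset
(S ∪｛ p ｝) q = S q ∨ ⌊ q ≟ p ⌋

-- A finite poset is given by the list of its elements, ordered by _⪯_.
module OrderIdeals (P : List Point) where

  record IsOrderIdeal (S : Subset) : Set where
    field
      subset     : ∀ {p} → S ∋ p → p ∈ P
      downClosed : ∀ {p q} → p ∈ P → S ∋ q → p ⪯ q → S ∋ p

  record 𝒥 : Set where
    field
      set          : Subset
      isOrderIdeal : IsOrderIdeal set
    open IsOrderIdeal isOrderIdeal public

  open 𝒥 public

  IsMaximal : 𝒥 → Point → Set
  IsMaximal I p = set I ∋ p × (∀ {q} → set I ∋ q → p ⪯ q → q ≡ p)

  isMaximal? : ∀ I p → Dec (IsMaximal I p)
  isMaximal? I p = T? (set I p) ×-dec
    map′ (λ h {q} q∈I → All.lookup h (subset I q∈I) q∈I) (λ h → All.universal (λ q → h {q}) P)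
      (all? (λ q → T? (set I q) →-dec ((p ⪯? q) →-dec (q ≟ p))) P)

  isOrderIdeal∪? : ∀ I p → Dec (IsOrderIdeal (set I ∪｛ p ｝))
  isOrderIdeal∪? I p = map′ to from
    ((p ∈? P) ×-dec
     all? (λ r → all? (λ q → T? ((set I ∪｛ p ｝) q) →-dec ((r ⪯? q) →-dec T? ((set I ∪｛ p ｝) r))) P) P)
    where
    S = set I ∪｛ p ｝

    to : p ∈ P × All (λ r → All (λ q → S ∋ q → r ⪯ q → S ∋ r) P) P → IsOrderIdeal S
    to (p∈P , h) = record
      { subset     = S⊆P
      ; downClosed = λ r∈P q∈S → All.lookup (All.lookup h r∈P) (S⊆P q∈S) q∈S
      }
      where
      S⊆P : ∀ {q} → S ∋ q → q ∈ P
      S⊆P {q} q∈S with Equivalence.to (T-∨ {set I q}) q∈S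
      ... | inj₁ q∈I = subset I q∈I
      ... | inj₂ q≡p = subst (_∈ P) (sym (toWitness {a? = q ≟ p} q≡p)) p∈P

    from : IsOrderIdeal S → p ∈ P × All (λ r → All (λ q → S ∋ q → r ⪯ q → S ∋ r) P) P
    from J = IsOrderIdeal.subset J
               (Equivalence.from (T-∨ {set I p}) (inj₂ (fromWitness {a? = p ≟ p} refl)))
           , All.tabulate λ r∈P → All.universal (λ q → IsOrderIdeal.downClosed J r∈P) P

module Toggleability (P : List Point) where

  open OrderIdeals P public

  functions : Module ℝ-commutativeRing 0ℓ 0ℓ
  functions = functionSpace ℝ-commutativeRing 𝒥

  open Module functions public using (_+ᴹ_; -ᴹ_; 0ᴹ; _*ₗ_) renaming (Carrierᴹ to 𝓕)
  open LinearAlgebra functions public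

  infixl 6 _-ᴹ_
  _-ᴹ_ : 𝓕 → 𝓕 → 𝓕
  f -ᴹ g = f +ᴹ -ᴹ g

  [_]ᴿ : ∀ {A : Set} → Dec A → ℝ
  [ a? ]ᴿ = if does a? then 1ᴿ else 0ᴿ

  one : 𝓕
  one _ = 1ᴿ

  -- These are defined for every integer pair, and vanish when p ∉ P.
  𝟏 𝒯⁻ 𝒯⁺ 𝒯 : Point → 𝓕
  𝟏  p I = [ T? (set I p) ]ᴿ
  𝒯⁻ p I = [ isMaximal? I p ]ᴿ
  𝒯⁺ p I = [ ¬? (T? (set I p)) ×-dec isOrderIdeal∪? I p ]ᴿ
  𝒯  p   = 𝒯⁺ p -ᴹ 𝒯⁻ p

  I_T : Pred 𝓕 0ℓ
  I_T = Span (map 𝟏 P) ∩ Span (one ∷ map 𝒯 P)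

  ∑ᵈ : ℤ → (Point → 𝓕) → 𝓕
  ∑ᵈ k f = foldr _+ᴹ_ 0ᴹ (map f (filter (λ (i , j) → (i ℤ.- j) ℤ.≟ k) P))

  syntax ∑ᵈ k f = ∑[i-j≡ k ] f

open import Data.Integer.Base using (_+_; _-_; _*_)
open import Data.Integer.Properties using (_≤?_)

-- The integers from a to b inclusive; empty if b < a.
[_⋯_] : ℤ → ℤ → List ℤ
[ a ⋯ b ] with b - a
... | + d      = applyUpTo (λ t → a + + t) (suc d)
... | -[1+ _ ] = []

module Rectangle (m n : ℤ) where

  poset : List Point
  poset = cartesianProduct [ 1ℤ ⋯ m ] [ 1ℤ ⋯ n ]

  open Toggleability poset public

  B₁ B₂ : List 𝓕
  B₁ = map (λ k → ∑[i-j≡ k ] 𝒯) (filter (λ k → ¬? (k ℤ.≟ 0ℤ)) [ 1ℤ - n ⋯ m - 1ℤ ])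
    ++ (-ᴹ one +ᴹ ∑[i-j≡ 0ℤ ] 𝒯) ∷ []
  B₂ = map (λ k → ∑[i-j≡ k ] 𝟏) [ 1ℤ - n ⋯ m - 1ℤ ]

-- ([n]×[n])∖𝔖₂
module ShiftedStaircase (n : ℤ) where

  poset : List Point
  poset = filter (λ (i , j) → i ≤? j) (cartesianProduct [ 1ℤ ⋯ n ] [ 1ℤ ⋯ n ])

  open Toggleability poset public

  B₁ B₂ : List 𝓕
  B₁ = map (λ k → ∑[i-j≡ k ] 𝒯) [ 1ℤ - n ⋯ ℤ.-1ℤ ]
    ++ map (λ k → 𝒯 (k , k)) [ + 2 ⋯ n ]
    ++ (𝒯 (1ℤ , 1ℤ) -ᴹ one) ∷ []
  B₂ = map (λ k → ∑[i-j≡ k ] 𝟏) [ 1ℤ - n ⋯ ℤ.-1ℤ ]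
    ++ map (λ i → 2ᴿ *ₗ 𝟏 (i , i) -ᴹ 𝟏 (i - 1ℤ , i) -ᴹ 𝟏 (i , i + 1ℤ)) [ + 2 ⋯ n - 1ℤ ]
    ++ (2ᴿ *ₗ 𝟏 (1ℤ , 1ℤ) -ᴹ 𝟏 (1ℤ , + 2))
     ∷ (2ᴿ *ₗ 𝟏 (n , n) -ᴹ 𝟏 (n - 1ℤ , n))
     ∷ []

-- Φ⁺(Aₙ)
module RootPosetA (n : ℤ) where

  poset : List Point
  poset = filter (λ (i , j) → n + 1ℤ ≤? i + j) (cartesianProduct [ 1ℤ ⋯ n ] [ 1ℤ ⋯ n ])

  open Toggleability poset public

  B₁ B₂ : List 𝓕
  B₁ = map (λ k → -ᴹ one +ᴹ ∑[i-j≡ + 2 * k + 1ℤ - n ] 𝒯) [ 0ℤ ⋯ n - 1ℤ ]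
  B₂ = map (λ k → ∑[i-j≡ + 2 * k + 1ℤ - n ] (λ p → 2ᴿ *ₗ 𝟏 p)
               -ᴹ ∑[i-j≡ + 2 * k + + 2 - n ] 𝟏
               -ᴹ ∑[i-j≡ + 2 * k - n ] 𝟏)
           [ 0ℤ ⋯ n - 1ℤ ]

-- Φ⁺(Bₙ)
module RootPosetB (n : ℤ) where

  top : ℤ
  top = + 2 * n - 1ℤ

  poset : List Point
  poset = filter (λ (i , j) → (j ≤? i) ×-dec (+ 2 * n ≤? i + j))
                 (cartesianProduct [ 1ℤ ⋯ top ] [ 1ℤ ⋯ top ])

  open Toggleability poset public

  B₁ B₂ : List 𝓕
  B₁ = map (λ k → -ᴹ one +ᴹ ∑[i-j≡ + 2 * k ] 𝒯) [ 1ℤ ⋯ n - 1ℤ ]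
    ++ (𝒯 (n , n) -ᴹ one)
     ∷ map (λ i → 𝒯 (i , i)) [ n + 1ℤ ⋯ top ]
  B₂ = map (λ k → ∑[i-j≡ + 2 * k ] (λ p → 2ᴿ *ₗ 𝟏 p)
               -ᴹ ∑[i-j≡ + 2 * k - 1ℤ ] 𝟏
               -ᴹ ∑[i-j≡ + 2 * k + 1ℤ ] 𝟏)
           [ 1ℤ ⋯ n - 1ℤ ]
    ++ map (λ k → 2ᴿ *ₗ 𝟏 (k , k) -ᴹ 𝟏 (k , k - 1ℤ) -ᴹ 𝟏 (k + 1ℤ , k)) [ n + 1ℤ ⋯ top - 1ℤ ]
    ++ (2ᴿ *ₗ 𝟏 (top , top) -ᴹ 𝟏 (top , top - 1ℤ))
     ∷ (2ᴿ *ₗ 𝟏 (n , n) -ᴹ 𝟏 (n + 1ℤ , n))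
     ∷ []

{-# OPTIONS --safe #-}
module Submission where

-- Expanding 𝒯_p⁺ and 𝒯_p⁻ by inclusion-exclusion in the indicators 𝟏_q, 𝒯_p is a constant,
-- plus linear terms, plus a quadratic term 𝟏_{p-e₁} 𝟏_{p-e₂} at the lower corner of p, minus
-- the same term at p + (1,1).  A second difference over the ideals below q shows that in a
-- combination of 1 and the 𝒯_p lying in the span of the indicators the quadratic terms
-- cancel, i.e. the coefficients d satisfy d(q) = d(q - (1,1)) whenever both lower
-- neighbours of q are present; the empty ideal fixes the constant.  The combination is then
-- Σ_q (Δd)(q) 𝟏_q for an explicit discrete Laplacian Δ (`lap`), so I_T is the image of such
-- weights d under Δ.  On diagonals, Δ is the Laplacian of a path, with Dirichlet ends for
-- the rectangle and a Neumann end for the shifted staircase; it is invertible there, and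
-- inverting it turns each 𝓑₁ into the corresponding 𝓑₂.  For the root posets d vanishes on
-- every other diagonal, Δ is -2 on the remaining ones, and 𝓑₂ is the negative of 𝓑₁.
-- All of this holds over an arbitrary commutative ℚ-algebra in place of ℝ.

open import Level using (0ℓ)
open import Algebra.Bundles using (CommutativeRing)
open import Algebra.Module.Bundles using (Module)
import Algebra.Properties.AbelianGroup as AbelianGroupProperties
open import Algebra.Solver.Ring.AlmostCommutativeRing
  using (fromCommutativeRing; _-Raw-AlmostCommutative⟶_)
import Algebra.Properties.Ring as RingProperties
import Algebra.Solver.Ring as RingSolver
open import Data.Bool.Base using (Bool; true; false; T; if_then_else_)
open import Data.Bool.Properties using (T?; T-∨)
open import Data.Empty using (⊥; ⊥-elim)
open import Data.Fin.Base using (Fin; zero; suc)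
open import Data.Integer.Base as ℤ using (ℤ; +_; 0ℤ; 1ℤ; +≤+)
import Data.Integer.Properties as ℤ
open import Data.Integer.Tactic.RingSolver using () renaming (solve to ℤsolve)
open import Data.List.Base
  using (List; []; _∷_; _++_; length; map; filter; foldr; applyUpTo; cartesianProduct)
import Data.List.Membership.DecPropositional as DecMembership
open import Data.List.Membership.Propositional using (_∈_; _∉_)
open import Data.List.Membership.Propositional.Properties
open import Data.List.Relation.Binary.Pointwise as Pointwise using (Pointwise; ++⁺)
open import Data.List.Relation.Unary.All as All using (All)
open import Data.List.Relation.Unary.AllPairs as AllPairs using ()
open import Data.List.Relation.Unary.Any using (here; there; any?)
open import Data.List.Relation.Unary.Unique.Propositional using (Unique)
import Data.List.Relation.Unary.Unique.Propositional.Properties as Unique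
open import Data.Maybe.Base using (Maybe; just; nothing)
open import Data.Nat.Base as ℕ using (ℕ; zero; suc; _≤_; z≤n)
import Data.Nat.Properties as ℕ
open import Data.Product.Base using (Σ; _×_; _,_; proj₁; proj₂)
open import Data.Rational.Base as ℚ using (ℚ; 0ℚ; 1ℚ; 1/_)
import Data.Rational.Properties as ℚ
open import Data.Sum.Base using (_⊎_; inj₁; inj₂)
import Data.Sum.Properties as Sum
open import Data.Unit.Base using (⊤; tt)
open import Function.Bundles using (Equivalence)
open import Relation.Binary.Definitions using (DecidableEquality)
open import Relation.Binary.PropositionalEquality as ≡ using (_≡_; _≢_)
import Relation.Binary.Reasoning.Setoid as SetoidReasoning
open import Relation.Nullary using (Dec; does; yes; no; ¬_; contradiction)
open import Relation.Nullary.Decidable using (toWitness; fromWitness; ¬?; _×-dec_; _→-dec_)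
open import Relation.Unary using (Pred; _∩_; Decidable)
open import Defs

open AbelianGroupProperties ℤ.+-0-abelianGroup using (∙-cancelˡ)
open DecMembership _≟_ using (_∈?_)

-- Equality of reals is undecidable, so neither pivoting nor a dimension count is available:
-- injectivity of the Laplacian and membership in its image both need explicit combinations. One
-- argument yields both. The recurrences of `Harmonic` are solved modulo an arbitrary subspace `W`.
-- With the zero space they show that a weight with zero Laplacian vanishes; with the image of the
-- Laplacian they show that every diagonal indicator lies in that image, because a path Laplacian is
-- symmetric and the sequence of indicators satisfies the same recurrence. The only divisions are by
-- 2 and by the length of the path, so a homomorphism from ℚ suffices; it is also the coefficient
-- map of the ring solver. The Laplacian depends only on diagonals even at the border of P. Where a
-- lower neighbour is missing, the quadratic term of a toggle degenerates to a linear one, and this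
-- term comes from a point on the same diagonal as the neighbour that is missing, so it stands in
-- for it.

ℚ-Algebra : CommutativeRing 0ℓ 0ℓ → Set
ℚ-Algebra R = ℚ.+-*-rawRing -Raw-AlmostCommutative⟶ fromCommutativeRing R

-- Finite sums and indicators over a ℚ-algebra

module Sums (R : CommutativeRing 0ℓ 0ℓ)
            (φ : ℚ-Algebra R) where

  open CommutativeRing R hiding (zero)
  open SetoidReasoning setoid
  module φ = _-Raw-AlmostCommutative⟶_ φ

  -- Normal forms of the solver have rational coefficients, and these are compared in ℚ, where
  -- equality is decidable; in R it need not be.
  decide : ∀ a b → Maybe (φ.⟦ a ⟧ ≈ φ.⟦ b ⟧)
  decide a b with a ℚ.≟ b
  ... | yes ≡.refl = just refl
  ... | no _ = nothing

  module Solver = RingSolver ℚ.+-*-rawRing (fromCommutativeRing R) φ decide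
  open Solver using (solve; _:+_; _:*_; _:-_; :-_; con; _:=_)

  private variable
    X Y : Set
    xs : List X

  𝟙 : Bool → Carrier
  𝟙 b = if b then 1# else 0#

  𝟙[_] : ∀ {A : Set} → Dec A → Carrier
  𝟙[ a? ] = 𝟙 (does a?)

  𝟙-true : ∀ {A : Set} (a? : Dec A) → A → 𝟙[ a? ] ≈ 1#
  𝟙-true (yes _) _ = refl
  𝟙-true (no ¬a) a = contradiction a ¬a

  𝟙-false : ∀ {A : Set} (a? : Dec A) → ¬ A → 𝟙[ a? ] ≈ 0#
  𝟙-false (yes a) ¬a = contradiction a ¬a
  𝟙-false (no _) _ = refl

  𝟙-⇔ : ∀ {A B : Set} (a? : Dec A) (b? : Dec B) → (A → B) → (B → A) → 𝟙[ a? ] ≈ 𝟙[ b? ]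
  𝟙-⇔ (yes a) b? f g = sym (𝟙-true b? (f a))
  𝟙-⇔ (no ¬a) b? f g = sym (𝟙-false b? (λ b → ¬a (g b)))

  ∑ : List X → (X → Carrier) → Carrier
  ∑ []       f = 0#
  ∑ (x ∷ xs) f = f x + ∑ xs f

  ∑-cong : ∀ {f g : X → Carrier} → (∀ {x} → x ∈ xs → f x ≈ g x) → ∑ xs f ≈ ∑ xs g
  ∑-cong {xs = []}     eq = refl
  ∑-cong {xs = x ∷ xs} eq = +-cong (eq (here ≡.refl)) (∑-cong (λ m → eq (there m)))

  ∑-0 : ∀ {f : X → Carrier} → (∀ {x} → x ∈ xs → f x ≈ 0#) → ∑ xs f ≈ 0#
  ∑-0 {xs = []}     eq = refl
  ∑-0 {xs = x ∷ xs} eq =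
    trans (+-cong (eq (here ≡.refl)) (∑-0 (λ m → eq (there m)))) (+-identityˡ 0#)

  ∑-+ : ∀ xs (f g : X → Carrier) → ∑ xs (λ x → f x + g x) ≈ ∑ xs f + ∑ xs g
  ∑-+ []       f g = sym (+-identityˡ 0#)
  ∑-+ (x ∷ xs) f g = trans (+-congˡ (∑-+ xs f g))
    (solve 4 (λ a b c d → (a :+ b) :+ (c :+ d) := (a :+ c) :+ (b :+ d)) refl _ _ _ _)

  ∑-*ˡ : ∀ xs c (f : X → Carrier) → ∑ xs (λ x → c * f x) ≈ c * ∑ xs f
  ∑-*ˡ []       c f = sym (zeroʳ c)
  ∑-*ˡ (x ∷ xs) c f = trans (+-congˡ (∑-*ˡ xs c f)) (sym (distribˡ c _ _))

  ∑-*ʳ : ∀ xs c (f : X → Carrier) → ∑ xs (λ x → f x * c) ≈ ∑ xs f * c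
  ∑-*ʳ []       c f = sym (zeroˡ c)
  ∑-*ʳ (x ∷ xs) c f = trans (+-congˡ (∑-*ʳ xs c f)) (sym (distribʳ c _ _))

  ∑-neg : ∀ xs (f : X → Carrier) → ∑ xs (λ x → - f x) ≈ - ∑ xs f
  ∑-neg xs f = trans (∑-cong {xs = xs} (λ _ → solve 1 (λ a → :- a := con (ℚ.- ℚ.1ℚ) :* a) refl _))
    (trans (∑-*ˡ xs _ f) (solve 1 (λ a → con (ℚ.- ℚ.1ℚ) :* a := :- a) refl _))

  ∑-- : ∀ xs (f g : X → Carrier) → ∑ xs (λ x → f x - g x) ≈ ∑ xs f - ∑ xs g
  ∑-- xs f g = trans (∑-+ xs f (λ x → - g x)) (+-congˡ (∑-neg xs g))

  ∑-comm : ∀ xs (ys : List Y) (f : X → Y → Carrier) →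
           ∑ xs (λ x → ∑ ys (f x)) ≈ ∑ ys (λ y → ∑ xs (λ x → f x y))
  ∑-comm []       ys f = sym (∑-0 {xs = ys} (λ _ → refl))
  ∑-comm (x ∷ xs) ys f = trans (+-congˡ (∑-comm xs ys f)) (sym (∑-+ ys (f x) _))

  ∑-single : ∀ {xs : List X} {f : X → Carrier} {x} → Unique xs → x ∈ xs →
             (∀ {y} → y ∈ xs → y ≢ x → f y ≈ 0#) → ∑ xs f ≈ f x
  ∑-single {xs = y ∷ ys} (y∉ AllPairs.∷ u) (here ≡.refl) z = trans
    (+-congˡ (∑-0 (λ m → z (there m) (λ eq → All.lookup y∉ m (≡.sym eq)))))
    (+-identityʳ _)
  ∑-single {xs = y ∷ ys} (y∉ AllPairs.∷ u) (there m) z = trans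
    (+-cong (z (here ≡.refl) (All.lookup y∉ m)) (∑-single u m (λ m' → z (there m'))))
    (+-identityˡ _)

  ∑-filter : ∀ {Q : X → Set} (Q? : ∀ x → Dec (Q x)) xs (f : X → Carrier) →
             ∑ (filter Q? xs) f ≈ ∑ xs (λ x → 𝟙[ Q? x ] * f x)
  ∑-filter Q? []       f = refl
  ∑-filter Q? (x ∷ xs) f with does (Q? x)
  ... | true  = +-cong (sym (*-identityˡ _)) (∑-filter Q? xs f)
  ... | false = trans (∑-filter Q? xs f)
    (trans (sym (+-identityˡ _)) (+-congʳ (sym (zeroˡ _))))

  module _ (_≟_ : DecidableEquality X) where

    -- The point `x` may lie outside `xs`, where the last hypothesis makes both sides vanish. This
    -- occurs for neighbours of border points.
    ∑-pick : ∀ {xs} (f : X → Carrier) x → Unique xs → (x ∉ xs → f x ≈ 0#) →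
             ∑ xs (λ y → 𝟙[ y ≟ x ] * f y) ≈ f x
    ∑-pick {xs} f x u z with any? (_≟_ x) xs
    ... | yes m = trans
      (∑-single u m (λ _ y≢x → trans (*-congʳ (𝟙-false (_ ≟ x) y≢x)) (zeroˡ _)))
      (trans (*-congʳ (𝟙-true (x ≟ x) ≡.refl)) (*-identityˡ _))
    ... | no ∉xs = trans
      (∑-0 (λ {y} m → trans (*-congʳ (𝟙-false (y ≟ x) (λ { ≡.refl → ∉xs m }))) (zeroˡ _)))
      (sym (z ∉xs))

    -- The shift `σ` does not map `xs` to itself. Both sums are compared with a double sum over a
    -- Kronecker delta, and the two vanishing hypotheses dispose of the terms that `σ` or `τ`
    -- carries out of `xs`.
    ∑-reindex : ∀ {xs} (σ τ : X → X) → (∀ x → τ (σ x) ≡ x) → (∀ x → σ (τ x) ≡ x) →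
                (f g : X → Carrier) → Unique xs →
                (∀ {x} → x ∉ xs → f x ≈ 0#) → (∀ {y} → y ∉ xs → f (τ y) * g y ≈ 0#) →
                ∑ xs (λ x → f x * g (σ x)) ≈ ∑ xs (λ y → f (τ y) * g y)
    ∑-reindex {xs} σ τ τσ στ f g u f0 fg0 = begin
      ∑ xs (λ x → f x * g (σ x))
        ≈⟨ ∑-cong {xs = xs} (λ {x} _ → sym (∑-pick (λ y → f x * g y) (σ x) u
             (λ ∉xs → trans (*-congʳ (reflexive (≡.cong f (≡.sym (τσ x))))) (fg0 ∉xs)))) ⟩
      ∑ xs (λ x → ∑ xs (λ y → 𝟙[ y ≟ σ x ] * (f x * g y)))
        ≈⟨ ∑-comm xs xs _ ⟩
      ∑ xs (λ y → ∑ xs (λ x → 𝟙[ y ≟ σ x ] * (f x * g y)))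
        ≈⟨ ∑-cong {xs = xs} (λ {y} _ → ∑-cong {xs = xs} (λ {x} _ → *-congʳ
             (𝟙-⇔ (y ≟ σ x) (x ≟ τ y)
               (λ { ≡.refl → ≡.sym (τσ x) }) (λ { ≡.refl → ≡.sym (στ y) })))) ⟩
      ∑ xs (λ y → ∑ xs (λ x → 𝟙[ x ≟ τ y ] * (f x * g y)))
        ≈⟨ ∑-cong {xs = xs} (λ {y} _ → ∑-pick (λ x → f x * g y) (τ y) u
             (λ ∉xs → trans (*-congʳ (f0 ∉xs)) (zeroˡ _))) ⟩
      ∑ xs (λ y → f (τ y) * g y) ∎

-- Families of functions indexed by labels, and bases

module Families (R : CommutativeRing 0ℓ 0ℓ)
                (φ : ℚ-Algebra R)
                (A : Set) where

  open CommutativeRing R hiding (zero)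
  open Sums R φ
  open LinearAlgebra (functionSpace R A)

  private
    𝓕 : Set
    𝓕 = A → Carrier

  module _ {X : Set} where

    private variable
      xs : List X
      b : X → 𝓕
      vs : List 𝓕

    -- A collection in the statement is indexed by positions. Matching it with a list of labels, up
    -- to pointwise equality, lets linear combinations be sums over labels.
    Lists : List X → (X → 𝓕) → List 𝓕 → Set
    Lists xs b = Pointwise (λ x v → ∀ a → b x a ≈ v a) xs

    lists-map : ∀ (b g : X → 𝓕) xs → (∀ {x} → x ∈ xs → ∀ a → b x a ≈ g x a) → Lists xs b (map g xs)
    lists-map b g []       eq = Pointwise.[]
    lists-map b g (x ∷ xs) eq = eq (here ≡.refl) Pointwise.∷ lists-map b g xs (λ m → eq (there m))

    lists-reindex : ∀ {Y : Set} (ι : Y → X) {ys} → Pointwise (λ y v → ∀ a → b (ι y) a ≈ v a) ys vs → Lists (map ι ys) b vs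
    lists-reindex ι Pointwise.[]       = Pointwise.[]
    lists-reindex ι (l Pointwise.∷ ls) = l Pointwise.∷ lists-reindex ι ls

    toCoeffs : Lists xs b vs → (X → Carrier) → Fin (length vs) → Carrier
    toCoeffs {xs = x ∷ _} (_ Pointwise.∷ ls) e zero    = e x
    toCoeffs {xs = x ∷ _} (_ Pointwise.∷ ls) e (suc i) = toCoeffs ls e i

    linComb-toCoeffs : (ls : Lists xs b vs) (e : X → Carrier) → ∀ a →
                       linComb vs (toCoeffs ls e) a ≈ ∑ xs (λ x → e x * b x a)
    linComb-toCoeffs Pointwise.[]       e a = refl
    linComb-toCoeffs (l Pointwise.∷ ls) e a = +-cong (*-congˡ (sym (l a))) (linComb-toCoeffs ls e a)

    module _ (_≟_ : DecidableEquality X) where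

      -- A label receives the coefficient of its first position, and 0 if it does not occur. The
      -- default 0 later gives toggle coefficients their support in P.
      fromCoeffs : {xs : List X} → Lists xs b vs → (Fin (length vs) → Carrier) → X → Carrier
      fromCoeffs {xs = []} Pointwise.[] c y = 0#
      fromCoeffs {xs = x ∷ _} (_ Pointwise.∷ ls) c y with y ≟ x
      ... | yes _ = c zero
      ... | no  _ = fromCoeffs ls (λ i → c (suc i)) y

      fromCoeffs-here : ∀ {x} {xs : List X} {v b vs} (l : ∀ a → b x a ≈ v a) (ls : Lists xs b vs) c →
                        fromCoeffs {b = b} {vs = v ∷ vs} {xs = x ∷ xs} (l Pointwise.∷ ls) c x ≈ c zero
      fromCoeffs-here {x = x} l ls c with x ≟ x
      ... | yes _   = refl
      ... | no  x≢x = contradiction ≡.refl x≢x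

      fromCoeffs-there : ∀ {x y} {xs : List X} {v b vs} (l : ∀ a → b x a ≈ v a) (ls : Lists xs b vs) c →
                         y ≢ x → fromCoeffs {b = b} {vs = v ∷ vs} {xs = x ∷ xs} (l Pointwise.∷ ls) c y
                                 ≈ fromCoeffs ls (λ i → c (suc i)) y
      fromCoeffs-there {x = x} {y} l ls c y≢x with y ≟ x
      ... | yes y≡x = contradiction y≡x y≢x
      ... | no  _   = refl

      fromCoeffs-∉ : ∀ {xs : List X} (ls : Lists xs b vs) c {y} → y ∉ xs → fromCoeffs ls c y ≈ 0#
      fromCoeffs-∉ Pointwise.[] c y∉ = refl
      fromCoeffs-∉ {b = b} (l Pointwise.∷ ls) c y∉ = trans
        (fromCoeffs-there {b = b} l ls c (λ y≡x → y∉ (here y≡x)))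
        (fromCoeffs-∉ ls _ (λ m → y∉ (there m)))

      linComb-fromCoeffs : ∀ {xs : List X} (ls : Lists xs b vs) c → Unique xs → ∀ a →
                           linComb vs c a ≈ ∑ xs (λ x → fromCoeffs ls c x * b x a)
      linComb-fromCoeffs Pointwise.[] c u a = refl
      linComb-fromCoeffs {b = b} {xs = x ∷ xs} (l Pointwise.∷ ls) c (x∉ AllPairs.∷ u) a = +-cong
        (*-cong (sym (fromCoeffs-here {b = b} l ls c)) (sym (l a)))
        (trans (linComb-fromCoeffs ls _ u a)
          (∑-cong {xs = xs} λ m → *-congʳ (sym (fromCoeffs-there {b = b} l ls c
            (λ y≡x → All.lookup x∉ m (≡.sym y≡x))))))

      fromCoeffs-0 : ∀ {xs : List X} (ls : Lists xs b vs) c → Unique xs →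
                     (∀ {x} → x ∈ xs → fromCoeffs ls c x ≈ 0#) → ∀ i → c i ≈ 0#
      fromCoeffs-0 {b = b} (l Pointwise.∷ ls) c u z zero = trans (sym (fromCoeffs-here {b = b} l ls c)) (z (here ≡.refl))
      fromCoeffs-0 {b = b} (l Pointwise.∷ ls) c (x∉ AllPairs.∷ u) z (suc i) = fromCoeffs-0 ls _ u
        (λ m → trans (sym (fromCoeffs-there {b = b} l ls c (λ y≡x → All.lookup x∉ m (≡.sym y≡x)))) (z (there m))) i

    record IsFamilyBasis (W : Pred 𝓕 0ℓ) (xs : List X) (b : X → 𝓕) : Set where
      field
        elements    : ∀ {x} → x ∈ xs → W (b x)
        independent : ∀ (e : X → Carrier) → (∀ a → ∑ xs (λ x → e x * b x a) ≈ 0#) → ∀ {x} → x ∈ xs → e x ≈ 0#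
        spanning    : ∀ {f} → W f → Σ (X → Carrier) λ e → ∀ a → f a ≈ ∑ xs (λ x → e x * b x a)

    isBasis : ∀ {W} → (∀ {f g} → (∀ a → f a ≈ g a) → W f → W g) →
              DecidableEquality X → {xs : List X} → Unique xs → Lists xs b vs →
              IsFamilyBasis W xs b → IsBasis W vs
    isBasis {b = b} {W = W} resp _≟_ u ls B = record
      { elements    = all ls B.elements
      ; independent = λ c c≈0 → fromCoeffs-0 _≟_ ls c u
          (B.independent _ λ a → trans (sym (linComb-fromCoeffs _≟_ ls c u a)) (c≈0 a))
      ; spanning    = λ Wf → let e , f≈ = B.spanning Wf in
          toCoeffs ls e , λ a → trans (f≈ a) (sym (linComb-toCoeffs ls e a))
      }
      where
      module B = IsFamilyBasis B
      all : ∀ {xs : List X} {vs} → Lists xs b vs → (∀ {x} → x ∈ xs → W (b x)) → All W vs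
      all Pointwise.[]       W-b = All.[]
      all (l Pointwise.∷ ls) W-b = resp l (W-b (here ≡.refl)) All.∷ all ls (λ m → W-b (there m))

-- Integer inequalities and unit steps in the plane

-- Linear inequalities are proved by exhibiting b - a as a sum of nonnegative quantities.
≤-by : ∀ {x y a b} → x ℤ.≤ y → b ℤ.- a ≡ y ℤ.- x → a ℤ.≤ b
≤-by h eq = ℤ.0≤i-j⇒j≤i (≡.subst (0ℤ ℤ.≤_) (≡.sym eq) (ℤ.i≤j⇒0≤j-i h))

-- The counterpart of `≤-by` for contradictions: a sum of inequalities whose difference normalises
-- to a negative literal. The value `k = 0` stands for the difference -1.
≤-absurd : ∀ {x y k} → x ℤ.≤ y → y ℤ.- x ≡ ℤ.-[1+ k ] → ⊥
≤-absurd {k = k} h eq with ≡.subst (0ℤ ℤ.≤_) eq (ℤ.i≤j⇒0≤j-i h)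
... | ()

0≤1 : 0ℤ ℤ.≤ 1ℤ
0≤1 = +≤+ z≤n

i-1≤i : ∀ i → i ℤ.- 1ℤ ℤ.≤ i
i-1≤i i = ≤-by 0≤1 (ℤsolve (i ∷ []))

i≤i+1 : ∀ i → i ℤ.≤ i ℤ.+ 1ℤ
i≤i+1 i = ≤-by 0≤1 (ℤsolve (i ∷ []))

i-1+1≡i : ∀ i → i ℤ.- 1ℤ ℤ.+ 1ℤ ≡ i
i-1+1≡i i = ℤsolve (i ∷ [])

i+1-1≡i : ∀ i → i ℤ.+ 1ℤ ℤ.- 1ℤ ≡ i
i+1-1≡i i = ℤsolve (i ∷ [])

<⇒+1≤ : ∀ {i j} → i ℤ.< j → i ℤ.+ 1ℤ ℤ.≤ j
<⇒+1≤ {i} {j} i<j = ≡.subst (ℤ._≤ j) (ℤ.+-comm 1ℤ i) (ℤ.i<j⇒suc[i]≤j i<j)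

≤∧≢⇒≤-1 : ∀ {i j} → i ℤ.≤ j → i ≢ j → i ℤ.≤ j ℤ.- 1ℤ
≤∧≢⇒≤-1 {i} {j} i≤j i≢j = ≤-by (<⇒+1≤ (ℤ.≤∧≢⇒< i≤j i≢j)) (ℤsolve (i ∷ j ∷ []))

left right down up : Point → Point
left  (i , j) = i ℤ.- 1ℤ , j
right (i , j) = i ℤ.+ 1ℤ , j
down  (i , j) = i , j ℤ.- 1ℤ
up    (i , j) = i , j ℤ.+ 1ℤ

diag⁺ diag⁻ : Point → Point
diag⁺ p = right (up p)
diag⁻ p = left (down p)

diag⁻⁺ : ∀ p → diag⁻ (diag⁺ p) ≡ p
diag⁻⁺ (i , j) = ≡.cong₂ _,_ (i+1-1≡i i) (i+1-1≡i j)

diag⁺⁻ : ∀ p → diag⁺ (diag⁻ p) ≡ p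
diag⁺⁻ (i , j) = ≡.cong₂ _,_ (i-1+1≡i i) (i-1+1≡i j)

right-left : ∀ p → right (left p) ≡ p
right-left (i , j) = ≡.cong (_, j) (i-1+1≡i i)

left-right : ∀ p → left (right p) ≡ p
left-right (i , j) = ≡.cong (_, j) (i+1-1≡i i)

up-down : ∀ p → up (down p) ≡ p
up-down (i , j) = ≡.cong (i ,_) (i-1+1≡i j)

down-up : ∀ p → down (up p) ≡ p
down-up (i , j) = ≡.cong (i ,_) (i+1-1≡i j)

left-injective : ∀ {p q} → left p ≡ left q → p ≡ q
left-injective {p} {q} eq = ≡.trans (≡.sym (right-left p)) (≡.trans (≡.cong right eq) (right-left q))

left⪯ : ∀ p → left p ⪯ p
left⪯ (i , j) = i-1≤i i , ℤ.≤-refl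

down⪯ : ∀ p → down p ⪯ p
down⪯ (i , j) = ℤ.≤-refl , i-1≤i j

⪯right : ∀ p → p ⪯ right p
⪯right (i , j) = i≤i+1 i , ℤ.≤-refl

⪯up : ∀ p → p ⪯ up p
⪯up (i , j) = ℤ.≤-refl , i≤i+1 j

⪯-refl : ∀ {p} → p ⪯ p
⪯-refl = ℤ.≤-refl , ℤ.≤-refl

⪯-trans : ∀ {p q r} → p ⪯ q → q ⪯ r → p ⪯ r
⪯-trans (a , b) (c , d) = ℤ.≤-trans a c , ℤ.≤-trans b d

⪯-antisym : ∀ {p q} → p ⪯ q → q ⪯ p → p ≡ q
⪯-antisym (a , b) (c , d) = ≡.cong₂ _,_ (ℤ.≤-antisym a c) (ℤ.≤-antisym b d)

i-1≢i : ∀ {i} → i ℤ.- 1ℤ ≢ i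
i-1≢i {i} eq = ≤-absurd {k = 0} (ℤ.≤-reflexive (≡.sym eq)) (ℤsolve (i ∷ []))

i+1≢i : ∀ {i} → i ℤ.+ 1ℤ ≢ i
i+1≢i {i} eq = ≤-absurd {k = 0} (ℤ.≤-reflexive eq) (ℤsolve (i ∷ []))

i-1-1≢i : ∀ {i} → i ℤ.- 1ℤ ℤ.- 1ℤ ≢ i
i-1-1≢i {i} eq = ≤-absurd {k = 1} (ℤ.≤-reflexive (≡.sym eq)) (ℤsolve (i ∷ []))

i+1≢i-1 : ∀ {i} → i ℤ.+ 1ℤ ≢ i ℤ.- 1ℤ
i+1≢i-1 {i} eq = ≤-absurd {k = 1} (ℤ.≤-reflexive eq) (ℤsolve (i ∷ []))

left≢ : ∀ {p} → left p ≢ p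
left≢ eq = i-1≢i (≡.cong proj₁ eq)

down≢ : ∀ {p} → down p ≢ p
down≢ eq = i-1≢i (≡.cong proj₂ eq)

-- Between `left q` and `q` the second coordinate is constant and the first has no integer left to
-- take.
left-covered : ∀ {p q} → left q ⪯ p → p ⪯ q → p ≢ q → p ≡ left q
left-covered {i , j} (a , b) (c , d) p≢q with ℤ.≤-antisym b d
... | ≡.refl = ≡.cong (_, j)
  (ℤ.≤-antisym (≤∧≢⇒≤-1 c (λ { ≡.refl → p≢q ≡.refl })) a)

down-covered : ∀ {p q} → down q ⪯ p → p ⪯ q → p ≢ q → p ≡ down q
down-covered {i , j} (a , b) (c , d) p≢q with ℤ.≤-antisym a c
... | ≡.refl = ≡.cong (i ,_)
  (ℤ.≤-antisym (≤∧≢⇒≤-1 d (λ { ≡.refl → p≢q ≡.refl })) b)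

-- Toggles as polynomials in the indicators

-- The covering relations of P are unit steps, and P is closed under joins of
-- two elements covering a common lattice point.
record IsLatticeRegion (P : List Point) : Set where
  field
    unique : Unique P
    below  : ∀ {p q} → p ∈ P → q ∈ P → p ⪯ q → p ≢ q →
             (left q ∈ P × p ⪯ left q) ⊎ (down q ∈ P × p ⪯ down q)
    above  : ∀ {p q} → p ∈ P → q ∈ P → p ⪯ q → p ≢ q →
             (right p ∈ P × right p ⪯ q) ⊎ (up p ∈ P × up p ⪯ q)
    corner : ∀ {q} → left q ∈ P → down q ∈ P → q ∈ P

-- At R = ℝ the functions 𝟏 and 𝒯 are those of Toggleability P.
module ToggleFunctions (R : CommutativeRing 0ℓ 0ℓ)
                       (φ : ℚ-Algebra R)
                       (P : List Point) where

  open CommutativeRing R hiding (zero)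
  open Sums R φ
  open OrderIdeals P

  𝓕 : Set
  𝓕 = 𝒥 → Carrier

  𝟏 𝒯 : Point → 𝓕
  𝟏 p I = 𝟙[ T? (set I p) ]
  𝒯 p I = 𝟙[ ¬? (T? (set I p)) ×-dec isOrderIdeal∪? I p ] - 𝟙[ isMaximal? I p ]

module Toggles (R : CommutativeRing 0ℓ 0ℓ)
               (φ : ℚ-Algebra R)
               (P : List Point) (region : IsLatticeRegion P) where

  open CommutativeRing R hiding (zero)
  open Sums R φ
  open Solver using (solve; _:+_; _:*_; _:-_; :-_; con; _:=_)
  open IsLatticeRegion region
  open RingProperties ring using (-0#≈0#; -‿involutive)
  open OrderIdeals P
  open Families R φ 𝒥
  open LinearAlgebra (functionSpace R 𝒥)
  open ToggleFunctions R φ P public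
  open SetoidReasoning setoid

  ν μ : Point → Carrier
  ν p = 𝟙[ ¬? (p ∈? P) ]
  μ p = ν (left p) * ν (down p)

  x-0≈x : ∀ x → x - 0# ≈ x
  x-0≈x x = trans (+-congˡ -0#≈0#) (+-identityʳ x)

  -- A neighbour outside P puts no condition on adding a point, so it counts as present. The product
  -- of `lowered` over the two lower neighbours is 1 exactly when every lower neighbour lying in P
  -- belongs to the ideal.
  lowered : Point → 𝓕
  lowered p I = 𝟏 p I + ν p

  lowered-1 : ∀ I p → (p ∈ P → set I ∋ p) → lowered p I ≈ 1#
  lowered-1 I p h with p ∈? P
  ... | yes p∈P = trans (+-identityʳ _) (𝟙-true (T? (set I p)) (h p∈P))
  ... | no  p∉P = trans (+-congʳ (𝟙-false (T? (set I p)) (λ p∈I → p∉P (subset I p∈I)))) (+-identityˡ _)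

  lowered-0 : ∀ I {p} → p ∈ P → ¬ set I ∋ p → lowered p I ≈ 0#
  lowered-0 I {p} p∈P p∉I = trans
    (+-cong (𝟙-false (T? (set I p)) p∉I) (𝟙-false (¬? (p ∈? P)) (λ p∉P → p∉P p∈P)))
    (+-identityˡ _)

  -- By `below`, whatever lies strictly under `p` lies under a lower neighbour of `p` in P; if those
  -- neighbours are in `I`, down-closure of `I` covers everything else.
  addable : ∀ I {p} → p ∈ P → ¬ set I ∋ p → (left p ∈ P → set I ∋ left p) →
            (down p ∈ P → set I ∋ down p) → IsOrderIdeal (set I ∪｛ p ｝)
  addable I {p} p∈P p∉I l d = record { subset = sub ; downClosed = λ {r} {q} r∈P q∈S r⪯q → down-closed {r} {q} r∈P q∈S r⪯q (r ≟ p) }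
    where
    cases : ∀ {q} → (set I ∪｛ p ｝) ∋ q → set I ∋ q ⊎ q ≡ p
    cases {q} q∈S with Equivalence.to (T-∨ {set I q}) q∈S
    ... | inj₁ q∈I = inj₁ q∈I
    ... | inj₂ q≡p = inj₂ (toWitness {a? = q ≟ p} q≡p)

    old : ∀ {q} → set I ∋ q → (set I ∪｛ p ｝) ∋ q
    old {q} q∈I = Equivalence.from (T-∨ {set I q}) (inj₁ q∈I)

    new : ∀ {q} → q ≡ p → (set I ∪｛ p ｝) ∋ q
    new {q} q≡p = Equivalence.from (T-∨ {set I q}) (inj₂ (fromWitness {a? = q ≟ p} q≡p))

    down-closed : ∀ {r q} → r ∈ P → (set I ∪｛ p ｝) ∋ q → r ⪯ q → Dec (r ≡ p) → (set I ∪｛ p ｝) ∋ r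
    down-closed r∈P q∈S r⪯q (yes r≡p) = new r≡p
    down-closed {r} {q} r∈P q∈S r⪯q (no r≢p) with cases {q} q∈S
    ... | inj₁ q∈I    = old (downClosed I r∈P q∈I r⪯q)
    ... | inj₂ ≡.refl with below r∈P p∈P r⪯q r≢p
    ...   | inj₁ (l∈P , r⪯l) = old (downClosed I r∈P (l l∈P) r⪯l)
    ...   | inj₂ (d∈P , r⪯d) = old (downClosed I r∈P (d d∈P) r⪯d)

    sub : ∀ {q} → (set I ∪｛ p ｝) ∋ q → q ∈ P
    sub {q} q∈S with cases {q} q∈S
    ... | inj₁ q∈I    = subset I q∈I
    ... | inj₂ ≡.refl = p∈P

  addable⁻ : ∀ I {p q} → IsOrderIdeal (set I ∪｛ p ｝) → q ∈ P → q ⪯ p → q ≢ p → set I ∋ q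
  addable⁻ I {p} {q} J q∈P q⪯p q≢p
    with Equivalence.to (T-∨ {set I q}) (IsOrderIdeal.downClosed J q∈P
           (Equivalence.from (T-∨ {set I p}) (inj₂ (fromWitness {a? = p ≟ p} ≡.refl))) q⪯p)
  ... | inj₁ q∈I = q∈I
  ... | inj₂ q≡p = contradiction (toWitness {a? = q ≟ p} q≡p) q≢p

  -- If `p` is in the ideal, down-closure makes both factors 1 and the difference vanishes. If not,
  -- the product alone tests whether `p` can be added.
  𝒯⁺-formula : ∀ I {p} → p ∈ P →
    𝟙[ ¬? (T? (set I p)) ×-dec isOrderIdeal∪? I p ] ≈ lowered (left p) I * lowered (down p) I - 𝟏 p I
  𝒯⁺-formula I {p} p∈P = go (T? (set I p)) (isOrderIdeal∪? I p) (lower (left p)) (lower (down p))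
    where
    lower : ∀ q → (q ∈ P × ¬ set I ∋ q) ⊎ (q ∈ P → set I ∋ q)
    lower q with q ∈? P | T? (set I q)
    ... | yes q∈P | no q∉I = inj₁ (q∈P , q∉I)
    ... | _ | yes q∈I = inj₂ (λ _ → q∈I)
    ... | no q∉P | _ = inj₂ (λ q∈P → contradiction q∈P q∉P)

    go : (a? : Dec (set I ∋ p)) (ideal? : Dec (IsOrderIdeal (set I ∪｛ p ｝))) →
         (left p ∈ P × ¬ set I ∋ left p) ⊎ (left p ∈ P → set I ∋ left p) →
         (down p ∈ P × ¬ set I ∋ down p) ⊎ (down p ∈ P → set I ∋ down p) →
         𝟙[ ¬? a? ×-dec ideal? ] ≈ lowered (left p) I * lowered (down p) I - 𝟙[ a? ]
    go (yes p∈I) ideal? _ _ = sym (trans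
      (+-congʳ (*-cong (lowered-1 I _ (λ l∈P → downClosed I l∈P p∈I (left⪯ p)))
                       (lowered-1 I _ (λ d∈P → downClosed I d∈P p∈I (down⪯ p)))))
      (trans (+-congʳ (*-identityˡ 1#)) (-‿inverseʳ 1#)))
    go (no p∉I) ideal? (inj₂ l) (inj₂ d) = trans (𝟙-true ideal? (addable I p∈P p∉I l d)) (sym (trans
      (+-congʳ (*-cong (lowered-1 I _ l) (lowered-1 I _ d)))
      (trans (x-0≈x _) (*-identityˡ 1#))))
    go (no p∉I) ideal? (inj₁ (l∈P , l∉I)) _ = trans
      (𝟙-false ideal? (λ J → l∉I (addable⁻ I J l∈P (left⪯ p) left≢)))
      (sym (trans (+-congʳ (trans (*-congʳ (lowered-0 I l∈P l∉I)) (zeroˡ _))) (-‿inverseʳ 0#)))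
    go (no p∉I) ideal? _ (inj₁ (d∈P , d∉I)) = trans
      (𝟙-false ideal? (λ J → d∉I (addable⁻ I J d∈P (down⪯ p) down≢)))
      (sym (trans (+-congʳ (trans (*-congˡ (lowered-0 I d∈P d∉I)) (zeroʳ _))) (-‿inverseʳ 0#)))

  𝟏-0 : ∀ I {p} → ¬ set I ∋ p → 𝟏 p I ≈ 0#
  𝟏-0 I {p} = 𝟙-false (T? (set I p))

  𝟏-∉ : ∀ I {p} → p ∉ P → 𝟏 p I ≈ 0#
  𝟏-∉ I p∉P = 𝟏-0 I (λ p∈I → p∉P (subset I p∈I))

  𝒯⁻-formula : ∀ I {p} → p ∈ P → 𝟙[ isMaximal? I p ] ≈
    𝟏 p I - (𝟏 (right p) I + 𝟏 (up p) I - 𝟏 (right p) I * 𝟏 (up p) I)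
  𝒯⁻-formula I {p} p∈P =
    go (T? (set I p)) (T? (set I (right p))) (T? (set I (up p))) (isMaximal? I p)
    where
    go : (p? : Dec (set I ∋ p)) (r? : Dec (set I ∋ right p)) (u? : Dec (set I ∋ up p))
         (m? : Dec (IsMaximal I p)) →
         𝟙[ m? ] ≈ 𝟙[ p? ] - (𝟙[ r? ] + 𝟙[ u? ] - 𝟙[ r? ] * 𝟙[ u? ])
    go (no p∉I) (yes r∈I) _ _ = contradiction (downClosed I p∈P r∈I (⪯right p)) p∉I
    go (no p∉I) _ (yes u∈I) _ = contradiction (downClosed I p∈P u∈I (⪯up p)) p∉I
    go (no p∉I) (no _) (no _) m? = trans (𝟙-false m? (λ m → p∉I (proj₁ m)))
      (sym (trans (+-congˡ (-‿cong (trans (+-cong (+-identityˡ 0#) (-‿cong (zeroˡ 0#))) (x-0≈x 0#))))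
        (x-0≈x 0#)))
    go (yes _) (yes r∈I) u? m? = trans
      (𝟙-false m? (λ m → right≢ (proj₂ m r∈I (⪯right p))))
      (sym (trans (+-congˡ (-‿cong (solve 2 (λ a b → a :+ b :- a :* b := a :+ (b :- a :* b)) refl 1# _)))
        (trans (+-congˡ (-‿cong (+-congˡ (trans (+-congˡ (-‿cong (*-identityˡ _))) (-‿inverseʳ _)))))
          (trans (+-congˡ (-‿cong (+-identityʳ 1#))) (-‿inverseʳ 1#)))))
      where
      right≢ : right p ≢ p
      right≢ eq = i+1≢i (≡.cong proj₁ eq)
    go (yes _) (no _) (yes u∈I) m? = trans
      (𝟙-false m? (λ m → up≢ (proj₂ m u∈I (⪯up p))))
      (sym (trans (+-congˡ (-‿cong (trans (+-cong (+-identityˡ 1#) (-‿cong (zeroˡ 1#))) (x-0≈x 1#))))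
        (-‿inverseʳ 1#)))
      where
      up≢ : up p ≢ p
      up≢ eq = i+1≢i (≡.cong proj₂ eq)
    go (yes p∈I) (no r∉I) (no u∉I) m? = trans
      (𝟙-true m? (p∈I , maximal))
      (sym (trans (+-congˡ (-‿cong (trans (+-cong (+-identityˡ 0#) (-‿cong (zeroˡ 0#))) (x-0≈x 0#))))
        (x-0≈x 1#)))
      where
      maximal : ∀ {q} → set I ∋ q → p ⪯ q → q ≡ p
      maximal {q} q∈I p⪯q with p ≟ q
      ... | yes ≡.refl = ≡.refl
      ... | no p≢q with above p∈P (subset I q∈I) p⪯q p≢q
      ...   | inj₁ (r∈P , r⪯q) = contradiction (downClosed I r∈P q∈I r⪯q) r∉I
      ...   | inj₂ (u∈P , u⪯q) = contradiction (downClosed I u∈P q∈I u⪯q) u∉I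

  𝒯-formula : ∀ I {p} → p ∈ P → 𝒯 p I ≈
    lowered (left p) I * lowered (down p) I - (𝟏 p I + 𝟏 p I)
      + (𝟏 (right p) I + 𝟏 (up p) I - 𝟏 (right p) I * 𝟏 (up p) I)
  𝒯-formula I p∈P = trans (+-cong (𝒯⁺-formula I p∈P) (-‿cong (𝒯⁻-formula I p∈P)))
    (solve 3 (λ e u c → (e :- u) :- (u :- c) := e :- (u :+ u) :+ c) refl _ _ _)

  -- μ p is the value of 𝒯 p at the empty ideal.
  𝒰 : Point → 𝓕
  𝒰 p I = 𝒯 p I - μ p

  weighted : (Point → Carrier) → (Point → 𝓕) → 𝓕
  weighted w f I = ∑ P (λ p → w p * f p I)

  -- The point `diag⁻ p` need not lie in P. When it does not, the two fields together force `d p` to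
  -- vanish; this is what kills every other diagonal of the root posets.
  record IsAdmissible (d : Point → Carrier) : Set where
    field
      support  : ∀ {p} → p ∉ P → d p ≈ 0#
      diagonal : ∀ {p} → left p ∈ P → down p ∈ P → d p ≈ d (diag⁻ p)

  -- The coefficient of `𝟏 p` collected from the toggles around `p`. The toggle at `left p`
  -- contributes through its upper neighbour `p`; the toggle at `up p` contributes only if
  -- `left (up p)` is missing, when its lower product reduces to a linear term in `𝟏 p`. `lapᵈ` is
  -- the mirror image.
  lapˡ lapᵈ lap : (Point → Carrier) → Point → Carrier
  lapˡ d p = d (left p) + d (up p) * ν (left (up p))
  lapᵈ d p = d (down p) + d (right p) * ν (down (right p))
  lap d p = lapˡ d p + lapᵈ d p - (d p + d p)

  -- The quadratic terms 𝟏 (left p) 𝟏 (down p) cancel along diagonals.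
  weighted-𝒰 : ∀ {d} → IsAdmissible d → ∀ I → weighted d 𝒰 I ≈ weighted (lap d) 𝟏 I
  weighted-𝒰 {d} adm I = begin
    ∑ P (λ p → d p * 𝒰 p I)
      ≈⟨ ∑-cong {xs = P} (λ {p} p∈P → trans (*-congˡ (+-congʳ (𝒯-formula I p∈P)))
           (solve 8 (λ d l d' nl nd u r v →
              d :* ((l :+ nl) :* (d' :+ nd) :- (u :+ u) :+ (r :+ v :- r :* v) :- nl :* nd)
              := ((d :* r :+ d :* nl :* d') :+ (d :* v :+ d :* nd :* l) :- (d :+ d) :* u)
                 :+ (d :* (l :* d') :- d :* (r :* v))) refl
              (d p) (𝟏 (left p) I) (𝟏 (down p) I) (ν (left p)) (ν (down p))
              (𝟏 p I) (𝟏 (right p) I) (𝟏 (up p) I))) ⟩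
    ∑ P (λ p → (A p + B p + (C p + D p) - E p) + (F p - G p))
      ≈⟨ trans (∑-+ P _ _) (+-cong (trans (∑-- P _ E) (+-congʳ (trans (∑-+ P _ _)
           (+-cong (∑-+ P A B) (∑-+ P C D))))) (∑-- P F G)) ⟩
    (∑ P A + ∑ P B + (∑ P C + ∑ P D) - ∑ P E) + (∑ P F - ∑ P G)
      ≈⟨ +-cong (+-congʳ (+-cong (+-cong
           (reindex right left left-right right-left d support)
           (reindex down up up-down down-up (λ p → d p * ν (left p)) support*))
           (+-cong (reindex up down down-up up-down d support)
                   (reindex left right right-left left-right (λ p → d p * ν (down p)) support*))))
         (trans (+-congˡ (-‿cong quadratic)) (-‿inverseʳ (∑ P F))) ⟩
    (∑ P A′ + ∑ P B′ + (∑ P C′ + ∑ P D′) - ∑ P E) + 0#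
      ≈⟨ trans (+-identityʳ _) (sym (trans (∑-- P _ E) (+-congʳ (trans (∑-+ P _ _)
           (+-cong (∑-+ P A′ B′) (∑-+ P C′ D′)))))) ⟩
    ∑ P (λ p → A′ p + B′ p + (C′ p + D′ p) - E p)
      ≈⟨ ∑-cong {xs = P} (λ {p} _ → solve 6
           (λ a b c e d u → (a :* u :+ b :* u) :+ (c :* u :+ e :* u) :- (d :+ d) :* u
                           := (a :+ b :+ (c :+ e) :- (d :+ d)) :* u) refl
           (d (left p)) (d (up p) * ν (left (up p))) (d (down p)) (d (right p) * ν (down (right p)))
           (d p) (𝟏 p I)) ⟩
    ∑ P (λ p → lap d p * 𝟏 p I) ∎
    where
    open IsAdmissible adm
    A B C D E F G A′ B′ C′ D′ : Point → Carrier
    A p = d p * 𝟏 (right p) I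
    B p = d p * ν (left p) * 𝟏 (down p) I
    C p = d p * 𝟏 (up p) I
    D p = d p * ν (down p) * 𝟏 (left p) I
    E p = (d p + d p) * 𝟏 p I
    F p = d p * (𝟏 (left p) I * 𝟏 (down p) I)
    G p = d p * (𝟏 (right p) I * 𝟏 (up p) I)
    A′ p = d (left p) * 𝟏 p I
    B′ p = d (up p) * ν (left (up p)) * 𝟏 p I
    C′ p = d (down p) * 𝟏 p I
    D′ p = d (right p) * ν (down (right p)) * 𝟏 p I

    support* : ∀ {p c} → p ∉ P → d p * c ≈ 0#
    support* p∉P = trans (*-congʳ (support p∉P)) (zeroˡ _)

    reindex : (σ τ : Point → Point) → (∀ p → τ (σ p) ≡ p) → (∀ p → σ (τ p) ≡ p) →
              (f : Point → Carrier) → (∀ {p} → p ∉ P → f p ≈ 0#) →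
              ∑ P (λ p → f p * 𝟏 (σ p) I) ≈ ∑ P (λ p → f (τ p) * 𝟏 p I)
    reindex σ τ τσ στ f f0 = ∑-reindex _≟_ σ τ τσ στ f (λ p → 𝟏 p I) unique f0
      (λ q∉P → trans (*-congˡ (𝟏-∉ I q∉P)) (zeroʳ _))

    corners : Point → Carrier
    corners q = 𝟏 (left q) I * 𝟏 (down q) I

    corners-0 : ∀ {q} → ¬ (left q ∈ P × down q ∈ P) → corners q ≈ 0#
    corners-0 {q} h with left q ∈? P
    ... | no  l∉P = trans (*-congʳ (𝟏-∉ I l∉P)) (zeroˡ _)
    ... | yes l∈P = trans (*-congˡ (𝟏-∉ I (λ d∈P → h (l∈P , d∈P)))) (zeroʳ _)

    quadratic : ∑ P G ≈ ∑ P F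
    quadratic = begin
      ∑ P G
        -- The two upper neighbours of `p` are the two lower neighbours of `diag⁺ p`, in exchanged
        -- order.
        ≈⟨ ∑-cong {xs = P} (λ {p} _ → *-congˡ (trans (*-cong
             (reflexive (≡.cong (λ q → 𝟏 q I) (≡.sym (down-up (right p)))))
             (reflexive (≡.cong (λ q → 𝟏 q I) (≡.sym (left-right (up p))))))
             (*-comm _ _))) ⟩
      ∑ P (λ p → d p * corners (diag⁺ p))
        ≈⟨ ∑-reindex _≟_ diag⁺ diag⁻ diag⁻⁺ diag⁺⁻ d corners unique support
             -- Closure under `corner`: for `q` outside P one of its lower neighbours is outside as
             -- well, so no product is lost at the border.
             (λ q∉P → trans (*-congˡ (corners-0 (λ (l , d) → q∉P (corner l d)))) (zeroʳ _)) ⟩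
      ∑ P (λ q → d (diag⁻ q) * corners q)
        ≈⟨ ∑-cong {xs = P} (λ {q} _ → same q) ⟩
      ∑ P F ∎
      where
      same : ∀ q → d (diag⁻ q) * corners q ≈ d q * corners q
      same q with left q ∈? P | down q ∈? P
      ... | yes l | yes d = *-congʳ (sym (diagonal l d))
      ... | yes l | no ¬d = trans (*-congˡ (corners-0 (λ h → ¬d (proj₂ h))))
                              (trans (trans (zeroʳ _) (sym (zeroʳ _))) (*-congˡ (sym (corners-0 (λ h → ¬d (proj₂ h))))))
      ... | no ¬l | _ = trans (*-congˡ (corners-0 (λ h → ¬l (proj₁ h))))
                              (trans (trans (zeroʳ _) (sym (zeroʳ _))) (*-congˡ (sym (corners-0 (λ h → ¬l (proj₁ h))))))

  -- Test ideals that read off coefficients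

  ideal : (G : Pred Point 0ℓ) → Decidable G →
          (∀ {p q} → p ∈ P → G q → p ⪯ q → G p) → 𝒥
  ideal G G? closed = record
    { set          = λ p → does ((p ∈? P) ×-dec G? p)
    ; isOrderIdeal = record
      { subset     = λ {p} p∈I → proj₁ (toWitness′ ((p ∈? P) ×-dec G? p) p∈I)
      ; downClosed = λ {p} {q} p∈P q∈I p⪯q → fromWitness′ ((p ∈? P) ×-dec G? p)
          (p∈P , closed p∈P (proj₂ (toWitness′ ((q ∈? P) ×-dec G? q) q∈I)) p⪯q)
      }
    }
    where
    toWitness′ : ∀ {A : Set} (a? : Dec A) → T (does a?) → A
    toWitness′ (yes a) _ = a

    fromWitness′ : ∀ {A : Set} (a? : Dec A) → A → T (does a?)
    fromWitness′ (yes _) _ = tt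
    fromWitness′ (no ¬a) a = ¬a a

  module _ (r : Point) where

    Below : Bool → Pred Point 0ℓ
    Below s p = p ⪯ r × (p ≡ r → T s)

    below? : ∀ s → Decidable (Below s)
    below? s p = (p ⪯? r) ×-dec ((p ≟ r) →-dec T? s)

    principal : Bool → 𝒥
    principal s = ideal (Below s) (below? s) λ { {p} {q} _ (q⪯r , h) p⪯q → ⪯-trans p⪯q q⪯r ,
      λ { ≡.refl → h (⪯-antisym q⪯r p⪯q) } }

  -- Evaluation at the principal ideal of r, minus evaluation at the same ideal
  -- without r, extracts the coefficient of 𝟏 r.
  weighted-𝟏-injective : ∀ w → (∀ I → weighted w 𝟏 I ≈ 0#) → ∀ {r} → r ∈ P → w r ≈ 0#
  weighted-𝟏-injective w w≈0 {r} r∈P = begin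
    w r
      ≈⟨ sym (∑-pick _≟_ w r unique (λ r∉P → contradiction r∈P r∉P)) ⟩
    ∑ P (λ p → 𝟙[ p ≟ r ] * w p)
      ≈⟨ ∑-cong {xs = P} (λ {p} _ → trans (*-congʳ (coefficient p))
           (solve 3 (λ a b c → (a :- b) :* c := c :* a :- c :* b) refl _ _ _)) ⟩
    ∑ P (λ p → w p * 𝟏 p (principal r true) - w p * 𝟏 p (principal r false))
      ≈⟨ ∑-- P _ _ ⟩
    weighted w 𝟏 (principal r true) - weighted w 𝟏 (principal r false)
      ≈⟨ +-cong (w≈0 (principal r true)) (-‿cong (w≈0 (principal r false))) ⟩
    0# - 0#
      ≈⟨ -‿inverseʳ 0# ⟩
    0# ∎
    where
    coefficient : ∀ p → 𝟙[ p ≟ r ] ≈ 𝟏 p (principal r true) - 𝟏 p (principal r false)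
    coefficient p = go (p ≟ r)
      where
      go : (p≟r : Dec (p ≡ r)) → 𝟙[ p≟r ] ≈ 𝟏 p (principal r true) - 𝟏 p (principal r false)
      go (yes ≡.refl) = sym (trans
        (+-cong (𝟙-true ((p ∈? P) ×-dec below? r true p) (r∈P , ⪯-refl , _))
              (-‿cong (𝟙-false ((p ∈? P) ×-dec below? r false p) (λ (_ , _ , h) → h ≡.refl))))
        (x-0≈x 1#))
      go (no p≢r) = sym (trans
        (+-congʳ (𝟙-⇔ ((p ∈? P) ×-dec below? r true p) ((p ∈? P) ×-dec below? r false p)
        (λ (a , b , _) → a , b , (λ p≡r → contradiction p≡r p≢r))
        (λ (a , b , _) → a , b , _)))
        (-‿inverseʳ _))

  module SecondDifference (q : Point) (l∈P : left q ∈ P) (d∈P : down q ∈ P) where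

    -- All points strictly below `q`, with `left q` and `down q` switched on and off independently.
    -- Nothing strictly below `q` lies above either of them, so each of the four sets stays
    -- down-closed, and `Δ` detects only products of these two indicators.
    Under : Bool → Bool → Pred Point 0ℓ
    Under s t p = (p ⪯ q × p ≢ q) × (p ≡ left q → T s) × (p ≡ down q → T t)

    under? : ∀ s t → Decidable (Under s t)
    under? s t p = ((p ⪯? q) ×-dec ¬? (p ≟ q)) ×-dec
      (((p ≟ left q) →-dec T? s) ×-dec ((p ≟ down q) →-dec T? t))

    under : Bool → Bool → 𝒥
    under s t = ideal (Under s t) (under? s t)
      λ { {p} {r} _ ((r⪯q , r≢q) , hs , ht) p⪯r →
          (⪯-trans p⪯r r⪯q , λ { ≡.refl → r≢q (⪯-antisym r⪯q p⪯r) })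
        , (λ { ≡.refl → hs (left-covered p⪯r r⪯q r≢q) })
        , (λ { ≡.refl → ht (down-covered p⪯r r⪯q r≢q) }) }

    Δ : 𝓕 → Carrier
    Δ f = (f (under true true) - f (under true false)) - (f (under false true) - f (under false false))

    Δ-cong : ∀ (f g : 𝓕) → (∀ I → f I ≈ g I) → Δ f ≈ Δ g
    Δ-cong f g eq = +-cong (+-cong (eq (under true true)) (-‿cong (eq (under true false))))
      (-‿cong (+-cong (eq (under false true)) (-‿cong (eq (under false false)))))

    Δ-+ : ∀ f g → Δ (λ I → f I + g I) ≈ Δ f + Δ g
    Δ-+ f g = solve 8 (λ a b c d e h i j → (((a :+ b) :- (c :+ d)) :- ((e :+ h) :- (i :+ j)))
      := ((a :- c) :- (e :- i)) :+ ((b :- d) :- (h :- j))) refl _ _ _ _ _ _ _ _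

    Δ-- : ∀ f g → Δ (λ I → f I - g I) ≈ Δ f - Δ g
    Δ-- f g = solve 8 (λ a b c d e h i j → (((a :- b) :- (c :- d)) :- ((e :- h) :- (i :- j)))
      := ((a :- c) :- (e :- i)) :- ((b :- d) :- (h :- j))) refl _ _ _ _ _ _ _ _

    Δ-* : ∀ c f → Δ (λ I → c * f I) ≈ c * Δ f
    Δ-* c f = solve 5 (λ c a b e g → (c :* a :- c :* b) :- (c :* e :- c :* g)
      := c :* ((a :- b) :- (e :- g))) refl _ _ _ _ _

    Δ-const : ∀ c → Δ (λ _ → c) ≈ 0#
    Δ-const c = -‿inverseʳ (c - c)

    Δ-∑ : ∀ xs (w : Point → Carrier) (f : Point → 𝓕) → Δ (λ I → ∑ xs (λ p → w p * f p I)) ≈ ∑ xs (λ p → w p * Δ (f p))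
    Δ-∑ []       w f = Δ-const 0#
    Δ-∑ (x ∷ xs) w f = trans (Δ-+ (λ I → w x * f x I) (λ I → ∑ xs (λ p → w p * f p I)))
      (+-cong (Δ-* (w x) (f x)) (Δ-∑ xs w f))

    Δ-0ˢ : ∀ f → (∀ t → f (under true t) ≈ f (under false t)) → Δ f ≈ 0#
    Δ-0ˢ f eq = trans (+-congʳ (+-cong (eq true) (-‿cong (eq false)))) (-‿inverseʳ _)

    Δ-0ᵗ : ∀ f → (∀ s → f (under s true) ≈ f (under s false)) → Δ f ≈ 0#
    Δ-0ᵗ f eq = trans
      (+-cong (trans (+-congʳ (eq true)) (-‿inverseʳ _)) (-‿cong (trans (+-congʳ (eq false)) (-‿inverseʳ _))))
      (-‿inverseʳ 0#)

    left≢down : left q ≢ down q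
    left≢down eq = i-1≢i (≡.cong proj₁ eq)

    𝟏-indepˢ : ∀ {p} → p ≢ left q → ∀ s s′ t → 𝟏 p (under s t) ≈ 𝟏 p (under s′ t)
    𝟏-indepˢ {p} p≢ s s′ t = 𝟙-⇔ ((p ∈? P) ×-dec under? s t p) ((p ∈? P) ×-dec under? s′ t p)
      (λ (a , b , _ , c) → a , b , (λ p≡ → contradiction p≡ p≢) , c)
      (λ (a , b , _ , c) → a , b , (λ p≡ → contradiction p≡ p≢) , c)

    𝟏-indepᵗ : ∀ {p} → p ≢ down q → ∀ s t t′ → 𝟏 p (under s t) ≈ 𝟏 p (under s t′)
    𝟏-indepᵗ {p} p≢ s t t′ = 𝟙-⇔ ((p ∈? P) ×-dec under? s t p) ((p ∈? P) ×-dec under? s t′ p)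
      (λ (a , b , c , _) → a , b , c , (λ p≡ → contradiction p≡ p≢))
      (λ (a , b , c , _) → a , b , c , (λ p≡ → contradiction p≡ p≢))

    𝟏-left : ∀ s t → 𝟏 (left q) (under s t) ≈ 𝟙 s
    𝟏-left s t = 𝟙-⇔ ((left q ∈? P) ×-dec under? s t (left q)) (T? s)
      (λ (_ , _ , h , _) → h ≡.refl)
      (λ h → l∈P , (left⪯ q , left≢) , (λ _ → h) , λ eq → contradiction eq left≢down)

    𝟏-down : ∀ s t → 𝟏 (down q) (under s t) ≈ 𝟙 t
    𝟏-down s t = 𝟙-⇔ ((down q ∈? P) ×-dec under? s t (down q)) (T? t)
      (λ (_ , _ , _ , h) → h ≡.refl)
      (λ h → d∈P , (down⪯ q , down≢) , (λ eq → contradiction (≡.sym eq) left≢down) , λ _ → h)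

    Δ-𝟏 : ∀ p → Δ (𝟏 p) ≈ 0#
    Δ-𝟏 p = go (p ≟ left q)
      where
      go : Dec (p ≡ left q) → Δ (𝟏 p) ≈ 0#
      go (no p≢l)     = Δ-0ˢ (𝟏 p) (𝟏-indepˢ p≢l true false)
      go (yes ≡.refl) = Δ-0ᵗ (𝟏 p) (λ s → 𝟏-indepᵗ left≢down s true false)

    -- A product that does not pair `left q` with `down q` is constant in one of the two switches.
    -- The hypotheses exclude that pairing in either order; the constants `α` and `β` leave room for
    -- `ν`.
    Δ-product-0 : ∀ x y α β → (x ≡ left q → y ≢ down q) → (y ≡ left q → x ≢ down q) →
                  Δ (λ I → (𝟏 x I + α) * (𝟏 y I + β)) ≈ 0#
    Δ-product-0 x y α β h h′ = go (x ≟ left q) (y ≟ left q)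
      where
      go : Dec (x ≡ left q) → Dec (y ≡ left q) → Δ (λ I → (𝟏 x I + α) * (𝟏 y I + β)) ≈ 0#
      go (yes ≡.refl) _ = Δ-0ᵗ (λ I → (𝟏 x I + α) * (𝟏 y I + β)) (λ s →
        *-cong (+-congʳ (𝟏-indepᵗ left≢down s true false)) (+-congʳ (𝟏-indepᵗ (h ≡.refl) s true false)))
      go _ (yes ≡.refl) = Δ-0ᵗ (λ I → (𝟏 x I + α) * (𝟏 y I + β)) (λ s →
        *-cong (+-congʳ (𝟏-indepᵗ (h′ ≡.refl) s true false)) (+-congʳ (𝟏-indepᵗ left≢down s true false)))
      go (no x≢l) (no y≢l) = Δ-0ˢ (λ I → (𝟏 x I + α) * (𝟏 y I + β)) (λ t →
        *-cong (+-congʳ (𝟏-indepˢ x≢l true false t)) (+-congʳ (𝟏-indepˢ y≢l true false t)))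

    Δ-corners : Δ (λ I → 𝟏 (left q) I * 𝟏 (down q) I) ≈ 1#
    Δ-corners = trans
      (+-cong (+-cong (value true true) (-‿cong (value true false)))
        (-‿cong (+-cong (value false true) (-‿cong (value false false)))))
      (trans (+-cong (+-cong (*-identityˡ 1#) (-‿cong (zeroʳ 1#)))
               (-‿cong (+-cong (zeroˡ 1#) (-‿cong (zeroˡ 0#)))))
        (trans (+-cong (x-0≈x 1#) (-‿cong (-‿inverseʳ 0#))) (x-0≈x 1#)))
      where
      value : ∀ s t → 𝟏 (left q) (under s t) * 𝟏 (down q) (under s t) ≈ 𝟙 s * 𝟙 t
      value s t = *-cong (𝟏-left s t) (𝟏-down s t)

    -- The lower neighbours of `p` are those of `q` only when `p` is `q`; likewise, in `Δ-upper`,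
    -- the upper neighbours of `p` are the lower ones of `q` only when `p` is `diag⁻ q`.
    Δ-lower : ∀ p → Δ (λ I → lowered (left p) I * lowered (down p) I) ≈ 𝟙[ p ≟ q ]
    Δ-lower p = go (p ≟ q)
      where
      go : (p≟q : Dec (p ≡ q)) → Δ (λ I → lowered (left p) I * lowered (down p) I) ≈ 𝟙[ p≟q ]
      go (yes ≡.refl) = trans
        (Δ-cong (λ I → lowered (left p) I * lowered (down p) I) (λ I → 𝟏 (left q) I * 𝟏 (down q) I) (λ I → *-cong (trans (+-congˡ (𝟙-false (¬? (left q ∈? P)) (λ ∉P → ∉P l∈P))) (+-identityʳ _))
                            (trans (+-congˡ (𝟙-false (¬? (down q ∈? P)) (λ ∉P → ∉P d∈P))) (+-identityʳ _))))
        Δ-corners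
      go (no p≢q) = Δ-product-0 (left p) (down p) (ν (left p)) (ν (down p))
        (λ eq _ → p≢q (left-injective eq))
        -- The crossed match, `left p` with `down q` and `down p` with `left q`, would move the
        -- first coordinate down twice without changing it.
        (λ eq eq′ → i-1-1≢i (≡.trans (≡.cong (ℤ._- 1ℤ) (≡.sym (≡.cong proj₁ eq))) (≡.cong proj₁ eq′)))

    Δ-upper : ∀ p → Δ (λ I → 𝟏 (right p) I * 𝟏 (up p) I) ≈ 𝟙[ p ≟ diag⁻ q ]
    Δ-upper p = go (p ≟ diag⁻ q)
      where
      go : (p≟ : Dec (p ≡ diag⁻ q)) → Δ (λ I → 𝟏 (right p) I * 𝟏 (up p) I) ≈ 𝟙[ p≟ ]
      go (yes ≡.refl) = trans
        (Δ-cong (λ I → 𝟏 (right p) I * 𝟏 (up p) I) (λ I → 𝟏 (left q) I * 𝟏 (down q) I) (λ I → trans (*-cong (reflexive (≡.cong (λ z → 𝟏 z I) (right-left (down q))))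
                                   (reflexive (≡.cong (λ z → 𝟏 z I) (up-down (left q)))))
                           (*-comm _ _)))
        Δ-corners
      go (no p≢) = trans
        (Δ-cong (λ I → 𝟏 (right p) I * 𝟏 (up p) I) (λ I → (𝟏 (right p) I + 0#) * (𝟏 (up p) I + 0#)) (λ I → *-cong (sym (+-identityʳ _)) (sym (+-identityʳ _))))
        (Δ-product-0 (right p) (up p) 0# 0#
        (λ eq eq′ → i+1≢i-1 {proj₁ q} (≡.trans (≡.cong (ℤ._+ 1ℤ) (≡.sym (≡.cong proj₁ eq′))) (≡.cong proj₁ eq)))
        (λ eq eq′ → p≢ (≡.trans (≡.sym (left-right p)) (≡.cong left eq′))))

    Δ-𝒯 : ∀ {p} → p ∈ P → Δ (𝒯 p) ≈ 𝟙[ p ≟ q ] - 𝟙[ p ≟ diag⁻ q ]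
    Δ-𝒯 {p} p∈P = begin
      Δ (𝒯 p)
        ≈⟨ Δ-cong (𝒯 p) (λ I → e I - (u I + u I) + (r I + v I - g I)) (λ I → 𝒯-formula I p∈P) ⟩
      Δ (λ I → e I - (u I + u I) + (r I + v I - g I))
        ≈⟨ trans (Δ-+ (λ I → e I - (u I + u I)) (λ I → r I + v I - g I)) (+-cong
             (trans (Δ-- e (λ I → u I + u I)) (+-congˡ (-‿cong (Δ-+ u u))))
             (trans (Δ-- (λ I → r I + v I) g) (+-congʳ (Δ-+ r v)))) ⟩
      Δ e - (Δ u + Δ u) + (Δ r + Δ v - Δ g)
        ≈⟨ +-cong (+-cong (Δ-lower p) (-‿cong (+-cong (Δ-𝟏 p) (Δ-𝟏 p))))
             (+-cong (+-cong (Δ-𝟏 (right p)) (Δ-𝟏 (up p))) (-‿cong (Δ-upper p))) ⟩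
      𝟙[ p ≟ q ] - (0# + 0#) + (0# + 0# - 𝟙[ p ≟ diag⁻ q ])
        ≈⟨ +-cong (trans (+-congˡ (-‿cong (+-identityˡ 0#))) (x-0≈x _))
             (trans (+-congʳ (+-identityˡ 0#)) (+-identityˡ _)) ⟩
      𝟙[ p ≟ q ] - 𝟙[ p ≟ diag⁻ q ] ∎
      where
      e u r v g : 𝓕
      e I = lowered (left p) I * lowered (down p) I
      u = 𝟏 p
      r = 𝟏 (right p)
      v = 𝟏 (up p)
      g I = 𝟏 (right p) I * 𝟏 (up p) I

    -- Only the toggles at `q` and at `diag⁻ q` have a nonzero second difference, with opposite
    -- signs. The hypothesis on `d` covers the case that `diag⁻ q` is outside P.
    Δ-weighted-𝒯 : ∀ {d} → (∀ {p} → p ∉ P → d p ≈ 0#) → Δ (weighted d 𝒯) ≈ d q - d (diag⁻ q)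
    Δ-weighted-𝒯 {d} d0 = begin
      Δ (weighted d 𝒯)
        ≈⟨ Δ-∑ P d 𝒯 ⟩
      ∑ P (λ p → d p * Δ (𝒯 p))
        ≈⟨ ∑-cong {xs = P} (λ {p} p∈P → trans (*-congˡ (Δ-𝒯 p∈P))
             (solve 3 (λ d a b → d :* (a :- b) := a :* d :- b :* d) refl _ _ _)) ⟩
      ∑ P (λ p → 𝟙[ p ≟ q ] * d p - 𝟙[ p ≟ diag⁻ q ] * d p)
        ≈⟨ ∑-- P _ _ ⟩
      ∑ P (λ p → 𝟙[ p ≟ q ] * d p) - ∑ P (λ p → 𝟙[ p ≟ diag⁻ q ] * d p)
        ≈⟨ +-cong (∑-pick _≟_ d q unique d0) (-‿cong (∑-pick _≟_ d (diag⁻ q) unique d0)) ⟩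
      d q - d (diag⁻ q) ∎

    Δ-weighted-𝟏 : ∀ w → Δ (weighted w 𝟏) ≈ 0#
    Δ-weighted-𝟏 w = trans (Δ-∑ P w 𝟏) (∑-0 {xs = P} (λ {p} _ → trans (*-congˡ (Δ-𝟏 p)) (zeroʳ _)))

  none? : Decidable {A = Point} (λ _ → ⊥)
  none? _ = no λ ()

  empty : 𝒥
  empty = ideal (λ _ → ⊥) none? (λ _ ())

  𝟏-empty : ∀ p → 𝟏 p empty ≈ 0#
  𝟏-empty p = 𝟙-false ((p ∈? P) ×-dec none? p) proj₂

  𝒰-empty : ∀ {p} → p ∈ P → 𝒰 p empty ≈ 0#
  𝒰-empty {p} p∈P = trans (+-congʳ (trans (𝒯-formula empty p∈P) (+-cong
      (+-cong (*-cong (trans (+-congʳ (𝟏-empty _)) (+-identityˡ _)) (trans (+-congʳ (𝟏-empty _)) (+-identityˡ _)))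
              (-‿cong (trans (+-cong (𝟏-empty p) (𝟏-empty p)) (+-identityˡ 0#))))
      (trans (+-cong (+-cong (𝟏-empty _) (𝟏-empty _)) (-‿cong (trans (*-congʳ (𝟏-empty _)) (zeroˡ _))))
        (trans (x-0≈x _) (+-identityˡ 0#))))))
    (trans (+-congʳ (trans (+-identityʳ _) (x-0≈x _))) (-‿inverseʳ _))

  -- Bases of the space of Laplacians of admissible weights

  lap-cong : ∀ {d d′} → (∀ p → d p ≈ d′ p) → ∀ q → lap d q ≈ lap d′ q
  lap-cong eq q = +-cong (+-cong (+-cong (eq (left q)) (*-congʳ (eq (up q))))
                                 (+-cong (eq (down q)) (*-congʳ (eq (right q)))))
                         (-‿cong (+-cong (eq q) (eq q)))

  lap-0 : ∀ q → lap (λ _ → 0#) q ≈ 0#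
  lap-0 q = trans (+-cong (trans (+-cong half half) (+-identityˡ 0#)) (-‿cong (+-identityˡ 0#))) (x-0≈x 0#)
    where
    half : ∀ {c} → 0# + 0# * c ≈ 0#
    half = trans (+-identityˡ _) (zeroˡ _)

  lap-+* : ∀ c d d′ q → lap (λ p → c * d p + d′ p) q ≈ c * lap d q + lap d′ q
  lap-+* c d d′ q = solve 13
    (λ c l r u b x n m l′ r′ u′ b′ x′ →
      ((c :* l :+ l′) :+ (c :* u :+ u′) :* n) :+ ((c :* b :+ b′) :+ (c :* r :+ r′) :* m)
        :- ((c :* x :+ x′) :+ (c :* x :+ x′))
      := c :* ((l :+ u :* n) :+ (b :+ r :* m) :- (x :+ x)) :+ ((l′ :+ u′ :* n) :+ (b′ :+ r′ :* m) :- (x′ :+ x′)))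
    refl c (d (left q)) (d (right q)) (d (up q)) (d (down q)) (d q) (ν (left (up q))) (ν (down (right q)))
    (d′ (left q)) (d′ (right q)) (d′ (up q)) (d′ (down q)) (d′ q)

  module _ {X : Set} where

    combine : List X → (X → Carrier) → (X → Point → Carrier) → Point → Carrier
    combine xs e w p = ∑ xs (λ x → e x * w x p)

    lap-combine : ∀ xs e w q → lap (combine xs e w) q ≈ combine xs e (λ x → lap (w x)) q
    lap-combine []       e w q = lap-0 q
    lap-combine (x ∷ xs) e w q = trans (lap-+* (e x) (w x) (combine xs e w) q) (+-congˡ (lap-combine xs e w q))

    combine-admissible : ∀ {xs e w} → (∀ {x} → x ∈ xs → IsAdmissible (w x)) → IsAdmissible (combine xs e w)
    combine-admissible {xs} adm = record
      { support  = λ p∉P → ∑-0 {xs = xs} (λ m → trans (*-congˡ (IsAdmissible.support (adm m) p∉P)) (zeroʳ _))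
      ; diagonal = λ l d → ∑-cong {xs = xs} (λ m → *-congˡ (IsAdmissible.diagonal (adm m) l d))
      }

    weighted-combine : ∀ xs e w I → ∑ xs (λ x → e x * weighted (w x) 𝟏 I) ≈ weighted (combine xs e w) 𝟏 I
    weighted-combine xs e w I = begin
      ∑ xs (λ x → e x * ∑ P (λ p → w x p * 𝟏 p I))
        ≈⟨ ∑-cong {xs = xs} (λ {x} _ → trans (sym (∑-*ˡ P (e x) (λ p → w x p * 𝟏 p I)))
             (∑-cong {xs = P} (λ _ → sym (*-assoc _ _ _)))) ⟩
      ∑ xs (λ x → ∑ P (λ p → e x * w x p * 𝟏 p I))
        ≈⟨ ∑-comm xs P (λ x p → e x * w x p * 𝟏 p I) ⟩
      ∑ P (λ p → ∑ xs (λ x → e x * w x p * 𝟏 p I))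
        ≈⟨ ∑-cong {xs = P} (λ {p} _ → ∑-*ʳ xs (𝟏 p I) (λ x → e x * w x p)) ⟩
      ∑ P (λ p → combine xs e w p * 𝟏 p I) ∎

    -- A basis of the space of all `lap d` with `d` admissible, read as functions on P. This removes
    -- order ideals from the problem: what remains concerns scalar functions on lattice points.
    record IsWeightBasis (xs : List X) (w : X → Point → Carrier) : Set where
      field
        elements    : ∀ {x} → x ∈ xs →
                      Σ (Point → Carrier) λ d → IsAdmissible d × (∀ {q} → q ∈ P → lap d q ≈ w x q)
        independent : ∀ (e : X → Carrier) → (∀ {q} → q ∈ P → combine xs e w q ≈ 0#) →
                      ∀ {x} → x ∈ xs → e x ≈ 0#
        spanning    : ∀ {d} → IsAdmissible d →
                      Σ (X → Carrier) λ e → ∀ {q} → q ∈ P → lap d q ≈ combine xs e w q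

    IsWeightBasis-resp : ∀ {xs w w′} → (∀ {x q} → x ∈ xs → q ∈ P → w x q ≈ w′ x q) →
                         IsWeightBasis xs w → IsWeightBasis xs w′
    IsWeightBasis-resp {xs} {w} {w′} eq B = record
      { elements    = λ m → let d , adm , d≈ = B.elements m in d , adm , λ q∈P → trans (d≈ q∈P) (eq m q∈P)
      ; independent = λ e e≈0 → B.independent e (λ q∈P → trans (same e q∈P) (e≈0 q∈P))
      ; spanning    = λ adm → let e , d≈ = B.spanning adm in e , λ q∈P → trans (d≈ q∈P) (same e q∈P)
      }
      where
      module B = IsWeightBasis B
      same : ∀ e {q} → q ∈ P → combine xs e w q ≈ combine xs e w′ q
      same e q∈P = ∑-cong {xs = xs} (λ m → *-congˡ (eq m q∈P))

    IsWeightBasis-neg : ∀ {xs w} → IsWeightBasis xs w → IsWeightBasis xs (λ x q → - w x q)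
    IsWeightBasis-neg {xs} {w} B = record
      { elements    = λ m → let d , adm , d≈ = B.elements m in
          (λ p → - d p) , record
            { support  = λ p∉P → trans (-‿cong (IsAdmissible.support adm p∉P)) -0#≈0#
            ; diagonal = λ l d → -‿cong (IsAdmissible.diagonal adm l d) } ,
          λ {q} q∈P → trans (lap-neg d q) (-‿cong (d≈ q∈P))
      ; independent = λ e e≈0 m → trans (sym (-‿involutive _)) (trans (-‿cong
          (B.independent (λ x → - e x) (λ q∈P → trans (flip e q∈P) (e≈0 q∈P)) m)) -0#≈0#)
      ; spanning    = λ adm → let e , d≈ = B.spanning adm in (λ x → - e x) ,
          λ q∈P → trans (d≈ q∈P) (∑-cong {xs = xs} (λ _ → solve 2 (λ a b → a :* b := (:- a) :* (:- b)) refl _ _))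
      }
      where
      module B = IsWeightBasis B
      flip : ∀ e {q} → q ∈ P → combine xs (λ x → - e x) w q ≈ combine xs e (λ x q → - w x q) q
      flip e q∈P = ∑-cong {xs = xs} (λ _ → solve 2 (λ a b → (:- a) :* b := a :* (:- b)) refl _ _)
      lap-neg : ∀ d q → lap (λ p → - d p) q ≈ - lap d q
      lap-neg d q = solve 7 (λ l u n b r m x →
        ((:- l) :+ (:- u) :* n) :+ ((:- b) :+ (:- r) :* m) :- ((:- x) :+ (:- x))
        := :- ((l :+ u :* n) :+ (b :+ r :* m) :- (x :+ x))) refl
        (d (left q)) (d (up q)) _ (d (down q)) (d (right q)) _ (d q)

  -- The indicators `χ` of such classes form a basis of the admissible weights: every admissible
  -- weight is constant on each class, and `classify` says that it vanishes at the points outside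
  -- all classes.
  record Classes (X : Set) (xs : List X) : Set₁ where
    field
      unique-xs  : Unique xs
      Class      : X → Pred Point 0ℓ
      class?     : ∀ x → Decidable (Class x)
      disjoint   : ∀ {x y p} → x ∈ xs → y ∈ xs → Class x p → Class y p → x ≡ y
      rep        : X → Point
      rep∈P      : ∀ {x} → x ∈ xs → rep x ∈ P
      rep∈Class  : ∀ {x} → x ∈ xs → Class x (rep x)

    χ : X → Point → Carrier
    χ x p = 𝟙[ (p ∈? P) ×-dec class? x p ]

    field
      admissible : ∀ {x} → x ∈ xs → IsAdmissible (χ x)
      classify   : ∀ {p} → p ∈ P →
        (Σ X λ x → x ∈ xs × Class x p × (∀ {d} → IsAdmissible d → d p ≈ d (rep x)))
        ⊎ ((∀ {x} → x ∈ xs → ¬ Class x p) × (∀ {d} → IsAdmissible d → d p ≈ 0#))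

    combine-χ : ∀ e {x p} → x ∈ xs → p ∈ P → Class x p → combine xs e χ p ≈ e x
    combine-χ e {x} {p} m p∈P c = trans
      (∑-single unique-xs m (λ {y} m′ y≢x → trans (*-congˡ
        (𝟙-false ((p ∈? P) ×-dec class? y p) (λ (_ , c′) → y≢x (disjoint m′ m c′ c)))) (zeroʳ _)))
      (trans (*-congˡ (𝟙-true ((p ∈? P) ×-dec class? x p) (p∈P , c))) (*-identityʳ _))

    expand : ∀ {d} → IsAdmissible d → ∀ p → d p ≈ combine xs (λ x → d (rep x)) χ p
    expand {d} adm p = go (p ∈? P)
      where
      go : Dec (p ∈ P) → d p ≈ combine xs (λ x → d (rep x)) χ p
      go (no p∉P) = trans (IsAdmissible.support adm p∉P)
                     (sym (IsAdmissible.support (combine-admissible {w = χ} admissible) p∉P))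
      go (yes p∈P) with classify p∈P
      ... | inj₁ (x , m , c , d≈) = trans (d≈ adm) (sym (combine-χ (λ x → d (rep x)) m p∈P c))
      ... | inj₂ (¬c , d≈0) = trans (d≈0 adm) (sym (∑-0 {xs = xs} (λ {x} m → trans (*-congˡ
              (𝟙-false ((p ∈? P) ×-dec class? x p) (λ (_ , c) → ¬c m c))) (zeroʳ _))))

    -- An injective linear map carries a basis to a basis of its image; here the map is `lap` and
    -- the basis is `χ`.
    isWeightBasis : (∀ {d} → IsAdmissible d → (∀ {q} → q ∈ P → lap d q ≈ 0#) → ∀ {p} → p ∈ P → d p ≈ 0#) →
                    IsWeightBasis xs (λ x → lap (χ x))
    isWeightBasis injective = record
      { elements    = λ {x} m → χ x , admissible m , λ _ → refl
      ; independent = λ e e≈0 {x} m → trans (sym (combine-χ e m (rep∈P m) (rep∈Class m)))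
          (injective (combine-admissible {w = χ} admissible)
            (λ {q} q∈P → trans (lap-combine xs e χ q) (e≈0 q∈P)) (rep∈P m))
      ; spanning    = λ {d} adm → (λ x → d (rep x)) ,
          λ {q} _ → trans (lap-cong (expand adm) q) (lap-combine xs _ χ q)
      }

  -- The toggleability space as an image of admissible weights

  -- The functions 𝟏 and 𝒯 enter the statement only up to pointwise equality.
  module ToggleabilitySpace (one′ : 𝓕) (𝟏′ 𝒯′ : Point → 𝓕) (one≈ : ∀ I → 1# ≈ one′ I)
    (𝟏≈ : ∀ p I → 𝟏 p I ≈ 𝟏′ p I) (𝒯≈ : ∀ p I → 𝒯 p I ≈ 𝒯′ p I) where

    I_T : Pred 𝓕 0ℓ
    I_T = Span (map 𝟏′ P) ∩ Span (one′ ∷ map 𝒯′ P)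

    lists-𝟏 : Lists P 𝟏 (map 𝟏′ P)
    lists-𝟏 = lists-map 𝟏 𝟏′ P (λ {p} _ → 𝟏≈ p)

    lists-𝒯 : Lists P 𝒯 (map 𝒯′ P)
    lists-𝒯 = lists-map 𝒯 𝒯′ P (λ {p} _ → 𝒯≈ p)

    span-𝟏 : ∀ {f} → Span (map 𝟏′ P) f → Σ (Point → Carrier) λ w → ∀ I → f I ≈ weighted w 𝟏 I
    span-𝟏 (c , f≈) = fromCoeffs _≟_ ls c , λ I → trans (f≈ I) (linComb-fromCoeffs _≟_ ls c unique I)
      where
      ls : Lists P 𝟏 (map 𝟏′ P)
      ls = lists-𝟏

    -- The weight `d` consists of the toggle coefficients of `f`. Applying `Δ` to the two
    -- expressions for `f` gives `d q - d (diag⁻ q)` on one side and 0 on the other.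
    I_T⇒admissible : ∀ {f} → I_T f →
      Σ (Point → Carrier) λ d → IsAdmissible d × (∀ I → f I ≈ weighted (lap d) 𝟏 I)
    I_T⇒admissible {f} (f∈𝟏 , (c , f≈)) with span-𝟏 f∈𝟏
    ... | w , f≈w = d , adm , λ I → trans (f≈𝒰 I) (weighted-𝒰 adm I)
      where
      ls : Lists P 𝒯 (map 𝒯′ P)
      ls = lists-𝒯

      d : Point → Carrier
      d = fromCoeffs _≟_ ls (λ i → c (suc i))

      support : ∀ {p} → p ∉ P → d p ≈ 0#
      support = fromCoeffs-∉ _≟_ ls (λ i → c (suc i))

      f≈𝒯 : ∀ I → f I ≈ c zero + weighted d 𝒯 I
      f≈𝒯 I = trans (f≈ I) (+-cong (trans (*-congˡ (sym (one≈ I))) (*-identityʳ _)) (linComb-fromCoeffs _≟_ ls _ unique I))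

      adm : IsAdmissible d
      adm = record { support = support ; diagonal = λ {q} l∈P d∈P → let open SecondDifference q l∈P d∈P in begin
        d q
          ≈⟨ solve 2 (λ a b → a := (a :- b) :+ b) refl _ _ ⟩
        (d q - d (diag⁻ q)) + d (diag⁻ q)
          ≈⟨ +-congʳ (begin
               d q - d (diag⁻ q)           ≈⟨ sym (+-identityˡ _) ⟩
               0# + (d q - d (diag⁻ q))    ≈⟨ +-cong (sym (Δ-const (c zero))) (sym (Δ-weighted-𝒯 support)) ⟩
               Δ (λ _ → c zero) + Δ (weighted d 𝒯) ≈⟨ sym (Δ-+ (λ _ → c zero) (weighted d 𝒯)) ⟩
               Δ (λ I → c zero + weighted d 𝒯 I)  ≈⟨ Δ-cong (λ I → c zero + weighted d 𝒯 I) (weighted w 𝟏) (λ I → trans (sym (f≈𝒯 I)) (f≈w I)) ⟩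
               Δ (weighted w 𝟏)             ≈⟨ Δ-weighted-𝟏 w ⟩
               0# ∎) ⟩
        0# + d (diag⁻ q)
          ≈⟨ +-identityˡ _ ⟩
        d (diag⁻ q) ∎ }

      κ : Carrier
      κ = ∑ P (λ p → d p * μ p)

      𝒯≈𝒰 : ∀ I → weighted d 𝒯 I ≈ weighted d 𝒰 I + κ
      𝒯≈𝒰 I = trans
        (∑-cong {xs = P} (λ _ → solve 3 (λ d t m → d :* t := d :* (t :- m) :+ d :* m) refl _ _ _))
        (∑-+ P _ _)

      -- Every indicator and every `𝒰` vanishes at the empty ideal, so only the constant remains
      -- there.
      constant : c zero + κ ≈ 0#
      constant = begin
        c zero + κ
          ≈⟨ +-congˡ (trans (sym (+-identityˡ κ)) (+-congʳ (sym
               (∑-0 {xs = P} (λ p∈P → trans (*-congˡ (𝒰-empty p∈P)) (zeroʳ _)))))) ⟩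
        c zero + (weighted d 𝒰 empty + κ)
          ≈⟨ trans (+-congˡ (sym (𝒯≈𝒰 empty))) (trans (sym (f≈𝒯 empty)) (f≈w empty)) ⟩
        weighted w 𝟏 empty
          ≈⟨ ∑-0 {xs = P} (λ _ → trans (*-congˡ (𝟏-empty _)) (zeroʳ _)) ⟩
        0# ∎

      f≈𝒰 : ∀ I → f I ≈ weighted d 𝒰 I
      f≈𝒰 I = begin
        f I                            ≈⟨ f≈𝒯 I ⟩
        c zero + weighted d 𝒯 I        ≈⟨ +-congˡ (𝒯≈𝒰 I) ⟩
        c zero + (weighted d 𝒰 I + κ)  ≈⟨ solve 3 (λ a b k → a :+ (b :+ k) := (a :+ k) :+ b) refl _ _ _ ⟩
        (c zero + κ) + weighted d 𝒰 I  ≈⟨ trans (+-congʳ constant) (+-identityˡ _) ⟩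
        weighted d 𝒰 I ∎

    admissible⇒I_T : ∀ {f d} → IsAdmissible d → (∀ I → f I ≈ weighted (lap d) 𝟏 I) → I_T f
    admissible⇒I_T {f} {d} adm f≈ =
        (toCoeffs lists-𝟏 (lap d) , λ I → trans (f≈ I) (sym (linComb-toCoeffs lists-𝟏 (lap d) I)))
      , (coeffs , λ I → trans (f≈𝒯 I) (+-cong (sym (trans (*-congˡ (sym (one≈ I))) (*-identityʳ κ))) (sym (linComb-toCoeffs lists-𝒯 d I))))
      where
      κ : Carrier
      κ = - ∑ P (λ p → d p * μ p)

      coeffs : Fin _ → Carrier
      coeffs zero    = κ
      coeffs (suc i) = toCoeffs lists-𝒯 d i

      f≈𝒯 : ∀ I → f I ≈ κ + weighted d 𝒯 I
      f≈𝒯 I = begin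
        f I                                          ≈⟨ trans (f≈ I) (sym (weighted-𝒰 adm I)) ⟩
        ∑ P (λ p → d p * 𝒰 p I)
          ≈⟨ ∑-cong {xs = P} (λ _ → solve 3 (λ d t m → d :* (t :- m) := d :* t :- d :* m) refl _ _ _) ⟩
        ∑ P (λ p → d p * 𝒯 p I - d p * μ p)          ≈⟨ ∑-- P _ _ ⟩
        weighted d 𝒯 I - ∑ P (λ p → d p * μ p)       ≈⟨ +-comm _ _ ⟩
        κ + weighted d 𝒯 I ∎

    I_T-resp : ∀ {f g : 𝓕} → (∀ I → f I ≈ g I) → I_T f → I_T g
    I_T-resp eq ((c , f≈) , (c′ , f≈′)) =
      (c , λ I → trans (sym (eq I)) (f≈ I)) , (c′ , λ I → trans (sym (eq I)) (f≈′ I))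

    -- A relation between functions on ideals is a relation between weights, by
    -- `weighted-𝟏-injective`; that is the content of independence here.
    weightBasis⇒isBasis : {X : Set} → DecidableEquality X → ∀ {xs w vs} → Unique xs → IsWeightBasis xs w →
                          Lists xs (λ x → weighted (w x) 𝟏) vs → IsBasis I_T vs
    weightBasis⇒isBasis _≟ˣ_ {xs} {w} u B ls = isBasis I_T-resp _≟ˣ_ u ls record
      { elements    = λ m → let d , adm , d≈ = B.elements m in
          admissible⇒I_T adm (λ I → ∑-cong {xs = P} (λ q∈P → *-congʳ (sym (d≈ q∈P))))
      ; independent = λ e e≈0 → B.independent e (weighted-𝟏-injective (combine xs e w)
          (λ I → trans (sym (weighted-combine xs e w I)) (e≈0 I)))
      ; spanning    = λ f∈I_T → let d , adm , f≈ = I_T⇒admissible f∈I_T ; e , d≈ = B.spanning adm in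
          e , λ I → trans (f≈ I) (trans (∑-cong {xs = P} (λ q∈P → *-congʳ (d≈ q∈P)))
                (sym (weighted-combine xs e w I)))
      }
      where module B = IsWeightBasis B

-- Second-order recurrences with boundary conditions

module Harmonic (R : CommutativeRing 0ℓ 0ℓ)
                (φ : ℚ-Algebra R)
                {A : Set} where

  open CommutativeRing R hiding (zero)
  open Sums R φ
  open Solver using (solve; _:+_; _:*_; _:-_; :-_; con; _:=_)

  nat : ℕ → Carrier
  nat zero    = 0#
  nat (suc t) = 1# + nat t

  natℚ : ℕ → ℚ
  natℚ zero    = 0ℚ
  natℚ (suc t) = 1ℚ ℚ.+ natℚ t

  0≤natℚ : ∀ t → 0ℚ ℚ.≤ natℚ t
  0≤natℚ zero    = ℚ.≤-refl
  0≤natℚ (suc t) = ℚ.+-mono-≤ (ℚ.nonNegative⁻¹ 1ℚ) (0≤natℚ t)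

  nat≈natℚ : ∀ t → nat t ≈ φ.⟦ natℚ t ⟧
  nat≈natℚ zero    = sym φ.0-homo
  nat≈natℚ (suc t) = sym (trans (φ.+-homo 1ℚ (natℚ t)) (+-cong φ.1-homo (sym (nat≈natℚ t))))

  -- The multiple `nat (suc t)` is the image of a positive rational, so the image of the reciprocal
  -- inverts it.
  nat-inverse : ∀ t → Σ Carrier λ y → y * nat (suc t) ≈ 1#
  nat-inverse t = φ.⟦ 1/ q ⟧ , trans (*-congˡ (nat≈natℚ (suc t)))
    (trans (sym (φ.*-homo (1/ q) q)) (trans (reflexive (≡.cong φ.⟦_⟧ (ℚ.*-inverseˡ q))) φ.1-homo))
    where
    q = natℚ (suc t)
    instance
      _ = ℚ.positive (ℚ.+-mono-<-≤ (ℚ.positive⁻¹ 1ℚ) (0≤natℚ t))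
      _ = ℚ.pos⇒nonZero q

  -- Closure under `c f + g` covers sums and multiples at once. The space is a parameter because the
  -- recurrences are used both for scalars modulo zero and for functions on points modulo the image
  -- of `lap`.
  record IsSubspace (W : Pred (A → Carrier) 0ℓ) : Set where
    field
      resp : ∀ {f g} → (∀ a → f a ≈ g a) → W f → W g
      +*   : ∀ c {f g} → W f → W g → W (λ a → c * f a + g a)

  -- Modulo a subspace, a sequence with vanishing second differences is linear.
  module _ {W : Pred (A → Carrier) 0ℓ} (isSubspace : IsSubspace W) (s : ℕ → A → Carrier) (N : ℕ)
           (start : W (s 0))
           (step : ∀ t → suc (suc t) ≤ suc N → W (λ a → s (suc (suc t)) a - (s (suc t) a + s (suc t) a) + s t a))
           where

    open IsSubspace isSubspace

    linear : ∀ t → t ≤ suc N → W (λ a → s t a - nat t * s 1 a)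
    linear zero _ = resp (λ a → sym (trans (+-congˡ (trans (-‿cong (zeroˡ _)) -0#≈0#)) (+-identityʳ _))) start
      where open RingProperties ring using (-0#≈0#)
    linear (suc zero) _ = resp
      (λ a → trans (solve 2 (λ x y → con (ℚ.- 1ℚ) :* x :+ x := y :- y) refl _ _) (+-congˡ (-‿cong
        (trans (sym (*-identityˡ (s 1 a))) (*-congʳ (sym (+-identityʳ 1#)))))))
      (+* φ.⟦ ℚ.- 1ℚ ⟧ start start)
    linear (suc (suc t)) t≤ = resp
      (λ a → solve 6 (λ x y z a n o →
          con (ℚ.- 1ℚ) :* (x :- n :* a) :+ (con (1ℚ ℚ.+ 1ℚ) :* (y :- (o :+ n) :* a) :+ (z :- (y :+ y) :+ x))
          := z :- (o :+ (o :+ n)) :* a) refl (s t a) (s (suc t) a) (s (suc (suc t)) a) (s 1 a) (nat t) 1#)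
      (+* φ.⟦ ℚ.- 1ℚ ⟧ (linear t (ℕ.≤-trans (ℕ.n≤1+n _) t+1≤))
        (+* φ.⟦ 1ℚ ℚ.+ 1ℚ ⟧ (linear (suc t) t+1≤) (step t t≤)))
      where
      t+1≤ : suc t ≤ suc N
      t+1≤ = ℕ.≤-trans (ℕ.n≤1+n _) t≤

    from-first : W (s 1) → ∀ t → t ≤ suc N → W (s t)
    from-first s₁ t t≤ = resp (λ a → solve 3 (λ n x y → n :* x :+ (y :- n :* x) := y) refl _ _ _)
      (+* (nat t) s₁ (linear t t≤))

    -- By linearity the last term is `suc N` times the first modulo `W`; dividing by `suc N` puts
    -- `s 1`, and with it every term, in `W`.
    dirichlet : W (s (suc N)) → ∀ t → t ≤ suc N → W (s t)
    dirichlet end = from-first (resp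
      (λ a → trans (solve 4 (λ i e x n → (:- i) :* (e :- n :* x) :+ (i :* e :+ (con (ℚ.- 1ℚ) :* e :+ e)) := (i :* n) :* x) refl
          i (s (suc N) a) (s 1 a) (nat (suc N)))
        (trans (*-congʳ (proj₂ (nat-inverse N))) (*-identityˡ (s 1 a))))
      -- The sum of `end` and its negative is the zero vector, which completes the shape `c f + g`.
      (+* (- i) (linear (suc N) ℕ.≤-refl) (+* i end (+* φ.⟦ ℚ.- 1ℚ ⟧ end end))))
      where i = proj₁ (nat-inverse N)

    -- Modulo `W` the last two terms are `suc N` and `N` times `s 1`, so their difference is `s 1`
    -- itself.
    neumann : W (λ a → s (suc N) a - s N a) → ∀ t → t ≤ suc N → W (s t)
    neumann end = from-first (resp
      (λ a → trans (solve 5 (λ x y n o z →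
          con (ℚ.- 1ℚ) :* (x :- (o :+ n) :* z) :+ (con 1ℚ :* (y :- n :* z) :+ (x :- y)) := o :* z) refl
          (s (suc N) a) (s N a) (nat N) 1# (s 1 a)) (*-identityˡ _))
      (+* φ.⟦ ℚ.- 1ℚ ⟧ (linear (suc N) ℕ.≤-refl)
        (+* φ.⟦ 1ℚ ⟧ (linear N (ℕ.n≤1+n N)) end)))

-- Regions cut out by bounds on coordinates, content and height

record InRegion (m n kmin kmax s i j : ℤ) : Set where
  constructor inRegion
  field
    i≥ : 1ℤ ℤ.≤ i
    i≤ : i ℤ.≤ m
    j≥ : 1ℤ ℤ.≤ j
    j≤ : j ℤ.≤ n
    k≥ : kmin ℤ.≤ i ℤ.- j
    k≤ : i ℤ.- j ℤ.≤ kmax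
    s≤ : s ℤ.≤ i ℤ.+ j

infixl 6 _⊞_
_⊞_ : ∀ {a b c d} → a ℤ.≤ b → c ℤ.≤ d → a ℤ.+ c ℤ.≤ b ℤ.+ d
_⊞_ = ℤ.+-mono-≤

-- One description serves all four posets. Bounds on the content are chosen one step too wide where
-- the poset does not end along a diagonal, so that its diagonals count as interior there. They are
-- attained only on the main diagonal: `kmax` is 0 for the shifted staircase and `kmin` is 0 for
-- type B.
module Region (m n kmin kmax s : ℤ) (P : List Point)
              (kmin<kmax : kmin ℤ.+ 1ℤ ℤ.≤ kmax) (unique : Unique P)
              (∈⇒ : ∀ {i j} → (i , j) ∈ P → InRegion m n kmin kmax s i j)
              (⇒∈ : ∀ {i j} → InRegion m n kmin kmax s i j → (i , j) ∈ P) where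

  left∈ : ∀ {i j} → (i , j) ∈ P → 1ℤ ℤ.+ 1ℤ ℤ.≤ i → kmin ℤ.+ 1ℤ ℤ.≤ i ℤ.- j → s ℤ.+ 1ℤ ℤ.≤ i ℤ.+ j → left (i , j) ∈ P
  left∈ {i} {j} p∈P i≥′ k≥′ s≤′ with ∈⇒ p∈P
  ... | inRegion i≥ i≤ j≥ j≤ k≥ k≤ s≤ = ⇒∈ record
    { i≥ = ≤-by i≥′ (ℤsolve (i ∷ []))
    ; i≤ = ℤ.≤-trans (i-1≤i i) i≤
    ; j≥ = j≥
    ; j≤ = j≤
    ; k≥ = ≤-by k≥′ (ℤsolve (i ∷ j ∷ kmin ∷ []))
    ; k≤ = ≤-by (0≤1 ⊞ k≤) (ℤsolve (i ∷ j ∷ kmax ∷ []))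
    ; s≤ = ≤-by s≤′ (ℤsolve (i ∷ j ∷ s ∷ []))
    }

  down∈ : ∀ {i j} → (i , j) ∈ P → 1ℤ ℤ.+ 1ℤ ℤ.≤ j → i ℤ.- j ℤ.+ 1ℤ ℤ.≤ kmax → s ℤ.+ 1ℤ ℤ.≤ i ℤ.+ j → down (i , j) ∈ P
  down∈ {i} {j} p∈P j≥′ k≤′ s≤′ with ∈⇒ p∈P
  ... | inRegion i≥ i≤ j≥ j≤ k≥ k≤ s≤ = ⇒∈ record
    { i≥ = i≥
    ; i≤ = i≤
    ; j≥ = ≤-by j≥′ (ℤsolve (j ∷ []))
    ; j≤ = ℤ.≤-trans (i-1≤i j) j≤
    ; k≥ = ≤-by (0≤1 ⊞ k≥) (ℤsolve (i ∷ j ∷ kmin ∷ []))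
    ; k≤ = ≤-by k≤′ (ℤsolve (i ∷ j ∷ kmax ∷ []))
    ; s≤ = ≤-by s≤′ (ℤsolve (i ∷ j ∷ s ∷ []))
    }

  right∈ : ∀ {i j} → (i , j) ∈ P → i ℤ.+ 1ℤ ℤ.≤ m → i ℤ.- j ℤ.+ 1ℤ ℤ.≤ kmax → right (i , j) ∈ P
  right∈ {i} {j} p∈P i≤′ k≤′ with ∈⇒ p∈P
  ... | inRegion i≥ i≤ j≥ j≤ k≥ k≤ s≤ = ⇒∈ record
    { i≥ = ℤ.≤-trans i≥ (i≤i+1 i)
    ; i≤ = i≤′
    ; j≥ = j≥
    ; j≤ = j≤
    ; k≥ = ≤-by (0≤1 ⊞ k≥) (ℤsolve (i ∷ j ∷ kmin ∷ []))
    ; k≤ = ≤-by k≤′ (ℤsolve (i ∷ j ∷ kmax ∷ []))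
    ; s≤ = ≤-by (0≤1 ⊞ s≤) (ℤsolve (i ∷ j ∷ s ∷ []))
    }

  up∈ : ∀ {i j} → (i , j) ∈ P → j ℤ.+ 1ℤ ℤ.≤ n → kmin ℤ.+ 1ℤ ℤ.≤ i ℤ.- j → up (i , j) ∈ P
  up∈ {i} {j} p∈P j≤′ k≥′ with ∈⇒ p∈P
  ... | inRegion i≥ i≤ j≥ j≤ k≥ k≤ s≤ = ⇒∈ record
    { i≥ = i≥
    ; i≤ = i≤
    ; j≥ = ℤ.≤-trans j≥ (i≤i+1 j)
    ; j≤ = j≤′
    ; k≥ = ≤-by k≥′ (ℤsolve (i ∷ j ∷ kmin ∷ []))
    ; k≤ = ≤-by (0≤1 ⊞ k≤) (ℤsolve (i ∷ j ∷ kmax ∷ []))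
    ; s≤ = ≤-by (0≤1 ⊞ s≤) (ℤsolve (i ∷ j ∷ s ∷ []))
    }

  -- If two comparable points differ in one coordinate, the step is forced and stays between them.
  -- If they differ in both, `below` steps left unless `q` lies on the diagonal `kmin`, and then
  -- down; `kmin<kmax` keeps that step inside. `above` treats `kmax` in the same way.
  isLatticeRegion : IsLatticeRegion P
  isLatticeRegion = record { unique = unique ; below = below ; above = above ; corner = corner }
    where
    below : ∀ {p q} → p ∈ P → q ∈ P → p ⪯ q → p ≢ q →
            (left q ∈ P × p ⪯ left q) ⊎ (down q ∈ P × p ⪯ down q)
    below {i′ , j′} {i , j} p∈P q∈P (i′≤i , j′≤j) p≢q
      with ∈⇒ p∈P | ∈⇒ q∈P | i′ ℤ.≟ i | j′ ℤ.≟ j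
    ... | _ | _ | yes ≡.refl | yes ≡.refl = contradiction ≡.refl p≢q
    ... | p | q | yes ≡.refl | no j′≢j = inj₂ (down∈ q∈P
        (≤-by (InRegion.j≥ p ⊞ j′≤) (ℤsolve (j ∷ j′ ∷ [])))
        (≤-by (InRegion.k≤ p ⊞ j′≤) (ℤsolve (i ∷ j ∷ j′ ∷ kmax ∷ [])))
        (≤-by (InRegion.s≤ p ⊞ j′≤) (ℤsolve (i ∷ j ∷ j′ ∷ s ∷ []))) , i′≤i , j′≤)
      where j′≤ = ≤∧≢⇒≤-1 j′≤j j′≢j
    ... | p | q | no i′≢i | yes ≡.refl = inj₁ (left∈ q∈P
        (≤-by (InRegion.i≥ p ⊞ i′≤) (ℤsolve (i ∷ i′ ∷ [])))
        (≤-by (InRegion.k≥ p ⊞ i′≤) (ℤsolve (i ∷ j ∷ i′ ∷ kmin ∷ [])))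
        (≤-by (InRegion.s≤ p ⊞ i′≤) (ℤsolve (i ∷ j ∷ i′ ∷ s ∷ []))) , i′≤ , j′≤j)
      where i′≤ = ≤∧≢⇒≤-1 i′≤i i′≢i
    ... | p | q | no i′≢i | no j′≢j with kmin ℤ.≟ i ℤ.- j
    ...   | yes ≡.refl = inj₂ (down∈ q∈P
        (≤-by (InRegion.j≥ p ⊞ j′≤) (ℤsolve (j ∷ j′ ∷ [])))
        kmin<kmax
        (≤-by (InRegion.s≤ p ⊞ i′≤i ⊞ j′≤) (ℤsolve (i ∷ j ∷ i′ ∷ j′ ∷ s ∷ []))) , i′≤i , j′≤)
      where j′≤ = ≤∧≢⇒≤-1 j′≤j j′≢j
    ...   | no k≢ = inj₁ (left∈ q∈P
        (≤-by (InRegion.i≥ p ⊞ i′≤) (ℤsolve (i ∷ i′ ∷ [])))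
        (<⇒+1≤ (ℤ.≤∧≢⇒< (InRegion.k≥ q) k≢))
        (≤-by (InRegion.s≤ p ⊞ i′≤ ⊞ j′≤j) (ℤsolve (i ∷ j ∷ i′ ∷ j′ ∷ s ∷ []))) , i′≤ , j′≤j)
      where i′≤ = ≤∧≢⇒≤-1 i′≤i i′≢i

    above : ∀ {p q} → p ∈ P → q ∈ P → p ⪯ q → p ≢ q →
            (right p ∈ P × right p ⪯ q) ⊎ (up p ∈ P × up p ⪯ q)
    above {i , j} {i′ , j′} p∈P q∈P (i≤i′ , j≤j′) p≢q
      with ∈⇒ p∈P | ∈⇒ q∈P | i ℤ.≟ i′ | j ℤ.≟ j′
    ... | _ | _ | yes ≡.refl | yes ≡.refl = contradiction ≡.refl p≢q
    ... | p | q | yes ≡.refl | no j≢j′ = inj₂ (up∈ p∈P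
        (≤-by (InRegion.j≤ q ⊞ j+1≤) (ℤsolve (j ∷ j′ ∷ n ∷ [])))
        (≤-by (InRegion.k≥ q ⊞ j+1≤) (ℤsolve (i ∷ j ∷ j′ ∷ kmin ∷ []))) , i≤i′ , j+1≤)
      where j+1≤ = <⇒+1≤ (ℤ.≤∧≢⇒< j≤j′ j≢j′)
    ... | p | q | no i≢i′ | yes ≡.refl = inj₁ (right∈ p∈P
        (≤-by (InRegion.i≤ q ⊞ i+1≤) (ℤsolve (i ∷ i′ ∷ m ∷ [])))
        (≤-by (InRegion.k≤ q ⊞ i+1≤) (ℤsolve (i ∷ j ∷ i′ ∷ kmax ∷ []))) , i+1≤ , j≤j′)
      where i+1≤ = <⇒+1≤ (ℤ.≤∧≢⇒< i≤i′ i≢i′)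
    ... | p | q | no i≢i′ | no j≢j′ with i ℤ.- j ℤ.≟ kmax
    ...   | yes ≡.refl = inj₂ (up∈ p∈P
        (≤-by (InRegion.j≤ q ⊞ j+1≤) (ℤsolve (j ∷ j′ ∷ n ∷ [])))
        kmin<kmax , i≤i′ , j+1≤)
      where j+1≤ = <⇒+1≤ (ℤ.≤∧≢⇒< j≤j′ j≢j′)
    ...   | no k≢ = inj₁ (right∈ p∈P
        (≤-by (InRegion.i≤ q ⊞ i+1≤) (ℤsolve (i ∷ i′ ∷ m ∷ [])))
        (<⇒+1≤ (ℤ.≤∧≢⇒< (InRegion.k≤ p) k≢)) , i+1≤ , j≤j′)
      where i+1≤ = <⇒+1≤ (ℤ.≤∧≢⇒< i≤i′ i≢i′)

    corner : ∀ {q} → left q ∈ P → down q ∈ P → q ∈ P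
    corner {i , j} l∈P d∈P with ∈⇒ l∈P | ∈⇒ d∈P
    ... | l | d = ⇒∈ record
      { i≥ = InRegion.i≥ d
      ; i≤ = InRegion.i≤ d
      ; j≥ = InRegion.j≥ l
      ; j≤ = InRegion.j≤ l
      ; k≥ = ≤-by (0≤1 ⊞ InRegion.k≥ l) (ℤsolve (i ∷ j ∷ kmin ∷ []))
      ; k≤ = ≤-by (0≤1 ⊞ InRegion.k≤ d) (ℤsolve (i ∷ j ∷ kmax ∷ []))
      ; s≤ = ≤-by (0≤1 ⊞ InRegion.s≤ l) (ℤsolve (i ∷ j ∷ s ∷ []))
      }

-- Admissible weights and the Laplacian on a region

module RegionWeights
  (R : CommutativeRing 0ℓ 0ℓ)
  (φ : ℚ-Algebra R)
  (m n kmin kmax s : ℤ) (P : List Point)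
  (kmin<kmax : kmin ℤ.+ 1ℤ ℤ.≤ kmax) (unique : Unique P)
  (∈⇒ : ∀ {i j} → (i , j) ∈ P → InRegion m n kmin kmax s i j)
  (⇒∈ : ∀ {i j} → InRegion m n kmin kmax s i j → (i , j) ∈ P) where

  open Region m n kmin kmax s P kmin<kmax unique ∈⇒ ⇒∈ public
  open CommutativeRing R hiding (zero)
  open Sums R φ
  open Toggles R φ P isLatticeRegion
  open IsLatticeRegion isLatticeRegion using (corner)

  ν-∈ : ∀ {p} → p ∈ P → ν p ≈ 0#
  ν-∈ {p} p∈P = 𝟙-false (¬? (p ∈? P)) (λ p∉P → p∉P p∈P)

  ν-∉ : ∀ {p} → p ∉ P → ν p ≈ 1#
  ν-∉ {p} p∉P = 𝟙-true (¬? (p ∈? P)) p∉P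

  χ-admissible : {C : Pred Point 0ℓ} (C? : Decidable C) →
    (∀ {p} → left p ∈ P → down p ∈ P → (C p → diag⁻ p ∈ P × C (diag⁻ p)) × (C (diag⁻ p) → C p)) →
    IsAdmissible (λ p → 𝟙[ (p ∈? P) ×-dec C? p ])
  χ-admissible C? h = record
    { support  = λ {p} p∉P → 𝟙-false ((p ∈? P) ×-dec C? p) (λ (p∈P , _) → p∉P p∈P)
    ; diagonal = λ {p} l d → 𝟙-⇔ ((p ∈? P) ×-dec C? p) ((diag⁻ p ∈? P) ×-dec C? (diag⁻ p))
        (λ (_ , c) → proj₁ (h l d) c) (λ (_ , c) → corner l d , proj₂ (h l d) c)
    }

  module _ {d : Point → Carrier} (adm : IsAdmissible d) where

    open IsAdmissible adm

    -- The region is convex along (1,1). On an interior diagonal, the later of two consecutive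
    -- points above a point of P has both lower neighbours in P, so admissibility equates the two
    -- values.
    diagonal-step : ∀ T {i j} → 0ℤ ℤ.≤ T → kmin ℤ.+ 1ℤ ℤ.≤ i ℤ.- j → i ℤ.- j ℤ.+ 1ℤ ℤ.≤ kmax →
      (i , j) ∈ P → (i ℤ.+ (1ℤ ℤ.+ T) , j ℤ.+ (1ℤ ℤ.+ T)) ∈ P →
      (i ℤ.+ T , j ℤ.+ T) ∈ P × d (i ℤ.+ (1ℤ ℤ.+ T) , j ℤ.+ (1ℤ ℤ.+ T)) ≈ d (i ℤ.+ T , j ℤ.+ T)
    diagonal-step T {i} {j} 0≤T k≥ k≤ p∈P q∈P = between , trans (diagonal l∈P d∈P)
      (reflexive (≡.cong d (≡.cong₂ _,_ (pred≡ i T) (pred≡ j T))))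
      where
      open InRegion (∈⇒ p∈P) hiding (k≥; k≤)
      module Q = InRegion (∈⇒ q∈P)
      pred≡ : ∀ i T → i ℤ.+ (1ℤ ℤ.+ T) ℤ.- 1ℤ ≡ i ℤ.+ T
      pred≡ i T = ℤsolve (i ∷ T ∷ [])
      sum≥ : s ℤ.+ 1ℤ ℤ.≤ (i ℤ.+ (1ℤ ℤ.+ T)) ℤ.+ (j ℤ.+ (1ℤ ℤ.+ T))
      sum≥ = ≤-by (s≤ ⊞ 0≤T ⊞ 0≤T ⊞ 0≤1) (ℤsolve (i ∷ j ∷ T ∷ s ∷ []))
      l∈P : left (i ℤ.+ (1ℤ ℤ.+ T) , j ℤ.+ (1ℤ ℤ.+ T)) ∈ P
      l∈P = left∈ q∈P (≤-by (i≥ ⊞ 0≤T) (ℤsolve (i ∷ T ∷ []))) (≤-by k≥ (ℤsolve (i ∷ j ∷ T ∷ kmin ∷ []))) sum≥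
      d∈P : down (i ℤ.+ (1ℤ ℤ.+ T) , j ℤ.+ (1ℤ ℤ.+ T)) ∈ P
      d∈P = down∈ q∈P (≤-by (j≥ ⊞ 0≤T) (ℤsolve (j ∷ T ∷ []))) (≤-by k≤ (ℤsolve (i ∷ j ∷ T ∷ kmax ∷ []))) sum≥
      between : (i ℤ.+ T , j ℤ.+ T) ∈ P
      between = ⇒∈ {i ℤ.+ T} {j ℤ.+ T} record
        { i≥ = ≤-by (i≥ ⊞ 0≤T) (ℤsolve (i ∷ T ∷ []))
        ; i≤ = ≤-by (Q.i≤ ⊞ 0≤1) (ℤsolve (i ∷ T ∷ m ∷ []))
        ; j≥ = ≤-by (j≥ ⊞ 0≤T) (ℤsolve (j ∷ T ∷ []))
        ; j≤ = ≤-by (Q.j≤ ⊞ 0≤1) (ℤsolve (j ∷ T ∷ n ∷ []))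
        ; k≥ = ≤-by (k≥ ⊞ 0≤1) (ℤsolve (i ∷ j ∷ T ∷ kmin ∷ []))
        ; k≤ = ≤-by (k≤ ⊞ 0≤1) (ℤsolve (i ∷ j ∷ T ∷ kmax ∷ []))
        ; s≤ = ≤-by (s≤ ⊞ 0≤T ⊞ 0≤T) (ℤsolve (i ∷ j ∷ T ∷ s ∷ []))
        }

    diagonal-constant : ∀ t {i j} → kmin ℤ.+ 1ℤ ℤ.≤ i ℤ.- j → i ℤ.- j ℤ.+ 1ℤ ℤ.≤ kmax →
      (i , j) ∈ P → (i ℤ.+ ℤ.+ t , j ℤ.+ ℤ.+ t) ∈ P → d (i ℤ.+ ℤ.+ t , j ℤ.+ ℤ.+ t) ≈ d (i , j)
    diagonal-constant zero {i} {j} k≥ k≤ p∈P q∈P =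
      reflexive (≡.cong d (≡.cong₂ _,_ (ℤ.+-identityʳ i) (ℤ.+-identityʳ j)))
    diagonal-constant (suc t) k≥ k≤ p∈P q∈P =
      let between , eq = diagonal-step (ℤ.+ t) (+≤+ z≤n) k≥ k≤ p∈P q∈P
      in trans eq (diagonal-constant t k≥ k≤ p∈P between)

    -- The correction term dies for one of two reasons: `up` of the point is outside P, where `d` is
    -- 0, or its left neighbour is in P, where `ν` is 0.
    lapˡ-interior : ∀ {i j} → (i , j) ∈ P → left (i , j) ∈ P → kmin ℤ.+ 1ℤ ℤ.+ 1ℤ ℤ.≤ i ℤ.- j →
                    lapˡ d (i , j) ≈ d (left (i , j))
    lapˡ-interior {i} {j} q∈P l∈P k≥ = trans (+-congˡ (go (up (i , j) ∈? P))) (+-identityʳ _)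
      where
      open InRegion (∈⇒ l∈P) using (i≥; s≤)
      go : Dec (up (i , j) ∈ P) → d (up (i , j)) * ν (left (up (i , j))) ≈ 0#
      go (no u∉P)  = trans (*-congʳ (support u∉P)) (zeroˡ _)
      go (yes u∈P) = trans (*-congˡ (ν-∈ (left∈ u∈P
        (≤-by i≥ (ℤsolve (i ∷ [])))
        (≤-by k≥ (ℤsolve (i ∷ j ∷ kmin ∷ [])))
        (≤-by (s≤ ⊞ 0≤1) (ℤsolve (i ∷ j ∷ s ∷ [])))))) (zeroʳ _)

    lapᵈ-interior : ∀ {i j} → (i , j) ∈ P → down (i , j) ∈ P → i ℤ.- j ℤ.+ 1ℤ ℤ.+ 1ℤ ℤ.≤ kmax →
                    lapᵈ d (i , j) ≈ d (down (i , j))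
    lapᵈ-interior {i} {j} q∈P d∈P k≤ = trans (+-congˡ (go (right (i , j) ∈? P))) (+-identityʳ _)
      where
      open InRegion (∈⇒ d∈P) using (j≥; s≤)
      go : Dec (right (i , j) ∈ P) → d (right (i , j)) * ν (down (right (i , j))) ≈ 0#
      go (no r∉P)  = trans (*-congʳ (support r∉P)) (zeroˡ _)
      go (yes r∈P) = trans (*-congˡ (ν-∈ (down∈ r∈P
        (≤-by j≥ (ℤsolve (j ∷ [])))
        (≤-by k≤ (ℤsolve (i ∷ j ∷ kmax ∷ [])))
        (≤-by (s≤ ⊞ 0≤1) (ℤsolve (i ∷ j ∷ s ∷ [])))))) (zeroʳ _)

    -- At a left edge the value at `left p` is replaced by the value at `up p`, a point of the same
    -- content. Hence `lap` has the same form on the whole diagonal.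
    lapˡ-boundary : ∀ {p} → left p ∉ P → left (up p) ∉ P → lapˡ d p ≈ d (up p)
    lapˡ-boundary l∉P u∉P = trans (+-cong (support l∉P) (trans (*-congˡ (ν-∉ u∉P)) (*-identityʳ _))) (+-identityˡ _)

    lapᵈ-boundary : ∀ {p} → down p ∉ P → down (right p) ∉ P → lapᵈ d p ≈ d (right p)
    lapᵈ-boundary l∉P u∉P = trans (+-cong (support l∉P) (trans (*-congˡ (ν-∉ u∉P)) (*-identityʳ _))) (+-identityˡ _)

-- Regions with least element (1,1)

2ℤ : ℤ
2ℤ = 1ℤ ℤ.+ 1ℤ

-- The minimal element of a rectangle or shifted staircase on the k-th diagonal.
corner-rep : ℤ → Point
corner-rep (ℤ.+ k)    = ℤ.+ suc k , 1ℤ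
corner-rep ℤ.-[1+ k ] = 1ℤ , ℤ.+ suc (suc k)

content : Point → ℤ
content (i , j) = i ℤ.- j

i-1-j : ∀ i j → i ℤ.- 1ℤ ℤ.- j ≡ i ℤ.- j ℤ.- 1ℤ
i-1-j i j = ℤsolve (i ∷ j ∷ [])

i-[j+1] : ∀ i j → i ℤ.- (j ℤ.+ 1ℤ) ≡ i ℤ.- j ℤ.- 1ℤ
i-[j+1] i j = ℤsolve (i ∷ j ∷ [])

i+1-j : ∀ i j → i ℤ.+ 1ℤ ℤ.- j ≡ i ℤ.- j ℤ.+ 1ℤ
i+1-j i j = ℤsolve (i ∷ j ∷ [])

i-[j-1] : ∀ i j → i ℤ.- (j ℤ.- 1ℤ) ≡ i ℤ.- j ℤ.+ 1ℤ
i-[j-1] i j = ℤsolve (i ∷ j ∷ [])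

content-diag⁻ : ∀ p → content (diag⁻ p) ≡ content p
content-diag⁻ (i , j) = eq i j
  where
  eq : ∀ i j → i ℤ.- 1ℤ ℤ.- (j ℤ.- 1ℤ) ≡ i ℤ.- j
  eq i j = ℤsolve (i ∷ j ∷ [])

OnDiagonal : ℤ → Pred Point 0ℓ
OnDiagonal k p = content p ≡ k

onDiagonal? : ∀ k → Decidable (OnDiagonal k)
onDiagonal? k p = content p ℤ.≟ k

main≡ : ∀ {q} → content q ≡ 0ℤ → q ≡ (proj₁ q , proj₁ q)
main≡ {i , j} eq = ≡.cong (i ,_) (≡.sym (ℤ.i-j≡0⇒i≡j i j eq))

content-main : ∀ i → content (i , i) ≡ 0ℤ
content-main i = ℤ.+-inverseʳ i

≥1⇒ : ∀ {i} → 1ℤ ℤ.≤ i → Σ ℕ λ t → i ≡ 1ℤ ℤ.+ ℤ.+ t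
≥1⇒ {ℤ.+ suc t} _ = t , ≡.refl
≥1⇒ {ℤ.+ zero} (+≤+ ())

≰⇒+1≤ : ∀ {i j} → ¬ (i ℤ.≤ j) → j ℤ.+ 1ℤ ℤ.≤ i
≰⇒+1≤ i≰j = <⇒+1≤ (ℤ.≰⇒> i≰j)

0≤+ : ∀ {t} → 0ℤ ℤ.≤ ℤ.+ t
0≤+ = +≤+ z≤n

module CornerRegion
  (R : CommutativeRing 0ℓ 0ℓ)
  (φ : ℚ-Algebra R)
  (m n kmax : ℤ) (P : List Point) (kmax≤m : kmax ℤ.≤ m)
  (kmin<kmax : ℤ.- n ℤ.+ 1ℤ ℤ.≤ kmax) (unique : Unique P)
  (∈⇒ : ∀ {i j} → (i , j) ∈ P → InRegion m n (ℤ.- n) kmax 2ℤ i j)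
  (⇒∈ : ∀ {i j} → InRegion m n (ℤ.- n) kmax 2ℤ i j → (i , j) ∈ P)
  (1≤m : 1ℤ ℤ.≤ m) (1≤n : 1ℤ ℤ.≤ n) (0≤kmax : 0ℤ ℤ.≤ kmax) where

  open RegionWeights R φ m n (ℤ.- n) kmax 2ℤ P kmin<kmax unique ∈⇒ ⇒∈ public
  open CommutativeRing R hiding (zero)
  open Sums R φ
  open Toggles R φ P isLatticeRegion

  content-corner-rep : ∀ k → content (corner-rep k) ≡ k
  content-corner-rep (ℤ.+ k)    = ≡.refl
  content-corner-rep ℤ.-[1+ k ] = ≡.refl

  corner-rep-bounds : ∀ k → corner-rep k ∈ P → ℤ.- n ℤ.+ 1ℤ ℤ.≤ k × k ℤ.+ 1ℤ ℤ.≤ m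
  corner-rep-bounds (ℤ.+ k) p∈P = ≤-by (j≤ ⊞ 0≤k) (eq₁ (ℤ.+ k) n) , ≤-by i≤ (eq₂ (ℤ.+ k) m)
    where
    open InRegion (∈⇒ p∈P)
    0≤k : 0ℤ ℤ.≤ ℤ.+ k
    0≤k = +≤+ z≤n
    eq₁ : ∀ K n → K ℤ.- (ℤ.- n ℤ.+ 1ℤ) ≡ n ℤ.+ K ℤ.- (1ℤ ℤ.+ 0ℤ)
    eq₁ K n = ℤsolve (K ∷ n ∷ [])
    eq₂ : ∀ K m → m ℤ.- (K ℤ.+ 1ℤ) ≡ m ℤ.- (1ℤ ℤ.+ K)
    eq₂ K m = ℤsolve (K ∷ m ∷ [])
  corner-rep-bounds ℤ.-[1+ k ] p∈P = ≤-by j≤ (eq₁ (ℤ.+ suc k) n) , ≤-by (i≤ ⊞ 0≤k) (eq₂ (ℤ.+ suc k) m)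
    where
    open InRegion (∈⇒ p∈P)
    0≤k : 0ℤ ℤ.≤ ℤ.+ suc k
    0≤k = +≤+ z≤n
    eq₁ : ∀ K n → ℤ.- K ℤ.- (ℤ.- n ℤ.+ 1ℤ) ≡ n ℤ.- (1ℤ ℤ.+ K)
    eq₁ K n = ℤsolve (K ∷ n ∷ [])
    eq₂ : ∀ K m → m ℤ.- (ℤ.- K ℤ.+ 1ℤ) ≡ m ℤ.+ K ℤ.- (1ℤ ℤ.+ 0ℤ)
    eq₂ K m = ℤsolve (K ∷ m ∷ [])

  module _ {d : Point → Carrier} (adm : IsAdmissible d) where

    open IsAdmissible adm

    assoc : ∀ K T → K ℤ.+ (1ℤ ℤ.+ T) ≡ 1ℤ ℤ.+ K ℤ.+ T
    assoc K T = ℤsolve (K ∷ T ∷ [])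

    start⁺ : ∀ K T → 0ℤ ℤ.≤ K → 0ℤ ℤ.≤ T → (K ℤ.+ (1ℤ ℤ.+ T) , 1ℤ ℤ.+ T) ∈ P →
             (1ℤ ℤ.+ K , 1ℤ) ∈ P × ℤ.- n ℤ.+ 1ℤ ℤ.≤ 1ℤ ℤ.+ K ℤ.- 1ℤ
    start⁺ K T K≥ 0≤T p∈P = ⇒∈ {1ℤ ℤ.+ K} {1ℤ} record
        { i≥ = ≤-by K≥ (ℤsolve (K ∷ []))
        ; i≤ = ≤-by (i≤ ⊞ 0≤T) (ℤsolve (K ∷ T ∷ m ∷ []))
        ; j≥ = ℤ.≤-refl
        ; j≤ = ≤-by (j≤ ⊞ 0≤T) (ℤsolve (T ∷ n ∷ []))
        ; k≥ = ≤-by k≥ (ℤsolve (K ∷ T ∷ n ∷ []))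
        ; k≤ = ≤-by k≤ (ℤsolve (K ∷ T ∷ kmax ∷ []))
        ; s≤ = ≤-by K≥ (ℤsolve (K ∷ []))
        } , ≤-by (K≥ ⊞ j≤ ⊞ 0≤T) (ℤsolve (K ∷ n ∷ T ∷ []))
      where open InRegion (∈⇒ p∈P)

    start⁻ : ∀ K T → 0ℤ ℤ.≤ K → 0ℤ ℤ.≤ T → (1ℤ ℤ.+ T , K ℤ.+ (1ℤ ℤ.+ T)) ∈ P → (1ℤ , 1ℤ ℤ.+ K) ∈ P
    start⁻ K T K≥ 0≤T p∈P = ⇒∈ {1ℤ} {1ℤ ℤ.+ K} record
        { i≥ = ℤ.≤-refl
        ; i≤ = ≤-by (i≤ ⊞ 0≤T) (ℤsolve (T ∷ m ∷ []))
        ; j≥ = ≤-by K≥ (ℤsolve (K ∷ []))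
        ; j≤ = ≤-by (j≤ ⊞ 0≤T) (ℤsolve (K ∷ T ∷ n ∷ []))
        ; k≥ = ≤-by k≥ (ℤsolve (K ∷ T ∷ n ∷ []))
        ; k≤ = ≤-by k≤ (ℤsolve (K ∷ T ∷ kmax ∷ []))
        ; s≤ = ≤-by K≥ (ℤsolve (K ∷ []))
        }
      where open InRegion (∈⇒ p∈P)

    constant⁺ : ∀ t K → 0ℤ ℤ.≤ K → K ℤ.+ 1ℤ ℤ.≤ kmax → (K ℤ.+ (1ℤ ℤ.+ ℤ.+ t) , 1ℤ ℤ.+ ℤ.+ t) ∈ P →
                d (K ℤ.+ (1ℤ ℤ.+ ℤ.+ t) , 1ℤ ℤ.+ ℤ.+ t) ≈ d (1ℤ ℤ.+ K , 1ℤ)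
    constant⁺ t K K≥ K≤ p∈P = trans (reflexive (≡.cong d eq)) (diagonal-constant adm t {1ℤ ℤ.+ K} {1ℤ}
      (proj₂ start) (≤-by K≤ (ℤsolve (K ∷ kmax ∷ []))) (proj₁ start) (≡.subst (_∈ P) eq p∈P))
      where
      start = start⁺ K (ℤ.+ t) K≥ (+≤+ z≤n) p∈P
      eq : (K ℤ.+ (1ℤ ℤ.+ ℤ.+ t) , 1ℤ ℤ.+ ℤ.+ t) ≡ (1ℤ ℤ.+ K ℤ.+ ℤ.+ t , 1ℤ ℤ.+ ℤ.+ t)
      eq = ≡.cong (_, _) (assoc K (ℤ.+ t))

    constant⁻ : ∀ t K → 0ℤ ℤ.≤ K → ℤ.- n ℤ.+ 1ℤ ℤ.≤ ℤ.- K → ℤ.- K ℤ.+ 1ℤ ℤ.≤ kmax →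
                (1ℤ ℤ.+ ℤ.+ t , K ℤ.+ (1ℤ ℤ.+ ℤ.+ t)) ∈ P →
                d (1ℤ ℤ.+ ℤ.+ t , K ℤ.+ (1ℤ ℤ.+ ℤ.+ t)) ≈ d (1ℤ , 1ℤ ℤ.+ K)
    constant⁻ t K K≥ K≥′ K≤ p∈P = trans (reflexive (≡.cong d eq)) (diagonal-constant adm t {1ℤ} {1ℤ ℤ.+ K}
      (≤-by K≥′ (ℤsolve (K ∷ n ∷ []))) (≤-by K≤ (ℤsolve (K ∷ kmax ∷ [])))
      (start⁻ K (ℤ.+ t) K≥ (+≤+ z≤n) p∈P) (≡.subst (_∈ P) eq p∈P))
      where
      eq : (1ℤ ℤ.+ ℤ.+ t , K ℤ.+ (1ℤ ℤ.+ ℤ.+ t)) ≡ (1ℤ ℤ.+ ℤ.+ t , 1ℤ ℤ.+ K ℤ.+ ℤ.+ t)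
      eq = ≡.cong (_ ,_) (assoc K (ℤ.+ t))

    -- Walking down the diagonal ends where a coordinate is 1. The bound on the content excludes the
    -- main diagonal of the shifted staircase, on which admissibility links no two points.
    diagonal-rep : ∀ {p} → p ∈ P → content p ℤ.+ 1ℤ ℤ.≤ kmax → d p ≈ d (corner-rep (content p))
    diagonal-rep {i , j} p∈P k≤ = go (i ℤ.- j) ≡.refl
      where
      open InRegion (∈⇒ p∈P) hiding (k≤)
      eq₁ : ∀ i j → i ≡ (i ℤ.- j) ℤ.+ j
      eq₁ i j = ℤsolve (i ∷ j ∷ [])
      eq₂ : ∀ i j → j ≡ ℤ.- (i ℤ.- j) ℤ.+ i
      eq₂ i j = ℤsolve (i ∷ j ∷ [])
      k>-n : ℤ.- n ℤ.+ 1ℤ ℤ.≤ i ℤ.- j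
      k>-n = ≤-by (i≥ ⊞ j≤) (ℤsolve (i ∷ j ∷ n ∷ []))
      go : ∀ k → i ℤ.- j ≡ k → d (i , j) ≈ d (corner-rep k)
      go (ℤ.+ k) eq with ≥1⇒ j≥
      ... | t , ≡.refl with ≡.trans (eq₁ i j) (≡.cong (ℤ._+ j) eq)
      ...   | ≡.refl = constant⁺ t (ℤ.+ k) (+≤+ z≤n) (≡.subst (λ k → k ℤ.+ 1ℤ ℤ.≤ kmax) eq k≤) p∈P
      go ℤ.-[1+ k ] eq with ≥1⇒ i≥
      ... | t , ≡.refl with ≡.trans (eq₂ i j) (≡.cong (λ k → ℤ.- k ℤ.+ i) eq)
      ...   | ≡.refl = constant⁻ t (ℤ.+ suc k) (+≤+ z≤n) (≡.subst (ℤ.- n ℤ.+ 1ℤ ℤ.≤_) eq k>-n)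
                         (≡.subst (λ k → k ℤ.+ 1ℤ ℤ.≤ kmax) eq k≤) p∈P

    diagonal-value : ∀ {p k} → p ∈ P → content p ≡ k → k ℤ.+ 1ℤ ℤ.≤ kmax → d p ≈ d (corner-rep k)
    diagonal-value p∈P ≡.refl k≤ = diagonal-rep p∈P k≤

    -- On a diagonal that misses P the representative is outside P as well. The resulting zeros are
    -- the Dirichlet boundary values.
    outside : ∀ k → ¬ (ℤ.- n ℤ.+ 1ℤ ℤ.≤ k × k ℤ.+ 1ℤ ℤ.≤ m) → d (corner-rep k) ≈ 0#
    outside k h = support (λ p∈P → h (corner-rep-bounds k p∈P))

    -- The cases ask whether a left neighbour exists and whether the diagonal to the left is the
    -- empty one, of content `- n`. They cannot both hold, since that diagonal is approached only
    -- from points with first coordinate 1.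
    lapˡ-formula : ∀ {i j} → (i , j) ∈ P → lapˡ d (i , j) ≈ d (corner-rep (i ℤ.- j ℤ.- 1ℤ))
    lapˡ-formula {i} {j} q∈P = go (2ℤ ℤ.≤? i) (ℤ.- n ℤ.≟ i ℤ.- j ℤ.- 1ℤ)
      where
      open InRegion (∈⇒ q∈P)
      k′≥ : ℤ.- n ℤ.≤ i ℤ.- j ℤ.- 1ℤ
      k′≥ = ≤-by (i≥ ⊞ j≤) (ℤsolve (i ∷ j ∷ n ∷ []))
      go : Dec (2ℤ ℤ.≤ i) → Dec (ℤ.- n ≡ i ℤ.- j ℤ.- 1ℤ) → lapˡ d (i , j) ≈ d (corner-rep (i ℤ.- j ℤ.- 1ℤ))
      go (yes 2≤i) (yes eq) = ⊥-elim (≤-absurd {k = 0} (2≤i ⊞ j≤ ⊞ ℤ.≤-reflexive (≡.sym eq)) (ℤsolve (i ∷ j ∷ n ∷ [])))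
      go (no 2≰i) (yes eq) = trans
        (trans (+-cong (support l∉P) (trans (*-congʳ (support u∉P)) (zeroˡ _))) (+-identityˡ 0#))
        (sym (outside (i ℤ.- j ℤ.- 1ℤ) (λ (h , _) → ≤-absurd {k = 0} (h ⊞ ℤ.≤-reflexive (≡.sym eq)) (ℤsolve (i ∷ j ∷ n ∷ [])))))
        where
        l∉P : left (i , j) ∉ P
        l∉P l∈P = 2≰i (≤-by (InRegion.i≥ (∈⇒ l∈P)) (ℤsolve (i ∷ [])))
        u∉P : up (i , j) ∉ P
        u∉P u∈P = ≤-absurd {k = 0} (InRegion.j≤ (∈⇒ u∈P) ⊞ i≥ ⊞ ℤ.≤-reflexive (≡.sym eq)) (ℤsolve (i ∷ j ∷ n ∷ []))
      go (yes 2≤i) (no k′≢) = trans (lapˡ-interior adm q∈P l∈P (≤-by k′> (ℤsolve (i ∷ j ∷ n ∷ []))))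
        (diagonal-value {left (i , j)} {i ℤ.- j ℤ.- 1ℤ} l∈P (i-1-j i j) (≤-by k≤ (ℤsolve (i ∷ j ∷ kmax ∷ []))))
        where
        k′> : ℤ.- n ℤ.+ 1ℤ ℤ.≤ i ℤ.- j ℤ.- 1ℤ
        k′> = <⇒+1≤ (ℤ.≤∧≢⇒< k′≥ k′≢)
        l∈P : left (i , j) ∈ P
        l∈P = left∈ q∈P 2≤i (≤-by (k′> ⊞ 0≤1) (ℤsolve (i ∷ j ∷ n ∷ []))) (2≤i ⊞ j≥)
      go (no 2≰i) (no k′≢) = trans (lapˡ-boundary adm (no-left j) (no-left (j ℤ.+ 1ℤ)))
        (diagonal-value {up (i , j)} {i ℤ.- j ℤ.- 1ℤ} u∈P (i-[j+1] i j) (≤-by k≤ (ℤsolve (i ∷ j ∷ kmax ∷ []))))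
        where
        k′> : ℤ.- n ℤ.+ 1ℤ ℤ.≤ i ℤ.- j ℤ.- 1ℤ
        k′> = <⇒+1≤ (ℤ.≤∧≢⇒< k′≥ k′≢)
        no-left : ∀ j → left (i , j) ∉ P
        no-left j l∈P = 2≰i (≤-by (InRegion.i≥ (∈⇒ l∈P)) (ℤsolve (i ∷ [])))
        u∈P : up (i , j) ∈ P
        u∈P = up∈ q∈P (≤-by (k′> ⊞ ≰⇒+1≤ 2≰i) (ℤsolve (i ∷ j ∷ n ∷ [])))
          (≤-by (k′> ⊞ 0≤1) (ℤsolve (i ∷ j ∷ n ∷ [])))

    lapᵈ-formula : ∀ {i j} → (i , j) ∈ P → i ℤ.- j ℤ.+ 1ℤ ℤ.+ 1ℤ ℤ.≤ kmax →
                   lapᵈ d (i , j) ≈ d (corner-rep (i ℤ.- j ℤ.+ 1ℤ))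
    lapᵈ-formula {i} {j} q∈P k≤ = go (2ℤ ℤ.≤? j)
      where
      open InRegion (∈⇒ q∈P) hiding (k≤)
      go : Dec (2ℤ ℤ.≤ j) → lapᵈ d (i , j) ≈ d (corner-rep (i ℤ.- j ℤ.+ 1ℤ))
      go (yes 2≤j) = trans (lapᵈ-interior adm q∈P d∈P k≤) (diagonal-value {down (i , j)} {i ℤ.- j ℤ.+ 1ℤ} d∈P (i-[j-1] i j) k≤)
        where
        d∈P : down (i , j) ∈ P
        d∈P = down∈ q∈P 2≤j (≤-by (k≤ ⊞ 0≤1) (ℤsolve (i ∷ j ∷ kmax ∷ [])))
                (≤-by (i≥ ⊞ 2≤j) (ℤsolve (i ∷ j ∷ [])))
      go (no 2≰j) = trans (lapᵈ-boundary adm (no-down i) (no-down (i ℤ.+ 1ℤ))) (diagonal-value {right (i , j)} {i ℤ.- j ℤ.+ 1ℤ} r∈P (i+1-j i j) k≤)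
        where
        no-down : ∀ i → down (i , j) ∉ P
        no-down i d∈P = 2≰j (≤-by (InRegion.j≥ (∈⇒ d∈P)) (ℤsolve (j ∷ [])))
        r∈P : right (i , j) ∈ P
        r∈P = right∈ q∈P (≤-by (k≤ ⊞ kmax≤m ⊞ ≰⇒+1≤ 2≰j) (ℤsolve (i ∷ j ∷ kmax ∷ m ∷ [])))
          (≤-by (k≤ ⊞ 0≤1) (ℤsolve (i ∷ j ∷ kmax ∷ [])))

  corner-rep∈ : ∀ k → ℤ.- n ℤ.+ 1ℤ ℤ.≤ k → k ℤ.+ 1ℤ ℤ.≤ kmax → corner-rep k ∈ P
  corner-rep∈ (ℤ.+ k) k≥ k≤ = go (ℤ.+ k) 0≤+ k≥ k≤
    where
    go : ∀ K → 0ℤ ℤ.≤ K → ℤ.- n ℤ.+ 1ℤ ℤ.≤ K → K ℤ.+ 1ℤ ℤ.≤ kmax → (1ℤ ℤ.+ K , 1ℤ) ∈ P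
    go K 0≤K k≥ k≤ = ⇒∈ {1ℤ ℤ.+ K} {1ℤ} record
      { i≥ = ≤-by 0≤K (ℤsolve (K ∷ []))
      ; i≤ = ≤-by (k≤ ⊞ kmax≤m) (ℤsolve (K ∷ m ∷ kmax ∷ []))
      ; j≥ = ℤ.≤-refl
      ; j≤ = 1≤n
      ; k≥ = ≤-by (k≥ ⊞ 0≤1) (ℤsolve (K ∷ n ∷ []))
      ; k≤ = ≤-by (k≤ ⊞ 0≤1) (ℤsolve (K ∷ kmax ∷ []))
      ; s≤ = ≤-by 0≤K (ℤsolve (K ∷ []))
      }
  corner-rep∈ ℤ.-[1+ k ] k≥ k≤ = go (ℤ.+ suc k) 0≤+ k≥ k≤
    where
    go : ∀ K → 0ℤ ℤ.≤ K → ℤ.- n ℤ.+ 1ℤ ℤ.≤ ℤ.- K → ℤ.- K ℤ.+ 1ℤ ℤ.≤ kmax → (1ℤ , 1ℤ ℤ.+ K) ∈ P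
    go K 0≤K k≥ k≤ = ⇒∈ {1ℤ} {1ℤ ℤ.+ K} record
      { i≥ = ℤ.≤-refl
      ; i≤ = 1≤m
      ; j≥ = ≤-by 0≤K (ℤsolve (K ∷ []))
      ; j≤ = ≤-by k≥ (ℤsolve (K ∷ n ∷ []))
      ; k≥ = ≤-by (k≥ ⊞ 0≤1) (ℤsolve (K ∷ n ∷ []))
      ; k≤ = ≤-by (k≤ ⊞ 0≤1) (ℤsolve (K ∷ kmax ∷ []))
      ; s≤ = ≤-by 0≤K (ℤsolve (K ∷ []))
      }

  content-bounds : ∀ {p} → p ∈ P → ℤ.- n ℤ.+ 1ℤ ℤ.≤ content p × content p ℤ.+ 1ℤ ℤ.≤ m
  content-bounds {i , j} p∈P = k≥′ , k≤′
    where
    open InRegion (∈⇒ p∈P)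
    k≥′ : ℤ.- n ℤ.+ 1ℤ ℤ.≤ i ℤ.- j
    k≥′ = ≤-by (i≥ ⊞ j≤) (ℤsolve (i ∷ j ∷ n ∷ []))
    k≤′ : i ℤ.- j ℤ.+ 1ℤ ℤ.≤ m
    k≤′ = ≤-by (i≤ ⊞ j≥) (ℤsolve (i ∷ j ∷ m ∷ []))

  -- Since (1,1) is the only minimal element, it is the only one whose toggle is nonzero at the
  -- empty ideal; this is why exactly one element of `B₁` carries a constant for the rectangle and
  -- the shifted staircase.
  nonminimal : ∀ {p} → p ∈ P → p ≢ (1ℤ , 1ℤ) → left p ∈ P ⊎ down p ∈ P
  nonminimal {i , j} p∈P p≢ = go (2ℤ ℤ.≤? i) (2ℤ ℤ.≤? j)
    where
    open InRegion (∈⇒ p∈P)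
    eq : ∀ {i} → 1ℤ ℤ.≤ i → ¬ (2ℤ ℤ.≤ i) → i ≡ 1ℤ
    eq {i} 1≤i 2≰i = ℤ.≤-antisym (≤-by (≰⇒+1≤ 2≰i) (ℤsolve (i ∷ []))) 1≤i
    go : Dec (2ℤ ℤ.≤ i) → Dec (2ℤ ℤ.≤ j) → left (i , j) ∈ P ⊎ down (i , j) ∈ P
    go (yes 2≤i) _ = inj₁ (left∈ p∈P 2≤i (proj₁ (content-bounds p∈P)) (2≤i ⊞ j≥))
    go (no 2≰i) (yes 2≤j) = inj₂ (down∈ p∈P 2≤j
      (≤-by (≰⇒+1≤ 2≰i ⊞ 2≤j ⊞ 0≤kmax) (ℤsolve (i ∷ j ∷ kmax ∷ [])))
      (≤-by (i≥ ⊞ 2≤j) (ℤsolve (i ∷ j ∷ []))))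
    go (no 2≰i) (no 2≰j) = contradiction (≡.cong₂ _,_ (eq i≥ 2≰i) (eq j≥ 2≰j)) p≢

  left-1∉ : left (1ℤ , 1ℤ) ∉ P
  left-1∉ l∈P = ≤-absurd {k = 0} (InRegion.i≥ (∈⇒ l∈P)) ≡.refl

  down-1∉ : down (1ℤ , 1ℤ) ∉ P
  down-1∉ d∈P = ≤-absurd {k = 0} (InRegion.j≥ (∈⇒ d∈P)) ≡.refl

  1∈ : (1ℤ , 1ℤ) ∈ P
  1∈ = ⇒∈ {1ℤ} {1ℤ} record
    { i≥ = ℤ.≤-refl ; i≤ = 1≤m ; j≥ = ℤ.≤-refl ; j≤ = 1≤n
    ; k≥ = ≤-by (1≤n ⊞ 0≤1) (ℤsolve (n ∷ [])) ; k≤ = 0≤kmax ; s≤ = ℤ.≤-refl }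

  diag⁻∈ : ∀ {p} → left p ∈ P → down p ∈ P → diag⁻ p ∈ P
  diag⁻∈ {i , j} l∈P d∈P = ⇒∈ {i ℤ.- 1ℤ} {j ℤ.- 1ℤ} record
    { i≥ = L.i≥
    ; i≤ = L.i≤
    ; j≥ = D.j≥
    ; j≤ = D.j≤
    ; k≥ = ≤-by (L.k≥ ⊞ 0≤1) (ℤsolve (i ∷ j ∷ n ∷ []))
    ; k≤ = ≤-by (D.k≤ ⊞ 0≤1) (ℤsolve (i ∷ j ∷ kmax ∷ []))
    ; s≤ = L.i≥ ⊞ D.j≥
    }
    where
    module L = InRegion (∈⇒ l∈P)
    module D = InRegion (∈⇒ d∈P)

  χᵈ : ℤ → Point → Carrier
  χᵈ k p = 𝟙[ (p ∈? P) ×-dec onDiagonal? k p ]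

  χᵈ-admissible : ∀ k → IsAdmissible (χᵈ k)
  χᵈ-admissible k = χ-admissible (onDiagonal? k) λ {p} l d →
    (λ c → diag⁻∈ l d , ≡.trans (content-diag⁻ p) c) , (λ c → ≡.trans (≡.sym (content-diag⁻ p)) c)

  χᵈ-rep : ∀ k l → ℤ.- n ℤ.+ 1ℤ ℤ.≤ k → k ℤ.+ 1ℤ ℤ.≤ kmax → χᵈ k (corner-rep l) ≈ 𝟙[ l ℤ.≟ k ]
  χᵈ-rep k l k≥ k≤ = 𝟙-⇔ ((corner-rep l ∈? P) ×-dec onDiagonal? k (corner-rep l)) (l ℤ.≟ k)
    (λ (_ , c) → ≡.trans (≡.sym (content-corner-rep l)) c)
    (λ { ≡.refl → corner-rep∈ k k≥ k≤ , content-corner-rep k })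

  χᵈ-content : ∀ {p k} → p ∈ P → χᵈ k p ≈ 𝟙[ content p ℤ.≟ k ]
  χᵈ-content {p} {k} p∈P = 𝟙-⇔ ((p ∈? P) ×-dec onDiagonal? k p) (content p ℤ.≟ k) proj₂ (p∈P ,_)

  Laplacian : Pred (Point → Carrier) 0ℓ
  Laplacian f = Σ (Point → Carrier) λ d → IsAdmissible d × (∀ {q} → q ∈ P → lap d q ≈ f q)

  open Harmonic R φ

  laplacian-isSubspace : IsSubspace {A = Point} (λ f → Laplacian f)
  laplacian-isSubspace = record
    { resp = λ eq (d , adm , d≈) → d , adm , λ {q} q∈P → trans (d≈ q∈P) (eq q)
    ; +*   = λ c (d , adm , d≈) (d′ , adm′ , d≈′) → (λ p → c * d p + d′ p) , record
        { support  = λ p∉P → trans (+-cong (trans (*-congˡ (IsAdmissible.support adm p∉P)) (zeroʳ c))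
                                           (IsAdmissible.support adm′ p∉P)) (+-identityˡ 0#)
        ; diagonal = λ l b → +-cong (*-congˡ (IsAdmissible.diagonal adm l b)) (IsAdmissible.diagonal adm′ l b)
        } , λ {q} q∈P → trans (lap-+* c d d′ q) (+-cong (*-congˡ (d≈ q∈P)) (d≈′ q∈P))
    }

  -- Functions on a one-point set are scalars, so with this instance the boundary lemmas say that a
  -- scalar sequence vanishes.
  0-isSubspace : IsSubspace {A = ⊤} (λ f → ∀ a → f a ≈ 0#)
  0-isSubspace = record
    { resp = λ eq f≈0 a → trans (sym (eq a)) (f≈0 a)
    ; +*   = λ c f≈0 g≈0 a → trans (+-cong (trans (*-congˡ (f≈0 a)) (zeroʳ c)) (g≈0 a)) (+-identityˡ 0#)
    }

  0-laplacian : ∀ {f} → (∀ {q} → q ∈ P → f q ≈ 0#) → Laplacian f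
  0-laplacian f≈0 = (λ _ → 0#) , record { support = λ _ → refl ; diagonal = λ _ _ → refl } ,
    λ {q} q∈P → trans (lap-0 q) (sym (f≈0 q∈P))

-- The Laplacian on the rectangle

index-pred : ∀ n T → 1ℤ ℤ.+ T ℤ.- n ℤ.- 1ℤ ≡ T ℤ.- n
index-pred n T = ℤsolve (n ∷ T ∷ [])

index-suc : ∀ n T → 1ℤ ℤ.+ T ℤ.- n ℤ.+ 1ℤ ≡ 1ℤ ℤ.+ (1ℤ ℤ.+ T) ℤ.- n
index-suc n T = ℤsolve (n ∷ T ∷ [])

index≥ : ∀ n T → 0ℤ ℤ.≤ T → ℤ.- n ℤ.+ 1ℤ ℤ.≤ 1ℤ ℤ.+ T ℤ.- n
index≥ n T 0≤T = ≤-by 0≤T (ℤsolve (n ∷ T ∷ []))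

index≤ : ∀ m n T → 1ℤ ℤ.+ (1ℤ ℤ.+ T) ℤ.≤ m ℤ.+ n → 1ℤ ℤ.+ T ℤ.- n ℤ.+ 1ℤ ℤ.≤ m
index≤ m n T h = ≤-by h (ℤsolve (m ∷ n ∷ T ∷ []))

-- Diagonals are numbered by `k + n`, from the empty diagonal `- n` numbered 0; those that meet the
-- rectangle have the numbers 1 to `m + n - 1`.
index : ∀ m n {k} → ℤ.- (ℤ.+ n) ℤ.+ 1ℤ ℤ.≤ k → k ℤ.+ 1ℤ ℤ.≤ ℤ.+ m →
        Σ ℕ λ t → suc t ≤ m ℕ.+ n × k ≡ ℤ.+ t ℤ.- ℤ.+ n
index m n {k} k≥ k≤ with ≥1⇒ (lower k (ℤ.+ n) k≥)
  where
  lower : ∀ k n → ℤ.- n ℤ.+ 1ℤ ℤ.≤ k → 1ℤ ℤ.≤ k ℤ.+ n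
  lower k n h = ≤-by h (ℤsolve (k ∷ n ∷ []))
... | t , eq = suc t , ℤ.drop‿+≤+ (≡.subst (λ z → 1ℤ ℤ.+ z ℤ.≤ ℤ.+ m ℤ.+ ℤ.+ n) eq (upper k (ℤ.+ m) (ℤ.+ n) k≤)) ,
      ≡.trans (shift k (ℤ.+ n)) (≡.cong (ℤ._- ℤ.+ n) eq)
  where
  upper : ∀ k m n → k ℤ.+ 1ℤ ℤ.≤ m → 1ℤ ℤ.+ (k ℤ.+ n) ℤ.≤ m ℤ.+ n
  upper k m n h = ≤-by h (ℤsolve (k ∷ m ∷ n ∷ []))
  shift : ∀ k n → k ≡ k ℤ.+ n ℤ.- n
  shift k n = ℤsolve (k ∷ n ∷ [])

module RectangleWeights
  (R : CommutativeRing 0ℓ 0ℓ)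
  (φ : ℚ-Algebra R)
  (m n : ℕ) (P : List Point) (unique : Unique P)
  (∈⇒ : ∀ {i j} → (i , j) ∈ P → InRegion (ℤ.+ suc m) (ℤ.+ suc n) (ℤ.- (ℤ.+ suc n)) (ℤ.+ suc m) 2ℤ i j)
  (⇒∈ : ∀ {i j} → InRegion (ℤ.+ suc m) (ℤ.+ suc n) (ℤ.- (ℤ.+ suc n)) (ℤ.+ suc m) 2ℤ i j → (i , j) ∈ P) where

  private
    M N : ℤ
    M = ℤ.+ suc m
    N = ℤ.+ suc n

    nonempty : ∀ m n → 1ℤ ℤ.≤ m → 1ℤ ℤ.≤ n → ℤ.- n ℤ.+ 1ℤ ℤ.≤ m
    nonempty m n 1≤m 1≤n = ≤-by (1≤m ⊞ 1≤n ⊞ 0≤1) (ℤsolve (m ∷ n ∷ []))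

    1≤+ : ∀ {k} → 1ℤ ℤ.≤ ℤ.+ suc k
    1≤+ = +≤+ (ℕ.s≤s z≤n)

  open CornerRegion R φ M N M P ℤ.≤-refl (nonempty M N 1≤+ 1≤+) unique ∈⇒ ⇒∈ 1≤+ 1≤+ 0≤+ public
  open CommutativeRing R hiding (zero)
  open Sums R φ
  open Solver using (solve; _:+_; _:*_; _:-_; :-_; con; _:=_)
  open Toggles R φ P isLatticeRegion
  open Harmonic R φ

  module _ {d : Point → Carrier} (adm : IsAdmissible d) where

    lapᵈ-rectangle : ∀ {i j} → (i , j) ∈ P → lapᵈ d (i , j) ≈ d (corner-rep (i ℤ.- j ℤ.+ 1ℤ))
    lapᵈ-rectangle {i} {j} q∈P = go M (∈⇒ q∈P) ≡.refl (M ℤ.≟ i ℤ.- j ℤ.+ 1ℤ)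
      where
      open IsAdmissible adm
      go : ∀ m → InRegion m N (ℤ.- N) m 2ℤ i j → m ≡ M → Dec (m ≡ i ℤ.- j ℤ.+ 1ℤ) →
           lapᵈ d (i , j) ≈ d (corner-rep (i ℤ.- j ℤ.+ 1ℤ))
      go m q ≡.refl (no k≢) = lapᵈ-formula adm q∈P (<⇒+1≤ (ℤ.≤∧≢⇒< k+1≤m (λ eq → k≢ (≡.sym eq))))
        where
        k+1≤m : i ℤ.- j ℤ.+ 1ℤ ℤ.≤ m
        k+1≤m = proj₂ (content-bounds q∈P)
      go m q m≡ (yes eq) = trans
        (trans (+-cong (support d∉P) (trans (*-congʳ (support r∉P)) (zeroˡ _))) (+-identityˡ 0#))
        (sym (outside adm (i ℤ.- j ℤ.+ 1ℤ) (λ (_ , h) →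
          ≤-absurd {k = 0} (≡.subst (i ℤ.- j ℤ.+ 1ℤ ℤ.+ 1ℤ ℤ.≤_) (≡.sym m≡) h ⊞ ℤ.≤-reflexive eq)
            (ℤsolve (i ∷ j ∷ m ∷ [])))))
        where
        open InRegion q
        d∉P : down (i , j) ∉ P
        d∉P d∈P = ≤-absurd {k = 0} (InRegion.j≥ (∈⇒ d∈P) ⊞ i≤ ⊞ ℤ.≤-reflexive eq) (ℤsolve (i ∷ j ∷ m ∷ []))
        r∉P : right (i , j) ∉ P
        r∉P r∈P = ≤-absurd {k = 0} (≡.subst (i ℤ.+ 1ℤ ℤ.≤_) (≡.sym m≡) (InRegion.i≤ (∈⇒ r∈P)) ⊞ j≥ ⊞ ℤ.≤-reflexive eq)
          (ℤsolve (i ∷ j ∷ m ∷ []))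

    -- The second difference of the sequence of diagonal values, where the empty diagonals at both
    -- ends have value 0.
    lap-rectangle : ∀ {q} → q ∈ P → lap d q ≈ d (corner-rep (content q ℤ.- 1ℤ)) + d (corner-rep (content q ℤ.+ 1ℤ))
      - (d (corner-rep (content q)) + d (corner-rep (content q)))
    lap-rectangle {i , j} q∈P = +-cong (+-cong (lapˡ-formula adm q∈P) (lapᵈ-rectangle q∈P))
      (-‿cong (+-cong eq eq))
      where eq = diagonal-rep adm q∈P (proj₂ (content-bounds q∈P))

  -- The t-th diagonal from the top left corner; diagonals 0 and m + n are empty.
  diagonal : ℕ → ℤ
  diagonal t = ℤ.+ t ℤ.- N

  interior : ∀ t → suc (suc t) ≤ suc m ℕ.+ suc n →
             ℤ.- N ℤ.+ 1ℤ ℤ.≤ diagonal (suc t) × diagonal (suc t) ℤ.+ 1ℤ ℤ.≤ M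
  interior t t≤ = index≥ N (ℤ.+ t) 0≤+ , index≤ M N (ℤ.+ t) (+≤+ t≤)

  end≡ : diagonal (suc m ℕ.+ suc n) ≡ M
  end≡ = eq M N
    where
    eq : ∀ m n → m ℤ.+ n ℤ.- n ≡ m
    eq m n = ℤsolve (m ∷ n ∷ [])

  first∉ : ∀ {k} → ℤ.- N ℤ.+ 1ℤ ℤ.≤ k → k ≢ diagonal 0
  first∉ = go N
    where
    go : ∀ n {k} → ℤ.- n ℤ.+ 1ℤ ℤ.≤ k → k ≢ 0ℤ ℤ.- n
    go n h ≡.refl = ≤-absurd {k = 0} h (ℤsolve (n ∷ []))

  last∉ : ∀ {k} → k ℤ.+ 1ℤ ℤ.≤ M → k ≢ diagonal (suc m ℕ.+ suc n)
  last∉ h eq = go M h (≡.trans eq end≡)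
    where
    go : ∀ m {k} → k ℤ.+ 1ℤ ℤ.≤ m → k ≢ m
    go m h ≡.refl = ≤-absurd {k = 0} h (ℤsolve (m ∷ []))

  -- The case `W = 0` of `dirichlet`. The last index is `suc m + suc n`, so the length handed over
  -- is its predecessor `m + suc n`.
  injective : ∀ {d} → IsAdmissible d → (∀ {q} → q ∈ P → lap d q ≈ 0#) → ∀ {p} → p ∈ P → d p ≈ 0#
  injective {d} adm lap≈0 {p} p∈P =
    let k≥ , k≤ = content-bounds p∈P
        t , t≤ , eq = index (suc m) (suc n) k≥ k≤
    in trans (diagonal-value adm p∈P eq (≡.subst (λ k → k ℤ.+ 1ℤ ℤ.≤ M) eq k≤))
         (dirichlet 0-isSubspace s (m ℕ.+ suc n) (λ _ → outside adm (diagonal 0) (λ (h , _) → first∉ h ≡.refl)) step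
           (λ _ → outside adm (diagonal (suc m ℕ.+ suc n)) (λ (_ , h) → last∉ h ≡.refl)) t (ℕ.<⇒≤ t≤) tt)
    where
    s : ℕ → ⊤ → Carrier
    s t _ = d (corner-rep (diagonal t))
    step : ∀ t → suc (suc t) ≤ suc m ℕ.+ suc n →
           ∀ a → s (suc (suc t)) a - (s (suc t) a + s (suc t) a) + s t a ≈ 0#
    step t t≤ a = trans (solve 3 (λ x y z → z :- (y :+ y) :+ x := x :+ z :- (y :+ y)) refl _ _ _)
      (trans (sym (trans (lap-rectangle adm rep∈) (+-cong (+-cong
        (value (≡.trans (≡.cong (ℤ._- 1ℤ) k≡) (index-pred N (ℤ.+ t))))
        (value (≡.trans (≡.cong (ℤ._+ 1ℤ) k≡) (index-suc N (ℤ.+ t)))))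
        (-‿cong (+-cong (value k≡) (value k≡)))))) (lap≈0 rep∈))
      where
      k = diagonal (suc t)
      rep∈ : corner-rep k ∈ P
      rep∈ = corner-rep∈ k (proj₁ (interior t t≤)) (proj₂ (interior t t≤))
      k≡ : content (corner-rep k) ≡ k
      k≡ = content-corner-rep k
      value : ∀ {k l} → k ≡ l → d (corner-rep k) ≈ d (corner-rep l)
      value eq = reflexive (≡.cong (λ k → d (corner-rep k)) eq)

  -- The sequence now consists of indicators of diagonals, modulo the image of `lap`. Its second
  -- difference at a diagonal is `lap` of the indicator of that diagonal, and the indicators of the
  -- two empty end diagonals vanish on P.
  ∑ᵈ-laplacian : ∀ {k} → ℤ.- N ℤ.+ 1ℤ ℤ.≤ k → k ℤ.+ 1ℤ ℤ.≤ M → Laplacian (λ q → 𝟙[ content q ℤ.≟ k ])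
  ∑ᵈ-laplacian {k} k≥ k≤ =
    let t , t≤ , eq = index (suc m) (suc n) k≥ k≤
    in ≡.subst (λ k → Laplacian (λ q → 𝟙[ content q ℤ.≟ k ])) (≡.sym eq)
         (dirichlet laplacian-isSubspace s (m ℕ.+ suc n)
           (0-laplacian (λ {q} q∈P → 𝟙-false (content q ℤ.≟ diagonal 0) (first∉ {content q} (proj₁ (content-bounds q∈P)))))
           step
           (0-laplacian (λ {q} q∈P → 𝟙-false (content q ℤ.≟ diagonal (suc m ℕ.+ suc n)) (last∉ {content q} (proj₂ (content-bounds q∈P)))))
           t (ℕ.<⇒≤ t≤))
    where
    s : ℕ → Point → Carrier
    s t q = 𝟙[ content q ℤ.≟ diagonal t ]
    step : ∀ t → suc (suc t) ≤ suc m ℕ.+ suc n →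
           Laplacian (λ a → s (suc (suc t)) a - (s (suc t) a + s (suc t) a) + s t a)
    step t t≤ = χᵈ l , χᵈ-admissible l , λ {q} q∈P → trans (lap-rectangle (χᵈ-admissible l) q∈P)
      (trans (+-cong (+-cong (value {content q ℤ.- 1ℤ} {content q} {diagonal (suc (suc t))} (pred-suc q)) (value (suc-pred q)))
        (-‿cong (+-cong (χᵈ-rep l (content q) l≥ l≤) (χᵈ-rep l (content q) l≥ l≤))))
        (solve 3 (λ z x y → z :+ x :- (y :+ y) := z :- (y :+ y) :+ x) refl _ _ _))
      where
      l = diagonal (suc t)
      l≥ = proj₁ (interior t t≤)
      l≤ = proj₂ (interior t t≤)
      value : ∀ {l′ c k′} → (l′ ≡ l → c ≡ k′) × (c ≡ k′ → l′ ≡ l) → χᵈ l (corner-rep l′) ≈ 𝟙[ c ℤ.≟ k′ ]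
      value {l′} {c} {k′} (f , g) = trans (χᵈ-rep l l′ l≥ l≤) (𝟙-⇔ (l′ ℤ.≟ l) (c ℤ.≟ k′) f g)
      pred-suc : ∀ q → (content q ℤ.- 1ℤ ≡ l → content q ≡ diagonal (suc (suc t)))
                     × (content q ≡ diagonal (suc (suc t)) → content q ℤ.- 1ℤ ≡ l)
      pred-suc q = (λ eq → ≡.trans (≡.sym (i-1+1≡i (content q))) (≡.trans (≡.cong (ℤ._+ 1ℤ) eq) (index-suc N (ℤ.+ t))))
                 , (λ eq → ≡.trans (≡.cong (ℤ._- 1ℤ) (≡.trans eq (≡.sym (index-suc N (ℤ.+ t))))) (i+1-1≡i l))
      suc-pred : ∀ q → (content q ℤ.+ 1ℤ ≡ l → content q ≡ diagonal t) × (content q ≡ diagonal t → content q ℤ.+ 1ℤ ≡ l)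
      suc-pred q = (λ eq → ≡.trans (≡.sym (i+1-1≡i (content q))) (≡.trans (≡.cong (ℤ._- 1ℤ) eq) (index-pred N (ℤ.+ t))))
                 , (λ eq → ≡.trans (≡.cong (ℤ._+ 1ℤ) (≡.trans eq (≡.sym (index-pred N (ℤ.+ t))))) (i-1+1≡i l))

  module _ {xs : List ℤ} (unique-xs : Unique xs)
           (∈xs⇒ : ∀ {k} → k ∈ xs → ℤ.- N ℤ.+ 1ℤ ℤ.≤ k × k ℤ.+ 1ℤ ℤ.≤ M)
           (⇒∈xs : ∀ {k} → ℤ.- N ℤ.+ 1ℤ ℤ.≤ k → k ℤ.+ 1ℤ ℤ.≤ M → k ∈ xs) where

    classes : Classes ℤ xs
    classes = record
      { unique-xs  = unique-xs
      ; Class      = OnDiagonal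
      ; class?     = onDiagonal?
      ; disjoint   = λ _ _ eq eq′ → ≡.trans (≡.sym eq) eq′
      ; rep        = corner-rep
      ; rep∈P      = λ {k} m → corner-rep∈ k (proj₁ (∈xs⇒ m)) (proj₂ (∈xs⇒ m))
      ; rep∈Class  = λ {k} _ → content-corner-rep k
      ; admissible = λ {k} _ → χᵈ-admissible k
      ; classify   = λ {p} p∈P → let k≥ , k≤ = content-bounds p∈P in
          inj₁ (content p , ⇒∈xs k≥ k≤ , ≡.refl , λ adm → diagonal-rep adm p∈P k≤)
      }

    𝒯-basis : IsWeightBasis xs (λ k → lap (χᵈ k))
    𝒯-basis = Classes.isWeightBasis classes injective

    combine-content : ∀ e {q} → q ∈ P → combine xs e (λ k q → 𝟙[ content q ℤ.≟ k ]) q ≈ e (content q)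
    combine-content e {q} q∈P = let k≥ , k≤ = content-bounds q∈P in trans
      (∑-cong {xs = xs} (λ _ → *-congˡ (sym (χᵈ-content q∈P))))
      (Classes.combine-χ classes e (⇒∈xs k≥ k≤) q∈P ≡.refl)

    -- A combination of diagonal indicators takes its coefficients as values, so independence is
    -- read at the representatives and the coefficients of `lap d` are the right-hand side of
    -- `lap-rectangle`.
    𝟏-basis : IsWeightBasis xs (λ k q → 𝟙[ content q ℤ.≟ k ])
    𝟏-basis = record
      { elements    = λ m → ∑ᵈ-laplacian (proj₁ (∈xs⇒ m)) (proj₂ (∈xs⇒ m))
      ; independent = λ e e≈0 {k} m → let rep∈ = corner-rep∈ k (proj₁ (∈xs⇒ m)) (proj₂ (∈xs⇒ m)) in
          trans (sym (trans (combine-content e rep∈) (reflexive (≡.cong e (content-corner-rep k))))) (e≈0 rep∈)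
      ; spanning    = λ {d} adm →
          (λ k → d (corner-rep (k ℤ.- 1ℤ)) + d (corner-rep (k ℤ.+ 1ℤ)) - (d (corner-rep k) + d (corner-rep k))) ,
          λ q∈P → trans (lap-rectangle adm q∈P) (sym (combine-content _ q∈P))
      }

-- Membership in integer intervals

a≤a+t : ∀ a t → 0ℤ ℤ.≤ t → a ℤ.≤ a ℤ.+ t
a≤a+t a t h = ≤-by h (ℤsolve (a ∷ t ∷ []))

a+t≤b : ∀ a b t → t ℤ.≤ b ℤ.- a → a ℤ.+ t ℤ.≤ b
a+t≤b a b t h = ≤-by h (ℤsolve (a ∷ b ∷ t ∷ []))

1≤k-a+1 : ∀ a k → a ℤ.≤ k → 1ℤ ℤ.≤ k ℤ.- a ℤ.+ 1ℤ
1≤k-a+1 a k h = ≤-by h (ℤsolve (a ∷ k ∷ []))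

k-a+1≤ : ∀ a b k → k ℤ.≤ b → k ℤ.- a ℤ.+ 1ℤ ℤ.≤ 1ℤ ℤ.+ (b ℤ.- a)
k-a+1≤ a b k h = ≤-by h (ℤsolve (a ∷ b ∷ k ∷ []))

a+[k-a]≡k : ∀ a k → a ℤ.+ (k ℤ.- a ℤ.+ 1ℤ ℤ.- 1ℤ) ≡ k
a+[k-a]≡k a k = ℤsolve (a ∷ k ∷ [])

∈-interval⁻ : ∀ a b {k} → k ∈ [ a ⋯ b ] → a ℤ.≤ k × k ℤ.≤ b
∈-interval⁻ a b m with b ℤ.- a in eq
... | ℤ.+ d with ∈-applyUpTo⁻ (λ t → a ℤ.+ ℤ.+ t) m
...   | t , t<1+d , ≡.refl = a≤a+t a (ℤ.+ t) 0≤+ ,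
  a+t≤b a b (ℤ.+ t) (≡.subst (ℤ.+ t ℤ.≤_) (≡.sym eq) (+≤+ (ℕ.s≤s⁻¹ t<1+d)))

∈-interval⁺ : ∀ {a b k} → a ℤ.≤ k → k ℤ.≤ b → k ∈ [ a ⋯ b ]
∈-interval⁺ {a} {b} {k} a≤k k≤b with b ℤ.- a in eq
... | ℤ.-[1+ d ] = ⊥-elim (≤-absurd (ℤ.≤-trans a≤k k≤b) eq)
... | ℤ.+ d with ≥1⇒ (1≤k-a+1 a k a≤k)
...   | t , eq′ = ≡.subst (_∈ applyUpTo (λ t → a ℤ.+ ℤ.+ t) (suc d))
  (≡.trans (≡.cong (λ z → a ℤ.+ (z ℤ.- 1ℤ)) (≡.sym eq′)) (a+[k-a]≡k a k))
  (∈-applyUpTo⁺ (λ t → a ℤ.+ ℤ.+ t) (ℤ.drop‿+≤+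
    (≡.subst₂ ℤ._≤_ eq′ (≡.cong (λ z → 1ℤ ℤ.+ z) eq) (k-a+1≤ a b k k≤b))))

unique-interval : ∀ a b → Unique [ a ⋯ b ]
unique-interval a b with b ℤ.- a
... | ℤ.-[1+ _ ] = AllPairs.[]
... | ℤ.+ d      = Unique.applyUpTo⁺₁ _ (suc d) λ i<j _ eq →
  ℕ.<⇒≢ i<j (ℤ.+-injective (∙-cancelˡ a _ _ eq))

-- From weights to sums of toggles and indicators

module ClassSums
  (R : CommutativeRing 0ℓ 0ℓ)
  (φ : ℚ-Algebra R)
  (P : List Point) (region : IsLatticeRegion P)
  (one′ : Toggles.𝓕 R φ P region) (𝟏′ 𝒯′ : Point → Toggles.𝓕 R φ P region)
  (one≈ : ∀ I → CommutativeRing._≈_ R (CommutativeRing.1# R) (one′ I))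
  (𝟏≈ : ∀ p I → CommutativeRing._≈_ R (Toggles.𝟏 R φ P region p I) (𝟏′ p I))
  (𝒯≈ : ∀ p I → CommutativeRing._≈_ R (Toggles.𝒯 R φ P region p I) (𝒯′ p I)) where

  open CommutativeRing R hiding (zero)
  open OrderIdeals P using (𝒥)
  open Sums R φ
  open Solver using (solve; _:+_; _:*_; _:-_; :-_; con; _:=_)
  open IsLatticeRegion region
  open Families R φ 𝒥
  open Toggles R φ P region
  open Module (functionSpace R 𝒥) using (_+ᴹ_; 0ᴹ)

  sumOf : (Point → 𝓕) → List Point → 𝓕
  sumOf f ps = foldr _+ᴹ_ 0ᴹ (map f ps)

  sumOf≈∑ : ∀ f ps I → sumOf f ps I ≈ ∑ ps (λ p → f p I)
  sumOf≈∑ f []       I = refl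
  sumOf≈∑ f (p ∷ ps) I = +-congˡ (sumOf≈∑ f ps I)

  NotMinimal : Pred Point 0ℓ
  NotMinimal p = left p ∈ P ⊎ down p ∈ P

  μ-0 : ∀ {p} → NotMinimal p → μ p ≈ 0#
  μ-0 {p} (inj₁ l) = trans (*-congʳ (𝟙-false (¬? (left p ∈? P)) (λ l∉ → l∉ l))) (zeroˡ _)
  μ-0 {p} (inj₂ d) = trans (*-congˡ (𝟙-false (¬? (down p ∈? P)) (λ d∉ → d∉ d))) (zeroʳ _)

  module _ {C : Pred Point 0ℓ} (C? : Decidable C) where

    indicator : Point → Carrier
    indicator p = 𝟙[ (p ∈? P) ×-dec C? p ]

    weighted-indicator : ∀ I → weighted indicator 𝒯 I ≈ sumOf 𝒯′ (filter C? P) I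
    weighted-indicator I = sym (trans (sumOf≈∑ 𝒯′ (filter C? P) I) (trans (∑-filter C? P (λ p → 𝒯′ p I))
      (∑-cong {xs = P} (λ {p} p∈P → *-cong (𝟙-⇔ (C? p) ((p ∈? P) ×-dec C? p) (p∈P ,_) proj₂) (sym (𝒯≈ p I))))))

    -- The number of minimal elements of P in the class, and therefore the value of the sum of its
    -- toggles at the empty ideal. It is the constant subtracted in `B₁`.
    minimals : Carrier
    minimals = ∑ P (λ p → indicator p * μ p)

    weighted-𝒰-indicator : ∀ I → weighted indicator 𝒰 I ≈ sumOf 𝒯′ (filter C? P) I - minimals
    weighted-𝒰-indicator I = trans
      (∑-cong {xs = P} (λ _ → solve 3 (λ c t m → c :* (t :- m) := c :* t :- c :* m) refl _ _ _))
      (trans (∑-- P (λ p → indicator p * 𝒯 p I) (λ p → indicator p * μ p)) (+-congʳ (weighted-indicator I)))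

    indicator-μ-0 : ∀ {p} → (C p → NotMinimal p) → indicator p * μ p ≈ 0#
    indicator-μ-0 {p} h with C? p
    ... | yes c = trans (*-congˡ (μ-0 (h c))) (zeroʳ _)
    ... | no ¬c = trans (*-congʳ (𝟙-false ((p ∈? P) ×-dec no ¬c) (λ (_ , c) → ¬c c))) (zeroˡ _)

    minimals-0 : (∀ {p} → p ∈ P → C p → NotMinimal p) → minimals ≈ 0#
    minimals-0 h = ∑-0 {xs = P} (λ p∈P → indicator-μ-0 (h p∈P))

    minimals-1 : ∀ {p₀} → p₀ ∈ P → C p₀ → left p₀ ∉ P → down p₀ ∉ P →
                 (∀ {p} → p ∈ P → C p → p ≢ p₀ → NotMinimal p) → minimals ≈ 1#
    minimals-1 {p₀} p₀∈P c l∉P d∉P h = trans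
      (∑-single unique p₀∈P (λ p∈P p≢p₀ → indicator-μ-0 (λ c → h p∈P c p≢p₀)))
      (trans (*-cong (𝟙-true ((p₀ ∈? P) ×-dec C? p₀) (p₀∈P , c))
        (trans (*-cong (𝟙-true (¬? (left p₀ ∈? P)) l∉P) (𝟙-true (¬? (down p₀ ∈? P)) d∉P)) (*-identityˡ 1#)))
        (*-identityˡ 1#))

    𝒰-sum : IsAdmissible indicator → minimals ≈ 0# →
            ∀ I → weighted (lap indicator) 𝟏 I ≈ sumOf 𝒯′ (filter C? P) I
    𝒰-sum adm m≈0 I = trans (sym (weighted-𝒰 adm I)) (trans (weighted-𝒰-indicator I)
      (trans (+-congˡ (-‿cong m≈0)) (x-0≈x _)))

    𝒰-sum-1 : IsAdmissible indicator → minimals ≈ 1# →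
              ∀ I → weighted (lap indicator) 𝟏 I ≈ - one′ I + sumOf 𝒯′ (filter C? P) I
    𝒰-sum-1 adm m≈1 I = trans (sym (weighted-𝒰 adm I)) (trans (weighted-𝒰-indicator I)
      (trans (+-congˡ (-‿cong (trans m≈1 (one≈ I)))) (+-comm _ _)))

    weighted-𝟙 : ∀ I → weighted (λ p → 𝟙[ C? p ]) 𝟏 I ≈ sumOf 𝟏′ (filter C? P) I
    weighted-𝟙 I = sym (trans (sumOf≈∑ 𝟏′ (filter C? P) I) (trans (∑-filter C? P (λ p → 𝟏′ p I))
      (∑-cong {xs = P} (λ {p} _ → *-congˡ (sym (𝟏≈ p I))))))

  𝒰-point : ∀ {p} → IsAdmissible (indicator (_≟ p)) → p ∈ P →
            ∀ I → weighted (lap (indicator (_≟ p))) 𝟏 I ≈ 𝒰 p I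
  𝒰-point {p} adm p∈P I = trans (sym (weighted-𝒰 adm I)) (trans
    (∑-single unique p∈P (λ {q} _ q≢p → trans (*-congʳ (𝟙-false ((q ∈? P) ×-dec (q ≟ p)) (λ (_ , eq) → q≢p eq))) (zeroˡ _)))
    (trans (*-congʳ (𝟙-true ((p ∈? P) ×-dec (p ≟ p)) (p∈P , ≡.refl))) (*-identityˡ _)))

  𝒰-nonminimal : ∀ {p} → NotMinimal p → ∀ I → 𝒰 p I ≈ 𝒯′ p I
  𝒰-nonminimal {p} h I = trans (+-cong (𝒯≈ p I) (-‿cong (μ-0 h))) (x-0≈x _)

  𝒰-minimal : ∀ {p} → left p ∉ P → down p ∉ P → ∀ I → 𝒰 p I ≈ 𝒯′ p I + - one′ I
  𝒰-minimal {p} l∉P d∉P I = +-cong (𝒯≈ p I) (-‿cong (trans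
    (*-cong (𝟙-true (¬? (left p ∈? P)) l∉P) (𝟙-true (¬? (down p ∈? P)) d∉P)) (trans (*-identityˡ 1#) (one≈ I))))

  weighted-neg : ∀ w I → weighted (λ q → - w q) 𝟏 I ≈ - weighted w 𝟏 I
  weighted-neg w I = trans (∑-cong {xs = P} (λ _ → solve 2 (λ a b → (:- a) :* b := :- (a :* b)) refl _ _))
    (∑-neg P (λ q → w q * 𝟏 q I))

  2* : ∀ x → x + x ≈ (1# + 1#) * x
  2* x = sym (trans (distribʳ x 1# 1#) (+-cong (*-identityˡ x) (*-identityˡ x)))

  -- Stated with images of rationals, here and in `∉-𝟏`, since the solver can compute with those as
  -- constants.
  ∉-ν : ∀ {p} → p ∉ P → ν p ≈ φ.⟦ ℚ.1ℚ ⟧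
  ∉-ν {p} p∉P = trans (𝟙-true (¬? (p ∈? P)) p∉P) (sym φ.1-homo)

  ∉-𝟏 : ∀ {p} → p ∉ P → ∀ I → 𝟏 p I ≈ φ.⟦ ℚ.0ℚ ⟧
  ∉-𝟏 p∉P I = trans (𝟏-∉ I p∉P) (sym φ.0-homo)

  -- With `right p` and `down p` missing, the upper product is 0 and the lower one is linear, so
  -- `𝒰 p` has no quadratic term. This holds along the main diagonal of the shifted staircase;
  -- `-𝒰-down-right` is the reflected case, for type B.
  -𝒰-left-up : ∀ {p} → p ∈ P → right p ∉ P → down p ∉ P → ∀ I →
               - 𝒰 p I ≈ (1# + 1#) * 𝟏′ p I + - 𝟏′ (left p) I + - 𝟏′ (up p) I
  -𝒰-left-up {p} p∈P r∉P d∉P I = trans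
    (-‿cong (+-cong (trans (𝒯-formula I p∈P) (+-cong
        (+-congʳ (*-congˡ (+-cong (∉-𝟏 d∉P I) (∉-ν d∉P))))
        (+-cong (+-congʳ (∉-𝟏 r∉P I)) (-‿cong (*-congʳ (∉-𝟏 r∉P I))))))
      (-‿cong (*-congˡ (∉-ν d∉P)))))
    (trans (solve 4 (λ l nl u v →
        :- ((l :+ nl) :* (con ℚ.0ℚ :+ con ℚ.1ℚ) :- (u :+ u) :+ (con ℚ.0ℚ :+ v :- con ℚ.0ℚ :* v) :- nl :* con ℚ.1ℚ)
        := (u :+ u) :+ :- l :+ :- v) refl _ _ _ _)
      (+-cong (+-cong (trans (2* _) (*-congˡ (𝟏≈ p I))) (-‿cong (𝟏≈ (left p) I))) (-‿cong (𝟏≈ (up p) I))))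

  -𝒰-down-right : ∀ {p} → p ∈ P → left p ∉ P → up p ∉ P → ∀ I →
                  - 𝒰 p I ≈ (1# + 1#) * 𝟏′ p I + - 𝟏′ (down p) I + - 𝟏′ (right p) I
  -𝒰-down-right {p} p∈P l∉P u∉P I = trans
    (-‿cong (+-cong (trans (𝒯-formula I p∈P) (+-cong
        (+-congʳ (*-congʳ (+-cong (∉-𝟏 l∉P I) (∉-ν l∉P))))
        (+-cong (+-congˡ (∉-𝟏 u∉P I)) (-‿cong (*-congˡ (∉-𝟏 u∉P I))))))
      (-‿cong (*-congʳ (∉-ν l∉P)))))
    (trans (solve 4 (λ d nd u r →
        :- ((con ℚ.0ℚ :+ con ℚ.1ℚ) :* (d :+ nd) :- (u :+ u) :+ (r :+ con ℚ.0ℚ :- r :* con ℚ.0ℚ) :- con ℚ.1ℚ :* nd)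
        := (u :+ u) :+ :- d :+ :- r) refl _ _ _ _)
      (+-cong (+-cong (trans (2* _) (*-congˡ (𝟏≈ p I))) (-‿cong (𝟏≈ (down p) I))) (-‿cong (𝟏≈ (right p) I))))

  -- The function `w` stands for twice the indicator; it is a variable because `B₂` of the root
  -- posets has the factor 2 inside the sum.
  weighted-second-difference : ∀ {w : Point → 𝓕} → (∀ p I → (1# + 1#) * 𝟏′ p I ≈ w p I) → ∀ {C C⁺ C⁻ : Pred Point 0ℓ} (C? : Decidable C) (C⁺? : Decidable C⁺) (C⁻? : Decidable C⁻) I →
    weighted (λ q → - (𝟙[ C⁺? q ] + 𝟙[ C⁻? q ] - (𝟙[ C? q ] + 𝟙[ C? q ]))) 𝟏 I
    ≈ sumOf w (filter C? P) I + - sumOf 𝟏′ (filter C⁺? P) I + - sumOf 𝟏′ (filter C⁻? P) I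
  weighted-second-difference {w} w≈ C? C⁺? C⁻? I = trans
    (∑-cong {xs = P} (λ {q} _ → trans
      (solve 4 (λ a b c u → (:- (a :+ b :- (c :+ c))) :* u := (c :* u :+ c :* u) :- a :* u :- b :* u) refl
        (𝟙[ C⁺? q ]) (𝟙[ C⁻? q ]) (𝟙[ C? q ]) (𝟏 q I))
      (+-congʳ (+-congʳ (2* _)))))
    (trans (trans (∑-- P _ (λ q → 𝟙[ C⁻? q ] * 𝟏 q I)) (+-congʳ (∑-- P (λ q → (1# + 1#) * (𝟙[ C? q ] * 𝟏 q I)) (λ q → 𝟙[ C⁺? q ] * 𝟏 q I))))
      (+-cong (+-cong (trans (∑-*ˡ P (1# + 1#) (λ q → 𝟙[ C? q ] * 𝟏 q I)) (trans (*-congˡ (weighted-𝟙 C? I)) double))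
        (-‿cong (weighted-𝟙 C⁺? I))) (-‿cong (weighted-𝟙 C⁻? I))))
    where
    double : (1# + 1#) * sumOf 𝟏′ (filter C? P) I ≈ sumOf w (filter C? P) I
    double = trans (*-congˡ (sumOf≈∑ 𝟏′ (filter C? P) I)) (trans (sym (∑-*ˡ (filter C? P) (1# + 1#) (λ p → 𝟏′ p I)))
      (trans (∑-cong {xs = filter C? P} (λ {p} _ → w≈ p I)) (sym (sumOf≈∑ w (filter C? P) I))))

-- Passing to the module of the statement

module Transfer
  (R : CommutativeRing 0ℓ 0ℓ)
  (φ : ℚ-Algebra R)
  (P : List Point) where

  open ToggleFunctions R φ P

  functionsOver : Module R 0ℓ 0ℓ
  functionsOver = functionSpace R (Toggleability.𝒥 P)

  one : Module.Carrierᴹ functionsOver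
  one _ = CommutativeRing.1# R

  -- The basis results are stated over a module `M` together with an equation to the function space,
  -- and matching on `≡.refl` identifies the two. For the reals, `M` is `Toggleability.functions P`.
  module _ {M : Module R 0ℓ 0ℓ} (eq : functionsOver ≡ M) where

    open Module M
    open LinearAlgebra M using (Span)

    I_Tᴹ : Carrierᴹ → (Point → Carrierᴹ) → (Point → Carrierᴹ) → Pred Carrierᴹ 0ℓ
    I_Tᴹ one′ 𝟏′ 𝒯′ = Span (map 𝟏′ P) ∩ Span (one′ ∷ map 𝒯′ P)

    sumᴹ : (Point → Carrierᴹ) → {C : Pred Point 0ℓ} → Decidable C → Carrierᴹ
    sumᴹ f C? = foldr _+ᴹ_ 0ᴹ (map f (filter C? P))

    record Agrees (one′ : Carrierᴹ) (𝟏′ 𝒯′ : Point → Carrierᴹ) : Set where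
      field
        one≈ : ≡.subst Module.Carrierᴹ eq one ≈ᴹ one′
        𝟏≈   : ∀ p → ≡.subst Module.Carrierᴹ eq (𝟏 p) ≈ᴹ 𝟏′ p
        𝒯≈   : ∀ p → ≡.subst Module.Carrierᴹ eq (𝒯 p) ≈ᴹ 𝒯′ p

-- The two bases for the rectangle

module RectanglePoset (m n : ℕ) where

  private
    M N : ℤ
    M = ℤ.+ suc m
    N = ℤ.+ suc n

  unique-poset : Unique (Rectangle.poset M N)
  unique-poset = Unique.cartesianProduct⁺ (unique-interval 1ℤ M) (unique-interval 1ℤ N)

  ∈⇒ : ∀ {i j} → (i , j) ∈ (Rectangle.poset M N) → InRegion M N (ℤ.- N) M 2ℤ i j
  ∈⇒ {i} {j} p∈P with ∈-cartesianProduct⁻ [ 1ℤ ⋯ M ] [ 1ℤ ⋯ N ] p∈P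
  ... | i∈ , j∈ with ∈-interval⁻ 1ℤ M i∈ | ∈-interval⁻ 1ℤ N j∈
  ...   | i≥ , i≤ | j≥ , j≤ = go M N i≥ i≤ j≥ j≤
    where
    go : ∀ m n → 1ℤ ℤ.≤ i → i ℤ.≤ m → 1ℤ ℤ.≤ j → j ℤ.≤ n → InRegion m n (ℤ.- n) m 2ℤ i j
    go m n i≥ i≤ j≥ j≤ = record
      { i≥ = i≥ ; i≤ = i≤ ; j≥ = j≥ ; j≤ = j≤
      ; k≥ = ≤-by (i≥ ⊞ j≤ ⊞ 0≤1) (ℤsolve (i ∷ j ∷ n ∷ []))
      ; k≤ = ≤-by (i≤ ⊞ j≥ ⊞ 0≤1) (ℤsolve (i ∷ j ∷ m ∷ []))
      ; s≤ = i≥ ⊞ j≥ }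

  ⇒∈ : ∀ {i j} → InRegion M N (ℤ.- N) M 2ℤ i j → (i , j) ∈ (Rectangle.poset M N)
  ⇒∈ p = ∈-cartesianProduct⁺ (∈-interval⁺ i≥ i≤) (∈-interval⁺ j≥ j≤)
    where open InRegion p

module RectangleTheorem
  (R : CommutativeRing 0ℓ 0ℓ)
  (φ : ℚ-Algebra R)
  (m n : ℕ) (P : List Point) (unique-P : Unique P)
  (∈⇒ : ∀ {i j} → (i , j) ∈ P → InRegion (ℤ.+ suc m) (ℤ.+ suc n) (ℤ.- (ℤ.+ suc n)) (ℤ.+ suc m) 2ℤ i j)
  (⇒∈ : ∀ {i j} → InRegion (ℤ.+ suc m) (ℤ.+ suc n) (ℤ.- (ℤ.+ suc n)) (ℤ.+ suc m) 2ℤ i j → (i , j) ∈ P) where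

  open CommutativeRing R hiding (zero)
  open OrderIdeals P using (𝒥)
  open LinearAlgebra using (IsBasis)

  private
    M N : ℤ
    M = ℤ.+ suc m
    N = ℤ.+ suc n

  open RectangleWeights R φ m n P unique-P ∈⇒ ⇒∈

  private
    diagonals : List ℤ
    diagonals = [ 1ℤ ℤ.- N ⋯ M ℤ.- 1ℤ ]

    unique-diagonals : Unique diagonals
    unique-diagonals = unique-interval (1ℤ ℤ.- N) (M ℤ.- 1ℤ)

    ∈-diagonals⁻ : ∀ {k} → k ∈ diagonals → ℤ.- N ℤ.+ 1ℤ ℤ.≤ k × k ℤ.+ 1ℤ ℤ.≤ M
    ∈-diagonals⁻ {k} k∈ = let k≥ , k≤ = ∈-interval⁻ (1ℤ ℤ.- N) (M ℤ.- 1ℤ) k∈ in go M N k≥ k≤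
      where
      go : ∀ m n → 1ℤ ℤ.- n ℤ.≤ k → k ℤ.≤ m ℤ.- 1ℤ → ℤ.- n ℤ.+ 1ℤ ℤ.≤ k × k ℤ.+ 1ℤ ℤ.≤ m
      go m n k≥ k≤ = ≤-by k≥ (ℤsolve (k ∷ n ∷ [])) , ≤-by k≤ (ℤsolve (k ∷ m ∷ []))

    ∈-diagonals⁺ : ∀ {k} → ℤ.- N ℤ.+ 1ℤ ℤ.≤ k → k ℤ.+ 1ℤ ℤ.≤ M → k ∈ diagonals
    ∈-diagonals⁺ {k} k≥ k≤ = let k≥′ , k≤′ = go M N k≥ k≤ in ∈-interval⁺ k≥′ k≤′
      where
      go : ∀ m n → ℤ.- n ℤ.+ 1ℤ ℤ.≤ k → k ℤ.+ 1ℤ ℤ.≤ m → 1ℤ ℤ.- n ℤ.≤ k × k ℤ.≤ m ℤ.- 1ℤ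
      go m n k≥ k≤ = ≤-by k≥ (ℤsolve (k ∷ n ∷ [])) , ≤-by k≤ (ℤsolve (k ∷ m ∷ []))

  open Transfer R φ P
  open Toggles R φ P isLatticeRegion using (module ToggleabilitySpace)
  open Families R φ 𝒥 using (lists-map)

  private
    nonzero : List ℤ
    nonzero = filter (λ k → ¬? (k ℤ.≟ 0ℤ)) diagonals

    -- The diagonal 0 comes last, following the order of `B₁`, in which it alone carries a constant.
    unique-labels : Unique (nonzero ++ 0ℤ ∷ [])
    unique-labels = Unique.++⁺ (Unique.filter⁺ (λ k → ¬? (k ℤ.≟ 0ℤ)) unique-diagonals) (All.[] AllPairs.∷ AllPairs.[])
      λ { (k∈ , here ≡.refl) → proj₂ (∈-filter⁻ (λ k → ¬? (k ℤ.≟ 0ℤ)) {xs = diagonals} k∈) ≡.refl }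

    0∈ : 0ℤ ∈ diagonals
    0∈ = let k≥ , k≤ = content-bounds 1∈ in ∈-diagonals⁺ k≥ k≤

    ∈-labels⁻ : ∀ {k} → k ∈ nonzero ++ 0ℤ ∷ [] → k ∈ diagonals
    ∈-labels⁻ k∈ with ∈-++⁻ nonzero k∈
    ... | inj₁ k∈′           = proj₁ (∈-filter⁻ (λ k → ¬? (k ℤ.≟ 0ℤ)) {xs = diagonals} k∈′)
    ... | inj₂ (here ≡.refl) = 0∈

    ∈-labels⁺ : ∀ {k} → k ∈ diagonals → k ∈ nonzero ++ 0ℤ ∷ []
    ∈-labels⁺ {k} k∈ with k ℤ.≟ 0ℤ
    ... | yes ≡.refl = ∈-++⁺ʳ nonzero (here ≡.refl)
    ... | no k≢0     = ∈-++⁺ˡ (∈-filter⁺ (λ k → ¬? (k ℤ.≟ 0ℤ)) k∈ k≢0)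

  B₂-basis : ∀ {M} (eq : functionsOver ≡ M) → let open Module M in
    ∀ {one′ 𝟏′ 𝒯′} → Agrees eq one′ 𝟏′ 𝒯′ →
    (v : ℤ → Carrierᴹ) → (∀ k → sumᴹ eq 𝟏′ (onDiagonal? k) ≈ᴹ v k) →
    IsBasis M (I_Tᴹ eq one′ 𝟏′ 𝒯′) (map v diagonals)
  B₂-basis ≡.refl {one′} {𝟏′} {𝒯′} agrees v v≈ =
    weightBasis⇒isBasis ℤ._≟_ unique-diagonals (𝟏-basis unique-diagonals ∈-diagonals⁻ ∈-diagonals⁺)
      (lists-map _ v diagonals (λ {k} _ I → trans (weighted-𝟙 (onDiagonal? k) I) (v≈ k I)))
    where
    open Agrees agrees
    open ToggleabilitySpace one′ 𝟏′ 𝒯′ one≈ 𝟏≈ 𝒯≈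
    open ClassSums R φ P isLatticeRegion one′ 𝟏′ 𝒯′ one≈ 𝟏≈ 𝒯≈

  -- A diagonal other than 0 avoids (1,1) and contains no minimal element; the diagonal 0 contains
  -- exactly that one.
  B₁-basis : ∀ {M} (eq : functionsOver ≡ M) → let open Module M in
    ∀ {one′ 𝟏′ 𝒯′} → Agrees eq one′ 𝟏′ 𝒯′ →
    (v : ℤ → Carrierᴹ) → (∀ k → sumᴹ eq 𝒯′ (onDiagonal? k) ≈ᴹ v k) →
    (v₀ : Carrierᴹ) → -ᴹ one′ +ᴹ sumᴹ eq 𝒯′ (onDiagonal? 0ℤ) ≈ᴹ v₀ →
    IsBasis M (I_Tᴹ eq one′ 𝟏′ 𝒯′) (map v nonzero ++ v₀ ∷ [])
  B₁-basis ≡.refl {one′} {𝟏′} {𝒯′} agrees v v≈ v₀ v₀≈ = weightBasis⇒isBasis ℤ._≟_ unique-labels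
      (𝒯-basis unique-labels (λ k∈ → ∈-diagonals⁻ (∈-labels⁻ k∈)) (λ k≥ k≤ → ∈-labels⁺ (∈-diagonals⁺ k≥ k≤)))
      (++⁺ (lists-map _ v nonzero (λ {k} k∈ I → trans (𝒰-sum (onDiagonal? k) (χᵈ-admissible k)
             (minimals-0 (onDiagonal? k) (λ p∈P c → nonminimal p∈P
               (λ { ≡.refl → proj₂ (∈-filter⁻ (λ k → ¬? (k ℤ.≟ 0ℤ)) {xs = diagonals} k∈) (≡.sym c) }))) I) (v≈ k I)))
           ((λ I → trans (𝒰-sum-1 (onDiagonal? 0ℤ) (χᵈ-admissible 0ℤ)
             (minimals-1 (onDiagonal? 0ℤ) 1∈ ≡.refl left-1∉ down-1∉ (λ p∈P _ → nonminimal p∈P)) I) (v₀≈ I))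
            Pointwise.∷ Pointwise.[]))
    where
    open Agrees agrees
    open ToggleabilitySpace one′ 𝟏′ 𝒯′ one≈ 𝟏≈ 𝒯≈
    open ClassSums R φ P isLatticeRegion one′ 𝟏′ 𝒯′ one≈ 𝟏≈ 𝒯≈

-- The Laplacian on the shifted staircase

pred-suc-≡ : ∀ {k l} → k ℤ.- 1ℤ ≡ l → k ≡ l ℤ.+ 1ℤ
pred-suc-≡ {k} eq = ≡.trans (≡.sym (i-1+1≡i k)) (≡.cong (ℤ._+ 1ℤ) eq)

suc-pred-≡ : ∀ {k l} → k ℤ.+ 1ℤ ≡ l → k ≡ l ℤ.- 1ℤ
suc-pred-≡ {k} eq = ≡.trans (≡.sym (i+1-1≡i k)) (≡.cong (ℤ._- 1ℤ) eq)

-- The Laplacian has a different form on the main diagonal, next to it, and further away.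
≤0-cases : ∀ k → k ℤ.≤ 0ℤ → k ℤ.+ 1ℤ ℤ.+ 1ℤ ℤ.≤ 0ℤ ⊎ k ℤ.+ 1ℤ ≡ 0ℤ ⊎ k ≡ 0ℤ
≤0-cases k k≤0 with k ℤ.≟ 0ℤ | k ℤ.+ 1ℤ ℤ.≟ 0ℤ
... | yes eq | _      = inj₂ (inj₂ eq)
... | no _   | yes eq = inj₂ (inj₁ eq)
... | no k≢0 | no k≢-1 = inj₁ (<⇒+1≤ (ℤ.≤∧≢⇒< (<⇒+1≤ (ℤ.≤∧≢⇒< k≤0 k≢0)) k≢-1))

module ShiftedWeights
  (R : CommutativeRing 0ℓ 0ℓ)
  (φ : ℚ-Algebra R)
  (n : ℕ) (P : List Point) (unique : Unique P)
  (∈⇒ : ∀ {i j} → (i , j) ∈ P → InRegion (ℤ.+ suc (suc n)) (ℤ.+ suc (suc n)) (ℤ.- (ℤ.+ suc (suc n))) 0ℤ 2ℤ i j)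
  (⇒∈ : ∀ {i j} → InRegion (ℤ.+ suc (suc n)) (ℤ.+ suc (suc n)) (ℤ.- (ℤ.+ suc (suc n))) 0ℤ 2ℤ i j → (i , j) ∈ P) where

  private
    N : ℤ
    N = ℤ.+ suc (suc n)

    1≤N : 1ℤ ℤ.≤ N
    1≤N = +≤+ (ℕ.s≤s z≤n)

    nonempty : ∀ n → 1ℤ ℤ.≤ n → ℤ.- n ℤ.+ 1ℤ ℤ.≤ 0ℤ
    nonempty n 1≤n = ≤-by 1≤n (ℤsolve (n ∷ []))

  open CornerRegion R φ N N 0ℤ P 0≤+ (nonempty N 1≤N) unique ∈⇒ ⇒∈ 1≤N 1≤N ℤ.≤-refl public
  open CommutativeRing R hiding (zero)
  open Sums R φ
  open Solver using (solve; _:+_; _:*_; _:-_; :-_; con; _:=_)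
  open Toggles R φ P isLatticeRegion
  open Harmonic R φ

  content≤0 : ∀ {q} → q ∈ P → content q ℤ.≤ 0ℤ
  content≤0 q∈P = InRegion.k≤ (∈⇒ q∈P)

  content>0⇒∉ : ∀ {p} → content p ≡ 1ℤ → p ∉ P
  content>0⇒∉ eq p∈P = ≤-absurd {k = 0} (≡.subst (ℤ._≤ 0ℤ) eq (content≤0 p∈P)) ≡.refl

  cases : ∀ {q} → q ∈ P → content q ℤ.+ 1ℤ ℤ.+ 1ℤ ℤ.≤ 0ℤ ⊎ content q ℤ.+ 1ℤ ≡ 0ℤ ⊎ content q ≡ 0ℤ
  cases {q} q∈P = ≤0-cases (content q) (content≤0 q∈P)

  right∉ : ∀ {q} → content q ≡ 0ℤ → right q ∉ P
  right∉ {i , j} eq = content>0⇒∉ (≡.trans (i+1-j i j) (≡.cong (ℤ._+ 1ℤ) eq))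

  down∉ : ∀ {q} → content q ≡ 0ℤ → down q ∉ P
  down∉ {i , j} eq = content>0⇒∉ (≡.trans (i-[j-1] i j) (≡.cong (ℤ._+ 1ℤ) eq))

  half : Carrier
  half = φ.⟦ ℚ.½ ⟧

  x+x≈0⇒x≈0 : ∀ {x} → x + x ≈ 0# → x ≈ 0#
  x+x≈0⇒x≈0 {x} eq = trans (solve 1 (λ x → x := con ℚ.½ :* (x :+ x)) refl x) (trans (*-congˡ eq) (zeroʳ half))

  module _ {d : Point → Carrier} (adm : IsAdmissible d) where

    open IsAdmissible adm

    lapᵈ-main : ∀ {q} → q ∈ P → content q ≡ 0ℤ → lapᵈ d q ≈ 0#
    lapᵈ-main {q} q∈P eq = trans (+-cong (support (down∉ {q} eq)) (trans (*-congʳ (support (right∉ {q} eq))) (zeroˡ _))) (+-identityˡ 0#)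

    lap-main : ∀ {q} → q ∈ P → content q ≡ 0ℤ → lap d q ≈ d (corner-rep ℤ.-1ℤ) - (d q + d q)
    lap-main {q} q∈P eq = +-congʳ (trans (+-cong (trans (lapˡ-formula adm q∈P)
      (reflexive (≡.cong (λ k → d (corner-rep (k ℤ.- 1ℤ))) eq))) (lapᵈ-main q∈P eq)) (+-identityʳ _))

    -- Here `down q` and `right q` are two different points of the main diagonal with unrelated
    -- values. Both contribute, because `down (right q)` lies outside the staircase and its `ν` is
    -- 1.
    lap-next : ∀ {q} → q ∈ P → content q ℤ.+ 1ℤ ≡ 0ℤ →
               lap d q ≈ d (corner-rep (ℤ.- 2ℤ)) + (d (down q) + d (right q)) - (d (corner-rep ℤ.-1ℤ) + d (corner-rep ℤ.-1ℤ))
    lap-next {q} q∈P eq = +-cong (+-cong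
        (trans (lapˡ-formula adm q∈P) (reflexive (≡.cong (λ k → d (corner-rep (k ℤ.- 1ℤ))) eq′)))
        (+-congˡ (trans (*-congˡ (ν-∉ (down∉ {right q} (≡.trans (i+1-j (proj₁ q) (proj₂ q)) eq)))) (*-identityʳ _))))
      (-‿cong (+-cong value value))
      where
      eq′ : content q ≡ ℤ.-1ℤ
      eq′ = suc-pred-≡ eq
      value : d q ≈ d (corner-rep ℤ.-1ℤ)
      value = diagonal-value adm q∈P eq′ (ℤ.≤-refl {0ℤ})

    lap-far : ∀ {q} → q ∈ P → content q ℤ.+ 1ℤ ℤ.+ 1ℤ ℤ.≤ 0ℤ →
              lap d q ≈ d (corner-rep (content q ℤ.- 1ℤ)) + d (corner-rep (content q ℤ.+ 1ℤ))
                        - (d (corner-rep (content q)) + d (corner-rep (content q)))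
    lap-far {q} q∈P k≤ = +-cong (+-cong (lapˡ-formula adm q∈P) (lapᵈ-formula adm q∈P k≤)) (-‿cong (+-cong value value))
      where
      value : d q ≈ d (corner-rep (content q))
      value = diagonal-rep adm q∈P (ℤ.≤-trans (i≤i+1 (content q ℤ.+ 1ℤ)) k≤)

  main∈ : ∀ {i} → 1ℤ ℤ.≤ i → i ℤ.≤ N → (i , i) ∈ P
  main∈ {i} 1≤i i≤N = ⇒∈ (go N 1≤N 1≤i i≤N)
    where
    go : ∀ n → 1ℤ ℤ.≤ n → 1ℤ ℤ.≤ i → i ℤ.≤ n → InRegion n n (ℤ.- n) 0ℤ 2ℤ i i
    go n 1≤n 1≤i i≤n = record
      { i≥ = 1≤i ; i≤ = i≤n ; j≥ = 1≤i ; j≤ = i≤n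
      ; k≥ = ≤-by (1≤n ⊞ 0≤1) (ℤsolve (i ∷ n ∷ []))
      ; k≤ = ℤ.≤-reflexive (ℤ.+-inverseʳ i)
      ; s≤ = 1≤i ⊞ 1≤i }

  second∈ : (1ℤ , 2ℤ) ∈ P
  second∈ = ⇒∈ record
    { i≥ = ℤ.≤-refl ; i≤ = 1≤N ; j≥ = +≤+ (ℕ.s≤s z≤n) ; j≤ = +≤+ (ℕ.s≤s (ℕ.s≤s z≤n))
    ; k≥ = ℤ.-≤- z≤n ; k≤ = ℤ.-≤+ ; s≤ = +≤+ (ℕ.s≤s (ℕ.s≤s z≤n)) }

  diagonal : ℕ → ℤ
  diagonal t = ℤ.+ t ℤ.- N

  interior : ∀ t → suc (suc t) ≤ suc n →
             ℤ.- N ℤ.+ 1ℤ ℤ.≤ diagonal (suc t) × diagonal (suc t) ℤ.+ 1ℤ ℤ.+ 1ℤ ℤ.≤ 0ℤ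
  interior t t≤ = index≥ N (ℤ.+ t) 0≤+ , go (ℤ.+ suc n) (ℤ.+ t) (+≤+ t≤)
    where
    go : ∀ n t → 1ℤ ℤ.+ (1ℤ ℤ.+ t) ℤ.≤ n → 1ℤ ℤ.+ t ℤ.- (1ℤ ℤ.+ n) ℤ.+ 1ℤ ℤ.+ 1ℤ ℤ.≤ 0ℤ
    go n t h = ≤-by h (ℤsolve (n ∷ t ∷ []))

  interior′ : ∀ t → suc (suc t) ≤ suc n → diagonal (suc t) ℤ.+ 1ℤ ℤ.≤ 0ℤ
  interior′ t t≤ = ℤ.≤-trans (i≤i+1 _) (proj₂ (interior t t≤))

  diagonal-last : diagonal (suc n) ≡ ℤ.-1ℤ
  diagonal-last = go (ℤ.+ suc n)
    where
    go : ∀ n → n ℤ.- (1ℤ ℤ.+ n) ≡ ℤ.-1ℤ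
    go n = ℤsolve (n ∷ [])

  diagonal-penultimate : diagonal n ≡ ℤ.- 2ℤ
  diagonal-penultimate = go (ℤ.+ n)
    where
    go : ∀ n → n ℤ.- (1ℤ ℤ.+ (1ℤ ℤ.+ n)) ≡ ℤ.- 2ℤ
    go n = ℤsolve (n ∷ [])

  diagonal-index : ∀ {k} → ℤ.- N ℤ.+ 1ℤ ℤ.≤ k → k ℤ.+ 1ℤ ℤ.≤ 0ℤ → Σ ℕ λ t → t ≤ suc n × k ≡ diagonal t
  diagonal-index k≥ k≤ = let t , t≤ , eq = index 0 (suc (suc n)) k≥ k≤ in t , ℕ.s≤s⁻¹ t≤ , eq

  first∉ : ∀ {k} → ℤ.- N ℤ.+ 1ℤ ℤ.≤ k → k ≢ diagonal 0
  first∉ = go N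
    where
    go : ∀ n {k} → ℤ.- n ℤ.+ 1ℤ ℤ.≤ k → k ≢ 0ℤ ℤ.- n
    go n h ≡.refl = ≤-absurd {k = 0} h (ℤsolve (n ∷ []))

  -1≥ : ℤ.- N ℤ.+ 1ℤ ℤ.≤ ℤ.-1ℤ
  -1≥ = go (ℤ.+ n) 0≤+
    where
    go : ∀ n → 0ℤ ℤ.≤ n → ℤ.- (1ℤ ℤ.+ (1ℤ ℤ.+ n)) ℤ.+ 1ℤ ℤ.≤ ℤ.-1ℤ
    go n h = ≤-by h (ℤsolve (n ∷ []))

  module _ {d : Point → Carrier} (adm : IsAdmissible d) (lap≈0 : ∀ {q} → q ∈ P → lap d q ≈ 0#) where

    private
      e : ℤ → Carrier
      e k = d (corner-rep k)

      main-double : ∀ {i} → (i , i) ∈ P → d (i , i) + d (i , i) ≈ e ℤ.-1ℤ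
      main-double {i} i∈P = trans (solve 2 (λ x y → y :+ y := x :- (x :- (y :+ y))) refl (e ℤ.-1ℤ) (d (i , i)))
        (trans (+-congˡ (-‿cong (trans (sym (lap-main adm i∈P (content-main i))) (lap≈0 i∈P)))) (x-0≈x _))

      s : ℕ → ⊤ → Carrier
      s t _ = e (diagonal t)

      value : ∀ {k l} → k ≡ l → e k ≈ e l
      value eq = reflexive (≡.cong e eq)

      step : ∀ t → suc (suc t) ≤ suc n → ∀ a → s (suc (suc t)) a - (s (suc t) a + s (suc t) a) + s t a ≈ 0#
      step t t≤ a = trans (solve 3 (λ x y z → z :- (y :+ y) :+ x := x :+ z :- (y :+ y)) refl _ _ _)
        (trans (sym (trans (lap-far adm rep∈ (≡.subst (λ k → k ℤ.+ 1ℤ ℤ.+ 1ℤ ℤ.≤ 0ℤ) (≡.sym k≡) (proj₂ (interior t t≤))))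
          (+-cong (+-cong
            (value (≡.trans (≡.cong (ℤ._- 1ℤ) k≡) (index-pred N (ℤ.+ t))))
            (value (≡.trans (≡.cong (ℤ._+ 1ℤ) k≡) (index-suc N (ℤ.+ t)))))
          (-‿cong (+-cong (value k≡) (value k≡)))))) (lap≈0 rep∈))
        where
        k = diagonal (suc t)
        rep∈ : corner-rep k ∈ P
        rep∈ = corner-rep∈ k (proj₁ (interior t t≤)) (interior′ t t≤)
        k≡ : content (corner-rep k) ≡ k
        k≡ = content-corner-rep k

      -- The equations at (1,1) and (2,2) make `d` there half of its value on the diagonal -1.
      -- Substituted into the equation at (1,2), this leaves equal values on the diagonals -1 and
      -- -2, which is the Neumann condition.
      end : ∀ a → s (suc n) a - s n a ≈ 0#
      end a = trans (+-cong (value diagonal-last) (-‿cong (value diagonal-penultimate))) (trans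
        (solve 4 (λ a b x y → a :- b := ((x :+ x :- a) :+ (y :+ y :- a)) :* con ℚ.½ :- (b :+ (x :+ y) :- (a :+ a))) refl
          (e ℤ.-1ℤ) (e (ℤ.- 2ℤ)) (d (1ℤ , 1ℤ)) (d (2ℤ , 2ℤ)))
        (trans (+-cong (trans (*-congʳ (trans (+-cong
            (trans (+-congʳ (main-double 1∈)) (-‿inverseʳ _))
            (trans (+-congʳ (main-double (main∈ {2ℤ} (+≤+ (ℕ.s≤s z≤n)) (+≤+ (ℕ.s≤s (ℕ.s≤s z≤n)))))) (-‿inverseʳ _)))
            (+-identityˡ 0#))) (zeroˡ _))
          (-‿cong (trans (sym (lap-next adm second∈ ≡.refl)) (lap≈0 second∈)))) (x-0≈x 0#)))

    off-diagonal-0 : ∀ {k} → ℤ.- N ℤ.+ 1ℤ ℤ.≤ k → k ℤ.+ 1ℤ ℤ.≤ 0ℤ → e k ≈ 0#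
    off-diagonal-0 k≥ k≤ = let t , t≤ , eq = diagonal-index k≥ k≤ in trans (value eq)
      (neumann 0-isSubspace s n (λ _ → outside adm (diagonal 0) (λ (h , _) → first∉ h ≡.refl)) step end t t≤ tt)

    injective : ∀ {p} → p ∈ P → d p ≈ 0#
    injective {p} p∈P = go (content p ℤ.≟ 0ℤ)
      where
      go : Dec (content p ≡ 0ℤ) → d p ≈ 0#
      go (yes eq) = trans (reflexive (≡.cong d (main≡ eq))) (x+x≈0⇒x≈0 (trans
        (main-double (≡.subst (_∈ P) (main≡ eq) p∈P)) (off-diagonal-0 -1≥ (ℤ.≤-refl {0ℤ}))))
      go (no k≢0) = let k< = <⇒+1≤ (ℤ.≤∧≢⇒< (content≤0 p∈P) k≢0) in
        trans (diagonal-rep adm p∈P k<) (off-diagonal-0 (proj₁ (content-bounds p∈P)) k<)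

  lap-χᵈ : ∀ {k} → ℤ.- N ℤ.+ 1ℤ ℤ.≤ k → k ℤ.+ 1ℤ ℤ.≤ 0ℤ → ∀ {q} → q ∈ P →
           lap (χᵈ k) q ≈ 𝟙[ content q ℤ.≟ k ℤ.+ 1ℤ ] + 𝟙[ content q ℤ.≟ k ℤ.- 1ℤ ]
                          - (𝟙[ content q ℤ.≟ k ] + 𝟙[ content q ℤ.≟ k ])
  lap-χᵈ {k} k≥ k≤ {q} q∈P = +-cong (+-cong
      (trans (lapˡ-formula (χᵈ-admissible k) q∈P) (trans (χᵈ-rep k _ k≥ k≤)
        (𝟙-⇔ (content q ℤ.- 1ℤ ℤ.≟ k) (content q ℤ.≟ k ℤ.+ 1ℤ) pred-suc-≡ (λ { eq → ≡.trans (≡.cong (ℤ._- 1ℤ) eq) (i+1-1≡i k) }))))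
      (upper (cases q∈P)))
    (-‿cong (+-cong (χᵈ-content q∈P) (χᵈ-content q∈P)))
    where
    upper : content q ℤ.+ 1ℤ ℤ.+ 1ℤ ℤ.≤ 0ℤ ⊎ content q ℤ.+ 1ℤ ≡ 0ℤ ⊎ content q ≡ 0ℤ →
            lapᵈ (χᵈ k) q ≈ 𝟙[ content q ℤ.≟ k ℤ.- 1ℤ ]
    upper (inj₁ far) = trans (lapᵈ-formula (χᵈ-admissible k) q∈P far) (trans (χᵈ-rep k _ k≥ k≤)
      (𝟙-⇔ (content q ℤ.+ 1ℤ ℤ.≟ k) (content q ℤ.≟ k ℤ.- 1ℤ) suc-pred-≡ (λ { eq → ≡.trans (≡.cong (ℤ._+ 1ℤ) eq) (i-1+1≡i k) })))
    upper (inj₂ (inj₁ next)) = trans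
      (trans (+-cong (off (down q) (≡.trans (i-[j-1] (proj₁ q) (proj₂ q)) next)) (trans (*-congʳ (off (right q) (≡.trans (i+1-j (proj₁ q) (proj₂ q)) next))) (zeroˡ _)))
        (+-identityˡ 0#))
      (sym (𝟙-false (content q ℤ.≟ k ℤ.- 1ℤ) (λ eq → ≤-absurd {k = 0} k≤
        (≡.trans (≡.cong (λ z → 0ℤ ℤ.- z) (≡.cong (ℤ._+ 1ℤ) (pred-suc-≡ {k} {content q} (≡.sym eq)))) (≡.cong (λ z → 0ℤ ℤ.- (z ℤ.+ 1ℤ)) next)))))
      where
      off : ∀ p → content p ≡ 0ℤ → χᵈ k p ≈ 0#
      off p eq = 𝟙-false ((p ∈? P) ×-dec onDiagonal? k p) (λ (_ , c) →
        ≤-absurd {k = 0} k≤ (≡.cong (λ z → 0ℤ ℤ.- (z ℤ.+ 1ℤ)) (≡.trans (≡.sym c) eq)))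
    upper (inj₂ (inj₂ main)) = trans (lapᵈ-main (χᵈ-admissible k) q∈P main)
      (sym (𝟙-false (content q ℤ.≟ k ℤ.- 1ℤ) (λ eq → ≤-absurd {k = 1} k≤
        (≡.trans (≡.cong (λ z → 0ℤ ℤ.- z) (≡.cong (ℤ._+ 1ℤ) (pred-suc-≡ {k} {content q} (≡.sym eq)))) (≡.cong (λ z → 0ℤ ℤ.- (z ℤ.+ 1ℤ ℤ.+ 1ℤ)) main)))))

  neighbours : ∀ {q} → q ∈ P → content q ℤ.+ 1ℤ ≡ 0ℤ → down q ∈ P × right q ∈ P
  neighbours {q} q∈P next =
    let 2≤j , i+1≤ , sum≥ = steps (proj₁ q) (proj₂ q) N i≥ j≤ next
    in down∈ q∈P 2≤j next≤ sum≥ , right∈ q∈P i+1≤ next≤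
    where
    open InRegion (∈⇒ q∈P)
    next≤ : content q ℤ.+ 1ℤ ℤ.≤ 0ℤ
    next≤ = ℤ.≤-reflexive next
    steps : ∀ i j n → 1ℤ ℤ.≤ i → j ℤ.≤ n → i ℤ.- j ℤ.+ 1ℤ ≡ 0ℤ → 2ℤ ℤ.≤ j × i ℤ.+ 1ℤ ℤ.≤ n × 2ℤ ℤ.+ 1ℤ ℤ.≤ i ℤ.+ j
    steps i j n i≥ j≤ eq = ≤-by (i≥ ⊞ h) (ℤsolve (i ∷ j ∷ [])) , ≤-by (j≤ ⊞ h) (ℤsolve (i ∷ j ∷ n ∷ [])) ,
        ≤-by (i≥ ⊞ i≥ ⊞ h) (ℤsolve (i ∷ j ∷ []))
      where
      h : i ℤ.- j ℤ.+ 1ℤ ℤ.≤ 0ℤ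
      h = ℤ.≤-reflexive eq

  -- The main diagonal carries 2 (S₋₁ - S₀), which supplies the Neumann boundary condition.
  lap-χᵈ-main : ∀ {q} → q ∈ P → lap (χᵈ 0ℤ) q ≈ (𝟙[ content q ℤ.≟ ℤ.-1ℤ ] + 𝟙[ content q ℤ.≟ ℤ.-1ℤ ])
                                               - (𝟙[ content q ℤ.≟ 0ℤ ] + 𝟙[ content q ℤ.≟ 0ℤ ])
  lap-χᵈ-main {q} q∈P = +-cong (go (cases q∈P)) (-‿cong (+-cong (χᵈ-content q∈P) (χᵈ-content q∈P)))
    where
    adm = χᵈ-admissible 0ℤ
    rep-0 : ∀ k → k ℤ.+ 1ℤ ℤ.≤ 0ℤ → χᵈ 0ℤ (corner-rep k) ≈ 0#
    rep-0 k k≤ = 𝟙-false ((corner-rep k ∈? P) ×-dec onDiagonal? 0ℤ (corner-rep k)) (λ (_ , c) →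
      ≤-absurd {k = 0} k≤ (≡.cong (λ z → 0ℤ ℤ.- (z ℤ.+ 1ℤ)) (≡.trans (≡.sym (content-corner-rep k)) c)))
    lower : lapˡ (χᵈ 0ℤ) q ≈ 0#
    lower = trans (lapˡ-formula adm q∈P) (rep-0 _ (≡.subst (ℤ._≤ 0ℤ) (≡.sym (i-1+1≡i (content q))) (content≤0 q∈P)))
    ¬-1 : content q ≢ ℤ.-1ℤ → 𝟙[ content q ℤ.≟ ℤ.-1ℤ ] + 𝟙[ content q ℤ.≟ ℤ.-1ℤ ] ≈ 0#
    ¬-1 h = trans (+-cong (𝟙-false (content q ℤ.≟ ℤ.-1ℤ) h) (𝟙-false (content q ℤ.≟ ℤ.-1ℤ) h)) (+-identityˡ 0#)
    go : content q ℤ.+ 1ℤ ℤ.+ 1ℤ ℤ.≤ 0ℤ ⊎ content q ℤ.+ 1ℤ ≡ 0ℤ ⊎ content q ≡ 0ℤ →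
         lapˡ (χᵈ 0ℤ) q + lapᵈ (χᵈ 0ℤ) q ≈ 𝟙[ content q ℤ.≟ ℤ.-1ℤ ] + 𝟙[ content q ℤ.≟ ℤ.-1ℤ ]
    go (inj₁ far) = trans (+-cong lower (trans (lapᵈ-formula adm q∈P far) (rep-0 _ far)))
      (trans (+-identityˡ 0#) (sym (¬-1 (λ eq → ≤-absurd {k = 0} far (≡.cong (λ z → 0ℤ ℤ.- (z ℤ.+ 1ℤ ℤ.+ 1ℤ)) eq)))))
    go (inj₂ (inj₂ main)) = trans (+-cong lower (lapᵈ-main adm q∈P main))
      (trans (+-identityˡ 0#) (sym (¬-1 (λ eq → contradiction (≡.trans (≡.sym eq) main) λ ()))))
    go (inj₂ (inj₁ next)) = trans (+-cong lower (+-cong (on (down q) d∈ (≡.trans (i-[j-1] (proj₁ q) (proj₂ q)) next))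
        (trans (*-cong (on (right q) r∈ (≡.trans (i+1-j (proj₁ q) (proj₂ q)) next))
          (ν-∉ (down∉ {right q} (≡.trans (i+1-j (proj₁ q) (proj₂ q)) next)))) (*-identityʳ 1#))))
      (trans (+-identityˡ _) (sym (+-cong (𝟙-true (content q ℤ.≟ ℤ.-1ℤ) (suc-pred-≡ next)) (𝟙-true (content q ℤ.≟ ℤ.-1ℤ) (suc-pred-≡ next)))))
      where
      on : ∀ p → p ∈ P → content p ≡ 0ℤ → χᵈ 0ℤ p ≈ 1#
      on p p∈P c = 𝟙-true ((p ∈? P) ×-dec onDiagonal? 0ℤ p) (p∈P , c)
      d∈ = proj₁ (neighbours q∈P next)
      r∈ = proj₂ (neighbours q∈P next)

  -- As for the rectangle, with a Neumann condition at the end of the path: the difference of the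
  -- last two off-diagonal indicators is itself a Laplacian.
  ∑ᵈ-laplacian : ∀ {k} → ℤ.- N ℤ.+ 1ℤ ℤ.≤ k → k ℤ.+ 1ℤ ℤ.≤ 0ℤ → Laplacian (λ q → 𝟙[ content q ℤ.≟ k ])
  ∑ᵈ-laplacian {k} k≥ k≤ = let t , t≤ , eq = diagonal-index k≥ k≤ in
    ≡.subst (λ k → Laplacian (λ q → 𝟙[ content q ℤ.≟ k ])) (≡.sym eq)
      (neumann laplacian-isSubspace s n
        (0-laplacian (λ {q} q∈P → 𝟙-false (content q ℤ.≟ diagonal 0) (first∉ {content q} (proj₁ (content-bounds q∈P)))))
        step end t t≤)
    where
    open IsSubspace laplacian-isSubspace
    s : ℕ → Point → Carrier
    s t q = 𝟙[ content q ℤ.≟ diagonal t ]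

    same : ∀ {k l} q → k ≡ l → 𝟙[ content q ℤ.≟ k ] ≈ 𝟙[ content q ℤ.≟ l ]
    same q ≡.refl = refl

    step : ∀ t → suc (suc t) ≤ suc n → Laplacian (λ a → s (suc (suc t)) a - (s (suc t) a + s (suc t) a) + s t a)
    step t t≤ = χᵈ (diagonal (suc t)) , χᵈ-admissible (diagonal (suc t)) , λ {q} q∈P →
      trans (lap-χᵈ (proj₁ (interior t t≤)) (interior′ t t≤) q∈P)
        (trans (+-congʳ (+-cong (same q (index-suc N (ℤ.+ t))) (same q (index-pred N (ℤ.+ t)))))
          (solve 3 (λ z x y → z :+ x :- (y :+ y) := z :- (y :+ y) :+ x) refl _ _ _))

    end : Laplacian (λ a → s (suc n) a - s n a)
    -- With S for the diagonal indicators, the two Laplacians at hand are 2(S₋₁ - S₀) and S₀ + S₋₂ -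
    -- 2S₋₁. Adding them with coefficients -½ and -1 cancels S₀ and leaves S₋₁ - S₋₂. The multiple
    -- by 0 only closes the combination.
    end = resp (λ q → trans
        (solve 3 (λ x y z → con (ℚ.- ℚ.½) :* ((x :+ x) :- (y :+ y))
            :+ (con (ℚ.- ℚ.1ℚ) :* (y :+ z :- (x :+ x)) :+ con ℚ.0ℚ :* (y :+ z :- (x :+ x))) := x :- z) refl _ _ _)
        (+-cong (same q (≡.sym diagonal-last)) (-‿cong (same q (≡.sym diagonal-penultimate)))))
      (+* φ.⟦ ℚ.- ℚ.½ ⟧ (χᵈ 0ℤ , χᵈ-admissible 0ℤ , lap-χᵈ-main)
        (+* φ.⟦ ℚ.- 1ℚ ⟧ near (resp (λ q → *-congʳ refl) (+*0 near))))
      where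
      near : Laplacian (λ q → 𝟙[ content q ℤ.≟ 0ℤ ] + 𝟙[ content q ℤ.≟ ℤ.- 2ℤ ] - (𝟙[ content q ℤ.≟ ℤ.-1ℤ ] + 𝟙[ content q ℤ.≟ ℤ.-1ℤ ]))
      near = χᵈ ℤ.-1ℤ , χᵈ-admissible ℤ.-1ℤ , lap-χᵈ -1≥ (ℤ.≤-refl {0ℤ})
      +*0 : ∀ {f} → Laplacian f → Laplacian (λ q → φ.⟦ 0ℚ ⟧ * f q)
      +*0 {f} L = 0-laplacian (λ _ → trans (*-congʳ φ.0-homo) (zeroˡ _))

  Label : ℤ ⊎ ℤ → Set
  Label (inj₁ k) = ℤ.- N ℤ.+ 1ℤ ℤ.≤ k × k ℤ.+ 1ℤ ℤ.≤ 0ℤ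
  Label (inj₂ i) = 1ℤ ℤ.≤ i × i ℤ.≤ N

  -- A point of the main diagonal has no lower neighbour `down` in P, so admissibility does not
  -- relate it to other points and it forms a class of its own.
  ShiftedClass : ℤ ⊎ ℤ → Pred Point 0ℓ
  ShiftedClass (inj₁ k) p = content p ≡ k
  ShiftedClass (inj₂ i) p = p ≡ (i , i)

  shiftedClass? : ∀ x → Decidable (ShiftedClass x)
  shiftedClass? (inj₁ k) = onDiagonal? k
  shiftedClass? (inj₂ i) = _≟ (i , i)

  shiftedRep : ℤ ⊎ ℤ → Point
  shiftedRep (inj₁ k) = corner-rep k
  shiftedRep (inj₂ i) = i , i

  χᵐ-admissible : ∀ i → IsAdmissible (λ p → 𝟙[ (p ∈? P) ×-dec (p ≟ (i , i)) ])
  χᵐ-admissible i = χ-admissible (_≟ (i , i)) λ {p} l d →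
      (λ { ≡.refl → contradiction d (down∉ {p} (content-main i)) })
    , (λ eq → contradiction d (down∉ {p} (≡.trans (≡.sym (content-diag⁻ p)) (≡.trans (≡.cong content eq) (content-main i)))))

  module _ {xs : List (ℤ ⊎ ℤ)} (unique-xs : Unique xs)
           (∈xs⇒ : ∀ {x} → x ∈ xs → Label x) (⇒∈xs : ∀ {x} → Label x → x ∈ xs) where

    off∈ : ∀ {p} → p ∈ P → content p ℤ.+ 1ℤ ℤ.≤ 0ℤ → inj₁ (content p) ∈ xs
    off∈ p∈P k≤ = ⇒∈xs {inj₁ _} (proj₁ (content-bounds p∈P) , k≤)

    on∈ : ∀ {i} → (i , i) ∈ P → inj₂ i ∈ xs
    on∈ {i} i∈P = ⇒∈xs {inj₂ i} (InRegion.i≥ (∈⇒ i∈P) , InRegion.i≤ (∈⇒ i∈P))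

    classes : Classes (ℤ ⊎ ℤ) xs
    classes = record
      { unique-xs  = unique-xs
      ; Class      = ShiftedClass
      ; class?     = shiftedClass?
      ; disjoint   = λ {x} {y} → disjoint {x} {y}
      ; rep        = shiftedRep
      ; rep∈P      = λ {x} → rep∈ {x}
      ; rep∈Class  = λ {x} → rep∈Class {x}
      ; admissible = λ {x} → admissible {x}
      ; classify   = λ {p} p∈P → inj₁ (classify p∈P)
      }
      where
      off≢main : ∀ {k i} → inj₁ k ∈ xs → content (i , i) ≢ k
      off≢main {k} {i} m eq = ≤-absurd {k = 0} (proj₂ (∈xs⇒ m))
        (≡.cong (λ z → 0ℤ ℤ.- (z ℤ.+ 1ℤ)) (≡.trans (≡.sym eq) (content-main i)))

      disjoint : ∀ {x y p} → x ∈ xs → y ∈ xs → ShiftedClass x p → ShiftedClass y p → x ≡ y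
      disjoint {inj₁ _} {inj₁ _} _ _ c c′ = ≡.cong inj₁ (≡.trans (≡.sym c) c′)
      disjoint {inj₁ _} {inj₂ i} m _ c ≡.refl = contradiction c (off≢main {i = i} m)
      disjoint {inj₂ i} {inj₁ _} _ m ≡.refl c = contradiction c (off≢main {i = i} m)
      disjoint {inj₂ _} {inj₂ _} _ _ c c′ = ≡.cong (λ p → inj₂ (proj₁ p)) (≡.trans (≡.sym c) c′)

      rep∈ : ∀ {x} → x ∈ xs → shiftedRep x ∈ P
      rep∈ {inj₁ k} m = corner-rep∈ k (proj₁ (∈xs⇒ m)) (proj₂ (∈xs⇒ m))
      rep∈ {inj₂ i} m = main∈ (proj₁ (∈xs⇒ m)) (proj₂ (∈xs⇒ m))

      rep∈Class : ∀ {x} → x ∈ xs → ShiftedClass x (shiftedRep x)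
      rep∈Class {inj₁ k} _ = content-corner-rep k
      rep∈Class {inj₂ i} _ = ≡.refl

      admissible : ∀ {x} → x ∈ xs → IsAdmissible (λ p → 𝟙[ (p ∈? P) ×-dec shiftedClass? x p ])
      admissible {inj₁ k} _ = χᵈ-admissible k
      admissible {inj₂ i} _ = χᵐ-admissible i

      classify : ∀ {p} → p ∈ P →
        Σ (ℤ ⊎ ℤ) λ x → x ∈ xs × ShiftedClass x p × (∀ {d} → IsAdmissible d → d p ≈ d (shiftedRep x))
      classify {p} p∈P = go (content p ℤ.≟ 0ℤ)
        where
        go : Dec (content p ≡ 0ℤ) →
             Σ (ℤ ⊎ ℤ) λ x → x ∈ xs × ShiftedClass x p × (∀ {d} → IsAdmissible d → d p ≈ d (shiftedRep x))
        go (yes eq) = inj₂ (proj₁ p) , on∈ (≡.subst (_∈ P) (main≡ eq) p∈P) , main≡ eq , λ {d} _ → reflexive (≡.cong d (main≡ eq))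
        go (no k≢0) = inj₁ (content p) , off∈ p∈P k≤ , ≡.refl , λ adm → diagonal-rep adm p∈P k≤
          where k≤ = <⇒+1≤ (ℤ.≤∧≢⇒< (content≤0 p∈P) k≢0)

    open Classes classes using (χ; combine-χ; admissible)

    𝒯-basis : IsWeightBasis xs (λ x → lap (χ x))
    𝒯-basis = Classes.isWeightBasis classes injective

    -- `B₂` mixes sums of indicators, which are not themselves values of `lap` at a class indicator,
    -- with negated toggles on the main diagonal, which are. Coefficients are therefore split into
    -- `offPart` and `mainPart`, and a combination becomes `offSum - lap mainSum`.
    mixedWeights : ℤ ⊎ ℤ → Point → Carrier
    mixedWeights (inj₁ k) q = 𝟙[ content q ℤ.≟ k ]
    mixedWeights (inj₂ i) q = - lap (χ (inj₂ i)) q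

    module _ (e : ℤ ⊎ ℤ → Carrier) where

      offPart mainPart : ℤ ⊎ ℤ → Carrier
      offPart (inj₁ k)  = e (inj₁ k)
      offPart (inj₂ i)  = 0#
      mainPart (inj₁ k) = 0#
      mainPart (inj₂ i) = e (inj₂ i)

      offSum mainSum : Point → Carrier
      offSum  = combine xs offPart χ
      mainSum = combine xs mainPart χ

      mainSum-admissible : IsAdmissible mainSum
      mainSum-admissible = combine-admissible {w = χ} admissible

      combine-mixed : ∀ {q} → q ∈ P → combine xs e mixedWeights q ≈ offSum q - lap mainSum q
      combine-mixed {q} q∈P = sym (trans (+-congˡ (-‿cong (lap-combine xs mainPart χ q)))
        (trans (sym (∑-- xs (λ x → offPart x * χ x q) (λ x → mainPart x * lap (χ x) q)))
          (∑-cong {xs = xs} (λ {x} _ → term x))))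
        where
        term : ∀ x → offPart x * χ x q - mainPart x * lap (χ x) q ≈ e x * mixedWeights x q
        term (inj₁ k) = trans (+-congˡ (-‿cong (zeroˡ _))) (trans (x-0≈x _) (*-congˡ (χᵈ-content q∈P)))
        term (inj₂ i) = trans (+-congʳ (zeroˡ _)) (trans (+-identityˡ _)
          (solve 2 (λ a b → :- (a :* b) := a :* (:- b)) refl _ _))

      offSum-off : ∀ {q} → q ∈ P → content q ℤ.+ 1ℤ ℤ.≤ 0ℤ → offSum q ≈ e (inj₁ (content q))
      offSum-off q∈P k≤ = combine-χ offPart (off∈ q∈P k≤) q∈P ≡.refl

      offSum-main : ∀ {q} → q ∈ P → content q ≡ 0ℤ → offSum q ≈ 0#
      offSum-main {q} q∈P eq = combine-χ offPart (on∈ (≡.subst (_∈ P) (main≡ eq) q∈P)) q∈P (main≡ eq)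

      mainSum-off : ∀ {q} → q ∈ P → content q ℤ.+ 1ℤ ℤ.≤ 0ℤ → mainSum q ≈ 0#
      mainSum-off q∈P k≤ = combine-χ mainPart (off∈ q∈P k≤) q∈P ≡.refl

      mainSum-main : ∀ {q} → q ∈ P → content q ≡ 0ℤ → mainSum q ≈ e (inj₂ (proj₁ q))
      mainSum-main {q} q∈P eq = combine-χ mainPart (on∈ (≡.subst (_∈ P) (main≡ eq) q∈P)) q∈P (main≡ eq)

    corner-rep-1∈ : corner-rep ℤ.-1ℤ ∈ P
    corner-rep-1∈ = corner-rep∈ ℤ.-1ℤ -1≥ (ℤ.≤-refl {0ℤ})

    -- On the main diagonal `offSum` is 0, so `lap mainSum` is 0 there; as `mainSum` vanishes on the
    -- diagonal next to it, twice its value is 0. Once `mainSum` is zero, `offSum` shows the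
    -- remaining coefficients as values.
    mixed-independent : ∀ e → (∀ {q} → q ∈ P → combine xs e mixedWeights q ≈ 0#) → ∀ {x} → x ∈ xs → e x ≈ 0#
    mixed-independent e e≈0 {x} m = go x m
      where
      main-0 : ∀ {q} → q ∈ P → content q ≡ 0ℤ → mainSum e q ≈ 0#
      main-0 {q} q∈P eq = x+x≈0⇒x≈0 (trans
        (solve 2 (λ x y → x :+ x := y :- (y :- (x :+ x))) refl (mainSum e q) (mainSum e (corner-rep ℤ.-1ℤ)))
        (trans (+-cong (mainSum-off e corner-rep-1∈ (ℤ.≤-refl {0ℤ})) (-‿cong (trans
          (sym (lap-main (mainSum-admissible e) q∈P eq))
          (trans (solve 2 (λ l o → l := o :- (o :- l)) refl (lap (mainSum e) q) (offSum e q))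
            (trans (+-cong (offSum-main e q∈P eq) (-‿cong (trans (sym (combine-mixed e q∈P)) (e≈0 q∈P)))) (x-0≈x 0#))))))
          (x-0≈x 0#)))

      mainSum≈0 : ∀ p → mainSum e p ≈ 0#
      mainSum≈0 p = cases′ (p ∈? P) (content p ℤ.≟ 0ℤ)
        where
        cases′ : Dec (p ∈ P) → Dec (content p ≡ 0ℤ) → mainSum e p ≈ 0#
        cases′ (no p∉P) _         = IsAdmissible.support (mainSum-admissible e) p∉P
        cases′ (yes p∈P) (yes eq) = main-0 p∈P eq
        cases′ (yes p∈P) (no k≢0) = mainSum-off e p∈P (<⇒+1≤ (ℤ.≤∧≢⇒< (content≤0 p∈P) k≢0))

      go : ∀ x → x ∈ xs → e x ≈ 0#
      go (inj₂ i) m = let i∈P = main∈ (proj₁ (∈xs⇒ m)) (proj₂ (∈xs⇒ m)) in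
        trans (sym (mainSum-main e i∈P (content-main i))) (mainSum≈0 (i , i))
      go (inj₁ k) m = trans (reflexive (≡.cong (λ k → e (inj₁ k)) (≡.sym (content-corner-rep k)))) (trans
          (sym (offSum-off e r∈P (≡.subst (λ k → k ℤ.+ 1ℤ ℤ.≤ 0ℤ) (≡.sym (content-corner-rep k)) (proj₂ (∈xs⇒ m)))))
          (trans (sym (x-0≈x _)) (trans (+-congˡ (-‿cong (sym (trans (lap-cong mainSum≈0 (corner-rep k)) (lap-0 (corner-rep k))))))
            (trans (sym (combine-mixed e r∈P)) (e≈0 r∈P)))))
        where
        r∈P : corner-rep k ∈ P
        r∈P = corner-rep∈ k (proj₁ (∈xs⇒ m)) (proj₂ (∈xs⇒ m))

    -- Changing d on the main diagonal to half of its value next to it makes lap d vanish there.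
    mixed-spanning : ∀ {d} → IsAdmissible d →
      Σ (ℤ ⊎ ℤ → Carrier) λ e → ∀ {q} → q ∈ P → lap d q ≈ combine xs e mixedWeights q
    mixed-spanning {d} adm = e , λ {q} q∈P → trans
        (solve 2 (λ l m → l := (con 1ℚ :* l :+ m) :- m) refl (lap d q) (lap (mainSum e) q))
        (trans (+-congʳ (trans (+-congʳ (*-congʳ φ.1-homo)) (trans (sym (lap-corrected q∈P)) (corrected-off (cases q∈P) q∈P))))
          (sym (combine-mixed e q∈P)))
      where
      h : Carrier
      h = half * d (corner-rep ℤ.-1ℤ)

      -- The contribution from the side of the main diagonal: the value on the next diagonal, or the
      -- two corrected main values `h` when that diagonal is the main one.
      upper : ∀ {k} → Dec (k ℤ.+ 1ℤ ℤ.+ 1ℤ ℤ.≤ 0ℤ) → Carrier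
      upper {k} (yes _) = d (corner-rep (k ℤ.+ 1ℤ))
      upper {k} (no _)  = h + h

      e : ℤ ⊎ ℤ → Carrier
      e (inj₁ k) = d (corner-rep (k ℤ.- 1ℤ)) + upper {k} (k ℤ.+ 1ℤ ℤ.+ 1ℤ ℤ.≤? 0ℤ) - (d (corner-rep k) + d (corner-rep k))
      e (inj₂ i) = h - d (i , i)

      corrected-laplacian : Laplacian (λ q → 1# * lap d q + lap (mainSum e) q)
      corrected-laplacian = IsSubspace.+* laplacian-isSubspace 1#
        (d , adm , λ _ → refl) (mainSum e , mainSum-admissible e , λ _ → refl)

      d′ : Point → Carrier
      d′ p = 1# * d p + mainSum e p

      adm′ : IsAdmissible d′
      adm′ = proj₁ (proj₂ corrected-laplacian)

      lap-corrected : ∀ {q} → q ∈ P → lap d′ q ≈ 1# * lap d q + lap (mainSum e) q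
      lap-corrected = proj₂ (proj₂ corrected-laplacian)

      d′-off : ∀ {p} → p ∈ P → content p ℤ.+ 1ℤ ℤ.≤ 0ℤ → d′ p ≈ d p
      d′-off p∈P k≤ = trans (+-cong (*-identityˡ _) (mainSum-off e p∈P k≤)) (+-identityʳ _)

      d′-main : ∀ {p} → p ∈ P → content p ≡ 0ℤ → d′ p ≈ h
      d′-main {p} p∈P eq = trans (+-cong (trans (*-identityˡ _) (reflexive (≡.cong d (main≡ eq)))) (mainSum-main e p∈P eq))
        (solve 2 (λ x y → x :+ (y :- x) := y) refl _ _)

      d′-rep : ∀ {k} → k ℤ.+ 1ℤ ℤ.≤ 0ℤ → d′ (corner-rep k) ≈ d (corner-rep k)
      d′-rep {k} k≤ = go (corner-rep k ∈? P)
        where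
        go : Dec (corner-rep k ∈ P) → d′ (corner-rep k) ≈ d (corner-rep k)
        go (yes r∈P) = d′-off r∈P (≡.subst (λ k → k ℤ.+ 1ℤ ℤ.≤ 0ℤ) (≡.sym (content-corner-rep k)) k≤)
        go (no r∉P)  = trans (IsAdmissible.support adm′ r∉P) (sym (IsAdmissible.support adm r∉P))

      corrected-off : ∀ {q} → content q ℤ.+ 1ℤ ℤ.+ 1ℤ ℤ.≤ 0ℤ ⊎ content q ℤ.+ 1ℤ ≡ 0ℤ ⊎ content q ≡ 0ℤ → q ∈ P →
                      lap d′ q ≈ offSum e q
      corrected-off {q} (inj₁ far) q∈P = trans (lap-far adm′ q∈P far) (trans
          (+-cong (+-cong (d′-rep (≡.subst (ℤ._≤ 0ℤ) (≡.sym (i-1+1≡i (content q))) (content≤0 q∈P)))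
              (trans (d′-rep far) (sym (value (_ ℤ.≤? 0ℤ)))))
            (-‿cong (+-cong (d′-rep k≤) (d′-rep k≤))))
          (sym (offSum-off e q∈P k≤)))
        where
        k≤ : content q ℤ.+ 1ℤ ℤ.≤ 0ℤ
        k≤ = ℤ.≤-trans (i≤i+1 _) far
        value : ∀ far? → upper {content q} far? ≈ d (corner-rep (content q ℤ.+ 1ℤ))
        value (yes _)  = refl
        value (no ¬far) = contradiction far ¬far
      corrected-off {q} (inj₂ (inj₁ next)) q∈P = trans (lap-next adm′ q∈P next) (trans
          (+-cong (+-cong (trans (d′-rep {ℤ.- 2ℤ} ℤ.-≤+) (reflexive (≡.cong (λ k → d (corner-rep (k ℤ.- 1ℤ))) (≡.sym k≡))))
              (trans (+-cong (d′-main (proj₁ (neighbours q∈P next)) (≡.trans (i-[j-1] (proj₁ q) (proj₂ q)) next))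
                             (d′-main (proj₂ (neighbours q∈P next)) (≡.trans (i+1-j (proj₁ q) (proj₂ q)) next)))
                (sym (value (_ ℤ.≤? 0ℤ)))))
            (-‿cong (+-cong at at)))
          (sym (offSum-off e q∈P (ℤ.≤-reflexive next))))
        where
        k≡ : content q ≡ ℤ.-1ℤ
        k≡ = suc-pred-≡ next
        at : d′ (corner-rep ℤ.-1ℤ) ≈ d (corner-rep (content q))
        at = trans (d′-rep {ℤ.-1ℤ} (ℤ.≤-refl {0ℤ})) (reflexive (≡.cong (λ k → d (corner-rep k)) (≡.sym k≡)))
        value : ∀ far? → upper {content q} far? ≈ h + h
        value (no _)    = refl
        value (yes far) = ⊥-elim (≤-absurd {k = 0} far (≡.cong (λ z → 0ℤ ℤ.- (z ℤ.+ 1ℤ)) next))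
      corrected-off {q} (inj₂ (inj₂ main)) q∈P = trans (lap-main adm′ q∈P main) (trans
          (+-cong (d′-rep {ℤ.-1ℤ} (ℤ.≤-refl {0ℤ})) (-‿cong (+-cong (d′-main q∈P main) (d′-main q∈P main))))
          (trans (solve 1 (λ x → x :- (con ℚ.½ :* x :+ con ℚ.½ :* x) := x :- x) refl _)
            (trans (-‿inverseʳ _) (sym (offSum-main e q∈P main)))))

    mixed-basis : IsWeightBasis xs mixedWeights
    mixed-basis = record
      { elements    = λ {x} → elements {x}
      ; independent = mixed-independent
      ; spanning    = mixed-spanning
      }
      where
      elements : ∀ {x} → x ∈ xs → Laplacian (mixedWeights x)
      elements {inj₁ k} m = ∑ᵈ-laplacian (proj₁ (∈xs⇒ m)) (proj₂ (∈xs⇒ m))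
      elements {inj₂ i} m = IsWeightBasis.elements (IsWeightBasis-neg 𝒯-basis) m

-- Parity and the Laplacian on root posets

i+i≢1 : ∀ i → i ℤ.+ i ≢ 1ℤ
i+i≢1 (ℤ.+ zero)    ()
i+i≢1 (ℤ.+ suc n)   eq = contradiction (≡.trans (≡.sym (ℕ.+-suc n n)) (ℕ.suc-injective (ℤ.+-injective eq))) λ ()
i+i≢1 ℤ.-[1+ n ] ()

parity : ∀ n → (Σ ℕ λ t → n ≡ t ℕ.+ t) ⊎ (Σ ℕ λ t → n ≡ suc (t ℕ.+ t))
parity zero = inj₁ (0 , ≡.refl)
parity (suc n) with parity n
... | inj₁ (t , ≡.refl) = inj₂ (t , ≡.refl)
... | inj₂ (t , ≡.refl) = inj₁ (suc t , ≡.cong suc (≡.sym (ℕ.+-suc t t)))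

i+i≤j+j⇒i≤j : ∀ {i j} → i ℤ.+ i ℤ.≤ j ℤ.+ j → i ℤ.≤ j
i+i≤j+j⇒i≤j {i} {j} h with i ℤ.≤? j
... | yes i≤j = i≤j
... | no  i≰j = ⊥-elim (≤-absurd {k = 1} (h ⊞ ≰⇒+1≤ i≰j ⊞ ≰⇒+1≤ i≰j) (ℤsolve (i ∷ j ∷ [])))

module ParityRegion
  (R : CommutativeRing 0ℓ 0ℓ)
  (φ : ℚ-Algebra R)
  (T kmin kmax : ℤ) (P : List Point)
  (kmin<kmax : kmin ℤ.+ 1ℤ ℤ.≤ kmax) (unique : Unique P)
  (∈⇒ : ∀ {i j} → (i , j) ∈ P → InRegion T T kmin kmax (T ℤ.+ 1ℤ) i j)
  (⇒∈ : ∀ {i j} → InRegion T T kmin kmax (T ℤ.+ 1ℤ) i j → (i , j) ∈ P) where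

  open RegionWeights R φ T T kmin kmax (T ℤ.+ 1ℤ) P kmin<kmax unique ∈⇒ ⇒∈ public
  open CommutativeRing R hiding (zero)
  open Sums R φ
  open Solver using (solve; _:+_; _:*_; _:-_; :-_; con; _:=_)
  open Toggles R φ P isLatticeRegion

  Interior : ℤ → Set
  Interior k = kmin ℤ.+ 1ℤ ℤ.≤ k × k ℤ.+ 1ℤ ℤ.≤ kmax

  -- Points lying an odd, respectively even, number of steps above the minimal elements.
  Odd Even : Point → Set
  Odd  (i , j) = Σ ℤ λ z → i ℤ.+ j ≡ T ℤ.+ 1ℤ ℤ.+ 1ℤ ℤ.+ (z ℤ.+ z)
  Even (i , j) = Σ ℤ λ z → i ℤ.+ j ≡ T ℤ.+ 1ℤ ℤ.+ (z ℤ.+ z)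

  Even⇒Odd : ∀ {p} → Even p → Odd (left p) × Odd (right p) × Odd (down p) × Odd (up p)
  Even⇒Odd {i , j} (z , eq) =
      (z ℤ.- 1ℤ , ≡.trans (l₁ i j) (≡.trans (≡.cong (ℤ._- 1ℤ) eq) (r₁ T z)))
    , (z        , ≡.trans (l₂ i j) (≡.trans (≡.cong (ℤ._+ 1ℤ) eq) (r₂ T z)))
    , (z ℤ.- 1ℤ , ≡.trans (l₃ i j) (≡.trans (≡.cong (ℤ._- 1ℤ) eq) (r₁ T z)))
    , (z        , ≡.trans (l₄ i j) (≡.trans (≡.cong (ℤ._+ 1ℤ) eq) (r₂ T z)))
    where
    l₁ : ∀ i j → i ℤ.- 1ℤ ℤ.+ j ≡ i ℤ.+ j ℤ.- 1ℤ
    l₁ i j = ℤsolve (i ∷ j ∷ [])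
    l₂ : ∀ i j → i ℤ.+ 1ℤ ℤ.+ j ≡ i ℤ.+ j ℤ.+ 1ℤ
    l₂ i j = ℤsolve (i ∷ j ∷ [])
    l₃ : ∀ i j → i ℤ.+ (j ℤ.- 1ℤ) ≡ i ℤ.+ j ℤ.- 1ℤ
    l₃ i j = ℤsolve (i ∷ j ∷ [])
    l₄ : ∀ i j → i ℤ.+ (j ℤ.+ 1ℤ) ≡ i ℤ.+ j ℤ.+ 1ℤ
    l₄ i j = ℤsolve (i ∷ j ∷ [])
    r₁ : ∀ T z → T ℤ.+ 1ℤ ℤ.+ (z ℤ.+ z) ℤ.- 1ℤ ≡ T ℤ.+ 1ℤ ℤ.+ 1ℤ ℤ.+ ((z ℤ.- 1ℤ) ℤ.+ (z ℤ.- 1ℤ))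
    r₁ T z = ℤsolve (T ∷ z ∷ [])
    r₂ : ∀ T z → T ℤ.+ 1ℤ ℤ.+ (z ℤ.+ z) ℤ.+ 1ℤ ≡ T ℤ.+ 1ℤ ℤ.+ 1ℤ ℤ.+ (z ℤ.+ z)
    r₂ T z = ℤsolve (T ∷ z ∷ [])

  ¬Even∧Odd : ∀ {p} → Even p → ¬ Odd p
  ¬Even∧Odd {i , j} (z , eq) (y , eq′) = i+i≢1 (z ℤ.- y)
    (≡.trans (lhs T z y) (≡.trans (≡.cong (ℤ._- (T ℤ.+ 1ℤ ℤ.+ (y ℤ.+ y))) (≡.trans (≡.sym eq) eq′)) (rhs T y)))
    where
    lhs : ∀ T z y → z ℤ.- y ℤ.+ (z ℤ.- y) ≡ T ℤ.+ 1ℤ ℤ.+ (z ℤ.+ z) ℤ.- (T ℤ.+ 1ℤ ℤ.+ (y ℤ.+ y))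
    lhs T z y = ℤsolve (T ∷ z ∷ y ∷ [])
    rhs : ∀ T y → T ℤ.+ 1ℤ ℤ.+ 1ℤ ℤ.+ (y ℤ.+ y) ℤ.- (T ℤ.+ 1ℤ ℤ.+ (y ℤ.+ y)) ≡ 1ℤ
    rhs T y = ℤsolve (T ∷ y ∷ [])

  parity-of : ∀ {i j} → (i , j) ∈ P →
    (Σ ℕ λ t → i ℤ.+ j ≡ T ℤ.+ 1ℤ ℤ.+ (ℤ.+ t ℤ.+ ℤ.+ t)) ⊎ Odd (i , j)
  parity-of {i} {j} p∈P with ≥1⇒ (excess (InRegion.s≤ (∈⇒ p∈P)))
    where
    excess : T ℤ.+ 1ℤ ℤ.≤ i ℤ.+ j → 1ℤ ℤ.≤ i ℤ.+ j ℤ.- T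
    excess h = ≤-by h (ℤsolve (i ∷ j ∷ T ∷ []))
  ... | x , eq with parity x
  ...   | inj₁ (t , ≡.refl) = inj₁ (t , go i j T (ℤ.+ t) eq)
    where
    go : ∀ i j T t → i ℤ.+ j ℤ.- T ≡ 1ℤ ℤ.+ (t ℤ.+ t) → i ℤ.+ j ≡ T ℤ.+ 1ℤ ℤ.+ (t ℤ.+ t)
    go i j T t eq = ≡.trans (lhs i j T) (≡.trans (≡.cong (λ z → T ℤ.+ z) eq) (rhs T t))
      where
      lhs : ∀ i j T → i ℤ.+ j ≡ T ℤ.+ (i ℤ.+ j ℤ.- T)
      lhs i j T = ℤsolve (i ∷ j ∷ T ∷ [])
      rhs : ∀ T t → T ℤ.+ (1ℤ ℤ.+ (t ℤ.+ t)) ≡ T ℤ.+ 1ℤ ℤ.+ (t ℤ.+ t)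
      rhs T t = ℤsolve (T ∷ t ∷ [])
  ...   | inj₂ (t , ≡.refl) = inj₂ (ℤ.+ t , go i j T (ℤ.+ t) eq)
    where
    go : ∀ i j T t → i ℤ.+ j ℤ.- T ≡ 1ℤ ℤ.+ (1ℤ ℤ.+ (t ℤ.+ t)) → i ℤ.+ j ≡ T ℤ.+ 1ℤ ℤ.+ 1ℤ ℤ.+ (t ℤ.+ t)
    go i j T t eq = ≡.trans (lhs i j T) (≡.trans (≡.cong (λ z → T ℤ.+ z) eq) (rhs T t))
      where
      lhs : ∀ i j T → i ℤ.+ j ≡ T ℤ.+ (i ℤ.+ j ℤ.- T)
      lhs i j T = ℤsolve (i ∷ j ∷ T ∷ [])
      rhs : ∀ T t → T ℤ.+ (1ℤ ℤ.+ (1ℤ ℤ.+ (t ℤ.+ t))) ≡ T ℤ.+ 1ℤ ℤ.+ 1ℤ ℤ.+ (t ℤ.+ t)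
      rhs T t = ℤsolve (T ∷ t ∷ [])

  -- A non-minimal point on an interior diagonal has both lower neighbours.
  lower∈ : ∀ {i j} → (i , j) ∈ P → T ℤ.+ 1ℤ ℤ.+ 1ℤ ℤ.≤ i ℤ.+ j →
           (kmin ℤ.+ 1ℤ ℤ.≤ i ℤ.- j → left (i , j) ∈ P) × (i ℤ.- j ℤ.+ 1ℤ ℤ.≤ kmax → down (i , j) ∈ P)
  lower∈ {i} {j} p∈P sum≥ =
      (λ k≥ → left∈ p∈P (≤-by (sum≥ ⊞ j≤) (ℤsolve (i ∷ j ∷ T ∷ []))) k≥ sum≥)
    , (λ k≤ → down∈ p∈P (≤-by (sum≥ ⊞ i≤) (ℤsolve (i ∷ j ∷ T ∷ []))) k≤ sum≥)
    where open InRegion (∈⇒ p∈P) hiding (k≥; k≤)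

  odd-sum : ∀ {i j} → (i , j) ∈ P → Odd (i , j) → T ℤ.+ 1ℤ ℤ.+ 1ℤ ℤ.≤ i ℤ.+ j
  odd-sum {i} {j} p∈P (z , eq) = go (T ℤ.+ 1ℤ ℤ.≟ i ℤ.+ j)
    where
    open InRegion (∈⇒ p∈P)
    go : Dec (T ℤ.+ 1ℤ ≡ i ℤ.+ j) → T ℤ.+ 1ℤ ℤ.+ 1ℤ ℤ.≤ i ℤ.+ j
    go (no s≢)  = <⇒+1≤ (ℤ.≤∧≢⇒< s≤ s≢)
    go (yes s≡) = contradiction (z , eq) (¬Even∧Odd {i , j} (0ℤ , ≡.trans (≡.sym s≡) (≡.sym (ℤ.+-identityʳ _))))

  χᵈ : ℤ → Point → Carrier
  χᵈ k p = 𝟙[ (p ∈? P) ×-dec onDiagonal? k p ]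

  -- Content and coordinate sum have the same parity, so all points of a diagonal lie at even height
  -- or all at odd height.
  EvenDiagonal : ℤ → Set
  EvenDiagonal k = Σ ℤ λ z → k ≡ T ℤ.+ 1ℤ ℤ.+ (z ℤ.+ z)

  even-on : ∀ {k p} → EvenDiagonal k → content p ≡ k → Even p
  even-on {k} {i , j} (z , eq) c = z ℤ.+ j , ≡.trans (lhs i j) (≡.trans (≡.cong (ℤ._+ (j ℤ.+ j)) (≡.trans c eq)) (rhs T z j))
    where
    lhs : ∀ i j → i ℤ.+ j ≡ i ℤ.- j ℤ.+ (j ℤ.+ j)
    lhs i j = ℤsolve (i ∷ j ∷ [])
    rhs : ∀ T z j → T ℤ.+ 1ℤ ℤ.+ (z ℤ.+ z) ℤ.+ (j ℤ.+ j) ≡ T ℤ.+ 1ℤ ℤ.+ (z ℤ.+ j ℤ.+ (z ℤ.+ j))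
    rhs T z j = ℤsolve (T ∷ z ∷ j ∷ [])

  -- Evenness ensures that `diag⁻ p` is in P: `left p` lies at odd, hence positive, height, which
  -- leaves room for one more step down.
  χᵈ-admissible : ∀ {k} → EvenDiagonal k → IsAdmissible (χᵈ k)
  χᵈ-admissible {k} even = χ-admissible (onDiagonal? k) λ {p} l d →
      (λ c → diag⁻∈ l d c , ≡.trans (content-diag⁻ p) c) , (λ c → ≡.trans (≡.sym (content-diag⁻ p)) c)
    where
    diag⁻∈ : ∀ {p} → left p ∈ P → down p ∈ P → content p ≡ k → diag⁻ p ∈ P
    diag⁻∈ {i , j} l∈P d∈P c = ⇒∈ {i ℤ.- 1ℤ} {j ℤ.- 1ℤ} record
      { i≥ = L.i≥
      ; i≤ = L.i≤
      ; j≥ = D.j≥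
      ; j≤ = D.j≤
      ; k≥ = ≤-by (L.k≥ ⊞ 0≤1) (ℤsolve (i ∷ j ∷ kmin ∷ []))
      ; k≤ = ≤-by (D.k≤ ⊞ 0≤1) (ℤsolve (i ∷ j ∷ kmax ∷ []))
      ; s≤ = ≤-by sum (ℤsolve (i ∷ j ∷ T ∷ []))
      }
      where
      module L = InRegion (∈⇒ l∈P)
      module D = InRegion (∈⇒ d∈P)
      sum : T ℤ.+ 1ℤ ℤ.+ 1ℤ ℤ.≤ i ℤ.- 1ℤ ℤ.+ j
      sum = odd-sum l∈P (proj₁ (Even⇒Odd {i , j} (even-on {p = i , j} even c)))

  χᵈ-1 : ∀ {k p} → p ∈ P → content p ≡ k → χᵈ k p ≈ 1#
  χᵈ-1 {k} {p} p∈P c = 𝟙-true ((p ∈? P) ×-dec onDiagonal? k p) (p∈P , c)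

  χᵈ-0 : ∀ {k p} → content p ≢ k → χᵈ k p ≈ 0#
  χᵈ-0 {k} {p} ¬c = 𝟙-false ((p ∈? P) ×-dec onDiagonal? k p) (λ (_ , c) → ¬c c)

  -- A point on a diagonal next to `k` has odd, hence positive, height. So its lower neighbour on
  -- the diagonal `k` is in P, and the corrections by `ν` vanish.
  lap-χᵈ : ∀ {k} → Interior k → EvenDiagonal k → ∀ {q} → q ∈ P →
           lap (χᵈ k) q ≈ 𝟙[ content q ℤ.≟ k ℤ.+ 1ℤ ] + 𝟙[ content q ℤ.≟ k ℤ.- 1ℤ ]
                          - (𝟙[ content q ℤ.≟ k ] + 𝟙[ content q ℤ.≟ k ])
  lap-χᵈ {k} (k≥ , k≤) even {i , j} q∈P =
      +-cong (+-cong (below (i ℤ.- j ℤ.≟ k ℤ.+ 1ℤ)) (above (i ℤ.- j ℤ.≟ k ℤ.- 1ℤ))) (-‿cong (+-cong at at))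
    where
    adm = χᵈ-admissible even
    at : χᵈ k (i , j) ≈ 𝟙[ i ℤ.- j ℤ.≟ k ]
    at = 𝟙-⇔ (((i , j) ∈? P) ×-dec onDiagonal? k (i , j)) (i ℤ.- j ℤ.≟ k) proj₂ (q∈P ,_)

    off : ∀ {p r c} → content p ≢ k → content r ≢ k → χᵈ k p + χᵈ k r * c ≈ 0#
    off {p} {r} p≢ r≢ = trans (+-cong (χᵈ-0 {p = p} p≢) (trans (*-congʳ (χᵈ-0 {p = r} r≢)) (zeroˡ _))) (+-identityˡ 0#)

    odd⁺ : i ℤ.- j ≡ k ℤ.+ 1ℤ → Odd (i , j)
    odd⁺ eq = ≡.subst Odd (right-left (i , j)) (proj₁ (proj₂ (Even⇒Odd {left (i , j)}
      (even-on {p = left (i , j)} even (≡.trans (i-1-j i j) (≡.trans (≡.cong (ℤ._- 1ℤ) eq) (i+1-1≡i k)))))))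

    odd⁻ : i ℤ.- j ≡ k ℤ.- 1ℤ → Odd (i , j)
    odd⁻ eq = ≡.subst Odd (left-right (i , j)) (proj₁ (Even⇒Odd {right (i , j)}
      (even-on {p = right (i , j)} even (≡.trans (i+1-j i j) (≡.trans (≡.cong (ℤ._+ 1ℤ) eq) (i-1+1≡i k))))))

    below : (c? : Dec (i ℤ.- j ≡ k ℤ.+ 1ℤ)) → lapˡ (χᵈ k) (i , j) ≈ 𝟙[ c? ]
    below (no ¬c) = off {left (i , j)} {up (i , j)}
      (λ eq → ¬c (pred-suc-≡ (≡.trans (≡.sym (i-1-j i j)) eq)))
      (λ eq → ¬c (pred-suc-≡ (≡.trans (≡.sym (i-[j+1] i j)) eq)))
    below (yes c) = trans (lapˡ-interior adm q∈P l∈P (≡.subst (kmin ℤ.+ 1ℤ ℤ.+ 1ℤ ℤ.≤_) (≡.sym c) (ℤ.+-monoˡ-≤ 1ℤ k≥)))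
        (χᵈ-1 {p = left (i , j)} l∈P (≡.trans (i-1-j i j) (≡.trans (≡.cong (ℤ._- 1ℤ) c) (i+1-1≡i k))))
      where
      l∈P : left (i , j) ∈ P
      l∈P = proj₁ (lower∈ q∈P (odd-sum q∈P (odd⁺ c))) (≡.subst (kmin ℤ.+ 1ℤ ℤ.≤_) (≡.sym c) (ℤ.≤-trans k≥ (i≤i+1 k)))

    above : (c? : Dec (i ℤ.- j ≡ k ℤ.- 1ℤ)) → lapᵈ (χᵈ k) (i , j) ≈ 𝟙[ c? ]
    above (no ¬c) = off {down (i , j)} {right (i , j)}
      (λ eq → ¬c (suc-pred-≡ (≡.trans (≡.sym (i-[j-1] i j)) eq)))
      (λ eq → ¬c (suc-pred-≡ (≡.trans (≡.sym (i+1-j i j)) eq)))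
    above (yes c) = trans (lapᵈ-interior adm q∈P d∈P (≡.subst (λ k → k ℤ.+ 1ℤ ℤ.≤ kmax) (≡.sym k≡) k≤))
        (χᵈ-1 {p = down (i , j)} d∈P (≡.trans (i-[j-1] i j) k≡))
      where
      k≡ : i ℤ.- j ℤ.+ 1ℤ ≡ k
      k≡ = ≡.trans (≡.cong (ℤ._+ 1ℤ) c) (i-1+1≡i k)
      d∈P : down (i , j) ∈ P
      d∈P = proj₂ (lower∈ q∈P (odd-sum q∈P (odd⁻ c))) (≡.subst (ℤ._≤ kmax) (≡.sym k≡) (ℤ.≤-trans (i≤i+1 k) k≤))

  -- The neighbouring contents are variables with equations, since `B₂` writes them in forms such as
  -- `2k + 2 - n`.
  neg-lap-χᵈ : ∀ {k k⁺ k⁻} → Interior k → EvenDiagonal k → k⁺ ≡ k ℤ.+ 1ℤ → k⁻ ≡ k ℤ.- 1ℤ → ∀ {q} → q ∈ P →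
    - (𝟙[ onDiagonal? k⁺ q ] + 𝟙[ onDiagonal? k⁻ q ] - (𝟙[ onDiagonal? k q ] + 𝟙[ onDiagonal? k q ])) ≈ - lap (χᵈ k) q
  neg-lap-χᵈ interior even ≡.refl ≡.refl q∈P = -‿cong (sym (lap-χᵈ interior even q∈P))

  foot-left∉ : ∀ {i j} → i ℤ.+ j ≡ T ℤ.+ 1ℤ → left (i , j) ∉ P
  foot-left∉ {i} {j} eq l∈P = go (InRegion.s≤ (∈⇒ l∈P)) (ℤ.≤-reflexive eq)
    where
    go : T ℤ.+ 1ℤ ℤ.≤ i ℤ.- 1ℤ ℤ.+ j → ¬ (i ℤ.+ j ℤ.≤ T ℤ.+ 1ℤ)
    go h h′ = ≤-absurd {k = 0} (h ⊞ h′) (ℤsolve (i ∷ j ∷ T ∷ []))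

  foot-down∉ : ∀ {i j} → i ℤ.+ j ≡ T ℤ.+ 1ℤ → down (i , j) ∉ P
  foot-down∉ {i} {j} eq d∈P = go (InRegion.s≤ (∈⇒ d∈P)) (ℤ.≤-reflexive eq)
    where
    go : T ℤ.+ 1ℤ ℤ.≤ i ℤ.+ (j ℤ.- 1ℤ) → ¬ (i ℤ.+ j ℤ.≤ T ℤ.+ 1ℤ)
    go h h′ = ≤-absurd {k = 0} (h ⊞ h′) (ℤsolve (i ∷ j ∷ T ∷ []))

  -- Content and coordinate sum determine a point, so a diagonal has only one point of height 0;
  -- every other point has positive height and a left neighbour in P.
  nonfoot : ∀ {i j i′ j′} → (i , j) ∈ P → Interior (i ℤ.- j) → i ℤ.- j ≡ i′ ℤ.- j′ → i′ ℤ.+ j′ ≡ T ℤ.+ 1ℤ →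
            (i , j) ≢ (i′ , j′) → left (i , j) ∈ P ⊎ down (i , j) ∈ P
  nonfoot {i} {j} {i′} {j′} p∈P interior k≡ sum≡ p≢ = inj₁ (proj₁ (lower∈ p∈P
      (<⇒+1≤ (ℤ.≤∧≢⇒< (InRegion.s≤ (∈⇒ p∈P)) (λ eq → p≢ (same (≡.trans (≡.sym eq) (≡.sym sum≡))))))) (proj₁ interior))
    where
    double : ∀ i j → i ℤ.+ j ℤ.+ (i ℤ.- j) ≡ i ℤ.+ i
    double i j = ℤsolve (i ∷ j ∷ [])
    cancel : ∀ i j → i ℤ.- (i ℤ.- j) ≡ j
    cancel i j = ℤsolve (i ∷ j ∷ [])
    same : i ℤ.+ j ≡ i′ ℤ.+ j′ → (i , j) ≡ (i′ , j′)
    same eq = ≡.cong₂ _,_ i≡ (≡.trans (≡.sym (cancel i j)) (≡.trans (≡.cong₂ ℤ._-_ i≡ k≡) (cancel i′ j′)))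
      where
      i+i≡ : i ℤ.+ i ≡ i′ ℤ.+ i′
      i+i≡ = ≡.trans (≡.sym (double i j)) (≡.trans (≡.cong₂ ℤ._+_ eq k≡) (double i′ j′))
      i≡ : i ≡ i′
      i≡ = ℤ.≤-antisym (i+i≤j+j⇒i≤j (ℤ.≤-reflexive i+i≡)) (i+i≤j+j⇒i≤j (ℤ.≤-reflexive (≡.sym i+i≡)))

  module _ (odd-interior : ∀ {p} → p ∈ P → Odd p → Interior (content p)) where

    module _ {d : Point → Carrier} (adm : IsAdmissible d) where

      open IsAdmissible adm

      -- Each odd point has both lower neighbours in P, so `d` is unchanged under `diag⁻`, which
      -- lowers the height by 2. From height 1 the next value is at height -1, outside P, and hence
      -- 0.
      odd-0′ : ∀ t {i j} → i ℤ.+ j ≡ T ℤ.+ 1ℤ ℤ.+ 1ℤ ℤ.+ (ℤ.+ t ℤ.+ ℤ.+ t) → d (i , j) ≈ 0#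
      odd-0′ t {i} {j} eq = go ((i , j) ∈? P)
        where
        pred-odd : ∀ T t i j → i ℤ.+ j ≡ T ℤ.+ 1ℤ ℤ.+ 1ℤ ℤ.+ (t ℤ.+ t) →
                   i ℤ.- 1ℤ ℤ.+ (j ℤ.- 1ℤ) ≡ T ℤ.+ 1ℤ ℤ.+ 1ℤ ℤ.+ ((t ℤ.- 1ℤ) ℤ.+ (t ℤ.- 1ℤ))
        pred-odd T t i j eq = ≡.trans (lhs i j) (≡.trans (≡.cong (λ z → z ℤ.- 1ℤ ℤ.- 1ℤ) eq) (rhs T t))
          where
          lhs : ∀ i j → i ℤ.- 1ℤ ℤ.+ (j ℤ.- 1ℤ) ≡ i ℤ.+ j ℤ.- 1ℤ ℤ.- 1ℤ
          lhs i j = ℤsolve (i ∷ j ∷ [])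
          rhs : ∀ T t → T ℤ.+ 1ℤ ℤ.+ 1ℤ ℤ.+ (t ℤ.+ t) ℤ.- 1ℤ ℤ.- 1ℤ ≡ T ℤ.+ 1ℤ ℤ.+ 1ℤ ℤ.+ ((t ℤ.- 1ℤ) ℤ.+ (t ℤ.- 1ℤ))
          rhs T t = ℤsolve (T ∷ t ∷ [])

        outside : ∀ {i j} → i ℤ.+ j ≡ T ℤ.+ 1ℤ ℤ.+ 1ℤ ℤ.+ (ℤ.-1ℤ ℤ.+ ℤ.-1ℤ) → (i , j) ∉ P
        outside {i} {j} eq p∈P = ≤-absurd {k = 0} (≡.subst (T ℤ.+ 1ℤ ℤ.≤_) eq (InRegion.s≤ (∈⇒ p∈P))) (ℤsolve (T ∷ []))

        descend : ∀ t → (i ℤ.- 1ℤ) ℤ.+ (j ℤ.- 1ℤ) ≡ T ℤ.+ 1ℤ ℤ.+ 1ℤ ℤ.+ ((ℤ.+ t ℤ.- 1ℤ) ℤ.+ (ℤ.+ t ℤ.- 1ℤ)) → d (diag⁻ (i , j)) ≈ 0#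
        descend zero    eq = support (outside eq)
        descend (suc t) eq = odd-0′ t eq

        go : Dec ((i , j) ∈ P) → d (i , j) ≈ 0#
        go (no p∉P)  = support p∉P
        go (yes p∈P) = trans (diagonal (proj₁ lower (proj₁ interior)) (proj₂ lower (proj₂ interior))) (descend t (pred-odd T (ℤ.+ t) i j eq))
          where
          interior = odd-interior p∈P (ℤ.+ t , eq)
          lower = lower∈ p∈P (odd-sum p∈P (ℤ.+ t , eq))

      odd-0 : ∀ {p} → Odd p → d p ≈ 0#
      odd-0 {i , j} (ℤ.+ t , eq)    = odd-0′ t eq
      odd-0 {i , j} (ℤ.-[1+ t ] , eq) = support (λ p∈P → negative t (≡.subst (T ℤ.+ 1ℤ ℤ.≤_) eq (InRegion.s≤ (∈⇒ p∈P))))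
        where
        negative : ∀ t → ¬ (T ℤ.+ 1ℤ ℤ.≤ T ℤ.+ 1ℤ ℤ.+ 1ℤ ℤ.+ (ℤ.-[1+ t ] ℤ.+ ℤ.-[1+ t ]))
        negative t h = go (ℤ.+ t) 0≤+ h
          where
          go : ∀ t → 0ℤ ℤ.≤ t → ¬ (T ℤ.+ 1ℤ ℤ.≤ T ℤ.+ 1ℤ ℤ.+ 1ℤ ℤ.+ (ℤ.- (1ℤ ℤ.+ t) ℤ.+ ℤ.- (1ℤ ℤ.+ t)))
          go t 0≤t h = ≤-absurd {k = 0} (h ⊞ 0≤t ⊞ 0≤t) (ℤsolve (T ∷ t ∷ []))

      -- All four neighbours of an even point are odd, and `d` vanishes there; only the central term
      -- of `lap` remains.
      lap-even : ∀ {q} → Even q → lap d q ≈ - (d q + d q)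
      lap-even {q} even = let l , r , b , u = Even⇒Odd {q} even in trans
        (+-congʳ (trans (+-cong
          (trans (+-cong (odd-0 {left q} l) (trans (*-congʳ (odd-0 {up q} u)) (zeroˡ _))) (+-identityˡ 0#))
          (trans (+-cong (odd-0 {down q} b) (trans (*-congʳ (odd-0 {right q} r)) (zeroˡ _))) (+-identityˡ 0#)))
          (+-identityˡ 0#)))
        (+-identityˡ _)

      injective : (∀ {q} → q ∈ P → lap d q ≈ 0#) → ∀ {p} → p ∈ P → d p ≈ 0#
      injective lap≈0 {p} p∈P with parity-of p∈P
      ... | inj₂ odd = odd-0 {p} odd
      ... | inj₁ (t , eq) = trans (solve 1 (λ x → x := (:- con ℚ.½) :* (:- (x :+ x))) refl _)
              (trans (*-congˡ (trans (sym (lap-even {p} (ℤ.+ t , eq))) (lap≈0 p∈P))) (zeroʳ _))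

  -- The minimal element below (i , j) on its diagonal, t steps down.
  foot∈ : ∀ {i j} t → (i , j) ∈ P → i ℤ.+ j ≡ T ℤ.+ 1ℤ ℤ.+ (ℤ.+ t ℤ.+ ℤ.+ t) → (i ℤ.- ℤ.+ t , j ℤ.- ℤ.+ t) ∈ P
  foot∈ {i} {j} t p∈P eq = ⇒∈ (go (ℤ.+ t) 0≤+ eq)
    where
    open InRegion (∈⇒ p∈P)
    go : ∀ t → 0ℤ ℤ.≤ t → i ℤ.+ j ≡ T ℤ.+ 1ℤ ℤ.+ (t ℤ.+ t) → InRegion T T kmin kmax (T ℤ.+ 1ℤ) (i ℤ.- t) (j ℤ.- t)
    go t 0≤t eq = record
      { i≥ = ≤-by (sum ⊞ j≤ ⊞ 0≤t) (ℤsolve (i ∷ j ∷ t ∷ T ∷ []))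
      ; i≤ = ≤-by (i≤ ⊞ 0≤t) (ℤsolve (i ∷ t ∷ T ∷ []))
      ; j≥ = ≤-by (sum ⊞ i≤ ⊞ 0≤t) (ℤsolve (i ∷ j ∷ t ∷ T ∷ []))
      ; j≤ = ≤-by (j≤ ⊞ 0≤t) (ℤsolve (j ∷ t ∷ T ∷ []))
      ; k≥ = ≤-by k≥ (ℤsolve (i ∷ j ∷ t ∷ kmin ∷ []))
      ; k≤ = ≤-by k≤ (ℤsolve (i ∷ j ∷ t ∷ kmax ∷ []))
      ; s≤ = ≤-by sum (ℤsolve (i ∷ j ∷ t ∷ T ∷ []))
      }
      where
      sum : T ℤ.+ 1ℤ ℤ.+ (t ℤ.+ t) ℤ.≤ i ℤ.+ j
      sum = ℤ.≤-reflexive (≡.sym eq)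

  foot-value : ∀ {d} → IsAdmissible d → ∀ {i j} t → (i , j) ∈ P → i ℤ.+ j ≡ T ℤ.+ 1ℤ ℤ.+ (ℤ.+ t ℤ.+ ℤ.+ t) →
               Interior (i ℤ.- j) → d (i , j) ≈ d (i ℤ.- ℤ.+ t , j ℤ.- ℤ.+ t)
  foot-value {d} adm {i} {j} t p∈P eq (k≥ , k≤) = trans (reflexive (≡.cong d (≡.sym p≡)))
      (diagonal-constant adm t (≡.subst (kmin ℤ.+ 1ℤ ℤ.≤_) k≡ k≥) (≡.subst (λ k → k ℤ.+ 1ℤ ℤ.≤ kmax) k≡ k≤)
        (foot∈ t p∈P eq) (≡.subst (_∈ P) (≡.sym p≡) p∈P))
    where
    back : ∀ i t → i ℤ.- t ℤ.+ t ≡ i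
    back i t = ℤsolve (i ∷ t ∷ [])
    p≡ : (i ℤ.- ℤ.+ t ℤ.+ ℤ.+ t , j ℤ.- ℤ.+ t ℤ.+ ℤ.+ t) ≡ (i , j)
    p≡ = ≡.cong₂ _,_ (back i (ℤ.+ t)) (back j (ℤ.+ t))
    shift : ∀ i j t → i ℤ.- j ≡ i ℤ.- t ℤ.- (j ℤ.- t)
    shift i j t = ℤsolve (i ∷ j ∷ t ∷ [])
    k≡ : i ℤ.- j ≡ i ℤ.- ℤ.+ t ℤ.- (j ℤ.- ℤ.+ t)
    k≡ = shift i j (ℤ.+ t)

-- Type A: classes are the even diagonals

module RootAWeights
  (R : CommutativeRing 0ℓ 0ℓ)
  (φ : ℚ-Algebra R)
  (n : ℤ) (1≤n : 1ℤ ℤ.≤ n) (P : List Point) (unique : Unique P)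
  (∈⇒ : ∀ {i j} → (i , j) ∈ P → InRegion n n (ℤ.- n) n (n ℤ.+ 1ℤ) i j)
  (⇒∈ : ∀ {i j} → InRegion n n (ℤ.- n) n (n ℤ.+ 1ℤ) i j → (i , j) ∈ P) where

  private
    nonempty : ℤ.- n ℤ.+ 1ℤ ℤ.≤ n
    nonempty = ≤-by (1≤n ⊞ 1≤n ⊞ 0≤1) (ℤsolve (n ∷ []))

  open ParityRegion R φ n (ℤ.- n) n P nonempty unique ∈⇒ ⇒∈ public
  open CommutativeRing R hiding (zero)
  open Toggles R φ P isLatticeRegion

  level : ℤ → ℤ
  level k = ℤ.+ 2 ℤ.* k ℤ.+ 1ℤ ℤ.- n

  level-even : ∀ k → EvenDiagonal (level k)
  level-even k = k ℤ.- n , eq n k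
    where
    eq : ∀ n k → ℤ.+ 2 ℤ.* k ℤ.+ 1ℤ ℤ.- n ≡ n ℤ.+ 1ℤ ℤ.+ (k ℤ.- n ℤ.+ (k ℤ.- n))
    eq n k = ℤsolve (n ∷ k ∷ [])

  Label : ℤ → Set
  Label k = 0ℤ ℤ.≤ k × k ℤ.≤ n ℤ.- 1ℤ

  level-interior : ∀ {k} → Label k → Interior (level k)
  level-interior {k} (k≥ , k≤) = go k≥ k≤
    where
    go : 0ℤ ℤ.≤ k → k ℤ.≤ n ℤ.- 1ℤ →
         ℤ.- n ℤ.+ 1ℤ ℤ.≤ ℤ.+ 2 ℤ.* k ℤ.+ 1ℤ ℤ.- n × ℤ.+ 2 ℤ.* k ℤ.+ 1ℤ ℤ.- n ℤ.+ 1ℤ ℤ.≤ n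
    go k≥ k≤ = ≤-by (k≥ ⊞ k≥) (ℤsolve (k ∷ n ∷ [])) , ≤-by (k≤ ⊞ k≤) (ℤsolve (k ∷ n ∷ []))

  all-interior : ∀ {p} → p ∈ P → Interior (content p)
  all-interior {i , j} p∈P = go
    where
    open InRegion (∈⇒ p∈P)
    go : ℤ.- n ℤ.+ 1ℤ ℤ.≤ i ℤ.- j × i ℤ.- j ℤ.+ 1ℤ ℤ.≤ n
    go = ≤-by (i≥ ⊞ j≤) (ℤsolve (i ∷ j ∷ n ∷ [])) , ≤-by (i≤ ⊞ j≥) (ℤsolve (i ∷ j ∷ n ∷ []))

  foot : ℤ → Point
  foot k = k ℤ.+ 1ℤ , n ℤ.- k

  foot∈P : ∀ {k} → Label k → foot k ∈ P
  foot∈P {k} (k≥ , k≤) = ⇒∈ {k ℤ.+ 1ℤ} {n ℤ.- k} record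
    { i≥ = ≤-by k≥ (ℤsolve (k ∷ []))
    ; i≤ = ≤-by k≤ (ℤsolve (k ∷ n ∷ []))
    ; j≥ = ≤-by k≤ (ℤsolve (k ∷ n ∷ []))
    ; j≤ = ≤-by k≥ (ℤsolve (k ∷ n ∷ []))
    ; k≥ = ≤-by (k≥ ⊞ k≥ ⊞ 0≤1) (ℤsolve (k ∷ n ∷ []))
    ; k≤ = ≤-by (k≤ ⊞ k≤ ⊞ 0≤1) (ℤsolve (k ∷ n ∷ []))
    ; s≤ = ≤-by 0≤0 (ℤsolve (k ∷ n ∷ []))
    }
    where
    0≤0 : 0ℤ ℤ.≤ 0ℤ
    0≤0 = ℤ.≤-refl

  content-foot : ∀ k → content (foot k) ≡ level k
  content-foot k = eq n k
    where
    eq : ∀ n k → k ℤ.+ 1ℤ ℤ.- (n ℤ.- k) ≡ ℤ.+ 2 ℤ.* k ℤ.+ 1ℤ ℤ.- n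
    eq n k = ℤsolve (n ∷ k ∷ [])

  level-injective : ∀ {k l} → level k ≡ level l → k ≡ l
  level-injective {k} {l} eq = ℤ.*-cancelˡ-≡ (ℤ.+ 2) k l
    (≡.trans (back n k) (≡.trans (≡.cong (λ z → z ℤ.+ n ℤ.- 1ℤ) eq) (≡.sym (back n l))))
    where
    back : ∀ n k → ℤ.+ 2 ℤ.* k ≡ ℤ.+ 2 ℤ.* k ℤ.+ 1ℤ ℤ.- n ℤ.+ n ℤ.- 1ℤ
    back n k = ℤsolve (n ∷ k ∷ [])

  module _ {xs : List ℤ} (unique-xs : Unique xs)
           (∈xs⇒ : ∀ {k} → k ∈ xs → Label k) (⇒∈xs : ∀ {k} → Label k → k ∈ xs) where

    classes : Classes ℤ xs
    classes = record
      { unique-xs  = unique-xs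
      ; Class      = λ k → OnDiagonal (level k)
      ; class?     = λ k → onDiagonal? (level k)
      ; disjoint   = λ _ _ c c′ → level-injective (≡.trans (≡.sym c) c′)
      ; rep        = foot
      ; rep∈P      = λ m → foot∈P (∈xs⇒ m)
      ; rep∈Class  = λ {k} _ → content-foot k
      ; admissible = λ {k} _ → χᵈ-admissible (level-even k)
      ; classify   = classify
      }
      where
      classify : ∀ {p} → p ∈ P →
        (Σ ℤ λ k → k ∈ xs × OnDiagonal (level k) p × (∀ {d} → IsAdmissible d → d p ≈ d (foot k)))
        ⊎ ((∀ {k} → k ∈ xs → ¬ OnDiagonal (level k) p) × (∀ {d} → IsAdmissible d → d p ≈ 0#))
      classify {i , j} p∈P = go (parity-of p∈P)
        where
        j≡ : ∀ t → i ℤ.+ j ≡ n ℤ.+ 1ℤ ℤ.+ (t ℤ.+ t) → j ≡ n ℤ.+ 1ℤ ℤ.+ (t ℤ.+ t) ℤ.- i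
        j≡ t eq = ≡.trans (lhs i j) (≡.cong (ℤ._- i) eq)
          where
          lhs : ∀ i j → j ≡ i ℤ.+ j ℤ.- i
          lhs i j = ℤsolve (i ∷ j ∷ [])
        on : ∀ t → i ℤ.+ j ≡ n ℤ.+ 1ℤ ℤ.+ (t ℤ.+ t) → i ℤ.- j ≡ level (i ℤ.- t ℤ.- 1ℤ)
        on t eq = ≡.trans (≡.cong (λ z → i ℤ.- z) (j≡ t eq)) (rhs n i t)
          where
          rhs : ∀ n i t → i ℤ.- (n ℤ.+ 1ℤ ℤ.+ (t ℤ.+ t) ℤ.- i) ≡ ℤ.+ 2 ℤ.* (i ℤ.- t ℤ.- 1ℤ) ℤ.+ 1ℤ ℤ.- n
          rhs n i t = ℤsolve (n ∷ i ∷ t ∷ [])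
        rep≡ : ∀ t → i ℤ.+ j ≡ n ℤ.+ 1ℤ ℤ.+ (t ℤ.+ t) → (i ℤ.- t , j ℤ.- t) ≡ foot (i ℤ.- t ℤ.- 1ℤ)
        rep≡ t eq = ≡.cong₂ _,_ (≡.sym (i-1+1≡i (i ℤ.- t))) (≡.trans (≡.cong (ℤ._- t) (j≡ t eq)) (rhs n i t))
          where
          rhs : ∀ n i t → n ℤ.+ 1ℤ ℤ.+ (t ℤ.+ t) ℤ.- i ℤ.- t ≡ n ℤ.- (i ℤ.- t ℤ.- 1ℤ)
          rhs n i t = ℤsolve (n ∷ i ∷ t ∷ [])
        label : ∀ t → 1ℤ ℤ.≤ i ℤ.- t → i ℤ.- t ℤ.≤ n → Label (i ℤ.- t ℤ.- 1ℤ)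
        label t h h′ = lower i t h , upper i t n h′
          where
          lower : ∀ i t → 1ℤ ℤ.≤ i ℤ.- t → 0ℤ ℤ.≤ i ℤ.- t ℤ.- 1ℤ
          lower i t h = ≤-by h (ℤsolve (i ∷ t ∷ []))
          upper : ∀ i t n → i ℤ.- t ℤ.≤ n → i ℤ.- t ℤ.- 1ℤ ℤ.≤ n ℤ.- 1ℤ
          upper i t n h = ≤-by h (ℤsolve (i ∷ t ∷ n ∷ []))
        go : (Σ ℕ λ t → i ℤ.+ j ≡ n ℤ.+ 1ℤ ℤ.+ (ℤ.+ t ℤ.+ ℤ.+ t)) ⊎ Odd (i , j) →
          (Σ ℤ λ k → k ∈ xs × OnDiagonal (level k) (i , j) × (∀ {d} → IsAdmissible d → d (i , j) ≈ d (foot k)))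
          ⊎ ((∀ {k} → k ∈ xs → ¬ OnDiagonal (level k) (i , j)) × (∀ {d} → IsAdmissible d → d (i , j) ≈ 0#))
        go (inj₂ odd) = inj₂ ((λ {k} _ c → ¬Even∧Odd {i , j} (even-on {p = i , j} (level-even k) c) odd)
                             , λ adm → odd-0 (λ p∈P _ → all-interior p∈P) adm {i , j} odd)
        go (inj₁ (t , eq)) = inj₁ (i ℤ.- ℤ.+ t ℤ.- 1ℤ
          , ⇒∈xs (label (ℤ.+ t) (InRegion.i≥ (∈⇒ (foot∈ t p∈P eq))) (InRegion.i≤ (∈⇒ (foot∈ t p∈P eq))))
          , on (ℤ.+ t) eq
          , λ {d} adm → trans (foot-value adm t p∈P eq (all-interior p∈P)) (reflexive (≡.cong d (rep≡ (ℤ.+ t) eq))))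

    𝒯-basis : IsWeightBasis xs (λ k → lap (χᵈ (level k)))
    𝒯-basis = Classes.isWeightBasis classes (injective (λ p∈P _ → all-interior p∈P))

-- Type B: even diagonals and points of the main diagonal

1≤2k⇒1≤k : ∀ k → 1ℤ ℤ.≤ ℤ.+ 2 ℤ.* k → 1ℤ ℤ.≤ k
1≤2k⇒1≤k k h = go (1ℤ ℤ.≤? k)
  where
  absurd : ∀ k → 1ℤ ℤ.≤ ℤ.+ 2 ℤ.* k → k ℤ.+ 1ℤ ℤ.≤ 1ℤ → ⊥
  absurd k h h′ = ≤-absurd {k = 0} (h ⊞ h′ ⊞ h′) (eq k)
    where
    eq : ∀ k → ℤ.+ 2 ℤ.* k ℤ.+ 1ℤ ℤ.+ 1ℤ ℤ.- (1ℤ ℤ.+ (k ℤ.+ 1ℤ) ℤ.+ (k ℤ.+ 1ℤ)) ≡ ℤ.-1ℤ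
    eq k = ℤsolve (k ∷ [])
  go : Dec (1ℤ ℤ.≤ k) → 1ℤ ℤ.≤ k
  go (yes 1≤k) = 1≤k
  go (no 1≰k)  = ⊥-elim (absurd k h (≰⇒+1≤ 1≰k))

module RootBWeights
  (R : CommutativeRing 0ℓ 0ℓ)
  (φ : ℚ-Algebra R)
  (n : ℤ) (1≤n : 1ℤ ℤ.≤ n) (P : List Point) (unique : Unique P)
  (∈⇒ : ∀ {i j} → (i , j) ∈ P → InRegion (ℤ.+ 2 ℤ.* n ℤ.- 1ℤ) (ℤ.+ 2 ℤ.* n ℤ.- 1ℤ) 0ℤ (ℤ.+ 2 ℤ.* n) (ℤ.+ 2 ℤ.* n ℤ.- 1ℤ ℤ.+ 1ℤ) i j)
  (⇒∈ : ∀ {i j} → InRegion (ℤ.+ 2 ℤ.* n ℤ.- 1ℤ) (ℤ.+ 2 ℤ.* n ℤ.- 1ℤ) 0ℤ (ℤ.+ 2 ℤ.* n) (ℤ.+ 2 ℤ.* n ℤ.- 1ℤ ℤ.+ 1ℤ) i j → (i , j) ∈ P) where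

  private
    nonempty : 0ℤ ℤ.+ 1ℤ ℤ.≤ ℤ.+ 2 ℤ.* n
    nonempty = ≤-by (1≤n ⊞ 1≤n ⊞ 0≤1) (ℤsolve (n ∷ []))

  open ParityRegion R φ (ℤ.+ 2 ℤ.* n ℤ.- 1ℤ) 0ℤ (ℤ.+ 2 ℤ.* n) P nonempty unique ∈⇒ ⇒∈ public
  open CommutativeRing R hiding (zero)
  open Toggles R φ P isLatticeRegion
  open Sums R φ

  double-even : ∀ k → EvenDiagonal (ℤ.+ 2 ℤ.* k)
  double-even k = k ℤ.- n , eq n k
    where
    eq : ∀ n k → ℤ.+ 2 ℤ.* k ≡ ℤ.+ 2 ℤ.* n ℤ.- 1ℤ ℤ.+ 1ℤ ℤ.+ (k ℤ.- n ℤ.+ (k ℤ.- n))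
    eq n k = ℤsolve (n ∷ k ∷ [])

  nonmain-interior : ∀ {p} → p ∈ P → content p ≢ 0ℤ → Interior (content p)
  nonmain-interior {i , j} p∈P k≢0 = <⇒+1≤ (ℤ.≤∧≢⇒< k≥ (λ eq → k≢0 (≡.sym eq))) , go
    where
    open InRegion (∈⇒ p∈P)
    go : i ℤ.- j ℤ.+ 1ℤ ℤ.≤ ℤ.+ 2 ℤ.* n
    go = ≤-by (i≤ ⊞ j≥ ⊞ 0≤1) (ℤsolve (i ∷ j ∷ n ∷ []))

  -- The only diagonal of the poset on the boundary of the content range is the main one, and its
  -- points are even.
  odd-interior : ∀ {p} → p ∈ P → Odd p → Interior (content p)
  odd-interior {p} p∈P odd = nonmain-interior p∈P (λ eq → ¬Even∧Odd {p} (even-on {p = p} (double-even 0ℤ) eq) odd)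

  Label : ℤ ⊎ ℤ → Set
  Label (inj₁ k) = 1ℤ ℤ.≤ k × k ℤ.≤ n ℤ.- 1ℤ
  Label (inj₂ i) = n ℤ.≤ i × i ℤ.≤ ℤ.+ 2 ℤ.* n ℤ.- 1ℤ

  -- A point of the main diagonal has no left neighbour in P, so admissible weights are free there
  -- and each such point is a class.
  Class : ℤ ⊎ ℤ → Pred Point 0ℓ
  Class (inj₁ k) p = content p ≡ ℤ.+ 2 ℤ.* k
  Class (inj₂ i) p = p ≡ (i , i)

  class? : ∀ x → Decidable (Class x)
  class? (inj₁ k) = onDiagonal? (ℤ.+ 2 ℤ.* k)
  class? (inj₂ i) = _≟ (i , i)

  foot : ℤ ⊎ ℤ → Point
  foot (inj₁ k) = n ℤ.+ k , n ℤ.- k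
  foot (inj₂ i) = i , i

  double-interior : ∀ {k} → Label (inj₁ k) → Interior (ℤ.+ 2 ℤ.* k)
  double-interior {k} (k≥ , k≤) = ≤-by (k≥ ⊞ k≥ ⊞ 0≤1) (ℤsolve (k ∷ [])) , ≤-by (k≤ ⊞ k≤ ⊞ 0≤1) (ℤsolve (k ∷ n ∷ []))

  main∈ : ∀ {i} → Label (inj₂ i) → (i , i) ∈ P
  main∈ {i} (i≥ , i≤) = ⇒∈ {i} {i} record
    { i≥ = ℤ.≤-trans 1≤n i≥ ; i≤ = i≤ ; j≥ = ℤ.≤-trans 1≤n i≥ ; j≤ = i≤
    ; k≥ = ℤ.≤-reflexive (≡.sym (ℤ.+-inverseʳ i))
    ; k≤ = ≤-by (1≤n ⊞ 1≤n ⊞ 0≤1 ⊞ 0≤1) (ℤsolve (i ∷ n ∷ []))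
    ; s≤ = ≤-by (i≥ ⊞ i≥) (ℤsolve (i ∷ n ∷ [])) }

  foot∈P : ∀ x → Label x → foot x ∈ P
  foot∈P (inj₂ i) label = main∈ label
  foot∈P (inj₁ k) (k≥ , k≤) = ⇒∈ {n ℤ.+ k} {n ℤ.- k} record
    { i≥ = ≤-by (1≤n ⊞ k≥ ⊞ 0≤1) (ℤsolve (k ∷ n ∷ []))
    ; i≤ = ≤-by k≤ (ℤsolve (k ∷ n ∷ []))
    ; j≥ = ≤-by k≤ (ℤsolve (k ∷ n ∷ []))
    ; j≤ = ≤-by (1≤n ⊞ k≥ ⊞ 0≤1) (ℤsolve (k ∷ n ∷ []))
    ; k≥ = ≤-by (k≥ ⊞ k≥ ⊞ 0≤1 ⊞ 0≤1) (ℤsolve (k ∷ n ∷ []))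
    ; k≤ = ≤-by (k≤ ⊞ k≤ ⊞ 0≤1 ⊞ 0≤1) (ℤsolve (k ∷ n ∷ []))
    ; s≤ = ≤-by 0≤0 (ℤsolve (k ∷ n ∷ []))
    }
    where
    0≤0 : 0ℤ ℤ.≤ 0ℤ
    0≤0 = ℤ.≤-refl

  content<0⇒∉ : ∀ {p} → content p ≡ ℤ.-1ℤ → p ∉ P
  content<0⇒∉ {p} eq p∈P = ≤-absurd {k = 0} (InRegion.k≥ (∈⇒ p∈P)) (≡.cong (λ z → z ℤ.- 0ℤ) eq)

  left∉ : ∀ {q} → content q ≡ 0ℤ → left q ∉ P
  left∉ {i , j} eq = content<0⇒∉ (≡.trans (i-1-j i j) (≡.cong (ℤ._- 1ℤ) eq))

  up∉ : ∀ {q} → content q ≡ 0ℤ → up q ∉ P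
  up∉ {i , j} eq = content<0⇒∉ (≡.trans (i-[j+1] i j) (≡.cong (ℤ._- 1ℤ) eq))

  χᵐ-admissible : ∀ i → IsAdmissible (λ p → 𝟙[ (p ∈? P) ×-dec (p ≟ (i , i)) ])
  χᵐ-admissible i = χ-admissible (_≟ (i , i)) λ {p} l d →
      (λ { ≡.refl → contradiction l (left∉ {p} (content-main i)) })
    , (λ eq → contradiction l (left∉ {p} (≡.trans (≡.sym (content-diag⁻ p)) (≡.trans (≡.cong content eq) (content-main i)))))

  module _ {xs : List (ℤ ⊎ ℤ)} (unique-xs : Unique xs)
           (∈xs⇒ : ∀ {x} → x ∈ xs → Label x) (⇒∈xs : ∀ {x} → Label x → x ∈ xs) where

    classes : Classes (ℤ ⊎ ℤ) xs
    classes = record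
      { unique-xs  = unique-xs
      ; Class      = Class
      ; class?     = class?
      ; disjoint   = λ {x} {y} → disjoint {x} {y}
      ; rep        = foot
      ; rep∈P      = λ {x} m → foot∈P x (∈xs⇒ m)
      ; rep∈Class  = λ {x} _ → foot∈Class x
      ; admissible = λ {x} _ → admissible x
      ; classify   = classify
      }
      where
      k≢0 : ∀ {k} → 1ℤ ℤ.≤ k → 0ℤ ≢ ℤ.+ 2 ℤ.* k
      k≢0 {k} 1≤k eq = ≤-absurd {k = 1} (ℤ.≤-reflexive (≡.sym eq) ⊞ 1≤k ⊞ 1≤k) (ℤsolve (k ∷ []))

      disjoint : ∀ {x y p} → x ∈ xs → y ∈ xs → Class x p → Class y p → x ≡ y
      disjoint {inj₁ k} {inj₁ l} _ _ c c′ = ≡.cong inj₁ (ℤ.*-cancelˡ-≡ (ℤ.+ 2) k l (≡.trans (≡.sym c) c′))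
      disjoint {inj₁ _} {inj₂ i} m _ c ≡.refl = contradiction (≡.trans (≡.sym (content-main i)) c) (k≢0 (proj₁ (∈xs⇒ m)))
      disjoint {inj₂ i} {inj₁ _} _ m ≡.refl c = contradiction (≡.trans (≡.sym (content-main i)) c) (k≢0 (proj₁ (∈xs⇒ m)))
      disjoint {inj₂ _} {inj₂ _} _ _ c c′ = ≡.cong (λ p → inj₂ (proj₁ p)) (≡.trans (≡.sym c) c′)

      foot∈Class : ∀ x → Class x (foot x)
      foot∈Class (inj₁ k) = eq n k
        where
        eq : ∀ n k → n ℤ.+ k ℤ.- (n ℤ.- k) ≡ ℤ.+ 2 ℤ.* k
        eq n k = ℤsolve (n ∷ k ∷ [])
      foot∈Class (inj₂ i) = ≡.refl

      admissible : ∀ x → IsAdmissible (λ p → 𝟙[ (p ∈? P) ×-dec class? x p ])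
      admissible (inj₁ k) = χᵈ-admissible (double-even k)
      admissible (inj₂ i) = χᵐ-admissible i

      Classified : Point → Set
      Classified p =
        (Σ (ℤ ⊎ ℤ) λ x → x ∈ xs × Class x p × (∀ {d} → IsAdmissible d → d p ≈ d (foot x)))
        ⊎ ((∀ {x} → x ∈ xs → ¬ Class x p) × (∀ {d} → IsAdmissible d → d p ≈ 0#))

      classify-main : ∀ {i j} → (i , j) ∈ P → i ℤ.- j ≡ 0ℤ → Classified (i , j)
      classify-main {i} {j} p∈P eq = inj₁ (inj₂ i , ⇒∈xs {inj₂ i} (n≤i , InRegion.i≤ (∈⇒ p∈P)) , main≡ {i , j} eq ,
          λ {d} _ → reflexive (≡.cong d (main≡ {i , j} eq)))
        where
        sum : ∀ n i j → ℤ.+ 2 ℤ.* n ℤ.- 1ℤ ℤ.+ 1ℤ ℤ.≤ i ℤ.+ j → 0ℤ ℤ.≤ i ℤ.- j → n ℤ.+ n ℤ.≤ i ℤ.+ i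
        sum n i j h h′ = ≤-by (h ⊞ h′) (ℤsolve (i ∷ j ∷ n ∷ []))
        n≤i : n ℤ.≤ i
        n≤i = i+i≤j+j⇒i≤j (sum n i j (InRegion.s≤ (∈⇒ p∈P)) (ℤ.≤-reflexive (≡.sym eq)))

      classify-odd : ∀ {i j} → i ℤ.- j ≢ 0ℤ → Odd (i , j) → Classified (i , j)
      classify-odd {i} {j} k≢0 odd = inj₂ ((λ {x} _ → none x) , λ adm → odd-0 odd-interior adm {i , j} odd)
        where
        none : ∀ x → ¬ Class x (i , j)
        none (inj₁ k) c     = ¬Even∧Odd {i , j} (even-on {p = i , j} (double-even k) c) odd
        none (inj₂ _) ≡.refl = k≢0 (content-main i)

      classify-even : ∀ {i j} t → (i , j) ∈ P → i ℤ.- j ≢ 0ℤ → i ℤ.+ j ≡ ℤ.+ 2 ℤ.* n ℤ.- 1ℤ ℤ.+ 1ℤ ℤ.+ (ℤ.+ t ℤ.+ ℤ.+ t) →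
                      Classified (i , j)
      classify-even {i} {j} t p∈P k≢0 eq = inj₁ (inj₁ k , ⇒∈xs {inj₁ k} label , on (ℤ.+ t) eq ,
          λ {d} adm → trans (foot-value adm t p∈P eq interior) (reflexive (≡.cong d (rep≡ (ℤ.+ t) eq))))
        where
        interior : Interior (i ℤ.- j)
        interior = nonmain-interior p∈P k≢0
        k : ℤ
        k = i ℤ.- n ℤ.- ℤ.+ t
        j≡ : ∀ t → i ℤ.+ j ≡ ℤ.+ 2 ℤ.* n ℤ.- 1ℤ ℤ.+ 1ℤ ℤ.+ (t ℤ.+ t) → j ≡ ℤ.+ 2 ℤ.* n ℤ.+ (t ℤ.+ t) ℤ.- i
        j≡ t eq = ≡.trans (lhs i j) (≡.trans (≡.cong (ℤ._- i) eq) (rhs n t i))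
          where
          lhs : ∀ i j → j ≡ i ℤ.+ j ℤ.- i
          lhs i j = ℤsolve (i ∷ j ∷ [])
          rhs : ∀ n t i → ℤ.+ 2 ℤ.* n ℤ.- 1ℤ ℤ.+ 1ℤ ℤ.+ (t ℤ.+ t) ℤ.- i ≡ ℤ.+ 2 ℤ.* n ℤ.+ (t ℤ.+ t) ℤ.- i
          rhs n t i = ℤsolve (n ∷ t ∷ i ∷ [])
        on : ∀ t → i ℤ.+ j ≡ ℤ.+ 2 ℤ.* n ℤ.- 1ℤ ℤ.+ 1ℤ ℤ.+ (t ℤ.+ t) → i ℤ.- j ≡ ℤ.+ 2 ℤ.* (i ℤ.- n ℤ.- t)
        on t eq = ≡.trans (≡.cong (λ z → i ℤ.- z) (j≡ t eq)) (rhs n i t)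
          where
          rhs : ∀ n i t → i ℤ.- (ℤ.+ 2 ℤ.* n ℤ.+ (t ℤ.+ t) ℤ.- i) ≡ ℤ.+ 2 ℤ.* (i ℤ.- n ℤ.- t)
          rhs n i t = ℤsolve (n ∷ i ∷ t ∷ [])
        rep≡ : ∀ t → i ℤ.+ j ≡ ℤ.+ 2 ℤ.* n ℤ.- 1ℤ ℤ.+ 1ℤ ℤ.+ (t ℤ.+ t) → (i ℤ.- t , j ℤ.- t) ≡ foot (inj₁ (i ℤ.- n ℤ.- t))
        rep≡ t eq = ≡.cong₂ _,_ (lhs n i t) (≡.trans (≡.cong (ℤ._- t) (j≡ t eq)) (rhs n i t))
          where
          lhs : ∀ n i t → i ℤ.- t ≡ n ℤ.+ (i ℤ.- n ℤ.- t)
          lhs n i t = ℤsolve (n ∷ i ∷ t ∷ [])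
          rhs : ∀ n i t → ℤ.+ 2 ℤ.* n ℤ.+ (t ℤ.+ t) ℤ.- i ℤ.- t ≡ n ℤ.- (i ℤ.- n ℤ.- t)
          rhs n i t = ℤsolve (n ∷ i ∷ t ∷ [])
        label : Label (inj₁ k)
        label = 1≤2k⇒1≤k _ (≡.subst (1ℤ ℤ.≤_) (on (ℤ.+ t) eq) (proj₁ interior))
              , go n (i ℤ.- n ℤ.- ℤ.+ t) (≡.subst (λ p → 1ℤ ℤ.≤ proj₂ p) (rep≡ (ℤ.+ t) eq) (InRegion.j≥ (∈⇒ (foot∈ t p∈P eq))))
          where
          go : ∀ n k → 1ℤ ℤ.≤ n ℤ.- k → k ℤ.≤ n ℤ.- 1ℤ
          go n k h = ≤-by h (ℤsolve (k ∷ n ∷ []))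

      classify : ∀ {p} → p ∈ P → Classified p
      classify {i , j} p∈P = main? (i ℤ.- j ℤ.≟ 0ℤ)
        where
        even? : i ℤ.- j ≢ 0ℤ → (Σ ℕ λ t → i ℤ.+ j ≡ ℤ.+ 2 ℤ.* n ℤ.- 1ℤ ℤ.+ 1ℤ ℤ.+ (ℤ.+ t ℤ.+ ℤ.+ t)) ⊎ Odd (i , j) →
                Classified (i , j)
        even? k≢0 (inj₁ (t , eq)) = classify-even t p∈P k≢0 eq
        even? k≢0 (inj₂ odd)      = classify-odd k≢0 odd
        main? : Dec (i ℤ.- j ≡ 0ℤ) → Classified (i , j)
        main? (yes eq) = classify-main p∈P eq
        main? (no k≢0) = even? k≢0 (parity-of p∈P)

    𝒯-basis : IsWeightBasis xs (λ x → lap (Classes.χ classes x))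
    𝒯-basis = Classes.isWeightBasis classes (injective odd-interior)

-- Label lists in the order of the statement

module Labels {ks is : List ℤ} (unique-ks : Unique ks) (unique-is : Unique is) where

  labels : List (ℤ ⊎ ℤ)
  labels = map inj₁ ks ++ map inj₂ is

  unique-labels : Unique labels
  unique-labels = Unique.++⁺ (Unique.map⁺ Sum.inj₁-injective unique-ks) (Unique.map⁺ Sum.inj₂-injective unique-is)
    λ (m , m′) → let _ , _ , eq = ∈-map⁻ inj₁ m ; _ , _ , eq′ = ∈-map⁻ inj₂ m′ in
      contradiction (≡.trans (≡.sym eq) eq′) λ ()

  module _ {Q : ℤ ⊎ ℤ → Set} where

    ∈-labels⁻ : (∀ {k} → k ∈ ks → Q (inj₁ k)) → (∀ {i} → i ∈ is → Q (inj₂ i)) → ∀ {x} → x ∈ labels → Q x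
    ∈-labels⁻ f g {x} m with ∈-++⁻ (map inj₁ ks) m
    ... | inj₁ m′ with ∈-map⁻ inj₁ m′
    ...   | _ , k∈ , ≡.refl = f k∈
    ∈-labels⁻ f g {x} m | inj₂ m′ with ∈-map⁻ inj₂ m′
    ...   | _ , i∈ , ≡.refl = g i∈

    ∈-labels⁺ : (∀ {k} → Q (inj₁ k) → k ∈ ks) → (∀ {i} → Q (inj₂ i) → i ∈ is) → ∀ {x} → Q x → x ∈ labels
    ∈-labels⁺ f g {inj₁ k} q = ∈-++⁺ˡ (∈-map⁺ inj₁ (f q))
    ∈-labels⁺ f g {inj₂ i} q = ∈-++⁺ʳ (map inj₁ ks) (∈-map⁺ inj₂ (g q))

_≟ˡ_ : DecidableEquality (ℤ ⊎ ℤ)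
_≟ˡ_ = Sum.≡-dec ℤ._≟_ ℤ._≟_

-- The interval from a to b, with its end points listed in various places.
module Ends (a b : ℤ) where

  lower upper : List ℤ
  lower = [ a ℤ.+ 1ℤ ⋯ b ]
  upper = [ a ℤ.+ 1ℤ ⋯ b ℤ.- 1ℤ ]

  a∉ : ∀ c → a ∉ [ a ℤ.+ 1ℤ ⋯ c ]
  a∉ c m = ≤-absurd {k = 0} (proj₁ (∈-interval⁻ (a ℤ.+ 1ℤ) c m)) (eq a)
    where
    eq : ∀ a → a ℤ.- (a ℤ.+ 1ℤ) ≡ ℤ.-1ℤ
    eq a = ℤsolve (a ∷ [])

  b∉ : ∀ c → b ∉ [ c ⋯ b ℤ.- 1ℤ ]
  b∉ c m = ≤-absurd {k = 0} (proj₂ (∈-interval⁻ c (b ℤ.- 1ℤ) m)) (eq b)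
    where
    eq : ∀ b → b ℤ.- 1ℤ ℤ.- b ≡ ℤ.-1ℤ
    eq b = ℤsolve (b ∷ [])

  lower⁻ : ∀ {i} → i ∈ lower → a ℤ.≤ i × i ℤ.≤ b
  lower⁻ m = let h , h′ = ∈-interval⁻ (a ℤ.+ 1ℤ) b m in ℤ.≤-trans (i≤i+1 a) h , h′

  lower⁺ : ∀ {i} → a ℤ.≤ i → i ℤ.≤ b → i ≢ a → i ∈ lower
  lower⁺ a≤i i≤b i≢a = ∈-interval⁺ (<⇒+1≤ (ℤ.≤∧≢⇒< a≤i (λ eq → i≢a (≡.sym eq)))) i≤b

  upper⁻ : ∀ {i} → i ∈ upper → a ℤ.≤ i × i ℤ.≤ b
  upper⁻ m = let h , h′ = ∈-interval⁻ (a ℤ.+ 1ℤ) (b ℤ.- 1ℤ) m in ℤ.≤-trans (i≤i+1 a) h , ℤ.≤-trans h′ (i-1≤i b)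

  upper⁺ : ∀ {i} → a ℤ.≤ i → i ℤ.≤ b → i ≢ a → i ≢ b → i ∈ upper
  upper⁺ a≤i i≤b i≢a i≢b = ∈-interval⁺ (<⇒+1≤ (ℤ.≤∧≢⇒< a≤i (λ eq → i≢a (≡.sym eq)))) (≤∧≢⇒≤-1 i≤b i≢b)

  module _ (a≤b : a ℤ.≤ b) where

    first⁻ : ∀ {i} → i ∈ a ∷ lower → a ℤ.≤ i × i ℤ.≤ b
    first⁻ (here ≡.refl) = ℤ.≤-refl , a≤b
    first⁻ (there m)     = lower⁻ m

    first⁺ : ∀ {i} → a ℤ.≤ i → i ℤ.≤ b → i ∈ a ∷ lower
    first⁺ {i} a≤i i≤b with i ℤ.≟ a
    ... | yes i≡a = here i≡a
    ... | no  i≢a = there (lower⁺ a≤i i≤b i≢a)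

    first-unique : Unique (a ∷ lower)
    first-unique = All.tabulate (λ { m ≡.refl → a∉ b m }) AllPairs.∷ unique-interval (a ℤ.+ 1ℤ) b

    last⁻ : ∀ {i} → i ∈ lower ++ a ∷ [] → a ℤ.≤ i × i ℤ.≤ b
    last⁻ m with ∈-++⁻ lower m
    ... | inj₁ m′           = lower⁻ m′
    ... | inj₂ (here ≡.refl) = ℤ.≤-refl , a≤b

    last⁺ : ∀ {i} → a ℤ.≤ i → i ℤ.≤ b → i ∈ lower ++ a ∷ []
    last⁺ {i} a≤i i≤b with i ℤ.≟ a
    ... | yes i≡a = ∈-++⁺ʳ lower (here i≡a)
    ... | no  i≢a = ∈-++⁺ˡ (lower⁺ a≤i i≤b i≢a)

    last-unique : Unique (lower ++ a ∷ [])
    last-unique = Unique.++⁺ (unique-interval (a ℤ.+ 1ℤ) b) (All.[] AllPairs.∷ AllPairs.[]) λ { (m , here ≡.refl) → a∉ b m }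

  -- The shifted staircase lists its lower end first, type B its upper end `2n - 1`; both orders are
  -- covered.
  Endpoints : ℤ → ℤ → Set
  Endpoints c d = (c ≡ a × d ≡ b) ⊎ (c ≡ b × d ≡ a)

  module _ (a<b : a ℤ.+ 1ℤ ℤ.≤ b) where

    private
      a≤b : a ℤ.≤ b
      a≤b = ℤ.≤-trans (i≤i+1 a) a<b

      a≢b : a ≢ b
      a≢b ≡.refl = ≤-absurd {k = 0} a<b (eq a)
        where
        eq : ∀ a → a ℤ.- (a ℤ.+ 1ℤ) ≡ ℤ.-1ℤ
        eq a = ℤsolve (a ∷ [])

    ends⁻ : ∀ {c d} → Endpoints c d → ∀ {i} → i ∈ upper ++ c ∷ d ∷ [] → a ℤ.≤ i × i ℤ.≤ b
    ends⁻ cd m with ∈-++⁻ upper m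
    ... | inj₁ m′ = upper⁻ m′
    ends⁻ (inj₁ (≡.refl , _)) m | inj₂ (here ≡.refl)         = ℤ.≤-refl , a≤b
    ends⁻ (inj₂ (≡.refl , _)) m | inj₂ (here ≡.refl)         = a≤b , ℤ.≤-refl
    ends⁻ (inj₁ (_ , ≡.refl)) m | inj₂ (there (here ≡.refl)) = a≤b , ℤ.≤-refl
    ends⁻ (inj₂ (_ , ≡.refl)) m | inj₂ (there (here ≡.refl)) = ℤ.≤-refl , a≤b

    ends⁺ : ∀ {c d} → Endpoints c d → ∀ {i} → a ℤ.≤ i → i ℤ.≤ b → i ∈ upper ++ c ∷ d ∷ []
    ends⁺ cd {i} a≤i i≤b with i ℤ.≟ a | i ℤ.≟ b
    ... | no i≢a | no i≢b = ∈-++⁺ˡ (upper⁺ a≤i i≤b i≢a i≢b)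
    ends⁺ (inj₁ (≡.refl , _)) a≤i i≤b | yes eq | _      = ∈-++⁺ʳ upper (here eq)
    ends⁺ (inj₂ (_ , ≡.refl)) a≤i i≤b | yes eq | _      = ∈-++⁺ʳ upper (there (here eq))
    ends⁺ (inj₁ (_ , ≡.refl)) a≤i i≤b | no _   | yes eq = ∈-++⁺ʳ upper (there (here eq))
    ends⁺ (inj₂ (≡.refl , _)) a≤i i≤b | no _   | yes eq = ∈-++⁺ʳ upper (here eq)

    ends-unique : ∀ {c d} → Endpoints c d → Unique (upper ++ c ∷ d ∷ [])
    ends-unique {c} {d} cd = Unique.++⁺ (unique-interval (a ℤ.+ 1ℤ) (b ℤ.- 1ℤ))
        ((c≢d cd All.∷ All.[]) AllPairs.∷ (All.[] AllPairs.∷ AllPairs.[]))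
        λ { (m , here ≡.refl) → proj₁ (∉ cd) m ; (m , there (here ≡.refl)) → proj₂ (∉ cd) m }
      where
      c≢d : ∀ {c d} → Endpoints c d → c ≢ d
      c≢d (inj₁ (≡.refl , ≡.refl)) = a≢b
      c≢d (inj₂ (≡.refl , ≡.refl)) = λ eq → a≢b (≡.sym eq)
      ∉ : ∀ {c d} → Endpoints c d → c ∉ upper × d ∉ upper
      ∉ (inj₁ (≡.refl , ≡.refl)) = a∉ (b ℤ.- 1ℤ) , b∉ (a ℤ.+ 1ℤ)
      ∉ (inj₂ (≡.refl , ≡.refl)) = b∉ (a ℤ.+ 1ℤ) , a∉ (b ℤ.- 1ℤ)

-- Coordinate descriptions of the other three posets

module ShiftedStaircasePoset (n : ℕ) where

  private
    N : ℤ
    N = ℤ.+ suc (suc n)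

  unique-poset : Unique (ShiftedStaircase.poset N)
  unique-poset = Unique.filter⁺ (λ (i , j) → i ℤ.≤? j)
    (Unique.cartesianProduct⁺ (unique-interval 1ℤ N) (unique-interval 1ℤ N))

  ∈⇒ : ∀ {i j} → (i , j) ∈ ShiftedStaircase.poset N → InRegion N N (ℤ.- N) 0ℤ 2ℤ i j
  ∈⇒ {i} {j} p∈P =
    let p∈ , i≤j = ∈-filter⁻ (λ (i , j) → i ℤ.≤? j) {xs = cartesianProduct [ 1ℤ ⋯ N ] [ 1ℤ ⋯ N ]} p∈P
        i∈ , j∈ = ∈-cartesianProduct⁻ [ 1ℤ ⋯ N ] [ 1ℤ ⋯ N ] p∈
        i≥ , i≤ = ∈-interval⁻ 1ℤ N i∈
        j≥ , j≤ = ∈-interval⁻ 1ℤ N j∈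
    in go N i≥ i≤ j≥ j≤ i≤j
    where
    go : ∀ n → 1ℤ ℤ.≤ i → i ℤ.≤ n → 1ℤ ℤ.≤ j → j ℤ.≤ n → i ℤ.≤ j → InRegion n n (ℤ.- n) 0ℤ 2ℤ i j
    go n i≥ i≤ j≥ j≤ i≤j = record
      { i≥ = i≥ ; i≤ = i≤ ; j≥ = j≥ ; j≤ = j≤
      ; k≥ = ≤-by (i≥ ⊞ j≤ ⊞ 0≤1) (ℤsolve (i ∷ j ∷ n ∷ []))
      ; k≤ = ≤-by i≤j (ℤsolve (i ∷ j ∷ []))
      ; s≤ = i≥ ⊞ j≥ }

  ⇒∈ : ∀ {i j} → InRegion N N (ℤ.- N) 0ℤ 2ℤ i j → (i , j) ∈ ShiftedStaircase.poset N
  ⇒∈ {i} {j} p = ∈-filter⁺ (λ (i , j) → i ℤ.≤? j) (∈-cartesianProduct⁺ (∈-interval⁺ i≥ i≤) (∈-interval⁺ j≥ j≤))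
    (ℤ.i-j≤0⇒i≤j k≤)
    where open InRegion p

module RootPosetAPoset (n : ℤ) where

  private
    Q : Point → Set
    Q (i , j) = n ℤ.+ 1ℤ ℤ.≤ i ℤ.+ j

    Q? : Decidable Q
    Q? (i , j) = n ℤ.+ 1ℤ ℤ.≤? i ℤ.+ j

  unique-poset : Unique (RootPosetA.poset n)
  unique-poset = Unique.filter⁺ Q? (Unique.cartesianProduct⁺ (unique-interval 1ℤ n) (unique-interval 1ℤ n))

  ∈⇒ : ∀ {i j} → (i , j) ∈ RootPosetA.poset n → InRegion n n (ℤ.- n) n (n ℤ.+ 1ℤ) i j
  ∈⇒ {i} {j} p∈P =
    let p∈ , sum≥ = ∈-filter⁻ Q? {xs = cartesianProduct [ 1ℤ ⋯ n ] [ 1ℤ ⋯ n ]} p∈P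
        i∈ , j∈ = ∈-cartesianProduct⁻ [ 1ℤ ⋯ n ] [ 1ℤ ⋯ n ] p∈
        i≥ , i≤ = ∈-interval⁻ 1ℤ n i∈
        j≥ , j≤ = ∈-interval⁻ 1ℤ n j∈
    in go i≥ i≤ j≥ j≤ sum≥
    where
    go : 1ℤ ℤ.≤ i → i ℤ.≤ n → 1ℤ ℤ.≤ j → j ℤ.≤ n → n ℤ.+ 1ℤ ℤ.≤ i ℤ.+ j → InRegion n n (ℤ.- n) n (n ℤ.+ 1ℤ) i j
    go i≥ i≤ j≥ j≤ sum≥ = record
      { i≥ = i≥ ; i≤ = i≤ ; j≥ = j≥ ; j≤ = j≤
      ; k≥ = ≤-by (i≥ ⊞ j≤ ⊞ 0≤1) (ℤsolve (i ∷ j ∷ n ∷ []))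
      ; k≤ = ≤-by (i≤ ⊞ j≥ ⊞ 0≤1) (ℤsolve (i ∷ j ∷ n ∷ []))
      ; s≤ = sum≥ }

  ⇒∈ : ∀ {i j} → InRegion n n (ℤ.- n) n (n ℤ.+ 1ℤ) i j → (i , j) ∈ RootPosetA.poset n
  ⇒∈ p = ∈-filter⁺ Q? (∈-cartesianProduct⁺ (∈-interval⁺ i≥ i≤) (∈-interval⁺ j≥ j≤)) s≤
    where open InRegion p

module RootPosetBPoset (n : ℤ) where

  private
    top : ℤ
    top = ℤ.+ 2 ℤ.* n ℤ.- 1ℤ

    Q : Point → Set
    Q (i , j) = j ℤ.≤ i × ℤ.+ 2 ℤ.* n ℤ.≤ i ℤ.+ j

    Q? : Decidable Q
    Q? (i , j) = (j ℤ.≤? i) ×-dec (ℤ.+ 2 ℤ.* n ℤ.≤? i ℤ.+ j)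

  unique-poset : Unique (RootPosetB.poset n)
  unique-poset = Unique.filter⁺ Q? (Unique.cartesianProduct⁺ (unique-interval 1ℤ top) (unique-interval 1ℤ top))

  ∈⇒ : ∀ {i j} → (i , j) ∈ RootPosetB.poset n →
       InRegion (ℤ.+ 2 ℤ.* n ℤ.- 1ℤ) (ℤ.+ 2 ℤ.* n ℤ.- 1ℤ) 0ℤ (ℤ.+ 2 ℤ.* n) (ℤ.+ 2 ℤ.* n ℤ.- 1ℤ ℤ.+ 1ℤ) i j
  ∈⇒ {i} {j} p∈P =
    let p∈ , j≤i , sum≥ = ∈-filter⁻ Q? {xs = cartesianProduct [ 1ℤ ⋯ top ] [ 1ℤ ⋯ top ]} p∈P
        i∈ , j∈ = ∈-cartesianProduct⁻ [ 1ℤ ⋯ top ] [ 1ℤ ⋯ top ] p∈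
        i≥ , i≤ = ∈-interval⁻ 1ℤ top i∈
        j≥ , j≤ = ∈-interval⁻ 1ℤ top j∈
    in go i≥ i≤ j≥ j≤ j≤i sum≥
    where
    go : 1ℤ ℤ.≤ i → i ℤ.≤ ℤ.+ 2 ℤ.* n ℤ.- 1ℤ → 1ℤ ℤ.≤ j → j ℤ.≤ ℤ.+ 2 ℤ.* n ℤ.- 1ℤ → j ℤ.≤ i → ℤ.+ 2 ℤ.* n ℤ.≤ i ℤ.+ j →
         InRegion (ℤ.+ 2 ℤ.* n ℤ.- 1ℤ) (ℤ.+ 2 ℤ.* n ℤ.- 1ℤ) 0ℤ (ℤ.+ 2 ℤ.* n) (ℤ.+ 2 ℤ.* n ℤ.- 1ℤ ℤ.+ 1ℤ) i j
    go i≥ i≤ j≥ j≤ j≤i sum≥ = record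
      { i≥ = i≥ ; i≤ = i≤ ; j≥ = j≥ ; j≤ = j≤
      ; k≥ = ≤-by j≤i (ℤsolve (i ∷ j ∷ []))
      ; k≤ = ≤-by (i≤ ⊞ j≥ ⊞ 0≤1 ⊞ 0≤1) (ℤsolve (i ∷ j ∷ n ∷ []))
      ; s≤ = ≤-by sum≥ (ℤsolve (i ∷ j ∷ n ∷ [])) }

  ⇒∈ : ∀ {i j} → InRegion (ℤ.+ 2 ℤ.* n ℤ.- 1ℤ) (ℤ.+ 2 ℤ.* n ℤ.- 1ℤ) 0ℤ (ℤ.+ 2 ℤ.* n) (ℤ.+ 2 ℤ.* n ℤ.- 1ℤ ℤ.+ 1ℤ) i j →
       (i , j) ∈ RootPosetB.poset n
  ⇒∈ {i} {j} p = ∈-filter⁺ Q? (∈-cartesianProduct⁺ (∈-interval⁺ i≥ i≤) (∈-interval⁺ j≥ j≤))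
    (ℤ.0≤i-j⇒j≤i k≥ , go s≤)
    where
    open InRegion p
    go : ℤ.+ 2 ℤ.* n ℤ.- 1ℤ ℤ.+ 1ℤ ℤ.≤ i ℤ.+ j → ℤ.+ 2 ℤ.* n ℤ.≤ i ℤ.+ j
    go h = ≤-by h (ℤsolve (i ∷ j ∷ n ∷ []))

-- The two bases for the shifted staircase

module ShiftedTheorem
  (R : CommutativeRing 0ℓ 0ℓ)
  (φ : ℚ-Algebra R)
  (n : ℕ) (P : List Point) (unique-P : Unique P)
  (∈⇒ : ∀ {i j} → (i , j) ∈ P → InRegion (ℤ.+ suc (suc n)) (ℤ.+ suc (suc n)) (ℤ.- (ℤ.+ suc (suc n))) 0ℤ 2ℤ i j)
  (⇒∈ : ∀ {i j} → InRegion (ℤ.+ suc (suc n)) (ℤ.+ suc (suc n)) (ℤ.- (ℤ.+ suc (suc n))) 0ℤ 2ℤ i j → (i , j) ∈ P) where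

  open CommutativeRing R hiding (zero)
  open OrderIdeals P using (𝒥)
  open LinearAlgebra using (IsBasis)
  open Transfer R φ P
  open ShiftedWeights R φ n P unique-P ∈⇒ ⇒∈
  open Toggles R φ P isLatticeRegion using (module ToggleabilitySpace)
  open Families R φ 𝒥 using (lists-map; lists-reindex)

  private
    N : ℤ
    N = ℤ.+ suc (suc n)

    offDiagonals : List ℤ
    offDiagonals = [ 1ℤ ℤ.- N ⋯ ℤ.-1ℤ ]

    unique-off : Unique offDiagonals
    unique-off = unique-interval (1ℤ ℤ.- N) ℤ.-1ℤ

    off⁻ : ∀ {k} → k ∈ offDiagonals → Label (inj₁ k)
    off⁻ {k} k∈ = let k≥ , k≤ = ∈-interval⁻ (1ℤ ℤ.- N) ℤ.-1ℤ k∈ in go N k≥ k≤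
      where
      go : ∀ n → 1ℤ ℤ.- n ℤ.≤ k → k ℤ.≤ ℤ.-1ℤ → ℤ.- n ℤ.+ 1ℤ ℤ.≤ k × k ℤ.+ 1ℤ ℤ.≤ 0ℤ
      go n k≥ k≤ = ≤-by k≥ (ℤsolve (k ∷ n ∷ [])) , ℤ.+-monoˡ-≤ 1ℤ k≤

    off⁺ : ∀ {k} → Label (inj₁ k) → k ∈ offDiagonals
    off⁺ {k} (k≥ , k≤) = let k≥′ , k≤′ = go N k≥ k≤ in ∈-interval⁺ k≥′ k≤′
      where
      go : ∀ n → ℤ.- n ℤ.+ 1ℤ ℤ.≤ k → k ℤ.+ 1ℤ ℤ.≤ 0ℤ → 1ℤ ℤ.- n ℤ.≤ k × k ℤ.≤ ℤ.-1ℤ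
      go n k≥ k≤ = ≤-by k≥ (ℤsolve (k ∷ n ∷ [])) , ≡.subst (ℤ._≤ ℤ.-1ℤ) (i+1-1≡i k) (ℤ.+-monoˡ-≤ ℤ.-1ℤ k≤)

    open Ends 1ℤ N

    1≤N : 1ℤ ℤ.≤ N
    1≤N = +≤+ (ℕ.s≤s z≤n)

    2≤N : 1ℤ ℤ.+ 1ℤ ℤ.≤ N
    2≤N = +≤+ (ℕ.s≤s (ℕ.s≤s z≤n))

    off≢corner : ∀ {k} → k ∈ offDiagonals → content (1ℤ , 1ℤ) ≢ k
    off≢corner k∈ ≡.refl = ≤-absurd {k = 0} (proj₂ (off⁻ k∈)) ≡.refl

  B₁-basis : ∀ {M} (eq : functionsOver ≡ M) → let open Module M in
    ∀ {one′ 𝟏′ 𝒯′} → Agrees eq one′ 𝟏′ 𝒯′ →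
    (v : ℤ → Carrierᴹ) → (∀ k → sumᴹ eq 𝒯′ (onDiagonal? k) ≈ᴹ v k) →
    (v₁ : Carrierᴹ) → 𝒯′ (1ℤ , 1ℤ) +ᴹ -ᴹ one′ ≈ᴹ v₁ →
    IsBasis M (I_Tᴹ eq one′ 𝟏′ 𝒯′)
      (map v [ 1ℤ ℤ.- (ℤ.+ suc (suc n)) ⋯ ℤ.-1ℤ ] ++ map (λ i → 𝒯′ (i , i)) [ ℤ.+ 2 ⋯ ℤ.+ suc (suc n) ] ++ v₁ ∷ [])
  B₁-basis ≡.refl {one′} {𝟏′} {𝒯′} agrees v v≈ v₁ v₁≈ = weightBasis⇒isBasis _≟ˡ_ unique-labels
      (𝒯-basis unique-labels
        (∈-labels⁻ {Label} off⁻ (last⁻ 1≤N))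
        (λ {x} → ∈-labels⁺ {Label} off⁺ (λ (i≥ , i≤) → last⁺ 1≤N i≥ i≤) {x}))
      (++⁺ (lists-reindex inj₁ (lists-map _ v offDiagonals (λ {k} k∈ I → trans (𝒰-sum (onDiagonal? k) (χᵈ-admissible k)
             (minimals-0 (onDiagonal? k) (λ p∈P c → nonminimal p∈P (λ { ≡.refl → off≢corner k∈ c }))) I) (v≈ k I))))
           (lists-reindex inj₂ (++⁺
             (lists-map _ (λ i → 𝒯′ (i , i)) lower (λ {i} i∈ I → trans (𝒰-point (χᵐ-admissible i) (main∈′ i∈) I)
               (𝒰-nonminimal (nonminimal (main∈′ i∈) (λ eq → a∉ N (≡.subst (_∈ lower) (≡.cong proj₁ eq) i∈))) I)))
             ((λ I → trans (𝒰-point (χᵐ-admissible 1ℤ) 1∈ I) (trans (𝒰-minimal left-1∉ down-1∉ I) (v₁≈ I)))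
               Pointwise.∷ Pointwise.[]))))
    where
    open Agrees agrees
    open ToggleabilitySpace one′ 𝟏′ 𝒯′ one≈ 𝟏≈ 𝒯≈
    open ClassSums R φ P isLatticeRegion one′ 𝟏′ 𝒯′ one≈ 𝟏≈ 𝒯≈
    open Labels unique-off (last-unique 1≤N)
    main∈′ : ∀ {i} → i ∈ lower → (i , i) ∈ P
    main∈′ i∈ = main∈ (proj₁ (lower⁻ i∈)) (proj₂ (lower⁻ i∈))

  -- The two end elements are the general one with a term missing: `left (1,1)` and `up (N,N)` lie
  -- outside P, and their indicators are zero.
  B₂-basis : ∀ {M} (eq : functionsOver ≡ M) → let open Module M in
    ∀ {one′ 𝟏′ 𝒯′} → Agrees eq one′ 𝟏′ 𝒯′ →
    (v : ℤ → Carrierᴹ) → (∀ k → sumᴹ eq 𝟏′ (onDiagonal? k) ≈ᴹ v k) →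
    (u : ℤ → Carrierᴹ) → (∀ i → (1# + 1#) *ₗ 𝟏′ (i , i) +ᴹ -ᴹ 𝟏′ (left (i , i)) +ᴹ -ᴹ 𝟏′ (up (i , i)) ≈ᴹ u i) →
    (v₁ : Carrierᴹ) → (1# + 1#) *ₗ 𝟏′ (1ℤ , 1ℤ) +ᴹ -ᴹ 𝟏′ (up (1ℤ , 1ℤ)) ≈ᴹ v₁ →
    (let N = ℤ.+ suc (suc n)) →
    (v₂ : Carrierᴹ) → (1# + 1#) *ₗ 𝟏′ (N , N) +ᴹ -ᴹ 𝟏′ (left (N , N)) ≈ᴹ v₂ →
    IsBasis M (I_Tᴹ eq one′ 𝟏′ 𝒯′) (map v [ 1ℤ ℤ.- N ⋯ ℤ.-1ℤ ] ++ map u [ ℤ.+ 2 ⋯ N ℤ.- 1ℤ ] ++ v₁ ∷ v₂ ∷ [])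
  B₂-basis ≡.refl {one′} {𝟏′} {𝒯′} agrees v v≈ u u≈ v₁ v₁≈ v₂ v₂≈ = weightBasis⇒isBasis _≟ˡ_ unique-labels
      (mixed-basis unique-labels (∈-labels⁻ {Label} off⁻ (ends⁻ 2≤N ends)) (λ {x} → ∈-labels⁺ {Label} off⁺ (λ (i≥ , i≤) → ends⁺ 2≤N ends i≥ i≤) {x}))
      (++⁺ (lists-reindex inj₁ (lists-map _ v offDiagonals (λ {k} _ I → trans (weighted-𝟙 (onDiagonal? k) I) (v≈ k I))))
           (lists-reindex inj₂ (++⁺
             (lists-map _ u upper (λ {i} i∈ I → trans (point (upper⁻ i∈) I) (u≈ i I)))
             ((λ I → trans (point (ℤ.≤-refl , 1≤N) I) (trans (+-congʳ (trans (+-congˡ (vanish left-1∉ I)) (+-identityʳ _))) (v₁≈ I)))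
               Pointwise.∷ ((λ I → trans (point (1≤N , ℤ.≤-refl) I) (trans (trans (+-congˡ (vanish up-N∉ I)) (+-identityʳ _)) (v₂≈ I)))
               Pointwise.∷ Pointwise.[])))))
    where
    open Agrees agrees
    open ToggleabilitySpace one′ 𝟏′ 𝒯′ one≈ 𝟏≈ 𝒯≈
    open ClassSums R φ P isLatticeRegion one′ 𝟏′ 𝒯′ one≈ 𝟏≈ 𝒯≈
    ends : Endpoints 1ℤ N
    ends = inj₁ (≡.refl , ≡.refl)
    open Labels unique-off (ends-unique 2≤N ends)
    open Toggles R φ P isLatticeRegion using (𝟏; weighted; lap; 𝟏-∉)
    open RingProperties ring using (-0#≈0#)
    point : ∀ {i} → 1ℤ ℤ.≤ i × i ℤ.≤ N → ∀ I → weighted (λ q → - lap (indicator (_≟ (i , i))) q) 𝟏 I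
            ≈ (1# + 1#) * 𝟏′ (i , i) I + - 𝟏′ (left (i , i)) I + - 𝟏′ (up (i , i)) I
    point {i} (i≥ , i≤) I = trans (weighted-neg (lap (indicator (_≟ (i , i)))) I) (trans
      (-‿cong (𝒰-point (χᵐ-admissible i) (main∈ i≥ i≤) I))
      (-𝒰-left-up (main∈ i≥ i≤) (right∉ {i , i} (content-main i)) (down∉ {i , i} (content-main i)) I))
    vanish : ∀ {p} → p ∉ P → ∀ I → - 𝟏′ p I ≈ 0#
    vanish {p} p∉P I = trans (-‿cong (trans (sym (𝟏≈ p I)) (𝟏-∉ I p∉P))) -0#≈0#
    up-N∉ : up (N , N) ∉ P
    up-N∉ u∈P = go N (InRegion.j≤ (∈⇒ u∈P))
      where
      go : ∀ n → ¬ (n ℤ.+ 1ℤ ℤ.≤ n)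
      go n h = ≤-absurd {k = 0} h (ℤsolve (n ∷ []))

-- The two bases for type A

module RootATheorem
  (R : CommutativeRing 0ℓ 0ℓ)
  (φ : ℚ-Algebra R)
  (n : ℤ) (1≤n : 1ℤ ℤ.≤ n) (P : List Point) (unique-P : Unique P)
  (∈⇒ : ∀ {i j} → (i , j) ∈ P → InRegion n n (ℤ.- n) n (n ℤ.+ 1ℤ) i j)
  (⇒∈ : ∀ {i j} → InRegion n n (ℤ.- n) n (n ℤ.+ 1ℤ) i j → (i , j) ∈ P) where

  open CommutativeRing R hiding (zero)
  open OrderIdeals P using (𝒥)
  open LinearAlgebra using (IsBasis)
  open Transfer R φ P
  open RootAWeights R φ n 1≤n P unique-P ∈⇒ ⇒∈
  open Toggles R φ P isLatticeRegion using (module ToggleabilitySpace; IsWeightBasis-neg; IsWeightBasis-resp)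
  open Families R φ 𝒥 using (lists-map)

  private
    levels : List ℤ
    levels = [ 0ℤ ⋯ n ℤ.- 1ℤ ]

    unique-levels : Unique levels
    unique-levels = unique-interval 0ℤ (n ℤ.- 1ℤ)

    levels⁻ : ∀ {k} → k ∈ levels → Label k
    levels⁻ = ∈-interval⁻ 0ℤ (n ℤ.- 1ℤ)

    levels⁺ : ∀ {k} → Label k → k ∈ levels
    levels⁺ (k≥ , k≤) = ∈-interval⁺ k≥ k≤

    foot-sum : ∀ k → k ℤ.+ 1ℤ ℤ.+ (n ℤ.- k) ≡ n ℤ.+ 1ℤ
    foot-sum k = eq n k
      where
      eq : ∀ n k → k ℤ.+ 1ℤ ℤ.+ (n ℤ.- k) ≡ n ℤ.+ 1ℤ
      eq n k = ℤsolve (n ∷ k ∷ [])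

  -- Each even diagonal contains exactly one minimal element, its `foot`, so its toggles sum to 1 at
  -- the empty ideal and every element carries the constant -1.
  B₁-basis : ∀ {M} (eq : functionsOver ≡ M) → let open Module M in
    ∀ {one′ 𝟏′ 𝒯′} → Agrees eq one′ 𝟏′ 𝒯′ →
    (v : ℤ → Carrierᴹ) → (∀ k → -ᴹ one′ +ᴹ sumᴹ eq 𝒯′ (onDiagonal? (ℤ.+ 2 ℤ.* k ℤ.+ 1ℤ ℤ.- n)) ≈ᴹ v k) →
    IsBasis M (I_Tᴹ eq one′ 𝟏′ 𝒯′) (map v [ 0ℤ ⋯ n ℤ.- 1ℤ ])
  B₁-basis ≡.refl {one′} {𝟏′} {𝒯′} agrees v v≈ = weightBasis⇒isBasis ℤ._≟_ unique-levels
      (𝒯-basis unique-levels levels⁻ levels⁺)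
      (lists-map _ v levels (λ {k} k∈ I → trans (𝒰-sum-1 (onDiagonal? (level k)) (χᵈ-admissible (level-even k))
        (minimals-1 (onDiagonal? (level k)) (foot∈P (levels⁻ k∈)) (content-foot k)
          (foot-left∉ {k ℤ.+ 1ℤ} (foot-sum k)) (foot-down∉ (foot-sum k))
          (λ p∈P c p≢ → nonfoot p∈P (all-interior p∈P) (≡.trans c (≡.sym (content-foot k))) (foot-sum k) p≢)) I) (v≈ k I)))
    where
    open Agrees agrees
    open ToggleabilitySpace one′ 𝟏′ 𝒯′ one≈ 𝟏≈ 𝒯≈
    open ClassSums R φ P isLatticeRegion one′ 𝟏′ 𝒯′ one≈ 𝟏≈ 𝒯≈

  -- By `neg-lap-χᵈ` the negated weight of an even diagonal is twice its indicator minus the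
  -- indicators of both neighbouring diagonals.
  B₂-basis : ∀ {M} (eq : functionsOver ≡ M) → let open Module M in
    ∀ {one′ 𝟏′ 𝒯′} → Agrees eq one′ 𝟏′ 𝒯′ →
    (w : Point → Carrierᴹ) → (∀ p → (1# + 1#) *ₗ 𝟏′ p ≈ᴹ w p) →
    (v : ℤ → Carrierᴹ) →
    (∀ k → sumᴹ eq w (onDiagonal? (ℤ.+ 2 ℤ.* k ℤ.+ 1ℤ ℤ.- n))
           +ᴹ -ᴹ sumᴹ eq 𝟏′ (onDiagonal? (ℤ.+ 2 ℤ.* k ℤ.+ ℤ.+ 2 ℤ.- n))
           +ᴹ -ᴹ sumᴹ eq 𝟏′ (onDiagonal? (ℤ.+ 2 ℤ.* k ℤ.- n)) ≈ᴹ v k) →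
    IsBasis M (I_Tᴹ eq one′ 𝟏′ 𝒯′) (map v [ 0ℤ ⋯ n ℤ.- 1ℤ ])
  B₂-basis ≡.refl {one′} {𝟏′} {𝒯′} agrees w w≈ v v≈ = weightBasis⇒isBasis ℤ._≟_ unique-levels
      (IsWeightBasis-resp (λ {k} k∈ q∈P → sym (neg-lap-χᵈ (level-interior (levels⁻ k∈)) (level-even k) (next k) (previous k) q∈P))
        (IsWeightBasis-neg (𝒯-basis unique-levels levels⁻ levels⁺)))
      (lists-map _ v levels (λ {k} _ I → trans
        (weighted-second-difference w≈ (onDiagonal? (level k)) (onDiagonal? (ℤ.+ 2 ℤ.* k ℤ.+ ℤ.+ 2 ℤ.- n)) (onDiagonal? (ℤ.+ 2 ℤ.* k ℤ.- n)) I)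
        (v≈ k I)))
    where
    open Agrees agrees
    open ToggleabilitySpace one′ 𝟏′ 𝒯′ one≈ 𝟏≈ 𝒯≈
    open ClassSums R φ P isLatticeRegion one′ 𝟏′ 𝒯′ one≈ 𝟏≈ 𝒯≈
    next : ∀ k → ℤ.+ 2 ℤ.* k ℤ.+ ℤ.+ 2 ℤ.- n ≡ level k ℤ.+ 1ℤ
    next k = eq n k
      where
      eq : ∀ n k → ℤ.+ 2 ℤ.* k ℤ.+ ℤ.+ 2 ℤ.- n ≡ ℤ.+ 2 ℤ.* k ℤ.+ 1ℤ ℤ.- n ℤ.+ 1ℤ
      eq n k = ℤsolve (n ∷ k ∷ [])
    previous : ∀ k → ℤ.+ 2 ℤ.* k ℤ.- n ≡ level k ℤ.- 1ℤ
    previous k = eq n k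
      where
      eq : ∀ n k → ℤ.+ 2 ℤ.* k ℤ.- n ≡ ℤ.+ 2 ℤ.* k ℤ.+ 1ℤ ℤ.- n ℤ.- 1ℤ
      eq n k = ℤsolve (n ∷ k ∷ [])

-- The two bases for type B

module RootBTheorem
  (R : CommutativeRing 0ℓ 0ℓ)
  (φ : ℚ-Algebra R)
  (n : ℤ) (2≤n : 1ℤ ℤ.+ 1ℤ ℤ.≤ n) (P : List Point) (unique-P : Unique P)
  (∈⇒ : ∀ {i j} → (i , j) ∈ P → InRegion (ℤ.+ 2 ℤ.* n ℤ.- 1ℤ) (ℤ.+ 2 ℤ.* n ℤ.- 1ℤ) 0ℤ (ℤ.+ 2 ℤ.* n) (ℤ.+ 2 ℤ.* n ℤ.- 1ℤ ℤ.+ 1ℤ) i j)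
  (⇒∈ : ∀ {i j} → InRegion (ℤ.+ 2 ℤ.* n ℤ.- 1ℤ) (ℤ.+ 2 ℤ.* n ℤ.- 1ℤ) 0ℤ (ℤ.+ 2 ℤ.* n) (ℤ.+ 2 ℤ.* n ℤ.- 1ℤ ℤ.+ 1ℤ) i j → (i , j) ∈ P) where

  open CommutativeRing R hiding (zero)
  open OrderIdeals P using (𝒥)
  open LinearAlgebra using (IsBasis)
  open Transfer R φ P
  private
    top : ℤ
    top = ℤ.+ 2 ℤ.* n ℤ.- 1ℤ

    1≤n : 1ℤ ℤ.≤ n
    1≤n = ℤ.≤-trans (+≤+ (ℕ.s≤s z≤n)) 2≤n
  open RootBWeights R φ n 1≤n P unique-P ∈⇒ ⇒∈
  open Toggles R φ P isLatticeRegion using (module ToggleabilitySpace; IsWeightBasis-neg; IsWeightBasis-resp)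
  open Families R φ 𝒥 using (lists-map; lists-reindex)

  private
    levels : List ℤ
    levels = [ 1ℤ ⋯ n ℤ.- 1ℤ ]

    unique-levels : Unique levels
    unique-levels = unique-interval 1ℤ (n ℤ.- 1ℤ)

    levels⁻ : ∀ {k} → k ∈ levels → Label (inj₁ k)
    levels⁻ = ∈-interval⁻ 1ℤ (n ℤ.- 1ℤ)

    levels⁺ : ∀ {k} → Label (inj₁ k) → k ∈ levels
    levels⁺ (k≥ , k≤) = ∈-interval⁺ k≥ k≤

    open Ends n top

    n<top : n ℤ.+ 1ℤ ℤ.≤ top
    n<top = go 2≤n
      where
      go : 1ℤ ℤ.+ 1ℤ ℤ.≤ n → n ℤ.+ 1ℤ ℤ.≤ ℤ.+ 2 ℤ.* n ℤ.- 1ℤ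
      go h = ≤-by h (ℤsolve (n ∷ []))

    n≤top : n ℤ.≤ top
    n≤top = ℤ.≤-trans (i≤i+1 n) n<top

    foot-sum : ∀ k → n ℤ.+ k ℤ.+ (n ℤ.- k) ≡ top ℤ.+ 1ℤ
    foot-sum k = eq n k
      where
      eq : ∀ n k → n ℤ.+ k ℤ.+ (n ℤ.- k) ≡ ℤ.+ 2 ℤ.* n ℤ.- 1ℤ ℤ.+ 1ℤ
      eq n k = ℤsolve (n ∷ k ∷ [])

    content-foot : ∀ k → n ℤ.+ k ℤ.- (n ℤ.- k) ≡ ℤ.+ 2 ℤ.* k
    content-foot k = eq n k
      where
      eq : ∀ n k → n ℤ.+ k ℤ.- (n ℤ.- k) ≡ ℤ.+ 2 ℤ.* k
      eq n k = ℤsolve (n ∷ k ∷ [])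

    main-sum : n ℤ.+ n ≡ top ℤ.+ 1ℤ
    main-sum = eq n
      where
      eq : ∀ n → n ℤ.+ n ≡ ℤ.+ 2 ℤ.* n ℤ.- 1ℤ ℤ.+ 1ℤ
      eq n = ℤsolve (n ∷ [])

    down-main∈ : ∀ {i} → i ∈ lower → down (i , i) ∈ P
    down-main∈ {i} i∈ = proj₂ (lower∈ (main∈ (lower⁻ i∈)) (go (proj₁ (∈-interval⁻ (n ℤ.+ 1ℤ) top i∈)))) (diag 1≤n)
      where
      go : n ℤ.+ 1ℤ ℤ.≤ i → ℤ.+ 2 ℤ.* n ℤ.- 1ℤ ℤ.+ 1ℤ ℤ.+ 1ℤ ℤ.≤ i ℤ.+ i
      go h = ≤-by (h ⊞ h ⊞ 0≤1) (ℤsolve (i ∷ n ∷ []))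
      diag : 1ℤ ℤ.≤ n → i ℤ.- i ℤ.+ 1ℤ ℤ.≤ ℤ.+ 2 ℤ.* n
      diag h = ≤-by (h ⊞ h ⊞ 0≤1) (ℤsolve (i ∷ n ∷ []))

  -- On the main diagonal only (n,n) is minimal, as every later point has its `down` neighbour in P.
  -- Each of the other even diagonals has a minimal foot, hence the constant in its element.
  B₁-basis : ∀ {M} (eq : functionsOver ≡ M) → let open Module M in
    ∀ {one′ 𝟏′ 𝒯′} → Agrees eq one′ 𝟏′ 𝒯′ →
    (v : ℤ → Carrierᴹ) → (∀ k → -ᴹ one′ +ᴹ sumᴹ eq 𝒯′ (onDiagonal? (ℤ.+ 2 ℤ.* k)) ≈ᴹ v k) →
    (v₁ : Carrierᴹ) → 𝒯′ (n , n) +ᴹ -ᴹ one′ ≈ᴹ v₁ →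
    IsBasis M (I_Tᴹ eq one′ 𝟏′ 𝒯′)
      (map v [ 1ℤ ⋯ n ℤ.- 1ℤ ] ++ v₁ ∷ map (λ i → 𝒯′ (i , i)) [ n ℤ.+ 1ℤ ⋯ ℤ.+ 2 ℤ.* n ℤ.- 1ℤ ])
  B₁-basis ≡.refl {one′} {𝟏′} {𝒯′} agrees v v≈ v₁ v₁≈ = weightBasis⇒isBasis _≟ˡ_ unique-labels
      (𝒯-basis unique-labels (∈-labels⁻ {Label} levels⁻ (first⁻ n≤top))
        (λ {x} → ∈-labels⁺ {Label} levels⁺ (λ (i≥ , i≤) → first⁺ n≤top i≥ i≤) {x}))
      (++⁺ (lists-reindex inj₁ (lists-map _ v levels (λ {k} k∈ I → trans (𝒰-sum-1 (onDiagonal? (ℤ.+ 2 ℤ.* k)) (χᵈ-admissible (double-even k))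
             (minimals-1 (onDiagonal? (ℤ.+ 2 ℤ.* k)) (foot∈P (inj₁ k) (levels⁻ k∈)) (content-foot k)
               (foot-left∉ {n ℤ.+ k} (foot-sum k)) (foot-down∉ (foot-sum k))
               (λ {p} p∈P c p≢ → nonfoot p∈P (≡.subst Interior (≡.sym c) (double-interior (levels⁻ k∈)))
                 (≡.trans c (≡.sym (content-foot k))) (foot-sum k) p≢)) I) (v≈ k I))))
           (lists-reindex inj₂
             ((λ I → trans (𝒰-point (χᵐ-admissible n) (main∈ (ℤ.≤-refl , n≤top)) I)
                 (trans (𝒰-minimal (foot-left∉ {n} main-sum) (foot-down∉ main-sum) I) (v₁≈ I)))
               Pointwise.∷ lists-map _ (λ i → 𝒯′ (i , i)) lower (λ {i} i∈ I →
                 trans (𝒰-point (χᵐ-admissible i) (main∈ (lower⁻ i∈)) I) (𝒰-nonminimal (inj₂ (down-main∈ i∈)) I)))))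
    where
    open Agrees agrees
    open ToggleabilitySpace one′ 𝟏′ 𝒯′ one≈ 𝟏≈ 𝒯≈
    open ClassSums R φ P isLatticeRegion one′ 𝟏′ 𝒯′ one≈ 𝟏≈ 𝒯≈
    open Labels unique-levels (first-unique n≤top)

  -- At the ends of the main diagonal the indicators of `right (top,top)` and `down (n,n)` are zero,
  -- these points being outside P; this shortens the general element.
  B₂-basis : ∀ {M} (eq : functionsOver ≡ M) → let open Module M in
    ∀ {one′ 𝟏′ 𝒯′} → Agrees eq one′ 𝟏′ 𝒯′ →
    (w : Point → Carrierᴹ) → (∀ p → (1# + 1#) *ₗ 𝟏′ p ≈ᴹ w p) →
    (v : ℤ → Carrierᴹ) →
    (∀ k → sumᴹ eq w (onDiagonal? (ℤ.+ 2 ℤ.* k))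
           +ᴹ -ᴹ sumᴹ eq 𝟏′ (onDiagonal? (ℤ.+ 2 ℤ.* k ℤ.- 1ℤ))
           +ᴹ -ᴹ sumᴹ eq 𝟏′ (onDiagonal? (ℤ.+ 2 ℤ.* k ℤ.+ 1ℤ)) ≈ᴹ v k) →
    (u : ℤ → Carrierᴹ) → (∀ i → (1# + 1#) *ₗ 𝟏′ (i , i) +ᴹ -ᴹ 𝟏′ (down (i , i)) +ᴹ -ᴹ 𝟏′ (right (i , i)) ≈ᴹ u i) →
    (let top = ℤ.+ 2 ℤ.* n ℤ.- 1ℤ) →
    (v₁ : Carrierᴹ) → (1# + 1#) *ₗ 𝟏′ (top , top) +ᴹ -ᴹ 𝟏′ (down (top , top)) ≈ᴹ v₁ →
    (v₂ : Carrierᴹ) → (1# + 1#) *ₗ 𝟏′ (n , n) +ᴹ -ᴹ 𝟏′ (right (n , n)) ≈ᴹ v₂ →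
    IsBasis M (I_Tᴹ eq one′ 𝟏′ 𝒯′) (map v [ 1ℤ ⋯ n ℤ.- 1ℤ ] ++ map u [ n ℤ.+ 1ℤ ⋯ top ℤ.- 1ℤ ] ++ v₁ ∷ v₂ ∷ [])
  B₂-basis ≡.refl {one′} {𝟏′} {𝒯′} agrees w w≈ v v≈ u u≈ v₁ v₁≈ v₂ v₂≈ = weightBasis⇒isBasis _≟ˡ_ unique-labels
      (IsWeightBasis-resp {w′ = weights} (λ {x} m q∈P → same x (∈-labels⁻ {Label} levels⁻ (ends⁻ n<top ends) m) q∈P)
        (IsWeightBasis-neg (𝒯-basis unique-labels (∈-labels⁻ {Label} levels⁻ (ends⁻ n<top ends))
          (λ {x} → ∈-labels⁺ {Label} levels⁺ (λ (i≥ , i≤) → ends⁺ n<top ends i≥ i≤) {x}))))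
      (++⁺ (lists-reindex inj₁ (lists-map _ v levels (λ {k} _ I → trans
             (weighted-second-difference w≈ (onDiagonal? (ℤ.+ 2 ℤ.* k)) (onDiagonal? (ℤ.+ 2 ℤ.* k ℤ.+ 1ℤ)) (onDiagonal? (ℤ.+ 2 ℤ.* k ℤ.- 1ℤ)) I)
             (trans (swap _ _ _) (v≈ k I)))))
           (lists-reindex inj₂ (++⁺
             (lists-map _ u upper (λ {i} i∈ I → trans (point (upper⁻ i∈) I) (u≈ i I)))
             ((λ I → trans (point (n≤top , ℤ.≤-refl) I) (trans (trans (+-congˡ (vanish right-top∉ I)) (+-identityʳ _)) (v₁≈ I)))
               Pointwise.∷ ((λ I → trans (point (ℤ.≤-refl , n≤top) I)
                   (trans (+-congʳ (trans (+-congˡ (vanish (foot-down∉ main-sum) I)) (+-identityʳ _))) (v₂≈ I)))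
               Pointwise.∷ Pointwise.[])))))
    where
    open Agrees agrees
    open ToggleabilitySpace one′ 𝟏′ 𝒯′ one≈ 𝟏≈ 𝒯≈
    open ClassSums R φ P isLatticeRegion one′ 𝟏′ 𝒯′ one≈ 𝟏≈ 𝒯≈
    open Sums R φ
    open Solver using (solve; _:+_; _:=_)
    open Toggles R φ P isLatticeRegion using (𝟏; weighted; lap; 𝟏-∉)
    open RingProperties ring using (-0#≈0#)
    ends : Endpoints top n
    ends = inj₂ (≡.refl , ≡.refl)
    open Labels unique-levels (ends-unique n<top ends)

    swap : ∀ a b c → a + b + c ≈ a + c + b
    swap = solve 3 (λ a b c → a :+ b :+ c := a :+ c :+ b) refl

    weights : ℤ ⊎ ℤ → Point → Carrier
    weights (inj₁ k) q = - (𝟙[ onDiagonal? (ℤ.+ 2 ℤ.* k ℤ.+ 1ℤ) q ] + 𝟙[ onDiagonal? (ℤ.+ 2 ℤ.* k ℤ.- 1ℤ) q ]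
                            - (𝟙[ onDiagonal? (ℤ.+ 2 ℤ.* k) q ] + 𝟙[ onDiagonal? (ℤ.+ 2 ℤ.* k) q ]))
    weights (inj₂ i) q = - lap (indicator (_≟ (i , i))) q

    same : ∀ x → Label x → ∀ {q} → q ∈ P → - lap (λ p → 𝟙[ (p ∈? P) ×-dec class? x p ]) q ≈ weights x q
    same (inj₁ k) label q∈P = sym (neg-lap-χᵈ (double-interior label) (double-even k) ≡.refl ≡.refl q∈P)
    same (inj₂ i) _     _   = refl

    point : ∀ {i} → Label (inj₂ i) → ∀ I → weighted (λ q → - lap (indicator (_≟ (i , i))) q) 𝟏 I
            ≈ (1# + 1#) * 𝟏′ (i , i) I + - 𝟏′ (down (i , i)) I + - 𝟏′ (right (i , i)) I
    point {i} label I = trans (weighted-neg (lap (indicator (_≟ (i , i)))) I) (trans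
      (-‿cong (𝒰-point (χᵐ-admissible i) (main∈ label) I))
      (-𝒰-down-right (main∈ label) (left∉ {i , i} (content-main i)) (up∉ {i , i} (content-main i)) I))

    vanish : ∀ {p} → p ∉ P → ∀ I → - 𝟏′ p I ≈ 0#
    vanish {p} p∉P I = trans (-‿cong (trans (sym (𝟏≈ p I)) (𝟏-∉ I p∉P))) -0#≈0#

    right-top∉ : right (top , top) ∉ P
    right-top∉ r∈P = go top (InRegion.i≤ (∈⇒ r∈P))
      where
      go : ∀ n → ¬ (n ℤ.+ 1ℤ ℤ.≤ n)
      go n h = ≤-absurd {k = 0} h (ℤsolve (n ∷ []))

-- Specialisation to the real numbers

module ≃ = CommutativeRing ℝ-commutativeRing

-- Constant sequences are added and multiplied termwise, so all the laws hold by reflexivity.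
fromℚ-homo : ℚ-Algebra ℝ-commutativeRing
fromℚ-homo = record
  { ⟦_⟧    = fromℚ
  ; +-homo = λ x y → ≃.refl {fromℚ (x ℚ.+ y)}
  ; *-homo = λ x y → ≃.refl {fromℚ (x ℚ.* y)}
  ; -‿homo = λ x → ≃.refl {fromℚ (ℚ.- x)}
  ; 0-homo = ≃.refl {fromℚ 0ℚ}
  ; 1-homo = ≃.refl {fromℚ 1ℚ}
  }

-- ≈ on ℝ is a defined function, so that reals cannot be inferred from an equation between
-- them; they are given explicitly, spelled exactly as in the definitions of 𝓑₁ and 𝓑₂.
module _ (P : List Point) where

  agrees : Transfer.Agrees ℝ-commutativeRing fromℚ-homo P {Toggleability.functions P} ≡.refl
           (Toggleability.one P) (Toggleability.𝟏 P) (Toggleability.𝒯 P)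
  agrees = record
    { one≈ = λ I → ≃.refl {Toggleability.one P I}
    ; 𝟏≈   = λ p I → ≃.refl {Toggleability.𝟏 P p I}
    ; 𝒯≈   = λ p I → ≃.refl {Toggleability.𝒯 P p I}
    }

module _ (m n : ℕ) where

  private
    open module G = RectangleTheorem ℝ-commutativeRing fromℚ-homo m n (Rectangle.poset (ℤ.+ suc m) (ℤ.+ suc n))
      (RectanglePoset.unique-poset m n) (RectanglePoset.∈⇒ m n) (RectanglePoset.⇒∈ m n)

  rectangle₂ : LinearAlgebra.IsBasis (Toggleability.functions (Rectangle.poset (ℤ.+ suc m) (ℤ.+ suc n)))
    (Toggleability.I_T (Rectangle.poset (ℤ.+ suc m) (ℤ.+ suc n))) (Rectangle.B₂ (ℤ.+ suc m) (ℤ.+ suc n))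
  rectangle₂ = B₂-basis {Toggleability.functions (Rectangle.poset (ℤ.+ suc m) (ℤ.+ suc n))} ≡.refl (agrees (Rectangle.poset (ℤ.+ suc m) (ℤ.+ suc n)))
     (λ k → Rectangle.∑ᵈ (ℤ.+ suc m) (ℤ.+ suc n) k (Rectangle.𝟏 (ℤ.+ suc m) (ℤ.+ suc n)))
     (λ k I → ≃.refl {Rectangle.∑ᵈ (ℤ.+ suc m) (ℤ.+ suc n) k (Rectangle.𝟏 (ℤ.+ suc m) (ℤ.+ suc n)) I})

  rectangle₁ : LinearAlgebra.IsBasis (Toggleability.functions (Rectangle.poset (ℤ.+ suc m) (ℤ.+ suc n)))
    (Toggleability.I_T (Rectangle.poset (ℤ.+ suc m) (ℤ.+ suc n))) (Rectangle.B₁ (ℤ.+ suc m) (ℤ.+ suc n))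
  rectangle₁ = B₁-basis {Toggleability.functions (Rectangle.poset (ℤ.+ suc m) (ℤ.+ suc n))} ≡.refl (agrees (Rectangle.poset (ℤ.+ suc m) (ℤ.+ suc n)))
     (λ k → Rectangle.∑ᵈ (ℤ.+ suc m) (ℤ.+ suc n) k (Rectangle.𝒯 (ℤ.+ suc m) (ℤ.+ suc n)))
     (λ k I → ≃.refl {Rectangle.∑ᵈ (ℤ.+ suc m) (ℤ.+ suc n) k (Rectangle.𝒯 (ℤ.+ suc m) (ℤ.+ suc n)) I})
     (Rectangle._+ᴹ_ (ℤ.+ suc m) (ℤ.+ suc n) (Rectangle.-ᴹ_ (ℤ.+ suc m) (ℤ.+ suc n) (Rectangle.one (ℤ.+ suc m) (ℤ.+ suc n)))
       (Rectangle.∑ᵈ (ℤ.+ suc m) (ℤ.+ suc n) 0ℤ (Rectangle.𝒯 (ℤ.+ suc m) (ℤ.+ suc n))))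
     (λ I → ≃.refl {(Rectangle._+ᴹ_ (ℤ.+ suc m) (ℤ.+ suc n) (Rectangle.-ᴹ_ (ℤ.+ suc m) (ℤ.+ suc n) (Rectangle.one (ℤ.+ suc m) (ℤ.+ suc n)))
       (Rectangle.∑ᵈ (ℤ.+ suc m) (ℤ.+ suc n) 0ℤ (Rectangle.𝒯 (ℤ.+ suc m) (ℤ.+ suc n)))) I})

module _ (n : ℕ) where

  private
    open module S = ShiftedTheorem ℝ-commutativeRing fromℚ-homo n (ShiftedStaircase.poset (ℤ.+ suc (suc n)))
      (ShiftedStaircasePoset.unique-poset n) (ShiftedStaircasePoset.∈⇒ n) (ShiftedStaircasePoset.⇒∈ n)

  shifted₁ : LinearAlgebra.IsBasis (Toggleability.functions (ShiftedStaircase.poset (ℤ.+ suc (suc n))))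
    (Toggleability.I_T (ShiftedStaircase.poset (ℤ.+ suc (suc n)))) (ShiftedStaircase.B₁ (ℤ.+ suc (suc n)))
  shifted₁ = let N = ℤ.+ suc (suc n) in
    B₁-basis {Toggleability.functions (ShiftedStaircase.poset N)} ≡.refl (agrees (ShiftedStaircase.poset N))
      (λ k → ShiftedStaircase.∑ᵈ N k (ShiftedStaircase.𝒯 N))
      (λ k I → ≃.refl {ShiftedStaircase.∑ᵈ N k (ShiftedStaircase.𝒯 N) I})
      (ShiftedStaircase._-ᴹ_ N (ShiftedStaircase.𝒯 N (1ℤ , 1ℤ)) (ShiftedStaircase.one N))
      (λ I → ≃.refl {ShiftedStaircase._-ᴹ_ N (ShiftedStaircase.𝒯 N (1ℤ , 1ℤ)) (ShiftedStaircase.one N) I})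

  shifted₂ : LinearAlgebra.IsBasis (Toggleability.functions (ShiftedStaircase.poset (ℤ.+ suc (suc n))))
    (Toggleability.I_T (ShiftedStaircase.poset (ℤ.+ suc (suc n)))) (ShiftedStaircase.B₂ (ℤ.+ suc (suc n)))
  shifted₂ = let
      N = ℤ.+ suc (suc n)
      u = λ i → ShiftedStaircase._-ᴹ_ N (ShiftedStaircase._-ᴹ_ N
            (ShiftedStaircase._*ₗ_ N 2ᴿ (ShiftedStaircase.𝟏 N (i , i)))
            (ShiftedStaircase.𝟏 N (i ℤ.- 1ℤ , i))) (ShiftedStaircase.𝟏 N (i , i ℤ.+ 1ℤ))
      v₁ = ShiftedStaircase._-ᴹ_ N (ShiftedStaircase._*ₗ_ N 2ᴿ (ShiftedStaircase.𝟏 N (1ℤ , 1ℤ))) (ShiftedStaircase.𝟏 N (1ℤ , ℤ.+ 2))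
      v₂ = ShiftedStaircase._-ᴹ_ N (ShiftedStaircase._*ₗ_ N 2ᴿ (ShiftedStaircase.𝟏 N (N , N))) (ShiftedStaircase.𝟏 N (N ℤ.- 1ℤ , N))
    in B₂-basis {Toggleability.functions (ShiftedStaircase.poset N)} ≡.refl (agrees (ShiftedStaircase.poset N))
      (λ k → ShiftedStaircase.∑ᵈ N k (ShiftedStaircase.𝟏 N))
      (λ k I → ≃.refl {ShiftedStaircase.∑ᵈ N k (ShiftedStaircase.𝟏 N) I})
      u (λ i I → ≃.refl {u i I})
      v₁ (λ I → ≃.refl {v₁ I})
      v₂ (λ I → ≃.refl {v₂ I})

module _ (n : ℤ) (2≤n : 1ℤ ℤ.+ 1ℤ ℤ.≤ n) where

  private
    1≤n : 1ℤ ℤ.≤ n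
    1≤n = ℤ.≤-trans (+≤+ (ℕ.s≤s z≤n)) 2≤n

    module A = RootATheorem ℝ-commutativeRing fromℚ-homo n 1≤n (RootPosetA.poset n)
      (RootPosetAPoset.unique-poset n) (RootPosetAPoset.∈⇒ n) (RootPosetAPoset.⇒∈ n)

    module B = RootBTheorem ℝ-commutativeRing fromℚ-homo n 2≤n (RootPosetB.poset n)
      (RootPosetBPoset.unique-poset n) (RootPosetBPoset.∈⇒ n) (RootPosetBPoset.⇒∈ n)

  rootA₁ : LinearAlgebra.IsBasis (Toggleability.functions (RootPosetA.poset n))
    (Toggleability.I_T (RootPosetA.poset n)) (RootPosetA.B₁ n)
  rootA₁ = let
      v = λ k → RootPosetA._+ᴹ_ n (RootPosetA.-ᴹ_ n (RootPosetA.one n))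
            (RootPosetA.∑ᵈ n (ℤ.+ 2 ℤ.* k ℤ.+ 1ℤ ℤ.- n) (RootPosetA.𝒯 n))
    in A.B₁-basis {Toggleability.functions (RootPosetA.poset n)} ≡.refl (agrees (RootPosetA.poset n))
      v (λ k I → ≃.refl {v k I})

  rootA₂ : LinearAlgebra.IsBasis (Toggleability.functions (RootPosetA.poset n))
    (Toggleability.I_T (RootPosetA.poset n)) (RootPosetA.B₂ n)
  rootA₂ = let
      w = λ p → RootPosetA._*ₗ_ n 2ᴿ (RootPosetA.𝟏 n p)
      v = λ k → RootPosetA._-ᴹ_ n (RootPosetA._-ᴹ_ n
            (RootPosetA.∑ᵈ n (ℤ.+ 2 ℤ.* k ℤ.+ 1ℤ ℤ.- n) (λ p → RootPosetA._*ₗ_ n 2ᴿ (RootPosetA.𝟏 n p)))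
            (RootPosetA.∑ᵈ n (ℤ.+ 2 ℤ.* k ℤ.+ ℤ.+ 2 ℤ.- n) (RootPosetA.𝟏 n)))
            (RootPosetA.∑ᵈ n (ℤ.+ 2 ℤ.* k ℤ.- n) (RootPosetA.𝟏 n))
    in A.B₂-basis {Toggleability.functions (RootPosetA.poset n)} ≡.refl (agrees (RootPosetA.poset n))
      w (λ p I → ≃.refl {w p I}) v (λ k I → ≃.refl {v k I})

  rootB₁ : LinearAlgebra.IsBasis (Toggleability.functions (RootPosetB.poset n))
    (Toggleability.I_T (RootPosetB.poset n)) (RootPosetB.B₁ n)
  rootB₁ = let
      v  = λ k → RootPosetB._+ᴹ_ n (RootPosetB.-ᴹ_ n (RootPosetB.one n)) (RootPosetB.∑ᵈ n (ℤ.+ 2 ℤ.* k) (RootPosetB.𝒯 n))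
      v₁ = RootPosetB._-ᴹ_ n (RootPosetB.𝒯 n (n , n)) (RootPosetB.one n)
    in B.B₁-basis {Toggleability.functions (RootPosetB.poset n)} ≡.refl (agrees (RootPosetB.poset n))
      v (λ k I → ≃.refl {v k I}) v₁ (λ I → ≃.refl {v₁ I})

  rootB₂ : LinearAlgebra.IsBasis (Toggleability.functions (RootPosetB.poset n))
    (Toggleability.I_T (RootPosetB.poset n)) (RootPosetB.B₂ n)
  rootB₂ = let
      w = λ p → RootPosetB._*ₗ_ n 2ᴿ (RootPosetB.𝟏 n p)
      top = RootPosetB.top n
      v  = λ k → RootPosetB._-ᴹ_ n (RootPosetB._-ᴹ_ n
             (RootPosetB.∑ᵈ n (ℤ.+ 2 ℤ.* k) (λ p → RootPosetB._*ₗ_ n 2ᴿ (RootPosetB.𝟏 n p)))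
             (RootPosetB.∑ᵈ n (ℤ.+ 2 ℤ.* k ℤ.- 1ℤ) (RootPosetB.𝟏 n)))
             (RootPosetB.∑ᵈ n (ℤ.+ 2 ℤ.* k ℤ.+ 1ℤ) (RootPosetB.𝟏 n))
      u  = λ i → RootPosetB._-ᴹ_ n (RootPosetB._-ᴹ_ n
             (RootPosetB._*ₗ_ n 2ᴿ (RootPosetB.𝟏 n (i , i)))
             (RootPosetB.𝟏 n (i , i ℤ.- 1ℤ))) (RootPosetB.𝟏 n (i ℤ.+ 1ℤ , i))
      v₁ = RootPosetB._-ᴹ_ n (RootPosetB._*ₗ_ n 2ᴿ (RootPosetB.𝟏 n (top , top))) (RootPosetB.𝟏 n (top , top ℤ.- 1ℤ))
      v₂ = RootPosetB._-ᴹ_ n (RootPosetB._*ₗ_ n 2ᴿ (RootPosetB.𝟏 n (n , n))) (RootPosetB.𝟏 n (n ℤ.+ 1ℤ , n))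
    in B.B₂-basis {Toggleability.functions (RootPosetB.poset n)} ≡.refl (agrees (RootPosetB.poset n))
      w (λ p I → ≃.refl {w p I}) v (λ k I → ≃.refl {v k I}) u (λ i I → ≃.refl {u i I}) v₁ (λ I → ≃.refl {v₁ I}) v₂ (λ I → ≃.refl {v₂ I})

theorem3p13 : (∀ (m n : ℕ) → 2 ≤ m → 2 ≤ n →
    let open Rectangle (+ m) (+ n) in IsBasis I_T B₁ × IsBasis I_T B₂)
    × (∀ (n : ℕ) → 2 ≤ n →
    let open ShiftedStaircase (+ n) in IsBasis I_T B₁ × IsBasis I_T B₂)
    × (∀ (n : ℕ) → 2 ≤ n →
    let open RootPosetA (+ n) in IsBasis I_T B₁ × IsBasis I_T B₂)
    × (∀ (n : ℕ) → 2 ≤ n →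
    let open RootPosetB (+ n) in IsBasis I_T B₁ × IsBasis I_T B₂)
theorem3p13 =
    (λ { (suc m) (suc n) _ _ → rectangle₁ m n , rectangle₂ m n })
  , (λ { (suc (suc n)) _ → shifted₁ n , shifted₂ n ; (suc zero) (ℕ.s≤s ()) })
  , (λ n 2≤n → rootA₁ (ℤ.+ n) (+≤+ 2≤n) , rootA₂ (ℤ.+ n) (+≤+ 2≤n))
  , (λ n 2≤n → rootB₁ (ℤ.+ n) (+≤+ 2≤n) , rootB₂ (ℤ.+ n) (+≤+ 2≤n))
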